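{- Let $n>2$ be an integer, $G_n=(\mathbb{Z}/n\mathbb{Z})^*$, and let $\mathbb{C}[G_n]$ be the group algebra with basis $\{\sigma_g:g\in G_n\}$. For $x\in\tfrac1n\mathbb{Z}/\mathbb{Z}$ let $S(x)=\sum_{g\in G_n}B_1(gx)\sigma_g\in\mathbb{C}[G_n]$, let $U\subset\mathbb{C}[G_n]$ be the complex span of $\{S(x):x\in\tfrac1n\mathbb{Z}/\mathbb{Z}\}$, and let $U^\perp=\{f\in\mathbb{C}[G_n]^*:f(u)=0\ \forall u\in U\}$. Let $\{\sigma_g^*\}$ be the dual basis and $u_g^*=\sigma_g^*+\sigma_{ -g}^*$. Then $\{u_g^*:g\in G_n\}$ is a basis of $U^\perp$. In particular $\dim_{\mathbb{C}}U^\perp=\dim_{\mathbb{C}}U=\varphi(n)/2$.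
   Context: $B_1$ is the periodic first Bernoulli function: $B_1(x)=\{x\}-\tfrac12$ for $x\notin\mathbb{Z}$, $B_1(x)=0$ for $x\in\mathbb{Z}$; $B_1(gx)$ is well defined for $g\in G_n$, $x\in\tfrac1n\mathbb{Z}/\mathbb{Z}$ by choosing representatives. $\varphi$ is Euler's totient function. Note $u_g^*=u_{ -g}^*$, so the set $\{u_g^*\}$ has $\varphi(n)/2$ elements. -}

module Defs where

open import Level using (Level; _⊔_) renaming (suc to lsuc)
open import Algebra.Bundles using (CommutativeRing)
open import Data.Nat as ℕ using (ℕ; zero; suc; _<ᵇ_; _≡ᵇ_)
open import Data.Nat.DivMod using (_%_)
open import Data.Nat.GCD using (gcd)
open import Data.Fin using (Fin; toℕ)
open import Data.List using (List; []; _∷_; foldr; mapMaybe; filter; length)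
open import Data.Maybe using (Maybe; just; nothing)
open import Data.Product using (Σ; Σ-syntax; ∃; ∃-syntax; _×_; _,_; proj₁)
open import Data.Bool using (Bool; true; false; if_then_else_; T)
open import Relation.Nullary using (¬_; yes; no)
open import Relation.Binary.PropositionalEquality using (_≡_)
import Data.Nat.Properties as ℕP
import Data.List as L

record Field (c ℓ : Level) : Set (lsuc (c ⊔ ℓ)) where
  field
    commutativeRing : CommutativeRing c ℓ
  open CommutativeRing commutativeRing public
  field
    _⁻¹      : Carrier → Carrier
    ⁻¹-inv   : ∀ x → ¬ (x ≈ 0#) → (x * (x ⁻¹)) ≈ 1#

  ι : ℕ → Carrier
  ι zero    = 0#
  ι (suc m) = 1# + ι m

record CharZeroField (c ℓ : Level) : Set (lsuc (c ⊔ ℓ)) where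
  field
    field′   : Field c ℓ
  open Field field′ public
  field
    charZero : ∀ m → ι m ≈ 0# → m ≡ 0

G : ℕ → Set
G n = Σ[ a ∈ Fin n ] gcd (toℕ a) n ≡ 1

val : ∀ {n} → G n → ℕ
val g = toℕ (proj₁ g)

Gs : (n : ℕ) → List (G n)
Gs n = mapMaybe pick (L.allFin n)
  where
  pick : Fin n → Maybe (G n)
  pick a with gcd (toℕ a) n ℕ.≟ 1
  ... | yes p = just (a , p)
  ... | no _  = nothing

φ : ℕ → ℕ
φ n = length (Gs n)

-- g lies in the "half" {g : 2g < n}, a set of representatives of G_n/{±1}
half : ∀ {n} → G n → Bool
half {n} g = (2 ℕ.* val g) <ᵇ n

-- Linear algebra in K[G_n] and its dual, over a char-0 field K.
-- An element of K[G_n] is v : G n → K (v = Σ_g v(g) σ_g).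
-- A functional f ∈ K[G_n]^* is given by its coordinates in the dual
-- basis {σ_g^*}: c : G n → K, i.e. f = Σ_g c(g) σ_g^*, so f(v) = Σ_g c(g) v(g).

module _ {c ℓ} (K : CharZeroField c ℓ) where
  open CharZeroField K

  Vec : ℕ → Set c
  Vec n = G n → Carrier

  ΣG : ∀ n → (G n → Carrier) → Carrier
  ΣG n f = foldr (λ g acc → f g + acc) 0# (Gs n)

  -- sum over x ∈ (1/n)ℤ/ℤ, x = a/n with a ∈ Fin n
  ΣX : ∀ n → (Fin n → Carrier) → Carrier
  ΣX n f = foldr (λ a acc → f a + acc) 0# (L.allFin n)

  ΣH : ∀ n → (G n → Carrier) → Carrier
  ΣH n f = ΣG n (λ g → if half g then f g else 0#)

  _≈ᵛ_ : ∀ {n} → Vec n → Vec n → Set ℓ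
  v ≈ᵛ w = ∀ g → v g ≈ w g

  zeroᵛ : ∀ {n} → Vec n
  zeroᵛ _ = 0#

  -- B₁(g·x) for x = a/n: with r = g·a mod n,
  -- B₁ = 0 if r = 0, and r/n − 1/2 = (2r − n)/(2n) otherwise.
  B₁ : ∀ n → G n → Fin n → Carrier
  B₁ (suc m) g a with (val g ℕ.* toℕ a) % suc m
  ... | zero    = 0#
  ... | suc r′  = (ι (2 ℕ.* suc r′) - ι (suc m)) * (ι (2 ℕ.* suc m) ⁻¹)

  S : ∀ n → Fin n → Vec n
  S n a g = B₁ n g a

  InU : ∀ n → Vec n → Set (c ⊔ ℓ)
  InU n v = Σ[ λ′ ∈ (Fin n → Carrier) ] v ≈ᵛ (λ g → ΣX n (λ a → λ′ a * S n a g))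

  ev : ∀ n → Vec n → Vec n → Carrier
  ev n cf v = ΣG n (λ g → cf g * v g)

  InU⊥ : ∀ n → Vec n → Set (c ⊔ ℓ)
  InU⊥ n f = ∀ u → InU n u → ev n f u ≈ 0#

  σ* : ∀ n → G n → Vec n
  σ* n g h = if val h ≡ᵇ val g then 1# else 0#

  σ*neg : ∀ n → G n → Vec n
  σ*neg (suc m) g h = if val h ≡ᵇ ((suc m ℕ.∸ val g) % suc m) then 1# else 0#

  u* : ∀ n → G n → Vec n
  u* n g h = σ* n g h + σ*neg n g h

  ΣF : ∀ m → (Fin m → Carrier) → Carrier
  ΣF m f = foldr (λ i acc → f i + acc) 0# (L.allFin m)

{-# OPTIONS --safe #-}
-- Oddness of B₁ puts every u_g^* into U^⊥, so the point is that the S(x) span all odd vectors. They have rational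
-- coordinates, so by the Fredholm alternative it is enough that an odd rational function f on G_n which annihilates
-- every S(x) vanishes. Put F(k) = f(k⁻¹), extended by zero to all integers.
--
-- Eisenstein's proof of the addition theorem of the cotangent, carried out over ℚ with truncated partial fractions
-- Σ_{k ≡ r mod n} 1/k, makes the double-angle functions an approximate cosine and sine, and hence gives the finite Fourier
-- expansion of cot(π b / n) in the terms a · sin(2 π a b / n). Pairing it with f yields Σ_k F(h k) / k = 0 for every h.
--
-- Suppose F ≠ 0. With the weight w(x) = binom(N − x , 5) consider the sum over δ prime to n and m ≥ 1 of
-- w(δ² m) Σ_h (Σ_{k ∣ m} F(h k))². All its terms are nonnegative, and those with m = 1, δ ≡ 1 mod n already contribute
-- order N^(5 + 1/2). Splitting off greatest common divisors turns it into Σ_h Σ F(h k) F(h l) w(a b k l) over all b, k, l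
-- and all a prime to n. Here Σ_k F(h k) / k = 0 removes the main term of the hyperbola method, leaving O(y^(4/3)) for the Riesz
-- means over a k and over b l, and summation by parts bounds the whole sum by N^(5 + 1/3) log² N.

module Submission where

open import Level using (0ℓ)
open import Algebra.Bundles using (CommutativeRing)
open import Data.Nat as ℕ using (ℕ; zero; suc; z≤n; s≤s)
import Data.Nat.Properties as ℕ
import Data.Nat.DivMod as ℕ
import Data.Nat.GCD as ℕ
import Data.Nat.Coprimality as ℕ
open import Data.Nat.Divisibility as ℕ using (_∣_; divides; _∣?_)
import Data.Nat.Tactic.RingSolver as ℕ-Solver
open import Data.Nat.ListAction using (product)
open import Data.Integer as ℤ using (ℤ; 0ℤ; 1ℤ)
import Data.Integer.Properties as ℤ
import Data.Integer.DivMod as ℤ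
import Data.Integer.Divisibility.Signed as ℤ∣
import Data.Integer.Tactic.RingSolver as ℤ-Solver
open import Data.Rational as ℚ using (ℚ; 0ℚ; 1ℚ)
import Data.Rational.Properties as ℚ
import Data.Rational.Unnormalised as ℚᵘ
import Data.Rational.Unnormalised.Properties as ℚᵘ
open import Data.List using (List; []; _∷_; foldr; mapMaybe; filterᵇ; length; lookup; tabulate; allFin)
open import Data.Product using (Σ; Σ-syntax; _×_; _,_; proj₁; proj₂)
open import Data.Sum using (_⊎_; inj₁; inj₂; [_,_]′)
open import Function using (_∘_)
open import Relation.Nullary using (¬_; Dec; yes; no; contradiction)
open import Relation.Nullary.Decidable using (dec⇒maybe)
open import Relation.Binary.Definitions using (tri<; tri≈; tri>)
open import Relation.Binary.PropositionalEquality as ≡ using (_≡_; _≢_; refl)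
open import Tactic.RingSolver using (solve-∀)
open import Tactic.RingSolver.Core.AlmostCommutativeRing using (AlmostCommutativeRing; fromCommutativeRing)

-- The arithmetic content is the nonvanishing of L(1 , χ) for odd characters χ, but characters,
-- complex numbers and limits do not occur: a rational function is treated as a whole, and every
-- limit becomes an explicit error bound over ℚ. The sum of squares is Ingham's device. For a
-- character χ the squares |Σ_{k ∣ m} χ(k)|² have the Dirichlet series ζ(s) L(s , χ) L(s , χ̄) L(s ,
-- χ₀) / L(2 s , χ₀), and the sum over δ² removes the denominator. The lower bound reflects the
-- divergence of L(2 s , χ₀) at s = 1/2. If L(1 , χ) were 0, the double pole at s = 1 would cancel,
-- and the hyperbola method would reach below the exponent 1/2; its 1/3 is good enough. On the
-- cotangent side the obstacle is conditional convergence. Moving the summation window is not free,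
-- and its cost does not tend to 0: it is the constant 1 in cot r cot s - cot(r + s)(cot r + cot s)
-- = 1. It is therefore kept as an unknown sequence κ, of which only a positive lower bound, an
-- upper bound and independence of r and s are established.

-- Finite sums over a commutative ring

module FiniteSum {c ℓ} (R : CommutativeRing c ℓ) where
  open CommutativeRing R renaming (refl to ≈-refl)
  open import Relation.Binary.Reasoning.Setoid setoid
  open import Algebra.Properties.Ring ring using (-0#≈0#)
  open import Algebra.Properties.AbelianGroup +-abelianGroup using (⁻¹-∙-comm)
  open import Algebra.Properties.CommutativeSemigroup +-commutativeSemigroup using (interchange)

  ∑ : ℕ → (ℕ → Carrier) → Carrier
  ∑ zero    f = 0#
  ∑ (suc n) f = ∑ n f + f n

  𝟙 : ∀ {p} {P : Set p} → Dec P → Carrier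
  𝟙 (yes _) = 1#
  𝟙 (no _)  = 0#

  𝟙-yes : ∀ {p} {P : Set p} (d : Dec P) → P → 𝟙 d ≈ 1#
  𝟙-yes (yes _) _  = ≈-refl
  𝟙-yes (no ¬p) p = contradiction p ¬p

  𝟙-no : ∀ {p} {P : Set p} (d : Dec P) → ¬ P → 𝟙 d ≈ 0#
  𝟙-no (yes p) ¬p = contradiction p ¬p
  𝟙-no (no _)  _  = ≈-refl

  𝟙-cong : ∀ {p q} {P : Set p} {Q : Set q} (d : Dec P) (e : Dec Q) →
           (P → Q) → (Q → P) → 𝟙 d ≈ 𝟙 e
  𝟙-cong (yes p) e f g = sym (𝟙-yes e (f p))
  𝟙-cong (no ¬p) e f g = sym (𝟙-no e (¬p ∘ g))

  ∑-cong : ∀ n {f g : ℕ → Carrier} → (∀ i → i ℕ.< n → f i ≈ g i) → ∑ n f ≈ ∑ n g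
  ∑-cong zero    _   = ≈-refl
  ∑-cong (suc n) f≈g =
    +-cong (∑-cong n λ i i<n → f≈g i (ℕ.m<n⇒m<1+n i<n)) (f≈g n ℕ.≤-refl)

  ∑-zero : ∀ n {f : ℕ → Carrier} → (∀ i → i ℕ.< n → f i ≈ 0#) → ∑ n f ≈ 0#
  ∑-zero zero    _   = ≈-refl
  ∑-zero (suc n) f≈0 = trans
    (+-cong (∑-zero n λ i i<n → f≈0 i (ℕ.m<n⇒m<1+n i<n)) (f≈0 n ℕ.≤-refl))
    (+-identityˡ 0#)

  ∑-+ : ∀ n (f g : ℕ → Carrier) → ∑ n (λ i → f i + g i) ≈ ∑ n f + ∑ n g
  ∑-+ zero    f g = sym (+-identityˡ 0#)
  ∑-+ (suc n) f g = trans (+-congʳ (∑-+ n f g)) (interchange _ _ _ _)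

  ∑-*ˡ : ∀ n a (f : ℕ → Carrier) → ∑ n (λ i → a * f i) ≈ a * ∑ n f
  ∑-*ˡ zero    a f = sym (zeroʳ a)
  ∑-*ˡ (suc n) a f = trans (+-congʳ (∑-*ˡ n a f)) (sym (distribˡ a _ _))

  ∑-*ʳ : ∀ n a (f : ℕ → Carrier) → ∑ n (λ i → f i * a) ≈ ∑ n f * a
  ∑-*ʳ zero    a f = sym (zeroˡ a)
  ∑-*ʳ (suc n) a f = trans (+-congʳ (∑-*ʳ n a f)) (sym (distribʳ a _ _))

  ∑-neg : ∀ n (f : ℕ → Carrier) → ∑ n (λ i → - f i) ≈ - ∑ n f
  ∑-neg zero    f = sym -0#≈0#
  ∑-neg (suc n) f = trans (+-congʳ (∑-neg n f)) (⁻¹-∙-comm _ _)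

  ∑-swap : ∀ m n (f : ℕ → ℕ → Carrier) →
           ∑ m (λ i → ∑ n (λ j → f i j)) ≈ ∑ n (λ j → ∑ m (λ i → f i j))
  ∑-swap zero    n f = sym (∑-zero n λ _ _ → ≈-refl)
  ∑-swap (suc m) n f = trans (+-congʳ (∑-swap m n f)) (sym (∑-+ n _ (f m)))

  ∑-split : ∀ m n (f : ℕ → Carrier) → ∑ (m ℕ.+ n) f ≈ ∑ m f + ∑ n (λ i → f (m ℕ.+ i))
  ∑-split m zero    f rewrite ℕ.+-identityʳ m = sym (+-identityʳ _)
  ∑-split m (suc n) f rewrite ℕ.+-suc m n =
    trans (+-congʳ (∑-split m n f)) (+-assoc _ _ _)

  ∑-head : ∀ n (f : ℕ → Carrier) → ∑ (suc n) f ≈ f 0 + ∑ n (f ∘ suc)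
  ∑-head n f = trans (∑-split 1 n f) (+-congʳ (+-identityˡ (f 0)))

  ∑-extend : ∀ {m n} → m ℕ.≤ n → (f : ℕ → Carrier) →
             (∀ i → m ℕ.≤ i → i ℕ.< n → f i ≈ 0#) → ∑ n f ≈ ∑ m f
  ∑-extend {m} {n} m≤n f f≈0 with n ℕ.∸ m | ℕ.m+[n∸m]≡n m≤n
  ... | k | refl = begin
    ∑ (m ℕ.+ k) f                      ≈⟨ ∑-split m k f ⟩
    ∑ m f + ∑ k (λ i → f (m ℕ.+ i))    ≈⟨ +-congˡ (∑-zero k λ i i<k →
                                            f≈0 (m ℕ.+ i) (ℕ.m≤m+n m i) (ℕ.+-monoʳ-< m i<k)) ⟩
    ∑ m f + 0#                         ≈⟨ +-identityʳ _ ⟩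
    ∑ m f                              ∎

  ∑-single : ∀ n {j} (f : ℕ → Carrier) → j ℕ.< n →
             (∀ i → i ℕ.< n → i ≢ j → f i ≈ 0#) → ∑ n f ≈ f j
  ∑-single (suc n) {j} f j<1+n f≈0 with j ℕ.≟ n
  ... | yes refl = trans
    (+-congʳ (∑-zero n λ i i<n → f≈0 i (ℕ.m<n⇒m<1+n i<n) (ℕ.<⇒≢ i<n)))
    (+-identityˡ _)
  ... | no j≢n = trans
    (+-cong (∑-single n f (ℕ.≤∧≢⇒< (ℕ.≤-pred j<1+n) j≢n)
               λ i i<n → f≈0 i (ℕ.m<n⇒m<1+n i<n))
            (f≈0 n ℕ.≤-refl (j≢n ∘ ≡.sym)))
    (+-identityʳ _)

  ∑-𝟙 : ∀ n {j} (f : ℕ → Carrier) → j ℕ.< n → ∑ n (λ i → 𝟙 (i ℕ.≟ j) * f i) ≈ f j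
  ∑-𝟙 n {j} f j<n = begin
    ∑ n (λ i → 𝟙 (i ℕ.≟ j) * f i)  ≈⟨ ∑-single n _ j<n (λ i _ i≢j →
                                        trans (*-congʳ (𝟙-no (i ℕ.≟ j) i≢j)) (zeroˡ _)) ⟩
    𝟙 (j ℕ.≟ j) * f j              ≈⟨ *-congʳ (𝟙-yes (j ℕ.≟ j) refl) ⟩
    1# * f j                       ≈⟨ *-identityˡ _ ⟩
    f j                            ∎

  -- Each value at `σ i` is spread out over all `j` against an indicator; after exchanging the sums,
  -- the indicator of `j ≡ σ i` is that of `i ≡ τ j`. Only indices below `n` are ever constrained.
  ∑-reindex : ∀ n (f : ℕ → Carrier) (σ τ : ℕ → ℕ) →
              (∀ i → i ℕ.< n → σ i ℕ.< n) → (∀ i → i ℕ.< n → τ i ℕ.< n) →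
              (∀ i → i ℕ.< n → σ (τ i) ≡ i) → (∀ i → i ℕ.< n → τ (σ i) ≡ i) →
              ∑ n (f ∘ σ) ≈ ∑ n f
  ∑-reindex n f σ τ σ< τ< στ τσ = begin
    ∑ n (f ∘ σ)                                   ≈⟨ ∑-cong n (λ i i<n → ∑-𝟙 n f (σ< i i<n)) ⟨
    ∑ n (λ i → ∑ n (λ j → 𝟙 (j ℕ.≟ σ i) * f j))  ≈⟨ ∑-swap n n _ ⟩
    ∑ n (λ j → ∑ n (λ i → 𝟙 (j ℕ.≟ σ i) * f j))  ≈⟨ ∑-cong n (λ j j<n → begin
       ∑ n (λ i → 𝟙 (j ℕ.≟ σ i) * f j)
         ≈⟨ ∑-cong n (λ i i<n → *-congʳ (𝟙-cong (j ℕ.≟ σ i) (i ℕ.≟ τ j)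
              (λ { refl → ≡.sym (τσ i i<n) }) (λ { refl → ≡.sym (στ j j<n) }))) ⟩
       ∑ n (λ i → 𝟙 (i ℕ.≟ τ j) * f j)  ≈⟨ ∑-𝟙 n (λ _ → f j) (τ< j j<n) ⟩
       f j                              ∎) ⟩
    ∑ n f                                         ∎

  ∑-blocks : ∀ m n (f : ℕ → Carrier) → ∑ (m ℕ.* n) f ≈ ∑ m (λ i → ∑ n (λ j → f (i ℕ.* n ℕ.+ j)))
  ∑-blocks zero    n f = ≈-refl
  ∑-blocks (suc m) n f = begin
    ∑ (n ℕ.+ m ℕ.* n) f  ≡⟨ ≡.cong (λ k → ∑ k f) (ℕ.+-comm n (m ℕ.* n)) ⟩
    ∑ (m ℕ.* n ℕ.+ n) f  ≈⟨ ∑-split (m ℕ.* n) n f ⟩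
    ∑ (m ℕ.* n) f + _    ≈⟨ +-congʳ (∑-blocks m n f) ⟩
    _                    ∎

-- The homomorphism from ℤ to a commutative ring

module IntegerEmbedding {c ℓ} (R : CommutativeRing c ℓ) (ι : ℕ → CommutativeRing.Carrier R)
  (ι-0 : CommutativeRing._≈_ R (ι 0) (CommutativeRing.0# R))
  (ι-suc : ∀ m → CommutativeRing._≈_ R (ι (suc m)) (CommutativeRing._+_ R (CommutativeRing.1# R) (ι m))) where
  open CommutativeRing R renaming (refl to ≈-refl)
  open import Relation.Binary.Reasoning.Setoid setoid
  open import Algebra.Properties.Ring ring using (-0#≈0#; -‿involutive; -‿distribˡ-*; -‿distribʳ-*; -‿+-comm)
  open import Algebra.Properties.CommutativeSemigroup +-commutativeSemigroup using (interchange)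
  open FiniteSum R
  private module ℤ∑ = FiniteSum ℤ.+-*-commutativeRing

  ι-homo-+ : ∀ m n → ι (m ℕ.+ n) ≈ ι m + ι n
  ι-homo-+ zero    n = sym (trans (+-congʳ ι-0) (+-identityˡ (ι n)))
  ι-homo-+ (suc m) n = begin
    ι (suc (m ℕ.+ n))  ≈⟨ ι-suc (m ℕ.+ n) ⟩
    1# + ι (m ℕ.+ n)   ≈⟨ +-congˡ (ι-homo-+ m n) ⟩
    1# + (ι m + ι n)   ≈⟨ +-assoc 1# (ι m) (ι n) ⟨
    1# + ι m + ι n     ≈⟨ +-congʳ (ι-suc m) ⟨
    ι (suc m) + ι n    ∎

  ι-homo-* : ∀ m n → ι (m ℕ.* n) ≈ ι m * ι n
  ι-homo-* zero    n = trans ι-0 (sym (trans (*-congʳ ι-0) (zeroˡ (ι n))))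
  ι-homo-* (suc m) n = begin
    ι (n ℕ.+ m ℕ.* n)     ≈⟨ ι-homo-+ n (m ℕ.* n) ⟩
    ι n + ι (m ℕ.* n)     ≈⟨ +-cong (sym (*-identityˡ (ι n))) (ι-homo-* m n) ⟩
    1# * ι n + ι m * ι n  ≈⟨ distribʳ (ι n) 1# (ι m) ⟨
    (1# + ι m) * ι n      ≈⟨ *-congʳ (ι-suc m) ⟨
    ι (suc m) * ι n       ∎

  -- Needed for ℚ and for the field K; in K it transports the integral relations that the Fredholm
  -- alternative produces.
  ιℤ : ℤ → Carrier
  ιℤ (ℤ.+ m)      = ι m
  ιℤ (ℤ.-[1+ m ]) = - ι (suc m)

  ιℤ-⊖ : ∀ m n → ιℤ (m ℤ.⊖ n) ≈ ι m - ι n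
  ιℤ-⊖ m       zero    = sym (trans (+-congˡ (trans (-‿cong ι-0) -0#≈0#)) (+-identityʳ (ι m)))
  ιℤ-⊖ zero    (suc n) = sym (trans (+-congʳ ι-0) (+-identityˡ (- ι (suc n))))
  ιℤ-⊖ (suc m) (suc n) = begin
    ιℤ (suc m ℤ.⊖ suc n)           ≡⟨ ≡.cong ιℤ (ℤ.[1+m]⊖[1+n]≡m⊖n m n) ⟩
    ιℤ (m ℤ.⊖ n)                   ≈⟨ ιℤ-⊖ m n ⟩
    ι m - ι n                      ≈⟨ +-identityˡ (ι m - ι n) ⟨
    0# + (ι m - ι n)               ≈⟨ +-congʳ (-‿inverseʳ 1#) ⟨
    (1# - 1#) + (ι m - ι n)        ≈⟨ interchange 1# (- 1#) (ι m) (- ι n) ⟩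
    (1# + ι m) + (- 1# - ι n)      ≈⟨ +-cong (sym (ι-suc m)) (trans (-‿+-comm 1# (ι n)) (-‿cong (sym (ι-suc n)))) ⟩
    ι (suc m) - ι (suc n)          ∎

  ιℤ-+ : ∀ k l → ιℤ (k ℤ.+ l) ≈ ιℤ k + ιℤ l
  ιℤ-+ (ℤ.+ a)      (ℤ.+ b)      = ι-homo-+ a b
  ιℤ-+ (ℤ.+ a)      (ℤ.-[1+ b ]) = ιℤ-⊖ a (suc b)
  ιℤ-+ (ℤ.-[1+ a ]) (ℤ.+ b)      = trans (ιℤ-⊖ b (suc a)) (+-comm (ι b) (- ι (suc a)))
  ιℤ-+ (ℤ.-[1+ a ]) (ℤ.-[1+ b ]) = begin
    - ι (suc (suc (a ℕ.+ b)))     ≡⟨ ≡.cong (λ k → - ι (suc k)) (≡.sym (ℕ.+-suc a b)) ⟩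
    - ι (suc a ℕ.+ suc b)         ≈⟨ -‿cong (ι-homo-+ (suc a) (suc b)) ⟩
    - (ι (suc a) + ι (suc b))     ≈⟨ -‿+-comm (ι (suc a)) (ι (suc b)) ⟨
    - ι (suc a) - ι (suc b)       ∎

  ιℤ-neg : ∀ k → ιℤ (ℤ.- k) ≈ - ιℤ k
  ιℤ-neg (ℤ.+ zero)   = trans ι-0 (sym (trans (-‿cong ι-0) -0#≈0#))
  ιℤ-neg (ℤ.+ suc m)  = ≈-refl
  ιℤ-neg (ℤ.-[1+ m ]) = sym (-‿involutive (ι (suc m)))

  ιℤ-* : ∀ k l → ιℤ (k ℤ.* l) ≈ ιℤ k * ιℤ l
  ιℤ-* (ℤ.+ a) l = pos l
    where
    pos : ∀ l → ιℤ (ℤ.+ a ℤ.* l) ≈ ι a * ιℤ l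
    pos (ℤ.+ b) = trans (reflexive (≡.cong ιℤ (≡.sym (ℤ.pos-* a b)))) (ι-homo-* a b)
    pos (ℤ.-[1+ b ]) = begin
      ιℤ (ℤ.+ a ℤ.* ℤ.-[1+ b ])       ≡⟨ ≡.cong ιℤ (≡.sym (ℤ.neg-distribʳ-* (ℤ.+ a) (ℤ.+ suc b))) ⟩
      ιℤ (ℤ.- (ℤ.+ a ℤ.* ℤ.+ suc b))  ≈⟨ ιℤ-neg (ℤ.+ a ℤ.* ℤ.+ suc b) ⟩
      - ιℤ (ℤ.+ a ℤ.* ℤ.+ suc b)      ≈⟨ -‿cong (pos (ℤ.+ suc b)) ⟩
      - (ι a * ι (suc b))             ≈⟨ -‿distribʳ-* (ι a) (ι (suc b)) ⟩
      ι a * - ι (suc b)               ∎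
  ιℤ-* (ℤ.-[1+ a ]) l = begin
    ιℤ (ℤ.-[1+ a ] ℤ.* l)         ≡⟨ ≡.cong ιℤ (≡.sym (ℤ.neg-distribˡ-* (ℤ.+ suc a) l)) ⟩
    ιℤ (ℤ.- (ℤ.+ suc a ℤ.* l))    ≈⟨ ιℤ-neg (ℤ.+ suc a ℤ.* l) ⟩
    - ιℤ (ℤ.+ suc a ℤ.* l)        ≈⟨ -‿cong (ιℤ-* (ℤ.+ suc a) l) ⟩
    - (ι (suc a) * ιℤ l)          ≈⟨ -‿distribˡ-* (ι (suc a)) (ιℤ l) ⟩
    - ι (suc a) * ιℤ l            ∎

  ιℤ-∑ : ∀ n (f : ℕ → ℤ) → ιℤ (ℤ∑.∑ n f) ≈ ∑ n (λ i → ιℤ (f i))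
  ιℤ-∑ zero    f = ι-0
  ιℤ-∑ (suc n) f = trans (ιℤ-+ (ℤ∑.∑ n f) (f n)) (+-congʳ (ιℤ-∑ n f))

  ιℤ-𝟙 : ∀ {p} {P : Set p} (d : Dec P) → ιℤ (ℤ∑.𝟙 d) ≈ 𝟙 d
  ιℤ-𝟙 (yes _) = trans (ι-suc 0) (trans (+-congˡ ι-0) (+-identityʳ 1#))
  ιℤ-𝟙 (no _)  = ι-0

-- The Fredholm alternative with integer coefficients

module Fredholm where
  open FiniteSum ℤ.+-*-commutativeRing
  open import Data.Integer using (_+_; _*_; _-_; -_)
  open ≡.≡-Reasoning

  dot : ℕ → (ℕ → ℤ) → (ℕ → ℤ) → ℤ
  dot m f v = ∑ m (λ i → f i * v i)

  dot-comm : ∀ m f v → dot m f v ≡ dot m v f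
  dot-comm m f v = ∑-cong m (λ i _ → ℤ.*-comm (f i) (v i))

  dot-combʳ : ∀ m f a v b w → dot m f (λ i → a * v i - b * w i) ≡ a * dot m f v - b * dot m f w
  dot-combʳ m f a v b w = begin
    ∑ m (λ i → f i * (a * v i - b * w i))
      ≡⟨ ∑-cong m (λ i _ → lem (f i) a (v i) b (w i)) ⟩
    ∑ m (λ i → a * (f i * v i) + (- b) * (f i * w i))
      ≡⟨ ∑-+ m _ _ ⟩
    ∑ m (λ i → a * (f i * v i)) + ∑ m (λ i → (- b) * (f i * w i))
      ≡⟨ ≡.cong₂ _+_ (∑-*ˡ m a _) (∑-*ˡ m (- b) _) ⟩
    a * dot m f v + (- b) * dot m f w
      ≡⟨ ≡.cong (a * dot m f v +_) (≡.sym (ℤ.neg-distribˡ-* b _)) ⟩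
    a * dot m f v - b * dot m f w ∎
    where
    lem : ∀ x a y b z → x * (a * y - b * z) ≡ a * (x * y) + (- b) * (x * z)
    lem = ℤ-Solver.solve-∀

  dot-combˡ : ∀ m a f b g v → dot m (λ i → a * f i - b * g i) v ≡ a * dot m f v - b * dot m g v
  dot-combˡ m a f b g v = begin
    dot m (λ i → a * f i - b * g i) v  ≡⟨ dot-comm m _ v ⟩
    dot m v (λ i → a * f i - b * g i)  ≡⟨ dot-combʳ m v a f b g ⟩
    a * dot m v f - b * dot m v g      ≡⟨ ≡.cong₂ (λ x y → a * x - b * y) (dot-comm m v f) (dot-comm m v g) ⟩
    a * dot m f v - b * dot m g v      ∎

  -- The rational span with denominators cleared. In this form it carries over to every field of
  -- characteristic zero, where `D` becomes invertible.
  InSpan : ℕ → ℕ → (ℕ → ℕ → ℤ) → (ℕ → ℤ) → Set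
  InSpan m p v w = Σ ℤ λ D → Σ (ℕ → ℤ) λ μ → D ≢ 0ℤ ×
    (∀ i → i ℕ.< m → D * w i ≡ ∑ p (λ a → μ a * v a i))

  Separated : ℕ → ℕ → (ℕ → ℕ → ℤ) → (ℕ → ℤ) → Set
  Separated m p v w = Σ (ℕ → ℤ) λ f → (∀ a → a ℕ.< p → dot m f (v a) ≡ 0ℤ) × dot m f w ≢ 0ℤ

  zero-or-nonzero : ∀ m (w : ℕ → ℤ) →
    (∀ i → i ℕ.< m → w i ≡ 0ℤ) ⊎ (Σ ℕ λ i → i ℕ.< m × w i ≢ 0ℤ)
  zero-or-nonzero zero    w = inj₁ λ _ ()
  zero-or-nonzero (suc m) w with zero-or-nonzero m w | w m ℤ.≟ 0ℤ
  ... | inj₂ (i , i<m , wi≢0) | _        = inj₂ (i , ℕ.m<n⇒m<1+n i<m , wi≢0)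
  ... | inj₁ _                | no wm≢0  = inj₂ (m , ℕ.≤-refl , wm≢0)
  ... | inj₁ w≡0              | yes wm≡0 = inj₁ λ i i<1+m →
    [ w≡0 i , (λ { refl → wm≡0 }) ]′ (ℕ.m<1+n⇒m<n∨m≡n i<1+m)

  private
    append : ℕ → (ℕ → ℤ) → ℤ → ℕ → ℤ
    append p μ c a with a ℕ.≟ p
    ... | yes _ = c
    ... | no _  = μ a

    ∑-append : ∀ p μ c (v : ℕ → ℤ) →
      ∑ (suc p) (λ a → append p μ c a * v a) ≡ ∑ p (λ a → μ a * v a) + c * v p
    ∑-append p μ c v = ≡.cong₂ _+_
      (∑-cong p λ a a<p → ≡.cong (_* v a) (before a (ℕ.<⇒≢ a<p)))
      (≡.cong (_* v p) at)
      where
      before : ∀ a → a ≢ p → append p μ c a ≡ μ a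
      before a a≢p with a ℕ.≟ p
      ... | yes a≡p = contradiction a≡p a≢p
      ... | no _    = refl
      at : append p μ c p ≡ c
      at with p ℕ.≟ p
      ... | yes _  = refl
      ... | no p≢p = contradiction refl p≢p

    nonzero-* : ∀ {x y} → x ≢ 0ℤ → y ≢ 0ℤ → x * y ≢ 0ℤ
    nonzero-* {x} x≢0 y≢0 xy≡0 = [ x≢0 , y≢0 ]′ (ℤ.i*j≡0⇒i≡0∨j≡0 x xy≡0)

  fredholm : ∀ m p v w → InSpan m p v w ⊎ Separated m p v w
  fredholm m zero v w with zero-or-nonzero m w
  ... | inj₁ w≡0 = inj₁ (1ℤ , (λ _ → 0ℤ) , (λ ()) , λ i i<m →
    ≡.trans (ℤ.*-identityˡ (w i)) (w≡0 i i<m))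
  ... | inj₂ (i , i<m , wi≢0) = inj₂ ((λ j → 𝟙 (j ℕ.≟ i)) , (λ _ ()) , λ eq →
    wi≢0 (≡.trans (≡.sym (∑-𝟙 m w i<m)) eq))
  fredholm m (suc p) v w with fredholm m p v (v p)
  ... | inj₁ (D , μ , D≢0 , Du) = extend (fredholm m p v w)
    where
    extend : InSpan m p v w ⊎ Separated m p v w → InSpan m (suc p) v w ⊎ Separated m (suc p) v w
    extend (inj₁ (E , ν , E≢0 , Ew)) = inj₁ (E , append p ν 0ℤ , E≢0 , λ i i<m → begin
      E * w i                                   ≡⟨ Ew i i<m ⟩
      ∑ p (λ a → ν a * v a i)                   ≡⟨ ℤ.+-identityʳ _ ⟨
      ∑ p (λ a → ν a * v a i) + 0ℤ              ≡⟨ ∑-append p ν 0ℤ (λ a → v a i) ⟨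
      ∑ (suc p) (λ a → append p ν 0ℤ a * v a i) ∎)
    extend (inj₂ (f , f⊥v , fw≢0)) = inj₂ (f , ⊥v , fw≢0)
      where
      D*fu≡0 : D * dot m f (v p) ≡ 0ℤ
      D*fu≡0 = begin
        D * dot m f (v p)                              ≡⟨ ∑-*ˡ m D _ ⟨
        ∑ m (λ i → D * (f i * v p i))                  ≡⟨ ∑-cong m (λ i i<m → ≡.trans
            (x*[y*z] D (f i) (v p i)) (≡.trans (≡.cong (f i *_) (Du i i<m)) (≡.sym (∑-*ˡ p (f i) _)))) ⟩
        ∑ m (λ i → ∑ p (λ a → f i * (μ a * v a i)))    ≡⟨ ∑-swap m p _ ⟩
        ∑ p (λ a → ∑ m (λ i → f i * (μ a * v a i)))    ≡⟨ ∑-cong p (λ a _ → ≡.trans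
            (∑-cong m (λ i _ → x*[y*z] (f i) (μ a) (v a i))) (∑-*ˡ m (μ a) _)) ⟩
        ∑ p (λ a → μ a * dot m f (v a))                ≡⟨ ∑-zero p (λ a a<p → ≡.trans
            (≡.cong (μ a *_) (f⊥v a a<p)) (ℤ.*-zeroʳ (μ a))) ⟩
        0ℤ                                             ∎
        where
        x*[y*z] : ∀ x y z → x * (y * z) ≡ y * (x * z)
        x*[y*z] = ℤ-Solver.solve-∀
      ⊥v : ∀ a → a ℕ.< suc p → dot m f (v a) ≡ 0ℤ
      ⊥v a a<1+p with ℕ.m<1+n⇒m<n∨m≡n a<1+p
      ... | inj₁ a<p  = f⊥v a a<p
      ... | inj₂ refl = [ (λ D≡0 → contradiction D≡0 D≢0) , (λ e → e) ]′ (ℤ.i*j≡0⇒i≡0∨j≡0 D D*fu≡0)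
  ... | inj₂ (h , h⊥v , hu≢0) = extend (fredholm m p v w′)
    where
    u = v p
    hu = dot m h u
    hw = dot m h w
    w′ : ℕ → ℤ
    w′ i = hu * w i - hw * u i
    extend : InSpan m p v w′ ⊎ Separated m p v w′ → InSpan m (suc p) v w ⊎ Separated m (suc p) v w
    extend (inj₁ (D , μ , D≢0 , Dw′)) =
      inj₁ (D * hu , append p μ (D * hw) , nonzero-* D≢0 hu≢0 , λ i i<m → begin
        (D * hu) * w i                                  ≡⟨ lem D hu (w i) hw (u i) ⟩
        D * w′ i + (D * hw) * u i                       ≡⟨ ≡.cong (_+ (D * hw) * u i) (Dw′ i i<m) ⟩
        ∑ p (λ a → μ a * v a i) + (D * hw) * u i        ≡⟨ ∑-append p μ (D * hw) (λ a → v a i) ⟨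
        ∑ (suc p) (λ a → append p μ (D * hw) a * v a i) ∎)
      where
      lem : ∀ D x y z t → (D * x) * y ≡ D * (x * y - z * t) + (D * z) * t
      lem = ℤ-Solver.solve-∀
    extend (inj₂ (f , f⊥v , fw′≢0)) = inj₂ (g , g⊥v , λ gw≡0 → fw′≢0 (begin
        dot m f w′                      ≡⟨ dot-combʳ m f hu w hw u ⟩
        hu * dot m f w - hw * dot m f u ≡⟨ ≡.cong (λ x → hu * dot m f w - x) (ℤ.*-comm hw _) ⟩
        hu * dot m f w - dot m f u * hw ≡⟨ dot-combˡ m hu f (dot m f u) h w ⟨
        dot m g w                       ≡⟨ gw≡0 ⟩
        0ℤ                              ∎))
      where
      g : ℕ → ℤ
      g i = hu * f i - dot m f u * h i
      g⊥v : ∀ a → a ℕ.< suc p → dot m g (v a) ≡ 0ℤ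
      g⊥v a a<1+p with ℕ.m<1+n⇒m<n∨m≡n a<1+p
      ... | inj₁ a<p  = begin
        dot m g (v a)                                    ≡⟨ dot-combˡ m hu f (dot m f u) h (v a) ⟩
        hu * dot m f (v a) - dot m f u * dot m h (v a)   ≡⟨ ≡.cong₂ (λ x y → hu * x - dot m f u * y) (f⊥v a a<p) (h⊥v a a<p) ⟩
        hu * 0ℤ - dot m f u * 0ℤ                         ≡⟨ ≡.cong₂ _-_ (ℤ.*-zeroʳ hu) (ℤ.*-zeroʳ (dot m f u)) ⟩
        0ℤ                                               ∎
      ... | inj₂ refl = begin
        dot m g u                      ≡⟨ dot-combˡ m hu f (dot m f u) h u ⟩
        hu * dot m f u - dot m f u * hu ≡⟨ ≡.cong (λ x → hu * dot m f u - x) (ℤ.*-comm (dot m f u) hu) ⟩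
        hu * dot m f u - hu * dot m f u ≡⟨ ℤ.+-inverseʳ (hu * dot m f u) ⟩
        0ℤ                             ∎

-- Inequalities, finite sums and reciprocals in ℚ

module RationalInequalities where
  open FiniteSum ℚ.+-*-commutativeRing public
  open import Data.Rational using (_+_; _*_; _-_; -_; _≤_; _<_; ∣_∣) public

  ℚ-ring : AlmostCommutativeRing 0ℓ 0ℓ
  ℚ-ring = fromCommutativeRing ℚ.+-*-commutativeRing λ x → dec⇒maybe (0ℚ ℚ.≟ x)

  0≤1 : 0ℚ ≤ 1ℚ
  0≤1 = ℚ.nonNegative⁻¹ 1ℚ

  0≤p+q : ∀ {p q} → 0ℚ ≤ p → 0ℚ ≤ q → 0ℚ ≤ p + q
  0≤p+q 0≤p 0≤q = ℚ.+-mono-≤ 0≤p 0≤q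

  *-mono : ∀ {p q r s} → 0ℚ ≤ p → p ≤ q → 0ℚ ≤ r → r ≤ s → p * r ≤ q * s
  *-mono {p} {q} {r} {s} 0≤p p≤q 0≤r r≤s = ℚ.≤-trans
    (ℚ.*-monoʳ-≤-nonNeg r {{ℚ.nonNegative 0≤r}} p≤q)
    (ℚ.*-monoˡ-≤-nonNeg q {{ℚ.nonNegative (ℚ.≤-trans 0≤p p≤q)}} r≤s)

  0≤p*q : ∀ {p q} → 0ℚ ≤ p → 0ℚ ≤ q → 0ℚ ≤ p * q
  0≤p*q {p} {q} 0≤p 0≤q = ≡.subst (_≤ p * q) (ℚ.*-zeroˡ 0ℚ) (*-mono ℚ.≤-refl 0≤p ℚ.≤-refl 0≤q)

  *-monoˡ : ∀ r {p q} → 0ℚ ≤ r → p ≤ q → r * p ≤ r * q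
  *-monoˡ r 0≤r = ℚ.*-monoˡ-≤-nonNeg r {{ℚ.nonNegative 0≤r}}

  *-monoʳ : ∀ r {p q} → 0ℚ ≤ r → p ≤ q → p * r ≤ q * r
  *-monoʳ r 0≤r = ℚ.*-monoʳ-≤-nonNeg r {{ℚ.nonNegative 0≤r}}

  p≤p+q : ∀ {p q} → 0ℚ ≤ q → p ≤ p + q
  p≤p+q {p} {q} 0≤q = ≡.subst (_≤ p + q) (ℚ.+-identityʳ p) (ℚ.+-monoʳ-≤ p 0≤q)

  p≤q+p : ∀ {p q} → 0ℚ ≤ q → p ≤ q + p
  p≤q+p {p} {q} 0≤q = ≡.subst (_≤ q + p) (ℚ.+-identityˡ p) (ℚ.+-monoˡ-≤ p 0≤q)

  0≤q-p : ∀ {p q} → p ≤ q → 0ℚ ≤ q - p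
  0≤q-p {p} {q} p≤q = ≡.subst (_≤ q - p) (ℚ.+-inverseʳ p) (ℚ.+-monoˡ-≤ (- p) p≤q)

  q-p≤q : ∀ {p q} → 0ℚ ≤ p → q - p ≤ q
  q-p≤q {p} {q} 0≤p = ≡.subst (q - p ≤_) (ℚ.+-identityʳ q) (ℚ.+-monoʳ-≤ q (ℚ.neg-antimono-≤ 0≤p))

  0≤p² : ∀ p → 0ℚ ≤ p * p
  0≤p² p with ℚ.≤-total 0ℚ p
  ... | inj₁ 0≤p = 0≤p*q 0≤p 0≤p
  ... | inj₂ p≤0 = ≡.subst (0ℚ ≤_) (lem p) (0≤p*q 0≤-p 0≤-p)
    where
    0≤-p = ℚ.neg-antimono-≤ p≤0
    lem : ∀ p → - p * - p ≡ p * p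
    lem = solve-∀ ℚ-ring

  p≤∣p∣ : ∀ p → p ≤ ∣ p ∣
  p≤∣p∣ p with ℚ.≤-total 0ℚ p
  ... | inj₁ 0≤p = ℚ.≤-reflexive (≡.sym (ℚ.0≤p⇒∣p∣≡p 0≤p))
  ... | inj₂ p≤0 = ℚ.≤-trans p≤0 (ℚ.0≤∣p∣ p)

  ∣+∣≤ : ∀ {p q a b} → ∣ p ∣ ≤ a → ∣ q ∣ ≤ b → ∣ p + q ∣ ≤ a + b
  ∣+∣≤ {p} {q} p≤a q≤b = ℚ.≤-trans (ℚ.∣p+q∣≤∣p∣+∣q∣ p q) (ℚ.+-mono-≤ p≤a q≤b)

  ∣-∣≤ : ∀ {p q a b} → ∣ p ∣ ≤ a → ∣ q ∣ ≤ b → ∣ p - q ∣ ≤ a + b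
  ∣-∣≤ {p} {q} p≤a q≤b = ℚ.≤-trans (ℚ.∣p-q∣≤∣p∣+∣q∣ p q) (ℚ.+-mono-≤ p≤a q≤b)

  ∣*∣≤ : ∀ {p q a b} → ∣ p ∣ ≤ a → ∣ q ∣ ≤ b → ∣ p * q ∣ ≤ a * b
  ∣*∣≤ {p} {q} {a} {b} p≤a q≤b = ≡.subst (_≤ a * b) (≡.sym (ℚ.∣p*q∣≡∣p∣*∣q∣ p q))
    (*-mono (ℚ.0≤∣p∣ p) p≤a (ℚ.0≤∣p∣ q) q≤b)

  ∣p∣≤⇒0≤ : ∀ {p a} → ∣ p ∣ ≤ a → 0ℚ ≤ a
  ∣p∣≤⇒0≤ {p} = ℚ.≤-trans (ℚ.0≤∣p∣ p)

  ∣p∣≡p : ∀ {p} → 0ℚ ≤ p → ∣ p ∣ ≡ p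
  ∣p∣≡p = ℚ.0≤p⇒∣p∣≡p

  0≤p≤a⇒∣p∣≤a : ∀ {p a} → 0ℚ ≤ p → p ≤ a → ∣ p ∣ ≤ a
  0≤p≤a⇒∣p∣≤a {p} {a} 0≤p p≤a = ≡.subst (_≤ a) (≡.sym (∣p∣≡p 0≤p)) p≤a

  ∑-mono : ∀ n {f g : ℕ → ℚ} → (∀ i → i ℕ.< n → f i ≤ g i) → ∑ n f ≤ ∑ n g
  ∑-mono zero    _   = ℚ.≤-refl
  ∑-mono (suc n) f≤g = ℚ.+-mono-≤ (∑-mono n λ i i<n → f≤g i (ℕ.m<n⇒m<1+n i<n)) (f≤g n ℕ.≤-refl)

  ∑-nonneg : ∀ n {f : ℕ → ℚ} → (∀ i → i ℕ.< n → 0ℚ ≤ f i) → 0ℚ ≤ ∑ n f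
  ∑-nonneg zero    _   = ℚ.≤-refl
  ∑-nonneg (suc n) 0≤f = 0≤p+q (∑-nonneg n λ i i<n → 0≤f i (ℕ.m<n⇒m<1+n i<n)) (0≤f n ℕ.≤-refl)

  ∣∑∣≤ : ∀ n {f g : ℕ → ℚ} → (∀ i → i ℕ.< n → ∣ f i ∣ ≤ g i) → ∣ ∑ n f ∣ ≤ ∑ n g
  ∣∑∣≤ zero    _   = ℚ.≤-refl
  ∣∑∣≤ (suc n) f≤g = ∣+∣≤ (∣∑∣≤ n λ i i<n → f≤g i (ℕ.m<n⇒m<1+n i<n)) (f≤g n ℕ.≤-refl)

  ∑-term≤ : ∀ n (f : ℕ → ℚ) → (∀ i → i ℕ.< n → 0ℚ ≤ f i) → ∀ {j} → j ℕ.< n → f j ≤ ∑ n f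
  ∑-term≤ (suc n) f 0≤f {j} j<1+n with ℕ.m<1+n⇒m<n∨m≡n j<1+n
  ... | inj₁ j<n  = ℚ.≤-trans (∑-term≤ n f (λ i i<n → 0≤f i (ℕ.m<n⇒m<1+n i<n)) j<n) (p≤p+q (0≤f n ℕ.≤-refl))
  ... | inj₂ refl = p≤q+p (∑-nonneg n λ i i<n → 0≤f i (ℕ.m<n⇒m<1+n i<n))

  ∑-mono-length : ∀ {m n} → m ℕ.≤ n → (f : ℕ → ℚ) → (∀ i → i ℕ.< n → 0ℚ ≤ f i) → ∑ m f ≤ ∑ n f
  ∑-mono-length {m} {n} m≤n f 0≤f with n ℕ.∸ m | ℕ.m+[n∸m]≡n m≤n
  ... | k | refl = ≡.subst (∑ m f ≤_) (≡.sym (∑-split m k f))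
    (p≤p+q (∑-nonneg k λ i i<k → 0≤f (m ℕ.+ i) (ℕ.+-monoʳ-< m i<k)))

  abstract
    ι : ℕ → ℚ
    ι zero    = 0ℚ
    ι (suc m) = 1ℚ + ι m

    ι-0 : ι 0 ≡ 0ℚ
    ι-0 = refl

    ι-suc : ∀ m → ι (suc m) ≡ 1ℚ + ι m
    ι-suc m = refl

    ι-+ : ∀ m n → ι (m ℕ.+ n) ≡ ι m + ι n
    ι-+ zero    n = ≡.sym (ℚ.+-identityˡ (ι n))
    ι-+ (suc m) n = ≡.trans (≡.cong (1ℚ +_) (ι-+ m n)) (≡.sym (ℚ.+-assoc 1ℚ (ι m) (ι n)))

    ι-* : ∀ m n → ι (m ℕ.* n) ≡ ι m * ι n
    ι-* zero    n = ≡.sym (ℚ.*-zeroˡ (ι n))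
    ι-* (suc m) n = ≡.trans (ι-+ n (m ℕ.* n)) (≡.trans (≡.cong (ι n +_) (ι-* m n)) (lem (ι m) (ι n)))
      where
      lem : ∀ x y → y + x * y ≡ (1ℚ + x) * y
      lem = solve-∀ ℚ-ring

    0≤ι : ∀ m → 0ℚ ≤ ι m
    0≤ι zero    = ℚ.≤-refl
    0≤ι (suc m) = 0≤p+q 0≤1 (0≤ι m)

    ι-mono : ∀ {m n} → m ℕ.≤ n → ι m ≤ ι n
    ι-mono {n = n} z≤n = 0≤ι n
    ι-mono (s≤s m≤n)   = ℚ.+-monoʳ-≤ 1ℚ (ι-mono m≤n)

    0<ι : ∀ m → 0ℚ < ι (suc m)
    0<ι m = ℚ.<-≤-trans (ℚ.positive⁻¹ 1ℚ) (p≤p+q (0≤ι m))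

  ι-1 : ι 1 ≡ 1ℚ
  ι-1 = ≡.trans (ι-suc 0) (≡.trans (≡.cong (1ℚ +_) ι-0) (ℚ.+-identityʳ 1ℚ))

  abstract
    recip : ∀ p → 0ℚ < p → ℚ
    recip p 0<p = (ℚ.1/ p) {{ℚ.pos⇒nonZero p {{ℚ.positive 0<p}}}}

    recip-inverse : ∀ p (0<p : 0ℚ < p) → p * recip p 0<p ≡ 1ℚ
    recip-inverse p 0<p = ℚ.*-inverseʳ p {{ℚ.pos⇒nonZero p {{ℚ.positive 0<p}}}}

    0≤recip : ∀ p (0<p : 0ℚ < p) → 0ℚ ≤ recip p 0<p
    0≤recip p 0<p = ℚ.<⇒≤ (ℚ.positive⁻¹ _ {{ℚ.1/pos⇒pos p {{ℚ.positive 0<p}}}})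

    0<recip : ∀ p (0<p : 0ℚ < p) → 0ℚ < recip p 0<p
    0<recip p 0<p = ℚ.positive⁻¹ _ {{ℚ.1/pos⇒pos p {{ℚ.positive 0<p}}}}

  recip-anti : ∀ {p q} (0<p : 0ℚ < p) (0<q : 0ℚ < q) → p ≤ q → recip q 0<q ≤ recip p 0<p
  recip-anti {p} {q} 0<p 0<q p≤q = ℚ.≤-trans (ℚ.≤-reflexive eq₁)
    (ℚ.≤-trans (*-monoʳ (recip p 0<p * recip q 0<q) (0≤p*q (0≤recip p 0<p) (0≤recip q 0<q)) p≤q)
               (ℚ.≤-reflexive eq₂))
    where
    eq₁ : recip q 0<q ≡ p * (recip p 0<p * recip q 0<q)
    eq₁ = ≡.trans (≡.sym (≡.trans (≡.cong (_* recip q 0<q) (recip-inverse p 0<p)) (ℚ.*-identityˡ _)))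
                  (ℚ.*-assoc p _ _)
    lem : ∀ q x y → q * (x * y) ≡ (q * y) * x
    lem = solve-∀ ℚ-ring
    eq₂ : q * (recip p 0<p * recip q 0<q) ≡ recip p 0<p
    eq₂ = ≡.trans (lem q _ _) (≡.trans (≡.cong (_* recip p 0<p) (recip-inverse q 0<q)) (ℚ.*-identityˡ _))

  abstract
    -- With the default `inv 0 = 0` the rule `inv-*` has no exceptions, and the term k = 0 of the
    -- symmetric sums of 1/k drops out by itself.
    inv : ℕ → ℚ
    inv zero    = 0ℚ
    inv (suc m) = recip (ι (suc m)) (0<ι m)

    inv-0 : inv 0 ≡ 0ℚ
    inv-0 = refl

    ι-inv : ∀ m → ι (suc m) * inv (suc m) ≡ 1ℚ
    ι-inv m = recip-inverse (ι (suc m)) (0<ι m)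

    0≤inv : ∀ m → 0ℚ ≤ inv m
    0≤inv zero    = ℚ.≤-refl
    0≤inv (suc m) = 0≤recip (ι (suc m)) (0<ι m)

    0<inv : ∀ m → 0ℚ < inv (suc m)
    0<inv m = 0<recip (ι (suc m)) (0<ι m)

    inv-anti : ∀ {m n} → m ℕ.≤ n → inv (suc n) ≤ inv (suc m)
    inv-anti {m} {n} m≤n = recip-anti (0<ι m) (0<ι n) (ι-mono (s≤s m≤n))

  inv≤1 : ∀ m → inv m ≤ 1ℚ
  inv≤1 zero    = ≡.subst (_≤ 1ℚ) (≡.sym inv-0) 0≤1
  inv≤1 (suc m) = ℚ.≤-trans (inv-anti {0} {m} z≤n) (ℚ.≤-reflexive
    (≡.trans (≡.sym (ℚ.*-identityˡ _)) (≡.trans (≡.cong (_* inv 1) (≡.sym ι-1)) (ι-inv 0))))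

  *-cancel-ι : ∀ m {p q} → ι (suc m) * p ≡ ι (suc m) * q → p ≡ q
  *-cancel-ι m {p} {q} eq = ≡.trans (≡.sym (undo p)) (≡.trans (≡.cong (inv (suc m) *_) eq) (undo q))
    where
    lem : ∀ i x p → i * (x * p) ≡ (x * i) * p
    lem = solve-∀ ℚ-ring
    undo : ∀ p → inv (suc m) * (ι (suc m) * p) ≡ p
    undo p = ≡.trans (lem (inv (suc m)) (ι (suc m)) p) (≡.trans (≡.cong (_* p) (ι-inv m)) (ℚ.*-identityˡ p))

  inv-* : ∀ m n → inv (m ℕ.* n) ≡ inv m * inv n
  inv-* zero    n rewrite inv-0 = ≡.sym (ℚ.*-zeroˡ (inv n))
  inv-* (suc m) zero rewrite ℕ.*-zeroʳ m | inv-0 = ≡.sym (ℚ.*-zeroʳ (inv (suc m)))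
  inv-* (suc m) (suc n) = *-cancel-ι (n ℕ.+ m ℕ.* suc n) (≡.trans (ι-inv (n ℕ.+ m ℕ.* suc n)) (≡.sym
    (≡.trans (≡.cong (_* (inv (suc m) * inv (suc n))) (ι-* (suc m) (suc n)))
    (≡.trans (lem (ι (suc m)) (ι (suc n)) (inv (suc m)) (inv (suc n)))
             (≡.cong₂ _*_ (ι-inv m) (ι-inv n))))))
    where
    lem : ∀ x y i j → x * y * (i * j) ≡ (x * i) * (y * j)
    lem = solve-∀ ℚ-ring

  ∑-const : ∀ n a → ∑ n (λ _ → a) ≡ ι n * a
  ∑-const zero    a = ≡.sym (≡.trans (≡.cong (_* a) ι-0) (ℚ.*-zeroˡ a))
  ∑-const (suc n) a = ≡.trans (≡.cong (_+ a) (∑-const n a)) (≡.trans (lem (ι n) a) (≡.cong (_* a) (≡.sym (ι-suc n))))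
    where
    lem : ∀ x a → x * a + a ≡ (1ℚ + x) * a
    lem = solve-∀ ℚ-ring

  ∣∑∣≤const : ∀ n {f : ℕ → ℚ} {C} → (∀ i → i ℕ.< n → ∣ f i ∣ ≤ C) → ∣ ∑ n f ∣ ≤ ι n * C
  ∣∑∣≤const n {C = C} f≤C = ℚ.≤-trans (∣∑∣≤ n f≤C) (ℚ.≤-reflexive (∑-const n C))

-- Summation by parts, periodic sequences and harmonic sums

module AbelSummation where
  open RationalInequalities

  abel : ∀ (F g : ℕ → ℚ) M →
    ∑ M (λ i → F i * g i) ≡ ∑ M F * g M + ∑ M (λ i → ∑ (suc i) F * (g i - g (suc i)))
  abel F g zero = ≡.sym (≡.trans (ℚ.+-identityʳ _) (ℚ.*-zeroˡ (g 0)))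
  abel F g (suc M) = ≡.trans (≡.cong (_+ F M * g M) (abel F g M))
    (lem (∑ M F) (F M) (g M) (g (suc M)) _)
    where
    lem : ∀ A f x y S → A * x + S + f * x ≡ (A + f) * y + (S + (A + f) * (x - y))
    lem = solve-∀ ℚ-ring

  ∑-telescope : ∀ (g : ℕ → ℚ) M → ∑ M (λ i → g i - g (suc i)) ≡ g 0 - g M
  ∑-telescope g zero    = ≡.sym (ℚ.+-inverseʳ (g 0))
  ∑-telescope g (suc M) = ≡.trans (≡.cong (_+ (g M - g (suc M))) (∑-telescope g M)) (lem (g 0) (g M) (g (suc M)))
    where
    lem : ∀ x y z → x - y + (y - z) ≡ x - z
    lem = solve-∀ ℚ-ring

  abel-antitone : ∀ {F g : ℕ → ℚ} {C} → (∀ m → ∣ ∑ m F ∣ ≤ C) →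
    (∀ i → 0ℚ ≤ g i) → (∀ i → g (suc i) ≤ g i) → ∀ M → ∣ ∑ M (λ i → F i * g i) ∣ ≤ C * g 0
  abel-antitone {F} {g} {C} A≤C 0≤g g↓ M = ≡.subst (λ x → ∣ x ∣ ≤ C * g 0) (≡.sym (abel F g M))
    (ℚ.≤-trans (∣+∣≤ (∣*∣≤ (A≤C M) (ℚ.≤-reflexive (∣p∣≡p (0≤g M))))
                     (∣∑∣≤ M λ i _ → ∣*∣≤ (A≤C (suc i)) (ℚ.≤-reflexive (∣p∣≡p (0≤q-p (g↓ i))))))
      (ℚ.≤-reflexive (≡.trans
        (≡.cong (C * g M +_) (≡.trans (∑-*ˡ M C _) (≡.cong (C *_) (∑-telescope g M))))
        (lem C (g 0) (g M)))))
    where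
    lem : ∀ C x y → C * y + C * (x - y) ≡ C * x
    lem = solve-∀ ℚ-ring

  -- The total variation is at most the last value, whence the factor 2. Monotonicity is asked for
  -- only up to `M` because the function `inv (N ∸ i)`, to which this is applied, increases up to i
  -- = N - 1 and then falls to the default 0.
  abel-monotone : ∀ {F g : ℕ → ℚ} {C} → (∀ m → ∣ ∑ m F ∣ ≤ C) → ∀ M →
    (∀ i → i ℕ.≤ M → 0ℚ ≤ g i) → (∀ i → i ℕ.< M → g i ≤ g (suc i)) →
    ∣ ∑ (suc M) (λ i → F i * g i) ∣ ≤ (C + C) * g M
  abel-monotone {F} {g} {C} A≤C M 0≤g g↑ =
    ≡.subst (λ x → ∣ x ∣ ≤ (C + C) * g M) (≡.sym eq)
    (ℚ.≤-trans (∣+∣≤ (∣*∣≤ (A≤C (suc M)) (ℚ.≤-reflexive (∣p∣≡p (0≤g M ℕ.≤-refl))))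
                     (∣∑∣≤ M λ i i<M → ∣*∣≤ (A≤C (suc i)) (ℚ.≤-reflexive (∣g-g∣ i i<M))))
      (ℚ.≤-trans (ℚ.≤-reflexive (≡.cong (C * g M +_) (≡.trans (∑-*ˡ M C _) (≡.cong (C *_) sum))))
      (ℚ.≤-trans (ℚ.+-monoʳ-≤ (C * g M) (*-monoˡ C 0≤C (q-p≤q (0≤g 0 z≤n))))
        (ℚ.≤-reflexive (≡.sym (ℚ.*-distribʳ-+ (g M) C C))))))
    where
    0≤C = ∣p∣≤⇒0≤ {0ℚ} (A≤C 0)
    lem₁ : ∀ A f x S → A * x + S + f * x ≡ (A + f) * x + S
    lem₁ = solve-∀ ℚ-ring
    eq : ∑ (suc M) (λ i → F i * g i) ≡ ∑ (suc M) F * g M + ∑ M (λ i → ∑ (suc i) F * (g i - g (suc i)))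
    eq = ≡.trans (≡.cong (_+ F M * g M) (abel F g M)) (lem₁ (∑ M F) (F M) (g M) _)
    lem₂ : ∀ x y → - (x - y) ≡ y - x
    lem₂ = solve-∀ ℚ-ring
    ∣g-g∣ : ∀ i → i ℕ.< M → ∣ g i - g (suc i) ∣ ≡ g (suc i) - g i
    ∣g-g∣ i i<M = ≡.trans (≡.sym (ℚ.∣-p∣≡∣p∣ _)) (≡.trans (≡.cong ∣_∣ (lem₂ (g i) (g (suc i)))) (∣p∣≡p (0≤q-p (g↑ i i<M))))
    sum : ∑ M (λ i → g (suc i) - g i) ≡ g M - g 0
    sum = ≡.trans (∑-cong M λ i _ → ≡.sym (lem₂ (g i) (g (suc i))))
         (≡.trans (∑-neg M _) (≡.trans (≡.cong -_ (∑-telescope g M)) (lem₂ (g 0) (g M))))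

  ∑-shift : ∀ K M (F : ℕ → ℚ) → ∑ M (λ i → F (K ℕ.+ i)) ≡ ∑ (K ℕ.+ M) F - ∑ K F
  ∑-shift K M F = ≡.trans (lem (∑ K F) _) (≡.cong (_- ∑ K F) (≡.sym (∑-split K M F)))
    where
    lem : ∀ x y → y ≡ x + y - x
    lem = solve-∀ ℚ-ring

  shift-bounded : ∀ {F : ℕ → ℚ} {C} → (∀ m → ∣ ∑ m F ∣ ≤ C) → ∀ K m → ∣ ∑ m (λ i → F (K ℕ.+ i)) ∣ ≤ C + C
  shift-bounded {F} {C} A≤C K m = ≡.subst (λ x → ∣ x ∣ ≤ C + C) (≡.sym (∑-shift K m F)) (∣-∣≤ (A≤C (K ℕ.+ m)) (A≤C K))

  Periodic : ℕ → (ℕ → ℚ) → Set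
  Periodic n F = ∀ i → F (n ℕ.+ i) ≡ F i

  periodic-* : ∀ {n F} → Periodic n F → ∀ q i → F (q ℕ.* n ℕ.+ i) ≡ F i
  periodic-* per zero    i = refl
  periodic-* {n} {F} per (suc q) i =
    ≡.trans (≡.cong F (ℕ.+-assoc n (q ℕ.* n) i)) (≡.trans (per _) (periodic-* per q i))

  periodic-% : ∀ {n F} .{{_ : ℕ.NonZero n}} → Periodic n F → ∀ i → F (i ℕ.% n) ≡ F i
  periodic-% {n} {F} per i = ≡.sym (≡.trans
    (≡.cong F (≡.trans (ℕ.m≡m%n+[m/n]*n i n) (ℕ.+-comm (i ℕ.% n) _))) (periodic-* per (i ℕ./ n) (i ℕ.% n)))

  periodic-bounded : ∀ {n F} .{{_ : ℕ.NonZero n}} → Periodic n F → ∀ i → ∣ F i ∣ ≤ ∑ n (λ i → ∣ F i ∣)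
  periodic-bounded {n} {F} per i = ≡.subst (λ x → ∣ x ∣ ≤ ∑ n (λ i → ∣ F i ∣)) (periodic-% per i)
    (∑-term≤ n (λ i → ∣ F i ∣) (λ i _ → ℚ.0≤∣p∣ (F i)) (ℕ.m%n<n i n))

  -- Complete periods cancel, which leaves a remainder shorter than one period.
  mean-zero-∑-bounded : ∀ {n F} .{{_ : ℕ.NonZero n}} → Periodic n F → ∑ n F ≡ 0ℚ →
    ∀ m → ∣ ∑ m F ∣ ≤ ∑ n (λ i → ∣ F i ∣)
  mean-zero-∑-bounded {n} {F} per ∑F≡0 m = ≡.subst (λ x → ∣ x ∣ ≤ _) (≡.sym eq)
    (ℚ.≤-trans (∣∑∣≤ (m ℕ.% n) (λ i _ → ℚ.≤-refl))
      (∑-mono-length (ℕ.<⇒≤ (ℕ.m%n<n m n)) (λ i → ∣ F i ∣) (λ i _ → ℚ.0≤∣p∣ (F i))))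
    where
    open ≡.≡-Reasoning
    q = m ℕ./ n
    eq : ∑ m F ≡ ∑ (m ℕ.% n) F
    eq = begin
      ∑ m F
        ≡⟨ ≡.cong (λ k → ∑ k F) (≡.trans (ℕ.m≡m%n+[m/n]*n m n) (ℕ.+-comm (m ℕ.% n) _)) ⟩
      ∑ (q ℕ.* n ℕ.+ m ℕ.% n) F
        ≡⟨ ∑-split (q ℕ.* n) (m ℕ.% n) F ⟩
      ∑ (q ℕ.* n) F + ∑ (m ℕ.% n) (λ i → F (q ℕ.* n ℕ.+ i))
        ≡⟨ ≡.cong₂ _+_ (≡.trans (∑-blocks q n F) (∑-zero q λ i _ →
              ≡.trans (∑-cong n λ j _ → periodic-* per i j) ∑F≡0))
            (∑-cong (m ℕ.% n) λ i _ → periodic-* per q i) ⟩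
      0ℚ + ∑ (m ℕ.% n) F
        ≡⟨ ℚ.+-identityˡ _ ⟩
      ∑ (m ℕ.% n) F ∎

  H : ℕ → ℚ
  H N = ∑ N (λ i → inv (suc i))

  0≤H : ∀ N → 0ℚ ≤ H N
  0≤H N = ∑-nonneg N λ i _ → 0≤inv (suc i)

  ι*inv : ∀ m n → ι (m ℕ.* suc n) * inv (suc n) ≡ ι m
  ι*inv m n = ≡.trans (≡.cong (_* inv (suc n)) (ι-* m (suc n)))
    (≡.trans (ℚ.*-assoc (ι m) _ _) (≡.trans (≡.cong (ι m *_) (ι-inv n)) (ℚ.*-identityʳ (ι m))))

  -- With s = j + 1, the first s terms are at most 1 each and the remaining s² - s terms at most 1/s
  -- each. This crude bound makes H(N)/N decay along squares; the final comparison of N^(1/3) with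
  -- N^(1/2) needs the logarithmic bound `H-dyadic`.
  H-square : ∀ j → H (suc j ℕ.* suc j) ≤ ι (suc j) + ι (suc j)
  H-square j = ℚ.≤-trans (ℚ.≤-reflexive (∑-split s (j ℕ.* s) _)) (ℚ.+-mono-≤ first rest)
    where
    s = suc j
    first : H s ≤ ι s
    first = ℚ.≤-trans (∑-mono s λ i _ → inv≤1 (suc i)) (ℚ.≤-reflexive (≡.trans (∑-const s 1ℚ) (ℚ.*-identityʳ (ι s))))
    rest : ∑ (j ℕ.* s) (λ i → inv (suc (s ℕ.+ i))) ≤ ι s
    rest = ℚ.≤-trans (∑-mono (j ℕ.* s) λ i _ → inv-anti {j} {s ℕ.+ i} (ℕ.≤-trans (ℕ.n≤1+n j) (ℕ.m≤m+n s i)))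
      (ℚ.≤-trans (ℚ.≤-reflexive (≡.trans (∑-const (j ℕ.* s) (inv s)) (ι*inv j j))) (ι-mono (ℕ.n≤1+n j)))

  H-double : ∀ m → H (suc m ℕ.+ suc m) ≤ H (suc m) + 1ℚ
  H-double m = ℚ.≤-trans (ℚ.≤-reflexive (∑-split (suc m) (suc m) _)) (ℚ.+-monoʳ-≤ (H (suc m))
    (ℚ.≤-trans (∑-mono (suc m) λ i _ → inv-anti {m} {suc m ℕ.+ i} (ℕ.≤-trans (ℕ.n≤1+n m) (ℕ.m≤m+n (suc m) i)))
      (ℚ.≤-reflexive (≡.trans (∑-const (suc m) (inv (suc m))) (ι-inv m)))))

  H-dyadic : ∀ i → H (2 ℕ.^ i) ≤ ι (suc i)
  H-dyadic zero = ℚ.≤-trans (ℚ.≤-reflexive (ℚ.+-identityˡ (inv 1))) (ℚ.≤-trans (inv≤1 1) (ℚ.≤-reflexive (≡.sym ι-1)))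
  H-dyadic (suc i) with 2 ℕ.^ i | H-dyadic i | ℕ.m^n>0 2 i
  ... | suc m | ih | _ rewrite ℕ.+-identityʳ m = ℚ.≤-trans (H-double m)
    (ℚ.≤-trans (ℚ.+-monoˡ-≤ 1ℚ ih) (ℚ.≤-reflexive (≡.trans (ℚ.+-comm (ι (suc i)) 1ℚ) (≡.sym (ι-suc (suc i))))))

-- Riesz means and the hyperbola method

module HyperbolaMethod where
  open RationalInequalities
  open AbelSummation

  mean : ℕ → (ℕ → ℚ) → ℚ
  mean n G = inv n * ∑ n G

  mean-zero : ∀ n {G} → ∑ (suc n) (λ i → G i - mean (suc n) G) ≡ 0ℚ
  mean-zero n {G} = ≡.trans (∑-+ (suc n) G _) (≡.trans (≡.cong (∑ (suc n) G +_)
    (≡.trans (∑-const (suc n) _) (≡.trans (lem (ι (suc n)) (inv (suc n)) (∑ (suc n) G))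
      (≡.cong -_ (≡.trans (≡.cong (_* ∑ (suc n) G) (ι-inv n)) (ℚ.*-identityˡ _))))))
    (ℚ.+-inverseʳ (∑ (suc n) G)))
    where
    lem : ∀ a b c → a * - (b * c) ≡ - ((a * b) * c)
    lem = solve-∀ ℚ-ring

  -- Truncated subtraction builds in the cutoff, so sums over `i` may run over any sufficiently long
  -- range.
  sawtooth : ℕ → ℕ → ℕ → ℚ
  sawtooth y k i = ι (y ℕ.∸ suc i ℕ.* k)

  sawtooth-suc : ∀ y k i → sawtooth y k (suc i) ≡ sawtooth (y ℕ.∸ k) k i
  sawtooth-suc y k i = ≡.cong ι (≡.sym (ℕ.∸-+-assoc y k (suc i ℕ.* k)))

  sawtooth-zero : ∀ {y k} → y ℕ.≤ k → ∀ i → sawtooth y k i ≡ 0ℚ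
  sawtooth-zero {y} {k} y≤k i = ≡.trans (≡.cong ι (ℕ.m≤n⇒m∸n≡0 (ℕ.≤-trans y≤k (ℕ.m≤m+n k (i ℕ.* k))))) ι-0

  ∑-sawtooth-suc : ∀ m y k → ∑ (suc m) (sawtooth y k) ≡ ι (y ℕ.∸ k) + ∑ m (sawtooth (y ℕ.∸ k) k)
  ∑-sawtooth-suc m y k = ≡.trans (∑-head m _) (≡.cong₂ _+_
    (≡.cong (λ x → ι (y ℕ.∸ x)) (ℕ.+-identityʳ k)) (∑-cong m λ i _ → sawtooth-suc y k i))

  private
    ι-split : ∀ {y k} → k ℕ.≤ y → ι y ≡ ι (y ℕ.∸ k) + ι k
    ι-split {y} {k} k≤y = ≡.trans (≡.cong ι (≡.sym (ℕ.m∸n+n≡m k≤y))) (ι-+ (y ℕ.∸ k) k)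

  ∑-sawtooth≤ : ∀ m y k → ι k * ∑ m (sawtooth y k) ≤ ι y * ι y
  ∑-sawtooth≤ zero y k = ≡.subst (_≤ ι y * ι y) (≡.sym (ℚ.*-zeroʳ (ι k))) (0≤p² (ι y))
  ∑-sawtooth≤ (suc m) y k with ℕ.≤-total y k
  ... | inj₁ y≤k = ≡.subst (_≤ ι y * ι y) (≡.sym (≡.trans
      (≡.cong (ι k *_) (∑-zero (suc m) λ i _ → sawtooth-zero y≤k i)) (ℚ.*-zeroʳ (ι k)))) (0≤p² (ι y))
  ... | inj₂ k≤y = ℚ.≤-trans (ℚ.≤-reflexive (≡.trans (≡.cong (ι k *_) (∑-sawtooth-suc m y k))
        (ℚ.*-distribˡ-+ (ι k) (ι y′) _)))
      (ℚ.≤-trans (ℚ.+-monoʳ-≤ (ι k * ι y′) (∑-sawtooth≤ m y′ k))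
      (ℚ.≤-trans (p≤p+q (0≤p*q (0≤ι k) (0≤ι y)))
        (ℚ.≤-reflexive (≡.trans (≡.cong (λ z → ι k * ι y′ + ι y′ * ι y′ + ι k * z) (ι-split k≤y))
          (≡.trans (lem (ι k) (ι y′)) (≡.cong₂ _*_ (≡.sym (ι-split k≤y)) (≡.sym (ι-split k≤y))))))))
    where
    y′ = y ℕ.∸ k
    lem : ∀ k y → k * y + y * y + k * (y + k) ≡ (y + k) * (y + k)
    lem = solve-∀ ℚ-ring

  -- The quantity inside the absolute value does not change when the first term is removed and y is
  -- replaced by y - k. The descent ends at some y ≤ k, where it equals y (k - y). The hypothesis
  -- says that `m` terms suffice to get there.
  ∑-sawtooth-asymptotic : ∀ m y k → y ℕ.≤ m ℕ.* k →
    ∣ (1ℚ + 1ℚ) * ι k * ∑ m (sawtooth y k) - ι y * ι y + ι y * ι k ∣ ≤ ι k * ι k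
  ∑-sawtooth-asymptotic zero zero k _ = ≡.subst (λ x → ∣ x ∣ ≤ ι k * ι k)
      (≡.sym (≡.trans (≡.cong (λ z → (1ℚ + 1ℚ) * ι k * 0ℚ - z * z + z * ι k) ι-0) (lem (ι k)))) (0≤p² (ι k))
    where
    lem : ∀ k → (1ℚ + 1ℚ) * k * 0ℚ - 0ℚ * 0ℚ + 0ℚ * k ≡ 0ℚ
    lem = solve-∀ ℚ-ring
  ∑-sawtooth-asymptotic (suc m) y k y≤ with ℕ.≤-total y k
  ... | inj₁ y≤k = ≡.subst (λ x → ∣ x ∣ ≤ ι k * ι k) (≡.sym (≡.trans
      (≡.cong (λ z → (1ℚ + 1ℚ) * ι k * z - ι y * ι y + ι y * ι k) (∑-zero (suc m) λ i _ → sawtooth-zero y≤k i))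
      (lem (ι k) (ι y))))
    (0≤p≤a⇒∣p∣≤a (0≤p*q (0≤ι y) (0≤q-p (ι-mono y≤k)))
      (*-mono (0≤ι y) (ι-mono y≤k) (0≤q-p (ι-mono y≤k)) (q-p≤q (0≤ι y))))
    where
    lem : ∀ k y → (1ℚ + 1ℚ) * k * 0ℚ - y * y + y * k ≡ y * (k - y)
    lem = solve-∀ ℚ-ring
  ... | inj₂ k≤y = ≡.subst (λ x → ∣ x ∣ ≤ ι k * ι k) (≡.sym (≡.trans
      (≡.cong₂ (λ s z → (1ℚ + 1ℚ) * ι k * s - z * z + z * ι k) (∑-sawtooth-suc m y k) (ι-split k≤y))
      (lem (ι k) (ι y′) (∑ m (sawtooth y′ k)))))
    (∑-sawtooth-asymptotic m y′ k (ℕ.m≤n+o⇒m∸n≤o y k y≤))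
    where
    y′ = y ℕ.∸ k
    lem : ∀ k y s → (1ℚ + 1ℚ) * k * (y + s) - (y + k) * (y + k) + (y + k) * k ≡ (1ℚ + 1ℚ) * k * s - y * y + y * k
    lem = solve-∀ ℚ-ring

  ι-⊓ : ∀ u k → ι u - ι (u ℕ.∸ k) ≡ ι (k ℕ.⊓ u)
  ι-⊓ u k = ≡.trans (≡.cong (_- ι (u ℕ.∸ k)) (≡.trans (≡.cong ι (≡.sym (ℕ.m⊓n+n∸m≡n k u))) (ι-+ (k ℕ.⊓ u) (u ℕ.∸ k))))
    (lem (ι (k ℕ.⊓ u)) (ι (u ℕ.∸ k)))
    where
    lem : ∀ x y → x + y - y ≡ x
    lem = solve-∀ ℚ-ring

  sawtooth-step : ∀ y k i → sawtooth y k i - sawtooth y k (suc i) ≡ ι (k ℕ.⊓ (y ℕ.∸ suc i ℕ.* k))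
  sawtooth-step y k i = ≡.trans (≡.cong (λ x → sawtooth y k i - ι x) eq) (ι-⊓ u k)
    where
    u = y ℕ.∸ suc i ℕ.* k
    eq : y ℕ.∸ suc (suc i) ℕ.* k ≡ u ℕ.∸ k
    eq = ≡.trans (≡.cong (y ℕ.∸_) (ℕ.+-comm k (suc i ℕ.* k))) (≡.sym (ℕ.∸-+-assoc y (suc i ℕ.* k) k))

  -- Euler–Maclaurin for periodic weights: α minus its mean has periodic partial sums E, and
  -- E minus its mean again has bounded partial sums, so two Abel summations leave O(k).
  ∑-periodic-sawtooth : ∀ n (α : ℕ → ℚ) → Periodic (suc n) α →
    Σ ℚ λ A → Σ ℚ λ B → Σ ℚ λ C → 0ℚ ≤ C × (∀ y k →
      ∣ ∑ y (λ i → α i * sawtooth y (suc k) i) - (A * (ι y * ι y * inv (suc k)) + B * ι y) ∣ ≤ C * ι (suc k))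
  ∑-periodic-sawtooth n′ α α-per = ᾱ * ℚ.½ , ē - ᾱ * ℚ.½ , ∣ ᾱ ∣ + (∣ ē ∣ + CE) ,
      0≤p+q (ℚ.0≤∣p∣ ᾱ) (0≤p+q (ℚ.0≤∣p∣ ē) 0≤CE) , bound
    where
    n = suc n′
    ᾱ = mean n α
    α₀ = λ i → α i - ᾱ
    α₀-per : Periodic n α₀
    α₀-per i = ≡.cong (_- ᾱ) (α-per i)
    E = λ i → ∑ (suc i) α₀
    E-per : Periodic n E
    E-per i = ≡.trans (≡.cong (λ m → ∑ m α₀) (≡.sym (ℕ.+-suc n i)))
      (≡.trans (∑-split n (suc i) α₀) (≡.trans (≡.cong₂ _+_ (mean-zero n′ {α}) (∑-cong (suc i) λ j _ → α₀-per j)) (ℚ.+-identityˡ _)))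
    ē = mean n E
    E₀ = λ i → E i - ē
    CE = ∑ n (λ i → ∣ E₀ i ∣)
    0≤CE = ∑-nonneg n (λ i _ → ℚ.0≤∣p∣ (E₀ i))
    E₀-bounded : ∀ m → ∣ ∑ m E₀ ∣ ≤ CE
    E₀-bounded = mean-zero-∑-bounded {n} {E₀} (λ i → ≡.cong (_- ē) (E-per i)) (mean-zero n′ {E})
    bound : ∀ y k → ∣ ∑ y (λ i → α i * sawtooth y (suc k) i) - (ᾱ * ℚ.½ * (ι y * ι y * inv (suc k)) + (ē - ᾱ * ℚ.½) * ι y) ∣
            ≤ (∣ ᾱ ∣ + (∣ ē ∣ + CE)) * ι (suc k)
    bound y k′ = ≡.subst (λ x → ∣ x ∣ ≤ (∣ ᾱ ∣ + (∣ ē ∣ + CE)) * ι k) (≡.sym total)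
      (ℚ.≤-trans (∣+∣≤ (∣*∣≤ (ℚ.≤-refl {∣ ᾱ ∣}) part₁) (∣+∣≤ (∣*∣≤ (ℚ.≤-refl {∣ ē ∣}) part₂) part₃))
        (ℚ.≤-reflexive (lem₀ (∣ ᾱ ∣) (∣ ē ∣) CE (ι k))))
      where
      k = suc k′
      g = sawtooth y k
      -- These differences equal min(k , y - (i + 1) k), cut off at 0: nonnegative, decreasing and
      -- at most k, as the second Abel summation requires.
      d = λ i → g i - g (suc i)
      S = ∑ y g
      lem₀ : ∀ a b c k → a * k + (b * k + c * k) ≡ (a + (b + c)) * k
      lem₀ = solve-∀ ℚ-ring
      gy≡0 : g y ≡ 0ℚ
      gy≡0 = ≡.trans (≡.cong ι (ℕ.m≤n⇒m∸n≡0 (ℕ.≤-trans (ℕ.n≤1+n y) (ℕ.m≤m*n (suc y) k)))) ι-0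
      g0 : g 0 ≡ ι (y ℕ.∸ k)
      g0 = ≡.cong (λ x → ι (y ℕ.∸ x)) (ℕ.+-identityʳ k)
      d↓ : ∀ i → d (suc i) ≤ d i
      d↓ i = ≡.subst₂ _≤_ (≡.sym (sawtooth-step y k (suc i))) (≡.sym (sawtooth-step y k i))
        (ι-mono (ℕ.⊓-monoʳ-≤ k (ℕ.∸-monoʳ-≤ y (ℕ.m≤n+m (suc i ℕ.* k) k))))
      0≤d : ∀ i → 0ℚ ≤ d i
      0≤d i = ≡.subst (0ℚ ≤_) (≡.sym (sawtooth-step y k i)) (0≤ι (k ℕ.⊓ (y ℕ.∸ suc i ℕ.* k)))
      d0≤k : d 0 ≤ ι k
      d0≤k = ≡.subst (_≤ ι k) (≡.sym (sawtooth-step y k 0)) (ι-mono (ℕ.m⊓n≤m k (y ℕ.∸ 1 ℕ.* k)))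
      part₃ : ∣ ∑ y (λ i → E₀ i * d i) ∣ ≤ CE * ι k
      part₃ = ℚ.≤-trans (abel-antitone {E₀} {d} E₀-bounded 0≤d d↓ y) (*-monoˡ CE 0≤CE d0≤k)
      part₂ : ∣ ι (y ℕ.∸ k) - ι y ∣ ≤ ι k
      part₂ = ≡.subst (_≤ ι k) (≡.trans (≡.cong ∣_∣ (lem (ι y) _)) (ℚ.∣-p∣≡∣p∣ _))
        (0≤p≤a⇒∣p∣≤a (0≤q-p (ι-mono (ℕ.m∸n≤m y k)))
          (≡.subst (_≤ ι k) (≡.sym (ι-⊓ y k)) (ι-mono (ℕ.m⊓n≤m k y))))
        where
        lem : ∀ x y → x - y ≡ - (y - x)
        lem = solve-∀ ℚ-ring
      part₁ : ∣ S - ℚ.½ * (ι y * ι y * inv k) + ℚ.½ * ι y ∣ ≤ ι k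
      part₁ = ≡.subst (λ x → ∣ x ∣ ≤ ι k) eq
        (ℚ.≤-trans (∣*∣≤ (ℚ.≤-reflexive (∣p∣≡p (0≤p*q (ℚ.nonNegative⁻¹ ℚ.½) (0≤inv k)))) (∑-sawtooth-asymptotic y y k (ℕ.m≤m*n y k)))
          (ℚ.≤-trans (ℚ.≤-reflexive (≡.trans (lem₁ (inv k) (ι k)) (≡.trans (≡.cong (λ z → ℚ.½ * (z * ι k)) (ι-inv k′))
              (≡.cong (ℚ.½ *_) (ℚ.*-identityˡ (ι k))))))
            (≡.subst (ℚ.½ * ι k ≤_) (ℚ.*-identityˡ (ι k)) (*-monoʳ (ι k) {ℚ.½} {1ℚ} (0≤ι k) (ℚ.≤ᵇ⇒≤ _)))))
        where
        lem₁ : ∀ i k → ℚ.½ * i * (k * k) ≡ ℚ.½ * (k * i * k)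
        lem₁ = solve-∀ ℚ-ring
        lem₂ : ∀ i k s y → ℚ.½ * i * ((1ℚ + 1ℚ) * k * s - y * y + y * k) ≡ (k * i) * s - ℚ.½ * (y * y * i) + ℚ.½ * ((k * i) * y)
        lem₂ = solve-∀ ℚ-ring
        eq : ℚ.½ * inv k * ((1ℚ + 1ℚ) * ι k * S - ι y * ι y + ι y * ι k) ≡ S - ℚ.½ * (ι y * ι y * inv k) + ℚ.½ * ι y
        eq = ≡.trans (lem₂ (inv k) (ι k) S (ι y)) (≡.cong₂ (λ a b → a - ℚ.½ * (ι y * ι y * inv k) + ℚ.½ * b)
               (≡.trans (≡.cong (_* S) (ι-inv k′)) (ℚ.*-identityˡ S)) (≡.trans (≡.cong (_* ι y) (ι-inv k′)) (ℚ.*-identityˡ (ι y))))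
      total : ∑ y (λ i → α i * g i) - (ᾱ * ℚ.½ * (ι y * ι y * inv k) + (ē - ᾱ * ℚ.½) * ι y)
            ≡ ᾱ * (S - ℚ.½ * (ι y * ι y * inv k) + ℚ.½ * ι y) + (ē * (ι (y ℕ.∸ k) - ι y) + ∑ y (λ i → E₀ i * d i))
      total = begin
        ∑ y (λ i → α i * g i) - X
          ≡⟨ ≡.cong (_- X) (≡.trans (∑-cong y λ i _ → lem₁ (α i) ᾱ (g i)) (∑-+ y _ _)) ⟩
        ∑ y (λ i → ᾱ * g i) + ∑ y (λ i → α₀ i * g i) - X
          ≡⟨ ≡.cong (_- X) (≡.cong₂ _+_ (∑-*ˡ y ᾱ g) (abel α₀ g y)) ⟩
        ᾱ * S + (∑ y α₀ * g y + ∑ y (λ i → E i * d i)) - X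
          ≡⟨ ≡.cong₂ (λ a b → ᾱ * S + (a + b) - X) (≡.trans (≡.cong (∑ y α₀ *_) gy≡0) (ℚ.*-zeroʳ (∑ y α₀)))
               (≡.trans (∑-cong y λ i _ → lem₁ (E i) ē (d i)) (∑-+ y _ _)) ⟩
        ᾱ * S + (0ℚ + (∑ y (λ i → ē * d i) + ∑ y (λ i → E₀ i * d i))) - X
          ≡⟨ ≡.cong (λ a → ᾱ * S + (0ℚ + (a + ∑ y (λ i → E₀ i * d i))) - X) (≡.trans (∑-*ˡ y ē d)
               (≡.cong (ē *_) (≡.trans (∑-telescope g y) (≡.cong₂ _-_ g0 gy≡0)))) ⟩
        ᾱ * S + (0ℚ + (ē * (ι (y ℕ.∸ k) - 0ℚ) + ∑ y (λ i → E₀ i * d i))) - X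
          ≡⟨ lem₂ ᾱ ē S (ι (y ℕ.∸ k)) (∑ y (λ i → E₀ i * d i)) (ι y) (inv k) ⟩
        _ ∎
        where
        open ≡.≡-Reasoning
        X = ᾱ * ℚ.½ * (ι y * ι y * inv k) + (ē - ᾱ * ℚ.½) * ι y
        lem₁ : ∀ a b g → a * g ≡ b * g + (a - b) * g
        lem₁ = solve-∀ ℚ-ring
        lem₂ : ∀ a e S u T y i → a * S + (0ℚ + (e * (u - 0ℚ) + T)) - (a * ℚ.½ * (y * y * i) + (e - a * ℚ.½) * y)
             ≡ a * (S - ℚ.½ * (y * y * i) + ℚ.½ * y) + (e * (u - y) + T)
        lem₂ = solve-∀ ℚ-ring

  -- With a = i + 1 and k = j + 1 this is the Riesz mean Σ α(a) F(k) max(0 , y − a k).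
  riesz : (α F : ℕ → ℚ) → ℕ → ℚ
  riesz α F y = ∑ y (λ i → ∑ y (λ j → α i * F j * sawtooth y (suc j) i))

  -- The bound on the sums of F(j)/(j + 1) encodes that the full series is 0: a partial sum is then
  -- minus a tail, and tails are of order 1/m.
  module _ (α F : ℕ → ℚ) (α≤1 : ∀ i → ∣ α i ∣ ≤ 1ℚ)
           (C₀ C₁ C₂ : ℚ) (F≤ : ∀ j → ∣ F j ∣ ≤ C₂) (∑F≤ : ∀ m → ∣ ∑ m F ∣ ≤ C₀)
           (∑F/k≤ : ∀ m → ∣ ∑ (suc m) (λ j → F j * inv (suc j)) ∣ ≤ C₁ * inv (suc m))
           (A B C : ℚ) (0≤C : 0ℚ ≤ C)
           (rem≤ : ∀ y k → ∣ ∑ y (λ i → α i * sawtooth y (suc k) i) - (A * (ι y * ι y * inv (suc k)) + B * ι y) ∣ ≤ C * ι (suc k))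
           where

    private
      Z : ℕ → ℕ → ℚ
      Z y j = ∑ y (λ i → α i * sawtooth y (suc j) i)
      rem : ℕ → ℕ → ℚ
      rem y j = Z y j - (A * (ι y * ι y * inv (suc j)) + B * ι y)
      0≤C₀ = ∣p∣≤⇒0≤ {0ℚ} (∑F≤ 0)
      0≤C₂ = ∣p∣≤⇒0≤ {F 0} (F≤ 0)

      -- For k up to the cut the sum over a is evaluated by Euler-Maclaurin. The main term A y²/k
      -- meets Σ F(k)/k and shrinks to order y²/K, the term B y meets the bounded sums of F, and the
      -- remainders add up to order K².
      small : ∀ y K → ∣ ∑ (suc K) (λ j → F j * Z y j) ∣
        ≤ ∣ A ∣ * C₁ * (ι y * ι y * inv (suc K)) + (∣ B ∣ * C₀ * ι y + C₂ * C * (ι (suc K) * ι (suc K)))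
      small y K = ≡.subst (λ x → ∣ x ∣ ≤ bound) (≡.sym (eq k))
        (∣+∣≤ (≡.subst (∣ A * (ι y * ι y) * L ∣ ≤_) (lem₂ (∣ A ∣) C₁ (ι y) (inv k))
            (∣*∣≤ {A * (ι y * ι y)} (∣*∣≤ {A} ℚ.≤-refl (ℚ.≤-reflexive (∣p∣≡p (0≤p² (ι y))))) (∑F/k≤ K)))
        (∣+∣≤ (≡.subst (∣ B * ι y * ∑ k F ∣ ≤_) (lem₃ (∣ B ∣) C₀ (ι y)) (∣*∣≤ {B * ι y} (∣*∣≤ {B} ℚ.≤-refl (ℚ.≤-reflexive (∣p∣≡p (0≤ι y)))) (∑F≤ k)))
          (ℚ.≤-trans (∣∑∣≤const k λ j j<k → ∣*∣≤ (F≤ j) (ℚ.≤-trans (rem≤ y j) (*-monoˡ C 0≤C (ι-mono j<k))))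
            (ℚ.≤-reflexive (lem₄ (ι k) C₂ C)))))
        where
        k = suc K
        L = ∑ k (λ j → F j * inv (suc j))
        bound = ∣ A ∣ * C₁ * (ι y * ι y * inv k) + (∣ B ∣ * C₀ * ι y + C₂ * C * (ι k * ι k))
        lem₁ : ∀ A B f z y i → f * z ≡ A * (y * y) * (f * i) + (B * y * f + f * (z - (A * (y * y * i) + B * y)))
        lem₁ = solve-∀ ℚ-ring
        lem₂ : ∀ A C y i → A * (y * y) * (C * i) ≡ A * C * (y * y * i)
        lem₂ = solve-∀ ℚ-ring
        lem₃ : ∀ B C y → B * y * C ≡ B * C * y
        lem₃ = solve-∀ ℚ-ring
        lem₄ : ∀ k c d → k * (c * (d * k)) ≡ c * d * (k * k)
        lem₄ = solve-∀ ℚ-ring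
        eq : ∀ k → ∑ k (λ j → F j * Z y j) ≡ A * (ι y * ι y) * ∑ k (λ j → F j * inv (suc j)) + (B * ι y * ∑ k F + ∑ k (λ j → F j * rem y j))
        eq k = ≡.trans (∑-cong k λ j _ → lem₁ A B (F j) (Z y j) (ι y) (inv (suc j)))
            (≡.trans (∑-+ k _ _) (≡.cong₂ _+_ (∑-*ˡ k (A * (ι y * ι y)) _) (≡.trans (∑-+ k _ _) (≡.cong₂ _+_ (∑-*ˡ k (B * ι y) F) refl))))

      -- Beyond the cut the sum over k is taken first: F has bounded partial sums and the sawtooth
      -- decreases in k, so each a costs a multiple of its value at the cut. Summed over a, these
      -- values stay below y²/K.
      large : ∀ y K M → ∣ ∑ y (λ i → ∑ M (λ j → α i * F (suc K ℕ.+ j) * sawtooth y (suc (suc K ℕ.+ j)) i)) ∣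
        ≤ (C₀ + C₀) * (ι y * ι y * inv (suc K))
      large y K M = ℚ.≤-trans (∣∑∣≤ y λ i _ → inner i)
        (ℚ.≤-trans (ℚ.≤-reflexive (∑-*ˡ y (C₀ + C₀) _))
          (*-monoˡ (C₀ + C₀) (0≤p+q 0≤C₀ 0≤C₀) (ℚ.≤-trans
            (ℚ.≤-reflexive (≡.trans (≡.sym (ℚ.*-identityˡ _)) (≡.trans (≡.cong (_* ∑ y (sawtooth y (suc K))) (≡.sym (ι-inv K)))
                (lem₁ (ι (suc K)) (inv (suc K)) (∑ y (sawtooth y (suc K)))))))
            (*-monoʳ (inv (suc K)) (0≤inv (suc K)) (∑-sawtooth≤ y y (suc K))))))
        where
        lem₁ : ∀ k i s → k * i * s ≡ k * s * i
        lem₁ = solve-∀ ℚ-ring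
        lem₂ : ∀ a b c → a * b * c ≡ a * (b * c)
        lem₂ = solve-∀ ℚ-ring
        mono-saw : ∀ i {k l} → k ℕ.≤ l → sawtooth y l i ≤ sawtooth y k i
        mono-saw i {k} {l} k≤l = ι-mono (ℕ.∸-monoʳ-≤ y (ℕ.*-monoʳ-≤ (suc i) k≤l))
        inner : ∀ i → ∣ ∑ M (λ j → α i * F (suc K ℕ.+ j) * sawtooth y (suc (suc K ℕ.+ j)) i) ∣ ≤ (C₀ + C₀) * sawtooth y (suc K) i
        inner i = ≡.subst (λ x → ∣ x ∣ ≤ _) (≡.sym (≡.trans (∑-cong M λ j _ → lem₂ (α i) _ _) (∑-*ˡ M (α i) _)))
          (ℚ.≤-trans (∣*∣≤ (α≤1 i) (abel-antitone {λ j → F (suc K ℕ.+ j)} {λ j → sawtooth y (suc (suc K ℕ.+ j)) i} (shift-bounded {F} ∑F≤ (suc K))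
              (λ j → 0≤ι (y ℕ.∸ suc i ℕ.* suc (suc K ℕ.+ j))) (λ j → mono-saw i (s≤s (ℕ.+-monoʳ-≤ (suc K) (ℕ.n≤1+n j)))) M))
            (ℚ.≤-trans (ℚ.≤-reflexive (ℚ.*-identityˡ _)) (*-monoˡ (C₀ + C₀) (0≤p+q 0≤C₀ 0≤C₀)
              (mono-saw i (ℕ.≤-trans (ℕ.m≤m+n (suc K) 0) (ℕ.n≤1+n (suc K ℕ.+ 0)))))))

      D₁ = ∣ A ∣ * C₁ + (C₀ + C₀)
      D₂ = ∣ B ∣ * C₀
      D₃ = C₂ * C

      riesz-split : ∀ y K → suc K ℕ.≤ y →
        ∣ riesz α F y ∣ ≤ D₁ * (ι y * ι y * inv (suc K)) + D₂ * ι y + D₃ * (ι (suc K) * ι (suc K))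
      riesz-split y K K<y = ≡.subst (λ x → ∣ x ∣ ≤ D₁ * (ι y * ι y * inv (suc K)) + D₂ * ι y + D₃ * (ι (suc K) * ι (suc K))) (≡.sym eq)
        (ℚ.≤-trans (∣+∣≤ (small y K) (large y K M)) (ℚ.≤-reflexive (lem₂ (∣ A ∣ * C₁) (C₀ + C₀) (ι y * ι y * inv (suc K)) D₂ (ι y)
            (D₃ * (ι (suc K) * ι (suc K))))))
        where
        M = y ℕ.∸ suc K
        lem₁ : ∀ a b c → a * b * c ≡ b * (a * c)
        lem₁ = solve-∀ ℚ-ring
        lem₂ : ∀ a c x D y e → a * x + (D * y + e) + c * x ≡ (a + c) * x + D * y + e
        lem₂ = solve-∀ ℚ-ring
        f : ℕ → ℕ → ℚ
        f i j = α i * F j * sawtooth y (suc j) i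
        eq : riesz α F y ≡ ∑ (suc K) (λ j → F j * Z y j) + ∑ y (λ i → ∑ M (λ j → f i (suc K ℕ.+ j)))
        eq = begin
          ∑ y (λ i → ∑ y (f i))
            ≡⟨ ∑-cong y (λ i _ → ≡.trans (≡.cong (λ z → ∑ z (f i)) (≡.sym (ℕ.m+[n∸m]≡n K<y))) (∑-split (suc K) M (f i))) ⟩
          ∑ y (λ i → ∑ (suc K) (f i) + ∑ M (λ j → f i (suc K ℕ.+ j)))
            ≡⟨ ∑-+ y _ _ ⟩
          ∑ y (λ i → ∑ (suc K) (f i)) + _
            ≡⟨ ≡.cong₂ _+_ (≡.trans (∑-swap y (suc K) f) (∑-cong (suc K) λ j _ →
                 ≡.trans (∑-cong y λ i _ → lem₁ (α i) (F j) _) (∑-*ˡ y (F j) _))) refl ⟩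
          _ ∎
          where open ≡.≡-Reasoning

    -- For y about c³ the errors y²/K and K² balance at K = c²: both are about c⁴, which is y c. The
    -- constant `e` is the slack that allows `c` to be the integer part of a cube root.
    riesz-bound′ : ∀ e → Σ ℚ λ D → 0ℚ ≤ D × (∀ y c → c ℕ.^ 3 ℕ.≤ y → y ℕ.≤ e ℕ.* c ℕ.^ 3 → ∣ riesz α F y ∣ ≤ D * (ι y * ι c))
    riesz-bound′ e = D , 0≤D , bound
      where
      0≤C₁ : 0ℚ ≤ C₁
      0≤C₁ = ≡.subst (0ℚ ≤_) (≡.trans (lem (ι 1) (inv 1) C₁) (≡.trans (≡.cong (_* C₁) (ι-inv 0)) (ℚ.*-identityˡ C₁)))
        (0≤p*q (0≤ι 1) (∣p∣≤⇒0≤ (∑F/k≤ 0)))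
        where
        lem : ∀ x i c → x * (c * i) ≡ x * i * c
        lem = solve-∀ ℚ-ring
      0≤D₁ = 0≤p+q (0≤p*q (ℚ.0≤∣p∣ A) 0≤C₁) (0≤p+q 0≤C₀ 0≤C₀)
      0≤D₂ = 0≤p*q (ℚ.0≤∣p∣ B) 0≤C₀
      0≤D₃ = 0≤p*q 0≤C₂ 0≤C
      D = D₁ * ι e + D₂ + D₃
      0≤D = 0≤p+q (0≤p+q (0≤p*q 0≤D₁ (0≤ι e)) 0≤D₂) 0≤D₃
      eℚ = ι e
      core : ∀ {y c k i} → 0ℚ ≤ y → 1ℚ ≤ c → 0ℚ ≤ i → k ≡ c * c → k * i ≡ 1ℚ → c * k ≤ y → y ≤ eℚ * (c * k) →
        D₁ * (y * y * i) + D₂ * y + D₃ * (k * k) ≤ D * (y * c)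
      core {y} {c} {k} {i} 0≤y 1≤c 0≤i k≡c² ki≡1 ck≤y y≤eck =
        ℚ.≤-trans (ℚ.+-mono-≤ (ℚ.+-mono-≤ (*-monoˡ D₁ 0≤D₁ y²/c²≤) (*-monoˡ D₂ 0≤D₂ y≤yc)) (*-monoˡ D₃ 0≤D₃ c⁴≤))
          (ℚ.≤-reflexive (lem D₁ eℚ D₂ D₃ (y * c)))
        where
        lem : ∀ D₁ e D₂ D₃ x → D₁ * (e * x) + D₂ * x + D₃ * x ≡ (D₁ * e + D₂ + D₃) * x
        lem = solve-∀ ℚ-ring
        lem₁ : ∀ c k → k * (c * c) ≡ (c * k) * c
        lem₁ = solve-∀ ℚ-ring
        lem₂ : ∀ y e c k i → y * (e * (c * k)) * i ≡ k * i * (e * (y * c))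
        lem₂ = solve-∀ ℚ-ring
        y≤yc : y ≤ y * c
        y≤yc = ≡.subst (_≤ y * c) (ℚ.*-identityʳ y) (*-monoˡ y 0≤y 1≤c)
        c⁴≤ : k * k ≤ y * c
        c⁴≤ = ℚ.≤-trans (ℚ.≤-reflexive (≡.trans (≡.cong (k *_) k≡c²) (lem₁ c k))) (*-monoʳ c (ℚ.≤-trans 0≤1 1≤c) ck≤y)
        y²/c²≤ : y * y * i ≤ eℚ * (y * c)
        y²/c²≤ = ℚ.≤-trans (*-monoʳ i 0≤i (*-monoˡ y 0≤y y≤eck))
          (ℚ.≤-reflexive (≡.trans (lem₂ y eℚ c k i) (≡.trans (≡.cong (_* (eℚ * (y * c))) ki≡1) (ℚ.*-identityˡ _))))
      c³ : ∀ c → c ℕ.^ 3 ≡ c ℕ.* (c ℕ.* c)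
      c³ c = ≡.cong (λ z → c ℕ.* (c ℕ.* z)) (ℕ.*-identityʳ c)
      positive : ∀ y c → 1 ℕ.≤ c → c ℕ.^ 3 ℕ.≤ y → y ℕ.≤ e ℕ.* c ℕ.^ 3 → ∣ riesz α F y ∣ ≤ D * (ι y * ι c)
      positive y c 1≤c c³≤y y≤ec³ rewrite c³ c with c ℕ.* c in eq | ℕ.*-mono-≤ 1≤c 1≤c
      ... | suc K | s≤s _ = ℚ.≤-trans (riesz-split y K (ℕ.≤-trans (ℕ.m≤n*m (suc K) c {{ℕ.>-nonZero 1≤c}}) c³≤y))
        (core (0≤ι y) (≡.subst (_≤ ι c) ι-1 (ι-mono 1≤c)) (0≤inv (suc K))
          (≡.trans (≡.cong ι (≡.sym eq)) (ι-* c c)) (ι-inv K)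
          (≡.subst (_≤ ι y) (ι-* c (suc K)) (ι-mono c³≤y))
          (≡.subst (ι y ≤_) (≡.trans (ι-* e (c ℕ.* suc K)) (≡.cong (eℚ *_) (ι-* c (suc K)))) (ι-mono y≤ec³)))
      bound : ∀ y c → c ℕ.^ 3 ℕ.≤ y → y ℕ.≤ e ℕ.* c ℕ.^ 3 → ∣ riesz α F y ∣ ≤ D * (ι y * ι c)
      vanishing : ∀ y → y ≡ 0 → ∣ riesz α F y ∣ ≤ D * (ι y * ι 0)
      vanishing .0 refl = 0≤p*q 0≤D (0≤p*q (0≤ι 0) (0≤ι 0))
      bound y zero    c³≤y y≤ec³ = vanishing y (ℕ.n≤0⇒n≡0 (≡.subst (y ℕ.≤_) (ℕ.*-zeroʳ e) y≤ec³))
      bound y (suc d) c³≤y y≤ec³ = positive y (suc d) (s≤s z≤n) c³≤y y≤ec³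

  riesz-bound : ∀ e n (α F : ℕ → ℚ) → Periodic (suc n) α → (∀ i → ∣ α i ∣ ≤ 1ℚ) →
    (C₀ C₁ C₂ : ℚ) → (∀ j → ∣ F j ∣ ≤ C₂) → (∀ m → ∣ ∑ m F ∣ ≤ C₀) →
    (∀ m → ∣ ∑ (suc m) (λ j → F j * inv (suc j)) ∣ ≤ C₁ * inv (suc m)) →
    Σ ℚ λ D → 0ℚ ≤ D × (∀ y c → c ℕ.^ 3 ℕ.≤ y → y ℕ.≤ e ℕ.* c ℕ.^ 3 → ∣ riesz α F y ∣ ≤ D * (ι y * ι c))
  riesz-bound e n α F α-per α≤1 C₀ C₁ C₂ F≤ ∑F≤ ∑F/k≤ =
    let A , B , C , 0≤C , rem≤ = ∑-periodic-sawtooth n α α-per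
    in riesz-bound′ α F α≤1 C₀ C₁ C₂ F≤ ∑F≤ ∑F/k≤ A B C 0≤C rem≤ e

-- Iterated differences and the binomial weight

module FiniteDifferences where
  open RationalInequalities

  D : ℕ → (ℕ → ℚ) → ℕ → ℚ
  D e g p = g p - g (p ℕ.+ e)

  𝔻 : List ℕ → (ℕ → ℚ) → ℕ → ℚ
  𝔻 []       g = g
  𝔻 (e ∷ es) g = D e (𝔻 es g)

  ι-product : List ℕ → ℚ
  ι-product []       = 1ℚ
  ι-product (e ∷ es) = ι e * ι-product es

  Bounded : ℕ → ℚ → (ℕ → ℚ) → Set
  Bounded zero    b g = ∀ p → ∣ g p ∣ ≤ b
  Bounded (suc k) b g = Bounded k b (D 1 g)

  D-suc : ∀ e g p → D (suc e) g p ≡ D 1 g p + D e g (p ℕ.+ 1)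
  D-suc e g p = ≡.trans (≡.cong (λ q → g p - g q) (≡.sym (ℕ.+-assoc p 1 e))) (lem (g p) (g (p ℕ.+ 1)) (g (p ℕ.+ 1 ℕ.+ e)))
    where
    lem : ∀ a b c → a - c ≡ a - b + (b - c)
    lem = solve-∀ ℚ-ring

  D-bound : ∀ {g b} → (∀ p → ∣ D 1 g p ∣ ≤ b) → ∀ e p → ∣ D e g p ∣ ≤ ι e * b
  D-bound {g} {b} Dg≤b zero p = ℚ.≤-reflexive (≡.trans
    (≡.cong ∣_∣ (≡.trans (≡.cong (λ q → g p - g q) (ℕ.+-identityʳ p)) (ℚ.+-inverseʳ (g p))))
    (≡.sym (≡.trans (≡.cong (_* b) ι-0) (ℚ.*-zeroˡ b))))
  D-bound {g} {b} Dg≤b (suc e) p = ≡.subst₂ (λ x y → ∣ x ∣ ≤ y) (≡.sym (D-suc e g p))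
    (≡.trans (lem (ι e) b) (≡.cong (_* b) (≡.sym (ι-suc e))))
    (∣+∣≤ (Dg≤b p) (D-bound {g} Dg≤b e (p ℕ.+ 1)))
    where
    lem : ∀ x b → b + x * b ≡ (1ℚ + x) * b
    lem = solve-∀ ℚ-ring

  D-comm : ∀ d e g p → D d (D e g) p ≡ D e (D d g) p
  D-comm d e g p = ≡.trans (≡.cong (λ q → g p - g (p ℕ.+ e) - (g (p ℕ.+ d) - g q)) swap)
    (lem (g p) (g (p ℕ.+ e)) (g (p ℕ.+ d)) (g (p ℕ.+ e ℕ.+ d)))
    where
    swap : p ℕ.+ d ℕ.+ e ≡ p ℕ.+ e ℕ.+ d
    swap = ≡.trans (ℕ.+-assoc p d e) (≡.trans (≡.cong (p ℕ.+_) (ℕ.+-comm d e)) (≡.sym (ℕ.+-assoc p e d)))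
    lem : ∀ a b c d → a - b - (c - d) ≡ a - c - (b - d)
    lem = solve-∀ ℚ-ring

  D-𝔻 : ∀ es g p → D 1 (𝔻 es g) p ≡ 𝔻 es (D 1 g) p
  D-𝔻 []       g p = refl
  D-𝔻 (e ∷ es) g p = ≡.trans (D-comm 1 e (𝔻 es g) p) (≡.cong₂ _-_ (D-𝔻 es g p) (D-𝔻 es g (p ℕ.+ e)))

  -- A difference of step e is a sum of e unit differences, and differences commute. Each step thus
  -- contributes a factor e and consumes one unit difference of `g`.
  𝔻-bound : ∀ es {g b} → Bounded (length es) b g → ∀ p → ∣ 𝔻 es g p ∣ ≤ ι-product es * b
  𝔻-bound []       {g} {b} g≤b p = ≡.subst (∣ g p ∣ ≤_) (≡.sym (ℚ.*-identityˡ b)) (g≤b p)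
  𝔻-bound (e ∷ es) {g} {b} g≤b p = ≡.subst (∣ D e (𝔻 es g) p ∣ ≤_) (≡.sym (ℚ.*-assoc (ι e) (ι-product es) b))
    (D-bound {𝔻 es g} (λ q → ≡.subst (λ x → ∣ x ∣ ≤ ι-product es * b) (≡.sym (D-𝔻 es g q)) (𝔻-bound es {D 1 g} g≤b q)) e p)

  Bounded-cong : ∀ k {b g h} → (∀ p → g p ≡ h p) → Bounded k b g → Bounded k b h
  Bounded-cong zero    {b} g≡h g≤b p = ≡.subst (λ x → ∣ x ∣ ≤ b) (g≡h p) (g≤b p)
  Bounded-cong (suc k) g≡h g≤b = Bounded-cong k (λ p → ≡.cong₂ _-_ (g≡h p) (g≡h (p ℕ.+ 1))) g≤b

  Bounded-suc : ∀ k {b g} → Bounded k b g → Bounded k b (g ∘ suc)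
  Bounded-suc zero    g≤b p = g≤b (suc p)
  Bounded-suc (suc k) g≤b = Bounded-suc k g≤b

  Δ² : (ℕ → ℚ) → ℕ → ℚ
  Δ² g x = g x - (g (suc x) + g (suc x)) + g (suc (suc x))

  mixed : (ℕ → ℚ) → ℕ → ℕ → ℚ
  mixed φ x z = Δ² (λ z → Δ² (λ x → φ (x ℕ.* z)) x) z

  -- In terms of the unit shift S this is (1 − S^(e+d))² = ((1 − S^e) + S^e (1 − S^d))².
  D²-+ : ∀ d e φ p → D (e ℕ.+ d) (D (e ℕ.+ d) φ) p ≡
    D e (D e φ) p + (D e (D d φ) (p ℕ.+ e) + D e (D d φ) (p ℕ.+ e)) + D d (D d φ) (p ℕ.+ e ℕ.+ e)
  D²-+ d e φ p = ≡.trans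
    (≡.cong₂ (λ a b → φ p - φ a - (φ a - φ b)) (eq₁ p e d) (eq₂ p e d))
    (≡.trans (lem (φ p) (φ (p ℕ.+ e)) (φ (p ℕ.+ e ℕ.+ e)) (φ (p ℕ.+ e ℕ.+ d)) (φ (p ℕ.+ e ℕ.+ e ℕ.+ d)) (φ (p ℕ.+ e ℕ.+ e ℕ.+ d ℕ.+ d)))
      refl)
    where
    eq₁ : ∀ p e d → p ℕ.+ (e ℕ.+ d) ≡ p ℕ.+ e ℕ.+ d
    eq₁ = ℕ-Solver.solve-∀
    eq₂ : ∀ p e d → p ℕ.+ (e ℕ.+ d) ℕ.+ (e ℕ.+ d) ≡ p ℕ.+ e ℕ.+ e ℕ.+ d ℕ.+ d
    eq₂ = ℕ-Solver.solve-∀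
    lem : ∀ v₀ v₁ v₂ w₁ w₂ u → v₀ - w₁ - (w₁ - u) ≡
      v₀ - v₁ - (v₁ - v₂) + (v₁ - w₁ - (v₂ - w₂) + (v₁ - w₁ - (v₂ - w₂))) + (v₂ - w₂ - (w₂ - u))
    lem = solve-∀ ℚ-ring

  -- The discrete form of ∂x² ∂z² φ(x z) = x² z² φ⁗ + 4 x z φ‴ + 2 φ″. The second difference in x is
  -- a second difference of φ with step z; when z moves, step and base point both change, and `D²-+`
  -- separates the two effects. The coefficients agree: 2 + 2 for φ‴, and -2 + 4 for φ″, where the 4
  -- is the product of the two steps 2.
  mixed-expand : ∀ φ x z → let p = x ℕ.* z in mixed φ x z ≡
    𝔻 (x ∷ x ∷ z ∷ z ∷ []) φ p
    - (𝔻 (x ∷ z ∷ 1 ∷ []) φ (p ℕ.+ x ℕ.+ z) + 𝔻 (x ∷ z ∷ 1 ∷ []) φ (p ℕ.+ x ℕ.+ z))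
    - (𝔻 (x ℕ.+ 1 ∷ z ∷ 1 ∷ []) φ (p ℕ.+ x ℕ.+ z) + 𝔻 (x ℕ.+ 1 ∷ z ∷ 1 ∷ []) φ (p ℕ.+ x ℕ.+ z))
    - (𝔻 (1 ∷ 1 ∷ []) φ (p ℕ.+ x ℕ.+ z ℕ.+ z) + 𝔻 (1 ∷ 1 ∷ []) φ (p ℕ.+ x ℕ.+ z ℕ.+ z))
    + 𝔻 (2 ∷ 2 ∷ []) φ (p ℕ.+ x ℕ.+ x ℕ.+ z ℕ.+ z)
  mixed-expand φ x z = begin
    mixed φ x z
      ≡⟨ ≡.cong₂ _+_ (≡.cong₂ _-_ (row z) (≡.cong₂ _+_ (row (suc z)) (row (suc z)))) (row (suc (suc z))) ⟩
    Ψ z p - (Ψ (suc z) (x ℕ.* suc z) + Ψ (suc z) (x ℕ.* suc z)) + Ψ (suc (suc z)) (x ℕ.* suc (suc z))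
      ≡⟨ ≡.cong₂ (λ a b → Ψ z p - (a + a) + b) eq₁ eq₂ ⟩
    Ψ z p - ((Ψ z p₁ + (V p₁z + V p₁z) + U₁) + (Ψ z p₁ + (V p₁z + V p₁z) + U₁)) + (Ψ z p₂ + (V₂ + V₂) + U₂)
      ≡⟨ ≡.cong (λ v → Ψ z p - ((Ψ z p₁ + (V p₁z + V p₁z) + U₁) + (Ψ z p₁ + (V p₁z + V p₁z) + U₁)) + (Ψ z p₂ + (v + v) + U₂)) V₂≡ ⟩
    Ψ z p - ((Ψ z p₁ + (V p₁z + V p₁z) + U₁) + (Ψ z p₁ + (V p₁z + V p₁z) + U₁))
      + (Ψ z p₂ + ((V (p₁z ℕ.+ x) + V (p₁z ℕ.+ (x ℕ.+ 1))) + (V (p₁z ℕ.+ x) + V (p₁z ℕ.+ (x ℕ.+ 1)))) + U₂)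
      ≡⟨ lem (Ψ z p) (Ψ z p₁) (Ψ z p₂) (V p₁z) (V (p₁z ℕ.+ x)) (V (p₁z ℕ.+ (x ℕ.+ 1))) U₁ U₂ ⟩
    _ ∎
    where
    open ≡.≡-Reasoning
    p = x ℕ.* z
    p₁ = p ℕ.+ x
    p₂ = p ℕ.+ x ℕ.+ x
    p₁z = p₁ ℕ.+ z
    Ψ : ℕ → ℕ → ℚ
    Ψ e = D e (D e φ)
    V = D z (D 1 φ)
    V₂ = D z (D 2 φ) (p₂ ℕ.+ z)
    U₁ = D 1 (D 1 φ) (p₁z ℕ.+ z)
    U₂ = D 2 (D 2 φ) (p₂ ℕ.+ z ℕ.+ z)
    row : ∀ z → Δ² (λ x → φ (x ℕ.* z)) x ≡ Ψ z (x ℕ.* z)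
    row z = ≡.trans (≡.cong₂ (λ a b → φ (x ℕ.* z) - (φ a + φ a) + φ b) (ℕ.+-comm z (x ℕ.* z)) (r₂ z x))
      (r₃ (φ (x ℕ.* z)) (φ (x ℕ.* z ℕ.+ z)) (φ (x ℕ.* z ℕ.+ z ℕ.+ z)))
      where
      r₂ : ∀ z x → z ℕ.+ (z ℕ.+ x ℕ.* z) ≡ x ℕ.* z ℕ.+ z ℕ.+ z
      r₂ = ℕ-Solver.solve-∀
      r₃ : ∀ a b c → a - (b + b) + c ≡ a - b - (b - c)
      r₃ = solve-∀ ℚ-ring
    1+z = ℕ.+-comm 1 z
    2+z = ℕ.+-comm 2 z
    eq₁ : Ψ (suc z) (x ℕ.* suc z) ≡ Ψ z p₁ + (V p₁z + V p₁z) + U₁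
    eq₁ = ≡.trans (≡.cong₂ Ψ 1+z (≡.trans (ℕ.*-suc x z) (ℕ.+-comm x p))) (D²-+ 1 z φ p₁)
    eq₂ : Ψ (suc (suc z)) (x ℕ.* suc (suc z)) ≡ Ψ z p₂ + (V₂ + V₂) + U₂
    eq₂ = ≡.trans (≡.cong₂ Ψ 2+z (e x z)) (D²-+ 2 z φ p₂)
      where
      e : ∀ x z → x ℕ.* (2 ℕ.+ z) ≡ x ℕ.* z ℕ.+ x ℕ.+ x
      e = ℕ-Solver.solve-∀
    -- The step 2 is cut into two unit steps, which lie at distances x and x + 1 from `p₁z`. Paired
    -- with `V p₁z` they give the third differences with steps x and x + 1.
    V₂≡ : V₂ ≡ V (p₁z ℕ.+ x) + V (p₁z ℕ.+ (x ℕ.+ 1))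
    V₂≡ = begin
      D z (D 2 φ) (p₂ ℕ.+ z)
        ≡⟨ ≡.cong₂ _-_ (D-suc 1 φ (p₂ ℕ.+ z)) (D-suc 1 φ (p₂ ℕ.+ z ℕ.+ z)) ⟩
      (a + b) - (c + d)
        ≡⟨ v₁ a b c d ⟩
      V (p₂ ℕ.+ z) + (b - d)
        ≡⟨ ≡.cong₂ _+_ (≡.cong V (e₁ p x z)) (≡.cong₂ (λ k l → D 1 φ k - D 1 φ l) (e₂ p x z) (e₃ p x z)) ⟩
      V (p₁z ℕ.+ x) + V (p₁z ℕ.+ (x ℕ.+ 1)) ∎
      where
      a = D 1 φ (p₂ ℕ.+ z)
      b = D 1 φ (p₂ ℕ.+ z ℕ.+ 1)
      c = D 1 φ (p₂ ℕ.+ z ℕ.+ z)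
      d = D 1 φ (p₂ ℕ.+ z ℕ.+ z ℕ.+ 1)
      v₁ : ∀ a b c d → (a + b) - (c + d) ≡ (a - c) + (b - d)
      v₁ = solve-∀ ℚ-ring
      e₁ : ∀ p x z → p ℕ.+ x ℕ.+ x ℕ.+ z ≡ p ℕ.+ x ℕ.+ z ℕ.+ x
      e₁ = ℕ-Solver.solve-∀
      e₂ : ∀ p x z → p ℕ.+ x ℕ.+ x ℕ.+ z ℕ.+ 1 ≡ p ℕ.+ x ℕ.+ z ℕ.+ (x ℕ.+ 1)
      e₂ = ℕ-Solver.solve-∀
      e₃ : ∀ p x z → p ℕ.+ x ℕ.+ x ℕ.+ z ℕ.+ z ℕ.+ 1 ≡ p ℕ.+ x ℕ.+ z ℕ.+ (x ℕ.+ 1) ℕ.+ z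
      e₃ = ℕ-Solver.solve-∀
    lem : ∀ a b c v w t u₁ u₂ → a - ((b + (v + v) + u₁) + (b + (v + v) + u₁)) + (c + ((w + t) + (w + t)) + u₂)
      ≡ (a - b - (b - c)) - ((v - w) + (v - w)) - ((v - t) + (v - t)) - (u₁ + u₁) + u₂
    lem = solve-∀ ℚ-ring

  mixed-bound : ∀ {φ b₂ b₃ b₄} → Bounded 2 b₂ φ → Bounded 3 b₃ φ → Bounded 4 b₄ φ → ∀ x z →
    ∣ mixed φ x z ∣ ≤ ι-product (x ∷ x ∷ z ∷ z ∷ []) * b₄
      + (ι-product (x ∷ z ∷ 1 ∷ []) * b₃ + ι-product (x ∷ z ∷ 1 ∷ []) * b₃)
      + (ι-product (x ℕ.+ 1 ∷ z ∷ 1 ∷ []) * b₃ + ι-product (x ℕ.+ 1 ∷ z ∷ 1 ∷ []) * b₃)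
      + (ι-product (1 ∷ 1 ∷ []) * b₂ + ι-product (1 ∷ 1 ∷ []) * b₂)
      + ι-product (2 ∷ 2 ∷ []) * b₂
  mixed-bound {φ} {b₂} {b₃} {b₄} φ₂ φ₃ φ₄ x z = ℚ.≤-trans (ℚ.≤-reflexive (≡.cong ∣_∣ (mixed-expand φ x z)))
    (∣+∣≤ (∣-∣≤ (∣-∣≤ (∣-∣≤ (𝔻-bound (x ∷ x ∷ z ∷ z ∷ []) {φ} φ₄ p)
      (∣+∣≤ (𝔻-bound (x ∷ z ∷ 1 ∷ []) {φ} φ₃ p₁) (𝔻-bound (x ∷ z ∷ 1 ∷ []) {φ} φ₃ p₁)))
      (∣+∣≤ (𝔻-bound (x ℕ.+ 1 ∷ z ∷ 1 ∷ []) {φ} φ₃ p₁) (𝔻-bound (x ℕ.+ 1 ∷ z ∷ 1 ∷ []) {φ} φ₃ p₁)))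
      (∣+∣≤ (𝔻-bound (1 ∷ 1 ∷ []) {φ} φ₂ (p₁ ℕ.+ z)) (𝔻-bound (1 ∷ 1 ∷ []) {φ} φ₂ (p₁ ℕ.+ z))))
      (𝔻-bound (2 ∷ 2 ∷ []) {φ} φ₂ (p ℕ.+ x ℕ.+ x ℕ.+ z ℕ.+ z)))
    where
    p = x ℕ.* z
    p₁ = p ℕ.+ x ℕ.+ z

  ι-product-≡ : ∀ es → ι-product es ≡ ι (product es)
  ι-product-≡ []       = ≡.sym ι-1
  ι-product-≡ (e ∷ es) = ≡.trans (≡.cong (ι e *_) (ι-product-≡ es)) (≡.sym (ι-* e (product es)))

  bin : ℕ → ℕ → ℕ
  bin zero    y       = 1
  bin (suc r) zero    = 0
  bin (suc r) (suc y) = bin (suc r) y ℕ.+ bin r y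

  bin-mono : ∀ r {x y} → x ℕ.≤ y → bin r x ℕ.≤ bin r y
  bin-mono zero    _         = ℕ.≤-refl
  bin-mono (suc r) z≤n       = z≤n
  bin-mono (suc r) (s≤s x≤y) = ℕ.+-mono-≤ (bin-mono (suc r) x≤y) (bin-mono r x≤y)

  bin≤^ : ∀ r y → bin r y ℕ.≤ y ℕ.^ r
  bin≤^ zero    y       = ℕ.≤-refl
  bin≤^ (suc r) zero    = z≤n
  bin≤^ (suc r) (suc y) = begin
    bin (suc r) y ℕ.+ bin r y          ≤⟨ ℕ.+-mono-≤ (bin≤^ (suc r) y) (bin≤^ r y) ⟩
    y ℕ.* y ℕ.^ r ℕ.+ y ℕ.^ r          ≡⟨ ℕ.+-comm (y ℕ.* y ℕ.^ r) (y ℕ.^ r) ⟩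
    suc y ℕ.* y ℕ.^ r                  ≤⟨ ℕ.*-monoʳ-≤ (suc y) (ℕ.^-monoˡ-≤ r (ℕ.n≤1+n y)) ⟩
    suc y ℕ.* suc y ℕ.^ r              ∎
    where open ℕ.≤-Reasoning

  bin-+ : ∀ r y z → bin (suc r) y ℕ.+ z ℕ.* bin r y ℕ.≤ bin (suc r) (z ℕ.+ y)
  bin-+ r y zero    = ℕ.≤-reflexive (ℕ.+-identityʳ _)
  bin-+ r y (suc z) = begin
    bin (suc r) y ℕ.+ (bin r y ℕ.+ z ℕ.* bin r y)  ≡⟨ eq (bin (suc r) y) (bin r y) (z ℕ.* bin r y) ⟩
    (bin (suc r) y ℕ.+ z ℕ.* bin r y) ℕ.+ bin r y  ≤⟨ ℕ.+-mono-≤ (bin-+ r y z) (bin-mono r (ℕ.m≤n+m y z)) ⟩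
    bin (suc r) (z ℕ.+ y) ℕ.+ bin r (z ℕ.+ y)      ∎
    where
    open ℕ.≤-Reasoning
    eq : ∀ a b c → a ℕ.+ (b ℕ.+ c) ≡ (a ℕ.+ c) ℕ.+ b
    eq = ℕ-Solver.solve-∀

  -- To choose r + 1 elements, take one from a block of z elements and r from the other r z; every
  -- stage gains a factor z.
  ^≤bin : ∀ r z → z ℕ.^ r ℕ.≤ bin r (r ℕ.* z)
  ^≤bin zero    z = ℕ.≤-refl
  ^≤bin (suc r) z = ℕ.≤-trans (ℕ.*-monoʳ-≤ z (^≤bin r z))
    (ℕ.≤-trans (ℕ.m≤n+m (z ℕ.* bin r (r ℕ.* z)) (bin (suc r) (r ℕ.* z))) (bin-+ r (r ℕ.* z) z))

  weight : ℕ → ℕ → ℕ → ℚ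
  weight r N x = ι (bin r (N ℕ.∸ x))

  0≤weight : ∀ r N x → 0ℚ ≤ weight r N x
  0≤weight r N x = 0≤ι (bin r (N ℕ.∸ x))

  weight-zero : ∀ r {N x} → N ℕ.≤ x → weight (suc r) N x ≡ 0ℚ
  weight-zero r {N} {x} N≤x = ≡.trans (≡.cong (λ y → ι (bin (suc r) y)) (ℕ.m≤n⇒m∸n≡0 N≤x)) ι-0

  -- Pascal's rule: a unit difference lowers the order by one. The rule stops at order 1, because
  -- `bin 0` is constantly 1 and does not vanish beyond `N`. Two summations by parts in each of two
  -- variables use four differences, hence the weight of order 5.
  D-weight : ∀ r N p → weight (suc r) N (suc p) ≡ D 1 (weight (suc (suc r)) N) p
  D-weight r N p with ℕ.≤-<-connex N p
  ... | inj₁ N≤p = ≡.trans (weight-zero r (ℕ.m≤n⇒m≤1+n N≤p)) (≡.sym (≡.trans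
      (≡.cong₂ _-_ (weight-zero (suc r) N≤p) (weight-zero (suc r) (ℕ.≤-trans N≤p (ℕ.m≤m+n p 1)))) (ℚ.+-inverseʳ 0ℚ)))
  ... | inj₂ p<N = ≡.trans (lem (ι (bin (suc (suc r)) y)) (ι (bin (suc r) y)))
      (≡.cong₂ _-_ (≡.trans (≡.sym (ι-+ _ _)) (≡.cong (λ m → ι (bin (suc (suc r)) m)) (≡.sym y-suc)))
        (≡.cong (λ q → ι (bin (suc (suc r)) (N ℕ.∸ q))) (ℕ.+-comm 1 p)))
    where
    y = N ℕ.∸ suc p
    y-suc : N ℕ.∸ p ≡ suc y
    y-suc = ℕ.+-∸-assoc 1 p<N
    lem : ∀ a b → b ≡ a + b - a
    lem = solve-∀ ℚ-ring

  weight-bounded : ∀ k r N → Bounded k (ι (N ℕ.^ suc r)) (weight (k ℕ.+ suc r) N)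
  weight-bounded zero r N p = 0≤p≤a⇒∣p∣≤a (0≤weight (suc r) N p)
    (ι-mono (ℕ.≤-trans (bin≤^ (suc r) (N ℕ.∸ p)) (ℕ.^-monoˡ-≤ (suc r) (ℕ.m∸n≤m N p))))
  weight-bounded (suc k) r N rewrite ℕ.+-suc k r = Bounded-cong k (D-weight (k ℕ.+ r) N)
    (Bounded-suc k (≡.subst (λ m → Bounded k (ι (N ℕ.^ suc r)) (weight m N)) (ℕ.+-suc k r) (weight-bounded k r N)))

  mixed-weight-zero : ∀ r {N x z} → N ℕ.≤ x ℕ.* z → mixed (weight (suc r) N) x z ≡ 0ℚ
  mixed-weight-zero r {N} {x} {z} N≤xz =
    ≡.trans (≡.cong₂ (λ a b → a - (b + b) + Δ² (λ x → φ (x ℕ.* suc (suc z))) x) (row z ℕ.≤-refl) (row (suc z) (ℕ.n≤1+n z)))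
    (≡.trans (≡.cong (λ c → 0ℚ - (0ℚ + 0ℚ) + c) (row (suc (suc z)) (ℕ.m≤n+m z 2))) refl)
    where
    φ = weight (suc r) N
    at : ∀ {x′ z′} → x ℕ.≤ x′ → z ℕ.≤ z′ → φ (x′ ℕ.* z′) ≡ 0ℚ
    at x≤ z≤ = weight-zero r (ℕ.≤-trans N≤xz (ℕ.*-mono-≤ x≤ z≤))
    row : ∀ z′ → z ℕ.≤ z′ → Δ² (λ x → φ (x ℕ.* z′)) x ≡ 0ℚ
    row z′ z≤z′ = ≡.trans (≡.cong₂ (λ a b → a - (b + b) + φ (suc (suc x) ℕ.* z′)) (at {x} {z′} ℕ.≤-refl z≤z′) (at {suc x} {z′} (ℕ.n≤1+n x) z≤z′))
      (≡.trans (≡.cong (λ c → 0ℚ - (0ℚ + 0ℚ) + c) (at {suc (suc x)} {z′} (ℕ.m≤n+m x 2) z≤z′)) refl)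

  -- Where x z < N, the powers of N lost by the differences of the weight match the products of
  -- steps: x² z² N, x z N² and N³ are all at most N³. The five terms of `mixed-bound` contribute 1
  -- + 2 + 4 + 2 + 4 = 13, the 4 in the middle because (x + 1) z ≤ 2 N.
  mixed-weight-bound : ∀ N x z → 1 ℕ.≤ x → 1 ℕ.≤ z → ∣ mixed (weight 5 N) x z ∣ ≤ ι (13 ℕ.* N ℕ.^ 3)
  mixed-weight-bound N x z 1≤x 1≤z with ℕ.≤-<-connex N (x ℕ.* z)
  ... | inj₁ N≤xz = ℚ.≤-trans (ℚ.≤-reflexive (≡.cong ∣_∣ (mixed-weight-zero 4 {N} {x} {z} N≤xz))) (0≤ι (13 ℕ.* N ℕ.^ 3))
  ... | inj₂ xz<N = ℚ.≤-trans (mixed-bound {weight 5 N} (weight-bounded 2 2 N) (weight-bounded 3 1 N) (weight-bounded 4 0 N) x z)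
      (ℚ.≤-trans (ℚ.≤-reflexive (sum (x ∷ x ∷ z ∷ z ∷ []) (N ℕ.^ 1) (x ∷ z ∷ 1 ∷ []) (x ℕ.+ 1 ∷ z ∷ 1 ∷ []) (N ℕ.^ 2) (1 ∷ 1 ∷ [])
          (N ℕ.^ 3) (2 ∷ 2 ∷ []))) (ι-mono (total (ℕ.<⇒≤ xz<N))))
    where
    prod : ∀ es b → ι-product es * ι b ≡ ι (product es ℕ.* b)
    prod es b = ≡.trans (≡.cong (_* ι b) (ι-product-≡ es)) (≡.sym (ι-* (product es) b))
    five : ∀ a b c d e → ι a + (ι b + ι b) + (ι c + ι c) + (ι d + ι d) + ι e ≡ ι (a ℕ.+ (b ℕ.+ b) ℕ.+ (c ℕ.+ c) ℕ.+ (d ℕ.+ d) ℕ.+ e)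
    five a b c d e rewrite ι-+ (a ℕ.+ (b ℕ.+ b) ℕ.+ (c ℕ.+ c) ℕ.+ (d ℕ.+ d)) e | ι-+ (a ℕ.+ (b ℕ.+ b) ℕ.+ (c ℕ.+ c)) (d ℕ.+ d)
      | ι-+ (a ℕ.+ (b ℕ.+ b)) (c ℕ.+ c) | ι-+ a (b ℕ.+ b) | ι-+ b b | ι-+ c c | ι-+ d d = refl
    sum : ∀ es₁ b₁ es₂ es₃ b₂ es₄ b₃ es₅ →
      ι-product es₁ * ι b₁ + (ι-product es₂ * ι b₂ + ι-product es₂ * ι b₂) + (ι-product es₃ * ι b₂ + ι-product es₃ * ι b₂)
      + (ι-product es₄ * ι b₃ + ι-product es₄ * ι b₃) + ι-product es₅ * ι b₃
      ≡ ι (product es₁ ℕ.* b₁ ℕ.+ (product es₂ ℕ.* b₂ ℕ.+ product es₂ ℕ.* b₂) ℕ.+ (product es₃ ℕ.* b₂ ℕ.+ product es₃ ℕ.* b₂)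
           ℕ.+ (product es₄ ℕ.* b₃ ℕ.+ product es₄ ℕ.* b₃) ℕ.+ product es₅ ℕ.* b₃)
    sum es₁ b₁ es₂ es₃ b₂ es₄ b₃ es₅ rewrite prod es₁ b₁ | prod es₂ b₂ | prod es₃ b₂ | prod es₄ b₃ | prod es₅ b₃
      = five (product es₁ ℕ.* b₁) (product es₂ ℕ.* b₂) (product es₃ ℕ.* b₂) (product es₄ ℕ.* b₃) (product es₅ ℕ.* b₃)
    total : x ℕ.* z ℕ.≤ N →
      product (x ∷ x ∷ z ∷ z ∷ []) ℕ.* N ℕ.^ 1 ℕ.+ (product (x ∷ z ∷ 1 ∷ []) ℕ.* N ℕ.^ 2 ℕ.+ product (x ∷ z ∷ 1 ∷ []) ℕ.* N ℕ.^ 2)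
      ℕ.+ (product (x ℕ.+ 1 ∷ z ∷ 1 ∷ []) ℕ.* N ℕ.^ 2 ℕ.+ product (x ℕ.+ 1 ∷ z ∷ 1 ∷ []) ℕ.* N ℕ.^ 2)
      ℕ.+ (product (1 ∷ 1 ∷ []) ℕ.* N ℕ.^ 3 ℕ.+ product (1 ∷ 1 ∷ []) ℕ.* N ℕ.^ 3) ℕ.+ product (2 ∷ 2 ∷ []) ℕ.* N ℕ.^ 3
      ℕ.≤ 13 ℕ.* N ℕ.^ 3
    total xz≤N = begin
      _ ≤⟨ ℕ.+-monoˡ-≤ (4 ℕ.* N³) (ℕ.+-monoˡ-≤ (1 ℕ.* N³ ℕ.+ 1 ℕ.* N³) (ℕ.+-mono-≤ (ℕ.+-mono-≤ t₁ (ℕ.+-mono-≤ t₂ t₂)) (ℕ.+-mono-≤ t₃ t₃))) ⟩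
      N³ ℕ.+ (N³ ℕ.+ N³) ℕ.+ (2 ℕ.* N³ ℕ.+ 2 ℕ.* N³) ℕ.+ (1 ℕ.* N³ ℕ.+ 1 ℕ.* N³) ℕ.+ 4 ℕ.* N³ ≡⟨ eq N³ ⟩
      13 ℕ.* N³ ∎
      where
      open ℕ.≤-Reasoning
      N³ = N ℕ.^ 3
      eq : ∀ a → a ℕ.+ (a ℕ.+ a) ℕ.+ (2 ℕ.* a ℕ.+ 2 ℕ.* a) ℕ.+ (1 ℕ.* a ℕ.+ 1 ℕ.* a) ℕ.+ 4 ℕ.* a ≡ 13 ℕ.* a
      eq = ℕ-Solver.solve-∀
      e₁ : ∀ x z → x ℕ.* (x ℕ.* (z ℕ.* (z ℕ.* 1))) ≡ (x ℕ.* z) ℕ.* (x ℕ.* z)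
      e₁ = ℕ-Solver.solve-∀
      e₂ : ∀ N → (N ℕ.* N) ℕ.* (N ℕ.* 1) ≡ N ℕ.* (N ℕ.* (N ℕ.* 1))
      e₂ = ℕ-Solver.solve-∀
      e₃ : ∀ x z → (x ℕ.+ 1) ℕ.* (z ℕ.* 1) ≡ x ℕ.* z ℕ.+ z
      e₃ = ℕ-Solver.solve-∀
      t₁ : x ℕ.* (x ℕ.* (z ℕ.* (z ℕ.* 1))) ℕ.* N ℕ.^ 1 ℕ.≤ N³
      t₁ = ℕ.≤-trans (ℕ.*-monoˡ-≤ (N ℕ.^ 1) (ℕ.≤-trans (ℕ.≤-reflexive (e₁ x z)) (ℕ.*-mono-≤ xz≤N xz≤N))) (ℕ.≤-reflexive (e₂ N))
      t₂ : x ℕ.* (z ℕ.* 1) ℕ.* N ℕ.^ 2 ℕ.≤ N³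
      t₂ = ℕ.*-monoˡ-≤ (N ℕ.^ 2) (ℕ.≤-trans (ℕ.≤-reflexive (≡.cong (x ℕ.*_) (ℕ.*-identityʳ z))) xz≤N)
      t₃ : (x ℕ.+ 1) ℕ.* (z ℕ.* 1) ℕ.* N ℕ.^ 2 ℕ.≤ 2 ℕ.* N³
      t₃ = ℕ.≤-trans (ℕ.*-monoˡ-≤ (N ℕ.^ 2) (ℕ.≤-trans (ℕ.≤-reflexive (e₃ x z))
             (ℕ.+-mono-≤ xz≤N (ℕ.≤-trans (ℕ.m≤n*m z x {{ℕ.>-nonZero 1≤x}}) xz≤N)))) (ℕ.≤-reflexive (e₄ N (N ℕ.^ 2)))
        where
        e₄ : ∀ N M → (N ℕ.+ N) ℕ.* M ≡ 2 ℕ.* (N ℕ.* M)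
        e₄ = ℕ-Solver.solve-∀

-- Smooth fourfold sums expressed by Riesz means

module SmoothSums where
  open RationalInequalities
  open AbelSummation
  open HyperbolaMethod
  open FiniteDifferences

  private
    partial : ∀ g x t → ∑ (x ℕ.+ t) (λ m → Δ² g (suc m) * ι (suc m ℕ.∸ x)) ≡
      g (suc x) - ι (suc t) * g (suc (x ℕ.+ t)) + ι t * g (suc (suc (x ℕ.+ t)))
    partial g x zero rewrite ℕ.+-identityʳ x | ι-1 | ι-0 = ≡.trans
      (∑-zero x λ m m<x → ≡.trans (≡.cong (Δ² g (suc m) *_) (≡.trans (≡.cong ι (ℕ.m≤n⇒m∸n≡0 m<x)) ι-0)) (ℚ.*-zeroʳ (Δ² g (suc m))))
      (≡.sym (lem (g (suc x)) (g (suc (suc x)))))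
      where
      lem : ∀ a b → a - 1ℚ * a + 0ℚ * b ≡ 0ℚ
      lem = solve-∀ ℚ-ring
    partial g x (suc t) rewrite ℕ.+-suc x t = ≡.trans
      (≡.cong₂ _+_ (partial g x t) (≡.cong (λ k → Δ² g (suc (x ℕ.+ t)) * ι k)
        (≡.trans (≡.cong (ℕ._∸ x) (≡.sym (ℕ.+-suc x t))) (ℕ.m+n∸m≡n x (suc t)))))
      (≡.trans (≡.cong (λ u → g₀ - u * g₁ + ι t * g₂ + Δ² g (suc (x ℕ.+ t)) * u) (ι-suc t))
        (≡.trans (lem g₀ g₁ g₂ g₃ (ι t)) (≡.cong₂ (λ u v → g₀ - u * g₂ + v * g₃)
          (≡.sym (≡.trans (ι-suc (suc t)) (≡.cong (1ℚ +_) (ι-suc t)))) (≡.sym (ι-suc t)))))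
      where
      g₀ = g (suc x)
      g₁ = g (suc (x ℕ.+ t))
      g₂ = g (suc (suc (x ℕ.+ t)))
      g₃ = g (suc (suc (suc (x ℕ.+ t))))
      lem : ∀ a b c d t → a - (1ℚ + t) * b + t * c + (b - (c + c) + d) * (1ℚ + t) ≡ a - (1ℚ + (1ℚ + t)) * c + (1ℚ + t) * d
      lem = solve-∀ ℚ-ring

  -- Two summations by parts for a function that vanishes from `N` on: it is a combination of the
  -- ramps max(0 , m + 2 - t), read off at t = x + 1, with its second differences as coefficients.
  Δ²-representation : ∀ N {g} → (∀ x → N ℕ.≤ x → g x ≡ 0ℚ) → ∀ x →
    g (suc x) ≡ ∑ N (λ m → Δ² g (suc m) * ι (suc m ℕ.∸ x))
  Δ²-representation N {g} g≡0 x with ℕ.≤-total x N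
  ... | inj₁ x≤N with N ℕ.∸ x | ℕ.m+[n∸m]≡n x≤N
  ... | t | refl = ≡.sym (≡.trans (partial g x t) (≡.trans
      (≡.cong₂ (λ a b → g (suc x) - ι (suc t) * a + ι t * b) (g≡0 _ (ℕ.n≤1+n (x ℕ.+ t))) (g≡0 _ (ℕ.m≤n+m (x ℕ.+ t) 2)))
      (lem (g (suc x)) (ι (suc t)) (ι t))))
    where
    lem : ∀ a b c → a - b * 0ℚ + c * 0ℚ ≡ a
    lem = solve-∀ ℚ-ring
  Δ²-representation N {g} g≡0 x | inj₂ N≤x = ≡.trans (g≡0 (suc x) (ℕ.m≤n⇒m≤1+n N≤x)) (≡.sym (∑-zero N λ m m<N →
    ≡.trans (≡.cong (Δ² g (suc m) *_) (≡.trans (≡.cong ι (ℕ.m≤n⇒m∸n≡0 (ℕ.≤-trans m<N N≤x))) ι-0)) (ℚ.*-zeroʳ (Δ² g (suc m)))))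

  riesz-range : ∀ (α F : ℕ → ℚ) y {M N} → M ℕ.≤ N → y ℕ.≤ suc M →
    ∑ N (λ i → ∑ N (λ j → α i * F j * sawtooth y (suc j) i)) ≡ ∑ M (λ i → ∑ M (λ j → α i * F j * sawtooth y (suc j) i))
  riesz-range α F y {M} {N} M≤N y≤1+M = ≡.trans
    (∑-extend M≤N _ λ i M≤i _ → ∑-zero N λ j _ → vanish i j
      (ℕ.≤-trans y≤1+M (ℕ.≤-trans (s≤s M≤i) (ℕ.m≤m*n (suc i) (suc j)))))
    (∑-cong M λ i _ → ∑-extend M≤N _ λ j M≤j _ → vanish i j
      (ℕ.≤-trans y≤1+M (ℕ.≤-trans (s≤s M≤j) (ℕ.m≤n*m (suc j) (suc i)))))
    where
    vanish : ∀ i j → y ℕ.≤ suc i ℕ.* suc j → α i * F j * sawtooth y (suc j) i ≡ 0ℚ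
    vanish i j y≤ = ≡.trans (≡.cong (α i * F j *_) (≡.trans (≡.cong ι (ℕ.m≤n⇒m∸n≡0 y≤)) ι-0)) (ℚ.*-zeroʳ (α i * F j))

  -- At t = a k every ramp of `Δ²-representation` is the kernel of a Riesz mean at y = m + 2, which
  -- explains the double successor.
  smooth-sum : ∀ (α F : ℕ → ℚ) N (g : ℕ → ℚ) → (∀ x → N ℕ.≤ x → g x ≡ 0ℚ) →
    ∑ N (λ i → ∑ N (λ j → α i * F j * g (suc i ℕ.* suc j))) ≡ ∑ N (λ m → Δ² g (suc m) * riesz α F (suc (suc m)))
  smooth-sum α F N g g≡0 = begin
    ∑ N (λ i → ∑ N (λ j → α i * F j * g (suc i ℕ.* suc j)))
      ≡⟨ ∑-cong N (λ i _ → ∑-cong N λ j _ → ≡.trans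
           (≡.cong (α i * F j *_) (Δ²-representation N g≡0 (j ℕ.+ i ℕ.* suc j))) (≡.sym (∑-*ˡ N (α i * F j) _))) ⟩
    ∑ N (λ i → ∑ N (λ j → ∑ N (λ m → α i * F j * (Δ² g (suc m) * s m i j))))
      ≡⟨ ∑-cong N (λ i _ → ∑-swap N N _) ⟩
    ∑ N (λ i → ∑ N (λ m → ∑ N (λ j → α i * F j * (Δ² g (suc m) * s m i j))))
      ≡⟨ ∑-swap N N _ ⟩
    ∑ N (λ m → ∑ N (λ i → ∑ N (λ j → α i * F j * (Δ² g (suc m) * s m i j))))
      ≡⟨ ∑-cong N (λ m m<N → ≡.trans (∑-cong N λ i _ → ≡.trans (∑-cong N λ j _ → lem (α i * F j) (Δ² g (suc m)) (s m i j)) (∑-*ˡ N (Δ² g (suc m)) _))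
           (≡.trans (∑-*ˡ N (Δ² g (suc m)) _) (≡.cong (Δ² g (suc m) *_)
             (≡.trans (riesz-range α F (suc (suc m)) m<N ℕ.≤-refl) (≡.sym (riesz-range α F (suc (suc m)) (ℕ.n≤1+n (suc m)) ℕ.≤-refl)))))) ⟩
    ∑ N (λ m → Δ² g (suc m) * riesz α F (suc (suc m))) ∎
    where
    open ≡.≡-Reasoning
    s : ℕ → ℕ → ℕ → ℚ
    s m i j = sawtooth (suc (suc m)) (suc j) i
    lem : ∀ a b c → a * (b * c) ≡ b * (a * c)
    lem = solve-∀ ℚ-ring

  Δ²-∑ : ∀ N (f : ℕ → ℕ → ℚ) x → Δ² (λ x → ∑ N (λ i → f i x)) x ≡ ∑ N (λ i → Δ² (f i) x)
  Δ²-∑ N f x = ≡.sym (≡.trans (∑-+ N _ _) (≡.cong (_+ ∑ N (λ i → f i (suc (suc x)))) (≡.trans (∑-+ N _ _)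
    (≡.cong (∑ N (λ i → f i x) +_) (≡.trans (∑-neg N _) (≡.cong -_ (∑-+ N _ _)))))))

  Δ²-* : ∀ a f x → Δ² (λ x → a * f x) x ≡ a * Δ² f x
  Δ²-* a f x = lem a (f x) (f (suc x)) (f (suc (suc x)))
    where
    lem : ∀ a b c d → a * b - (a * c + a * c) + a * d ≡ a * (b - (c + c) + d)
    lem = solve-∀ ℚ-ring

  fourfold : (α F β F′ w : ℕ → ℚ) → ℕ → ℚ
  fourfold α F β F′ w N = ∑ N (λ i → ∑ N (λ j → α i * F j *
    ∑ N (λ i′ → ∑ N (λ j′ → β i′ * F′ j′ * w (suc i ℕ.* suc j ℕ.* (suc i′ ℕ.* suc j′))))))

  -- `smooth-sum` is applied to x = a k and then to z = b l. The second difference in x passes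
  -- through the inner sums, so together they leave the mixed second difference of w(x z).
  fourfold-smooth : ∀ α F β F′ w N → (∀ x → N ℕ.≤ x → w x ≡ 0ℚ) → fourfold α F β F′ w N ≡
    ∑ N (λ m → ∑ N (λ m′ → mixed w (suc m) (suc m′) * riesz β F′ (suc (suc m′))) * riesz α F (suc (suc m)))
  fourfold-smooth α F β F′ w N w≡0 = ≡.trans
    (smooth-sum α F N g λ x N≤x → ∑-zero N λ i _ → ∑-zero N λ j _ → ≡.trans
       (≡.cong (β i * F′ j *_) (w≡0 _ (ℕ.≤-trans N≤x (ℕ.m≤m*n x (suc i ℕ.* suc j))))) (ℚ.*-zeroʳ (β i * F′ j)))
    (∑-cong N λ m _ → ≡.cong (_* riesz α F (suc (suc m))) (≡.trans (expand (suc m)) (smooth-sum β F′ N (h (suc m)) (h≡0 m))))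
    where
    g : ℕ → ℚ
    g x = ∑ N (λ i′ → ∑ N (λ j′ → β i′ * F′ j′ * w (x ℕ.* (suc i′ ℕ.* suc j′))))
    h : ℕ → ℕ → ℚ
    h x z = Δ² (λ x → w (x ℕ.* z)) x
    expand : ∀ x → Δ² g x ≡ ∑ N (λ i → ∑ N (λ j → β i * F′ j * h x (suc i ℕ.* suc j)))
    expand x = ≡.trans (Δ²-∑ N (λ i x → ∑ N (λ j → β i * F′ j * w (x ℕ.* (suc i ℕ.* suc j)))) x) (∑-cong N λ i _ →
      ≡.trans (Δ²-∑ N (λ j x → β i * F′ j * w (x ℕ.* (suc i ℕ.* suc j))) x) (∑-cong N λ j _ →
        Δ²-* (β i * F′ j) (λ x → w (x ℕ.* (suc i ℕ.* suc j))) x))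
    h≡0 : ∀ m z → N ℕ.≤ z → h (suc m) z ≡ 0ℚ
    h≡0 m z N≤z rewrite w≡0 (suc m ℕ.* z) (ℕ.≤-trans N≤z (ℕ.m≤n*m z (suc m)))
      | w≡0 (suc (suc m) ℕ.* z) (ℕ.≤-trans N≤z (ℕ.m≤n*m z (suc (suc m))))
      | w≡0 (suc (suc (suc m)) ℕ.* z) (ℕ.≤-trans N≤z (ℕ.m≤n*m z (suc (suc (suc m))))) = refl

  cube-root : ∀ y → Σ ℕ λ c → c ℕ.^ 3 ℕ.≤ y × y ℕ.< suc c ℕ.^ 3
  cube-root zero = 0 , z≤n , s≤s z≤n
  cube-root (suc y) with cube-root y
  ... | c , c³≤y , y<[1+c]³ with suc c ℕ.^ 3 ℕ.≤? suc y
  ...   | yes [1+c]³≤1+y = suc c , [1+c]³≤1+y , ℕ.≤-<-trans y<[1+c]³ (ℕ.^-monoˡ-< 3 (ℕ.n<1+n (suc c)))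
  ...   | no ¬≤          = c , ℕ.m≤n⇒m≤1+n c³≤y , ℕ.≰⇒> ¬≤

  2+m≤2*[1+m] : ∀ m → suc (suc m) ℕ.≤ 2 ℕ.* suc m
  2+m≤2*[1+m] m = s≤s (ℕ.≤-trans (ℕ.≤-reflexive (ℕ.+-comm 1 m)) (ℕ.+-monoʳ-≤ m (s≤s z≤n)))

  -- From y ≥ 1 follows c ≥ 1, hence c + 1 ≤ 2 c. This is the origin of the slack 8 in
  -- `RieszBounded`.
  cube-root-8 : ∀ y c → 1 ℕ.≤ y → y ℕ.< suc c ℕ.^ 3 → y ℕ.≤ 8 ℕ.* c ℕ.^ 3
  cube-root-8 y zero    1≤y y<1 = contradiction y<1 (ℕ.≤⇒≯ 1≤y)
  cube-root-8 y (suc d) _   y<  = ℕ.≤-trans (ℕ.<⇒≤ y<) (ℕ.≤-trans (ℕ.^-monoˡ-≤ 3 (2+m≤2*[1+m] d)) (ℕ.≤-reflexive (eq (suc d))))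
    where
    eq : ∀ c → (2 ℕ.* c) ℕ.* ((2 ℕ.* c) ℕ.* ((2 ℕ.* c) ℕ.* 1)) ≡ 8 ℕ.* (c ℕ.* (c ℕ.* (c ℕ.* 1)))
    eq = ℕ-Solver.solve-∀

  RieszBounded : (α F : ℕ → ℚ) → ℚ → Set
  RieszBounded α F D = 0ℚ ≤ D × (∀ y c → c ℕ.^ 3 ℕ.≤ y → y ℕ.≤ 8 ℕ.* c ℕ.^ 3 → ∣ riesz α F y ∣ ≤ D * (ι y * ι c))

  -- The weight confines the pair to x z < N. There the Riesz bounds multiply to a constant times y
  -- y′ · c c′, with y y′ ≤ 4 N and (c c′)³ ≤ 4 N. The factor N/(x z) ≥ 1 is inserted so that the
  -- count of such pairs is majorised by N H(N)², at the price of logarithms only.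
  fourfold-bound : ∀ {α F β F′ D D′} → RieszBounded α F D → RieszBounded β F′ D′ → ∀ N s → 4 ℕ.* N ℕ.< suc s ℕ.^ 3 →
    ∣ fourfold α F β F′ (weight 5 N) N ∣ ≤ ι (13 ℕ.* N ℕ.^ 3) * (D * D′) * (ι (4 ℕ.* N) * ι s) * ι N * (H N * H N)
  fourfold-bound {α} {F} {β} {F′} {D} {D′} (0≤D , R≤) (0≤D′ , R′≤) N s 4N<s³ =
    ℚ.≤-trans (ℚ.≤-reflexive (≡.cong ∣_∣ (≡.trans (fourfold-smooth α F β F′ w N (λ x N≤x → weight-zero 4 N≤x))
        (∑-cong N λ m _ → ≡.sym (∑-*ʳ N (riesz α F (suc (suc m))) _)))))
      (ℚ.≤-trans (∣∑∣≤ N λ m _ → ∣∑∣≤ N λ m′ _ → term m m′)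
        (ℚ.≤-reflexive (≡.trans (∑-cong N λ m _ → ∑-*ˡ N (K * inv (suc m)) _)
          (≡.trans (∑-*ʳ N (H N) _) (≡.trans (≡.cong (_* H N) (∑-*ˡ N K _)) (ℚ.*-assoc K (H N) (H N)))))))
    where
    w = weight 5 N
    K₀ = ι (13 ℕ.* N ℕ.^ 3) * (D * D′) * (ι (4 ℕ.* N) * ι s)
    K = K₀ * ι N
    0≤K₀ : 0ℚ ≤ K₀
    0≤K₀ = 0≤p*q (0≤p*q (0≤ι (13 ℕ.* N ℕ.^ 3)) (0≤p*q 0≤D 0≤D′)) (0≤p*q (0≤ι (4 ℕ.* N)) (0≤ι s))
    term : ∀ m m′ → ∣ mixed w (suc m) (suc m′) * riesz β F′ (suc (suc m′)) * riesz α F (suc (suc m)) ∣ ≤ K * inv (suc m) * inv (suc m′)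
    term m m′ with ℕ.≤-<-connex N (suc m ℕ.* suc m′)
    ... | inj₁ N≤ = ℚ.≤-trans (ℚ.≤-reflexive (≡.cong ∣_∣ (≡.trans (≡.cong (λ x → x * R′ * R)
        (mixed-weight-zero 4 {N} {suc m} {suc m′} N≤)) (lem R′ R))))
        (0≤p*q (0≤p*q (0≤p*q 0≤K₀ (0≤ι N)) (0≤inv (suc m))) (0≤inv (suc m′)))
      where
      R′ = riesz β F′ (suc (suc m′))
      R = riesz α F (suc (suc m))
      lem : ∀ a b → 0ℚ * a * b ≡ 0ℚ
      lem = solve-∀ ℚ-ring
    ... | inj₂ mm′<N = ℚ.≤-trans
        (∣*∣≤ (∣*∣≤ (mixed-weight-bound N (suc m) (suc m′) (s≤s z≤n) (s≤s z≤n)) (R′≤ y′ c′ (proj₁ (proj₂ (cube-root y′)))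
            (cube-root-8 y′ c′ (s≤s z≤n) (proj₂ (proj₂ (cube-root y′))))))
          (R≤ y c (proj₁ (proj₂ (cube-root y))) (cube-root-8 y c (s≤s z≤n) (proj₂ (proj₂ (cube-root y))))))
        (ℚ.≤-trans (ℚ.≤-reflexive (lem (ι (13 ℕ.* N ℕ.^ 3)) D D′ (ι y) (ι y′) (ι c) (ι c′)))
          (ℚ.≤-trans (*-monoˡ (ι (13 ℕ.* N ℕ.^ 3) * (D * D′)) (0≤p*q (0≤ι (13 ℕ.* N ℕ.^ 3)) (0≤p*q 0≤D 0≤D′))
              (*-mono (0≤p*q (0≤ι y) (0≤ι y′)) (≡.subst (_≤ ι (4 ℕ.* N)) (ι-* y y′) (ι-mono yy′≤4N))
                      (0≤p*q (0≤ι c) (0≤ι c′)) (≡.subst (_≤ ι s) (ι-* c c′) (ι-mono cc′≤s))))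
            (ℚ.≤-trans (≡.subst (_≤ K₀ * (ι N * (inv (suc m) * inv (suc m′)))) (ℚ.*-identityʳ K₀) (*-monoˡ K₀ 0≤K₀ 1≤))
              (ℚ.≤-reflexive (lem₂ K₀ (ι N) (inv (suc m)) (inv (suc m′)))))))
      where
      y = suc (suc m)
      y′ = suc (suc m′)
      c = proj₁ (cube-root y)
      c′ = proj₁ (cube-root y′)
      lem : ∀ a D D′ y y′ c c′ → a * (D′ * (y′ * c′)) * (D * (y * c)) ≡ a * (D * D′) * ((y * y′) * (c * c′))
      lem = solve-∀ ℚ-ring
      lem₂ : ∀ k n i j → k * (n * (i * j)) ≡ k * n * i * j
      lem₂ = solve-∀ ℚ-ring
      yy′≤4N : y ℕ.* y′ ℕ.≤ 4 ℕ.* N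
      yy′≤4N = ℕ.≤-trans (ℕ.*-mono-≤ (2+m≤2*[1+m] m) (2+m≤2*[1+m] m′)) (ℕ.≤-trans (ℕ.≤-reflexive (e (suc m) (suc m′))) (ℕ.*-monoʳ-≤ 4 (ℕ.<⇒≤ mm′<N)))
        where
        e : ∀ a b → (2 ℕ.* a) ℕ.* (2 ℕ.* b) ≡ 4 ℕ.* (a ℕ.* b)
        e = ℕ-Solver.solve-∀
      cc′≤s : c ℕ.* c′ ℕ.≤ s
      cc′≤s = ℕ.≮⇒≥ λ s<cc′ → ℕ.<-irrefl refl (ℕ.<-≤-trans 4N<s³ (ℕ.≤-trans (ℕ.^-monoˡ-≤ 3 s<cc′)
        (ℕ.≤-trans (ℕ.≤-reflexive (e c c′)) (ℕ.≤-trans (ℕ.*-mono-≤ (proj₁ (proj₂ (cube-root y))) (proj₁ (proj₂ (cube-root y′)))) yy′≤4N))))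
        where
        e : ∀ a b → (a ℕ.* b) ℕ.* ((a ℕ.* b) ℕ.* ((a ℕ.* b) ℕ.* 1)) ≡ (a ℕ.* (a ℕ.* (a ℕ.* 1))) ℕ.* (b ℕ.* (b ℕ.* (b ℕ.* 1)))
        e = ℕ-Solver.solve-∀
      1≤ : 1ℚ ≤ ι N * (inv (suc m) * inv (suc m′))
      1≤ = ≡.subst (_≤ ι N * (inv (suc m) * inv (suc m′))) (≡.trans (≡.cong (ι (suc m ℕ.* suc m′) *_)
          (≡.sym (inv-* (suc m) (suc m′)))) (ι-inv (m′ ℕ.+ m ℕ.* suc m′)))
        (*-monoʳ (inv (suc m) * inv (suc m′)) (0≤p*q (0≤inv (suc m)) (0≤inv (suc m′))) (ι-mono (ℕ.<⇒≤ mm′<N)))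

-- Congruences, units and inverses modulo n

module UnitsModulo (n′ : ℕ) where
  n : ℕ
  n = suc n′

  infix 4 _≋_
  -- A record rather than a bare equation of remainders, so that `a` and `b` can be recovered from
  -- the type.
  record _≋_ (a b : ℕ) : Set where
    constructor mk≋
    field %≡ : a ℕ.% n ≡ b ℕ.% n
  open _≋_ public

  ≋-refl : ∀ {a} → a ≋ a
  ≋-refl = mk≋ refl

  ≋-reflexive : ∀ {a b} → a ≡ b → a ≋ b
  ≋-reflexive refl = ≋-refl

  ≋-sym : ∀ {a b} → a ≋ b → b ≋ a
  ≋-sym (mk≋ p) = mk≋ (≡.sym p)

  ≋-trans : ∀ {a b c} → a ≋ b → b ≋ c → a ≋ c
  ≋-trans (mk≋ p) (mk≋ q) = mk≋ (≡.trans p q)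

  %-≋ : ∀ a → a ℕ.% n ≋ a
  %-≋ a = mk≋ (ℕ.m%n%n≡m%n a n)

  ≋-* : ∀ {a a′ b b′} → a ≋ a′ → b ≋ b′ → a ℕ.* b ≋ a′ ℕ.* b′
  ≋-* {a} {a′} {b} {b′} (mk≋ p) (mk≋ q) = mk≋ (≡.trans (ℕ.%-distribˡ-* a b n)
    (≡.trans (≡.cong₂ (λ x y → (x ℕ.* y) ℕ.% n) p q) (≡.sym (ℕ.%-distribˡ-* a′ b′ n))))

  ≋-*ˡ : ∀ a {b b′} → b ≋ b′ → a ℕ.* b ≋ a ℕ.* b′
  ≋-*ˡ a = ≋-* {a} ≋-refl

  ≋-*ʳ : ∀ {a a′} b → a ≋ a′ → a ℕ.* b ≋ a′ ℕ.* b
  ≋-*ʳ b a≋a′ = ≋-* {b = b} a≋a′ ≋-refl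

  +-kn-≋ : ∀ a k → a ℕ.+ k ℕ.* n ≋ a
  +-kn-≋ a k = mk≋ (ℕ.[m+kn]%n≡m%n a k n)

  ≋⇒≡ : ∀ {a b} → a ≋ b → a ℕ.< n → b ℕ.< n → a ≡ b
  ≋⇒≡ (mk≋ a≋b) a<n b<n = ≡.trans (≡.sym (ℕ.m<n⇒m%n≡m a<n)) (≡.trans a≋b (ℕ.m<n⇒m%n≡m b<n))

  record Unit (a : ℕ) : Set where
    constructor mkUnit
    field gcd≡1 : ℕ.gcd a n ≡ 1
  open Unit public

  unit? : ∀ a → Dec (Unit a)
  unit? a with ℕ.gcd a n ℕ.≟ 1
  ... | yes p = yes (mkUnit p)
  ... | no ¬p = no λ u → ¬p (gcd≡1 u)

  private
    from : ∀ {a} → Unit a → ∀ {d} → d ∣ a → d ∣ n → d ≡ 1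
    from (mkUnit u) d∣a d∣n = ℕ.gcd≡1⇒coprime u (d∣a , d∣n)

    to : ∀ {a} → (∀ {d} → d ∣ a → d ∣ n → d ≡ 1) → Unit a
    to f = mkUnit (ℕ.coprime⇒gcd≡1 λ (d∣a , d∣n) → f d∣a d∣n)

  unit-≋ : ∀ {a b} → a ≋ b → Unit a → Unit b
  unit-≋ {a} {b} (mk≋ a≋b) ua = to λ {d} d∣b d∣n → from ua
    (≡.subst (d ∣_) (≡.sym (ℕ.m≡m%n+[m/n]*n a n))
      (ℕ.∣m∣n⇒∣m+n (≡.subst (d ∣_) (≡.sym a≋b) (ℕ.%-presˡ-∣ d∣b d∣n)) (ℕ.∣n⇒∣m*n (a ℕ./ n) d∣n)))
    d∣n

  unit-*⁻ˡ : ∀ a b → Unit (a ℕ.* b) → Unit a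
  unit-*⁻ˡ a b uab = to λ d∣a d∣n → from uab (ℕ.∣m⇒∣m*n b d∣a) d∣n

  unit-*⁻ʳ : ∀ a b → Unit (a ℕ.* b) → Unit b
  unit-*⁻ʳ a b uab = to λ d∣b d∣n → from uab (ℕ.∣n⇒∣m*n a d∣b) d∣n

  unit-* : ∀ {a b} → Unit a → Unit b → Unit (a ℕ.* b)
  unit-* {a} {b} ua ub = to λ {d} d∣ab d∣n → from ub
    (ℕ.coprime-divisor {d} {a} (λ (e∣d , e∣a) → from ua e∣a (ℕ.∣-trans e∣d d∣n)) d∣ab) d∣n

  unit-1 : Unit 1
  unit-1 = mkUnit (ℕ.gcd-zeroˡ n)

  inverse : ∀ {a} → Unit a → Σ ℕ λ b → a ℕ.* b ≋ 1
  inverse {a} (mkUnit ua) with ℕ.coprime-Bézout (ℕ.gcd≡1⇒coprime ua)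
  ... | ℕ.Bézout.+- x y eq = x , ≋-trans (≋-reflexive (≡.trans (ℕ.*-comm a x) (≡.sym eq))) (+-kn-≋ 1 y)
  -- Here x a ≡ -1, and the factor n′ ≡ -1 repairs the sign.
  ... | ℕ.Bézout.-+ x y eq = x ℕ.* n′ , ≋-trans (≋-sym (mk≋ (ℕ.[m+n]%n≡m%n (a ℕ.* (x ℕ.* n′)) n)))
      (≋-trans (≋-reflexive (≡.trans (lem a x n′) (≡.trans (≡.cong (λ t → 1 ℕ.+ n′ ℕ.* t) eq) (≡.cong suc (≡.sym (ℕ.*-assoc n′ y n))))))
        (+-kn-≋ 1 (n′ ℕ.* y)))
    where
    lem : ∀ a x m → a ℕ.* (x ℕ.* m) ℕ.+ (1 ℕ.+ m) ≡ 1 ℕ.+ m ℕ.* (1 ℕ.+ x ℕ.* a)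
    lem = ℕ-Solver.solve-∀

  abstract
    -- Junk value 0 on non-units.
    _⁻¹ : ℕ → ℕ
    a ⁻¹ with unit? a
    ... | yes ua = proj₁ (inverse ua) ℕ.% n
    ... | no _   = 0

    ⁻¹-inverse : ∀ {a} → Unit a → a ℕ.* a ⁻¹ ≋ 1
    ⁻¹-inverse {a} ua with unit? a
    ... | yes ua′ = ≋-trans (≋-*ˡ a (%-≋ (proj₁ (inverse ua′)))) (proj₂ (inverse ua′))
    ... | no ¬ua  = contradiction ua ¬ua

    ⁻¹-< : ∀ a → a ⁻¹ ℕ.< n
    ⁻¹-< a with unit? a
    ... | yes ua = ℕ.m%n<n (proj₁ (inverse ua)) n
    ... | no _   = s≤s z≤n

  ⁻¹-unit : ∀ {a} → Unit a → Unit (a ⁻¹)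
  ⁻¹-unit {a} ua = unit-*⁻ʳ a (a ⁻¹) (unit-≋ (≋-sym (⁻¹-inverse ua)) unit-1)

  *-undo : ∀ x y → x ℕ.* y ≋ 1 → ∀ a → x ℕ.* (y ℕ.* a) ≋ a
  *-undo x y xy≋1 a = ≋-trans (≋-reflexive (≡.sym (ℕ.*-assoc x y a)))
    (≋-trans (≋-*ʳ a xy≋1) (≋-reflexive (ℕ.*-identityˡ a)))

  ⁻¹-inverseˡ : ∀ {a} → Unit a → a ⁻¹ ℕ.* a ≋ 1
  ⁻¹-inverseˡ {a} ua = ≋-trans (≋-reflexive (ℕ.*-comm (a ⁻¹) a)) (⁻¹-inverse ua)

  *-cancel-≋ : ∀ {g a b} → Unit g → g ℕ.* a ≋ g ℕ.* b → a ≋ b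
  *-cancel-≋ {g} {a} {b} ug ga≋gb = ≋-trans (≋-sym (*-undo (g ⁻¹) g (⁻¹-inverseˡ ug) a))
    (≋-trans (≋-*ˡ (g ⁻¹) ga≋gb) (*-undo (g ⁻¹) g (⁻¹-inverseˡ ug) b))

  ⁻¹-unique : ∀ {a b} → Unit a → a ℕ.* b ≋ 1 → b ≋ a ⁻¹
  ⁻¹-unique ua ab≋1 = *-cancel-≋ ua (≋-trans ab≋1 (≋-sym (⁻¹-inverse ua)))

  ⁻¹-≋ : ∀ {a b} → Unit a → a ≋ b → a ⁻¹ ≡ b ⁻¹
  ⁻¹-≋ {a} {b} ua a≋b = ≋⇒≡ (⁻¹-unique (unit-≋ a≋b ua) (≋-trans (≋-*ʳ (a ⁻¹) (≋-sym a≋b)) (⁻¹-inverse ua))) (⁻¹-< a) (⁻¹-< b)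

  module _ {c ℓ} (R : CommutativeRing c ℓ) where
    open FiniteSum R
    open CommutativeRing R using (Carrier; _≈_)

    ∑-unit : ∀ {g} → Unit g → (f : ℕ → Carrier) → ∑ n (λ a → f (g ℕ.* a ℕ.% n)) ≈ ∑ n f
    ∑-unit {g} ug f = ∑-reindex n f (λ a → g ℕ.* a ℕ.% n) (λ a → g ⁻¹ ℕ.* a ℕ.% n)
      (λ a _ → ℕ.m%n<n (g ℕ.* a) n) (λ a _ → ℕ.m%n<n (g ⁻¹ ℕ.* a) n)
      (λ a a<n → ≋⇒≡ (undo g (g ⁻¹) (⁻¹-inverse ug) a) (ℕ.m%n<n (g ℕ.* (g ⁻¹ ℕ.* a ℕ.% n)) n) a<n)
      (λ a a<n → ≋⇒≡ (undo (g ⁻¹) g (⁻¹-inverseˡ ug) a) (ℕ.m%n<n (g ⁻¹ ℕ.* (g ℕ.* a ℕ.% n)) n) a<n)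
      where
      undo : ∀ x y → x ℕ.* y ≋ 1 → ∀ a → (x ℕ.* (y ℕ.* a ℕ.% n)) ℕ.% n ≋ a
      undo x y xy≋1 a = ≋-trans (%-≋ (x ℕ.* (y ℕ.* a ℕ.% n))) (≋-trans (≋-*ˡ x (%-≋ (y ℕ.* a))) (*-undo x y xy≋1 a))

-- Sums over multiples and over pairs with given gcd

module DivisorSums where
  open RationalInequalities

  -- Every block of d + 1 indices contains exactly one multiple, at its last place since indices are
  -- shifted by one. Vanishing beyond `N` allows the range to be completed to whole blocks.
  ∑-multiples : ∀ d N (G : ℕ → ℚ) → (∀ x → N ℕ.< x → G x ≡ 0ℚ) →
    ∑ N (λ i → 𝟙 (suc d ∣? suc i) * G (suc i)) ≡ ∑ N (λ b → G (suc d ℕ.* suc b))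
  ∑-multiples d N G G≡0 = begin
    ∑ N f                                              ≡⟨ ∑-extend (ℕ.m≤m*n N (suc d)) f (λ i N≤i _ →
                                                            ≡.trans (≡.cong (𝟙 (suc d ∣? suc i) *_) (G≡0 (suc i) (s≤s N≤i)))
                                                                (ℚ.*-zeroʳ (𝟙 (suc d ∣? suc i)))) ⟨
    ∑ (N ℕ.* suc d) f                                  ≡⟨ ∑-blocks N (suc d) f ⟩
    ∑ N (λ q → ∑ (suc d) (λ r → f (q ℕ.* suc d ℕ.+ r))) ≡⟨ ∑-cong N (λ q _ → block q) ⟩
    ∑ N (λ b → G (suc d ℕ.* suc b))                    ∎
    where
    open ≡.≡-Reasoning
    f : ℕ → ℚ
    f i = 𝟙 (suc d ∣? suc i) * G (suc i)
    top : ∀ q → suc (q ℕ.* suc d ℕ.+ d) ≡ suc d ℕ.* suc q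
    top q = lem q d
      where
      lem : ∀ q d → 1 ℕ.+ (q ℕ.* (1 ℕ.+ d) ℕ.+ d) ≡ (1 ℕ.+ d) ℕ.* (1 ℕ.+ q)
      lem = ℕ-Solver.solve-∀
    block : ∀ q → ∑ (suc d) (λ r → f (q ℕ.* suc d ℕ.+ r)) ≡ G (suc d ℕ.* suc q)
    block q = ≡.trans (∑-single (suc d) (λ r → f (q ℕ.* suc d ℕ.+ r)) (ℕ.n<1+n d) λ r r<1+d r≢d →
        ≡.trans (≡.cong (_* G (suc (q ℕ.* suc d ℕ.+ r))) (𝟙-no (suc d ∣? suc (q ℕ.* suc d ℕ.+ r)) λ 1+d∣ →
          ℕ.<⇒≱ (ℕ.≤∧≢⇒< (ℕ.≤-pred r<1+d) r≢d) (ℕ.≤-pred (ℕ.∣⇒≤ (ℕ.∣m+n∣m⇒∣n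
            (≡.subst (suc d ∣_) (≡.sym (ℕ.+-suc (q ℕ.* suc d) r)) 1+d∣) (ℕ.n∣m*n q))))))
          (ℚ.*-zeroˡ (G (suc (q ℕ.* suc d ℕ.+ r)))))
      (≡.trans (≡.cong₂ _*_ (𝟙-yes (suc d ∣? suc (q ℕ.* suc d ℕ.+ d)) (≡.subst (suc d ∣_) (≡.sym (top q)) (ℕ.m∣m*n (suc q)))) (≡.cong G (top q)))
        (ℚ.*-identityˡ _))

  -- Since `A` vanishes outside the range, the coprime quotients may again run up to `N`, and
  -- `∑-multiples` applies to each variable separately.
  ∑-by-gcd : ∀ N (A : ℕ → ℕ → ℚ) → (∀ k l → N ℕ.< k → A k (suc l) ≡ 0ℚ) → (∀ k l → N ℕ.< l → A (suc k) l ≡ 0ℚ) →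
    ∑ N (λ i → ∑ N (λ j → A (suc i) (suc j))) ≡
    ∑ N (λ d → ∑ N (λ i → ∑ N (λ j → 𝟙 (ℕ.gcd (suc i) (suc j) ℕ.≟ 1) * A (suc d ℕ.* suc i) (suc d ℕ.* suc j))))
  ∑-by-gcd N A Ak≡0 Al≡0 = begin
    ∑ N (λ i → ∑ N (λ j → A (suc i) (suc j)))
      ≡⟨ ∑-cong N (λ i i<N → ∑-cong N λ j _ → ≡.sym (sum-over-gcd i j i<N)) ⟩
    ∑ N (λ i → ∑ N (λ j → ∑ N (λ d → B d (suc i) (suc j))))
      ≡⟨ ≡.trans (∑-cong N λ i _ → ∑-swap N N _) (∑-swap N N _) ⟩
    ∑ N (λ d → ∑ N (λ i → ∑ N (λ j → B d (suc i) (suc j))))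
      ≡⟨ ∑-cong N (λ d _ → fixed d) ⟩
    _ ∎
    where
    open ≡.≡-Reasoning
    B : ℕ → ℕ → ℕ → ℚ
    B d k l = 𝟙 (ℕ.gcd k l ℕ.≟ suc d) * A k l
    sum-over-gcd : ∀ i j → i ℕ.< N → ∑ N (λ d → B d (suc i) (suc j)) ≡ A (suc i) (suc j)
    sum-over-gcd i j i<N = go (ℕ.gcd (suc i) (suc j)) refl
      where
      go : ∀ g → ℕ.gcd (suc i) (suc j) ≡ g → ∑ N (λ d → B d (suc i) (suc j)) ≡ A (suc i) (suc j)
      go zero    eq = contradiction eq (ℕ.gcd[m,n]≢0 (suc i) (suc j) (inj₁ λ ()))
      go (suc e) eq = ≡.trans (∑-cong N λ d _ → ≡.cong (_* A (suc i) (suc j))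
          (𝟙-cong (ℕ.gcd (suc i) (suc j) ℕ.≟ suc d) (d ℕ.≟ e)
            (λ p → ℕ.suc-injective (≡.trans (≡.sym p) eq)) (λ p → ≡.trans eq (≡.cong suc (≡.sym p)))))
        (∑-𝟙 N (λ _ → A (suc i) (suc j)) (ℕ.≤-trans (ℕ.≤-trans (ℕ.≤-reflexive (≡.sym eq)) (ℕ.∣⇒≤ (ℕ.gcd[m,n]∣m (suc i) (suc j)))) i<N))
    drop : ∀ {P : Set} d (k : ℕ) (D : Dec P) → (P → suc d ∣ k) → ∀ (x : ℚ) → 𝟙 D * x ≡ 𝟙 (suc d ∣? k) * (𝟙 D * x)
    drop d k (no _)  _ x = ≡.sym (≡.trans (≡.cong (𝟙 (suc d ∣? k) *_) (ℚ.*-zeroˡ x)) (≡.trans (ℚ.*-zeroʳ (𝟙 (suc d ∣? k))) (≡.sym (ℚ.*-zeroˡ x))))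
    drop d k (yes p) f x = ≡.sym (≡.trans (≡.cong (_* (1ℚ * x)) (𝟙-yes (suc d ∣? k) (f p))) (ℚ.*-identityˡ (1ℚ * x)))
    fixed : ∀ d → ∑ N (λ i → ∑ N (λ j → B d (suc i) (suc j))) ≡
      ∑ N (λ i → ∑ N (λ j → 𝟙 (ℕ.gcd (suc i) (suc j) ℕ.≟ 1) * A (suc d ℕ.* suc i) (suc d ℕ.* suc j)))
    fixed d = begin
      ∑ N (λ i → ∑ N (λ j → B d (suc i) (suc j)))
        ≡⟨ ∑-cong N (λ i _ → ≡.trans (∑-cong N λ j _ → drop d (suc j) (ℕ.gcd (suc i) (suc j) ℕ.≟ suc d)
             (λ p → ≡.subst (_∣ suc j) p (ℕ.gcd[m,n]∣n (suc i) (suc j))) (A (suc i) (suc j)))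
             (∑-multiples d N (B d (suc i)) (λ l N<l → ≡.trans (≡.cong (𝟙 (ℕ.gcd (suc i) l ℕ.≟ suc d) *_) (Al≡0 i l N<l))
                 (ℚ.*-zeroʳ (𝟙 (ℕ.gcd (suc i) l ℕ.≟ suc d)))))) ⟩
      ∑ N (λ i → ∑ N (λ j → B d (suc i) (suc d ℕ.* suc j)))
        ≡⟨ ∑-swap N N _ ⟩
      ∑ N (λ j → ∑ N (λ i → B d (suc i) (suc d ℕ.* suc j)))
        ≡⟨ ∑-cong N (λ j _ → ≡.trans (∑-cong N λ i _ → drop d (suc i) (ℕ.gcd (suc i) (suc d ℕ.* suc j) ℕ.≟ suc d)
             (λ p → ≡.subst (_∣ suc i) p (ℕ.gcd[m,n]∣m (suc i) (suc d ℕ.* suc j))) (A (suc i) (suc d ℕ.* suc j)))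
             (∑-multiples d N (λ k → B d k (suc d ℕ.* suc j))
                 (λ k N<k → ≡.trans (≡.cong (𝟙 (ℕ.gcd k (suc d ℕ.* suc j) ℕ.≟ suc d) *_) (Ak≡0 k (j ℕ.+ d ℕ.* suc j) N<k))
                 (ℚ.*-zeroʳ (𝟙 (ℕ.gcd k (suc d ℕ.* suc j) ℕ.≟ suc d)))))) ⟩
      ∑ N (λ j → ∑ N (λ i → B d (suc d ℕ.* suc i) (suc d ℕ.* suc j)))
        ≡⟨ ∑-swap N N _ ⟩
      ∑ N (λ i → ∑ N (λ j → B d (suc d ℕ.* suc i) (suc d ℕ.* suc j)))
        ≡⟨ ∑-cong N (λ i _ → ∑-cong N λ j _ → ≡.cong (_* A (suc d ℕ.* suc i) (suc d ℕ.* suc j))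
             (𝟙-cong (ℕ.gcd (suc d ℕ.* suc i) (suc d ℕ.* suc j) ℕ.≟ suc d) (ℕ.gcd (suc i) (suc j) ℕ.≟ 1)
               (λ p → ℕ.*-cancelˡ-≡ (ℕ.gcd (suc i) (suc j)) 1 (suc d) (≡.trans (scale i j) (≡.trans p (≡.sym (ℕ.*-identityʳ (suc d))))))
               (λ p → ≡.trans (≡.sym (scale i j)) (≡.trans (≡.cong (suc d ℕ.*_) p) (ℕ.*-identityʳ (suc d)))))) ⟩
      ∑ N (λ i → ∑ N (λ j → 𝟙 (ℕ.gcd (suc i) (suc j) ℕ.≟ 1) * A (suc d ℕ.* suc i) (suc d ℕ.* suc j))) ∎
      where
      scale : ∀ i j → suc d ℕ.* ℕ.gcd (suc i) (suc j) ≡ ℕ.gcd (suc d ℕ.* suc i) (suc d ℕ.* suc j)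
      scale i j = ℕ.c*gcd[m,n]≡gcd[cm,cn] (suc d) (suc i) (suc j)

  coprime-∣-* : ∀ g {k l m} → ℕ.gcd k l ≡ 1 → suc g ℕ.* k ∣ m → suc g ℕ.* l ∣ m → suc g ℕ.* (k ℕ.* l) ∣ m
  coprime-∣-* g′ {k} {l} {m} cop gk∣m (divides q eq) = ≡.subst (g ℕ.* (k ℕ.* l) ∣_) (≡.sym eq)
    (≡.subst₂ _∣_ (lem₁ g k l) (lem₂ g l q) (ℕ.*-monoʳ-∣ (g ℕ.* l) k∣q))
    where
    g = suc g′
    lem₁ : ∀ g k l → g ℕ.* l ℕ.* k ≡ g ℕ.* (k ℕ.* l)
    lem₁ = ℕ-Solver.solve-∀
    lem₂ : ∀ g l q → g ℕ.* l ℕ.* q ≡ q ℕ.* (g ℕ.* l)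
    lem₂ = ℕ-Solver.solve-∀
    k∣q : k ∣ q
    k∣q = ℕ.coprime-divisor {k} {l} (ℕ.gcd≡1⇒coprime cop) (ℕ.*-cancelˡ-∣ g (≡.subst (g ℕ.* k ∣_)
      (≡.trans eq (≡.trans (≡.sym (lem₂ g l q)) (ℕ.*-assoc g l q))) gk∣m))

-- The sum of squares and its rearrangement

module Positivity (n′ : ℕ) (F : ℕ → ℚ)
  (F-≋ : ∀ {a b} → UnitsModulo._≋_ n′ a b → F a ≡ F b)
  (F-nonunit : ∀ {a} → ¬ UnitsModulo.Unit n′ a → F a ≡ 0ℚ) where
  open RationalInequalities
  open SmoothSums
  open DivisorSums
  open UnitsModulo n′

  χ₀ : ℕ → ℚ
  χ₀ a = 𝟙 (unit? a)

  -- For k and l prime to n and F = Σ_χ c_χ χ this is a constant times Σ_χ |c_χ|² χ(k) χ̄(l): all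
  -- characters at once, without naming any.
  P : ℕ → ℕ → ℚ
  P k l = ∑ n (λ h → F (h ℕ.* k) * F (h ℕ.* l))

  -- If d is a unit, h ↦ d h permutes the residues; otherwise every summand contains F at a
  -- non-unit. The factor `χ₀ d` covers both cases.
  P-scale : ∀ d k l → P (d ℕ.* k) (d ℕ.* l) ≡ χ₀ d * P k l
  P-scale d k l with unit? d
  ... | yes ud = ≡.trans (∑-cong n λ h _ → ≡.cong₂ _*_ (F-≋ (step h k)) (F-≋ (step h l)))
      (≡.trans (∑-unit ℚ.+-*-commutativeRing ud (λ h → F (h ℕ.* k) * F (h ℕ.* l))) (≡.sym (ℚ.*-identityˡ (P k l))))
    where
    lem : ∀ h d k → h ℕ.* (d ℕ.* k) ≡ d ℕ.* h ℕ.* k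
    lem = ℕ-Solver.solve-∀
    step : ∀ h k → h ℕ.* (d ℕ.* k) ≋ (d ℕ.* h ℕ.% n) ℕ.* k
    step h k = ≋-trans (≋-reflexive (lem h d k)) (≋-*ʳ k (≋-sym (%-≋ (d ℕ.* h))))
  ... | no ¬ud = ≡.trans (∑-zero n λ h _ → ≡.trans
      (≡.cong (_* F (h ℕ.* (d ℕ.* l))) (F-nonunit λ u → ¬ud (unit-*⁻ˡ d k (unit-*⁻ʳ h (d ℕ.* k) u))))
      (ℚ.*-zeroˡ (F (h ℕ.* (d ℕ.* l))))) (≡.sym (ℚ.*-zeroˡ (P k l)))

  module _ (N : ℕ) (w : ℕ → ℚ) (w≡0 : ∀ x → N ℕ.≤ x → w x ≡ 0ℚ) where

    divisorSum : ℕ → ℕ → ℚ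
    divisorSum h m = ∑ N (λ k → 𝟙 (suc k ∣? m) * F (h ℕ.* suc k))

    -- The sum over δ = d + 1 supplies the factor L(2 s , χ₀) that the Dirichlet series of the
    -- squares lacks for being a product of four L-series; these are the four variables of
    -- `fourfold`.
    squares : ℚ
    squares = ∑ N (λ d → χ₀ (suc d) * ∑ N (λ m → w (suc d ℕ.* suc d ℕ.* suc m) *
      ∑ n (λ h → divisorSum h (suc m) * divisorSum h (suc m))))

    private
      cop : ℕ → ℕ → ℚ
      cop k l = 𝟙 (ℕ.gcd (suc k) (suc l) ℕ.≟ 1)

      -- Both sides reduce to this sum over δ, g, (k , l) coprime and b.
      normal-form : ℚ
      normal-form = ∑ N (λ d → χ₀ (suc d) * ∑ N (λ g → ∑ N (λ k → ∑ N (λ l →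
        cop k l * (χ₀ (suc g) * P (suc k) (suc l) * ∑ N (λ b → w (suc d ℕ.* suc d ℕ.* (suc g ℕ.* (suc k ℕ.* suc l) ℕ.* suc b))))))))

      square-expand : ∀ m → ∑ n (λ h → divisorSum h m * divisorSum h m) ≡
        ∑ N (λ k → ∑ N (λ l → 𝟙 (suc k ∣? m) * 𝟙 (suc l ∣? m) * P (suc k) (suc l)))
      square-expand m = begin
        ∑ n (λ h → divisorSum h m * divisorSum h m)
          ≡⟨ ∑-cong n (λ h _ → ≡.trans (≡.sym (∑-*ʳ N (divisorSum h m) _)) (∑-cong N λ k _ → ≡.sym (∑-*ˡ N (a h k) (a h)))) ⟩
        ∑ n (λ h → ∑ N (λ k → ∑ N (λ l → a h k * a h l)))
          ≡⟨ ≡.trans (∑-swap n N _) (∑-cong N λ k _ → ∑-swap n N _) ⟩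
        ∑ N (λ k → ∑ N (λ l → ∑ n (λ h → a h k * a h l)))
          ≡⟨ ∑-cong N (λ k _ → ∑-cong N λ l _ → ≡.trans (∑-cong n λ h _ → lem (𝟙 (suc k ∣? m)) (F (h ℕ.* suc k)) (𝟙 (suc l ∣? m)) (F (h ℕ.* suc l)))
               (∑-*ˡ n (𝟙 (suc k ∣? m) * 𝟙 (suc l ∣? m)) _)) ⟩
        _ ∎
        where
        open ≡.≡-Reasoning
        a : ℕ → ℕ → ℚ
        a h k = 𝟙 (suc k ∣? m) * F (h ℕ.* suc k)
        lem : ∀ x a y b → x * a * (y * b) ≡ x * y * (a * b)
        lem = solve-∀ ℚ-ring

      -- With k = g k′, l = g l′ and k′, l′ coprime, both divide m exactly when g k′ l′ does. Then m
      -- = g k′ l′ b, and `P-scale` yields χ₀(g).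
      squares-normal : squares ≡ normal-form
      squares-normal = ∑-cong N λ d _ → ≡.cong (χ₀ (suc d) *_) (inner d)
        where
        open ≡.≡-Reasoning
        inner : ∀ d → ∑ N (λ m → w (suc d ℕ.* suc d ℕ.* suc m) * ∑ n (λ h → divisorSum h (suc m) * divisorSum h (suc m))) ≡
          ∑ N (λ g → ∑ N (λ k → ∑ N (λ l →
          cop k l * (χ₀ (suc g) * P (suc k) (suc l) * ∑ N (λ b → w (suc d ℕ.* suc d ℕ.* (suc g ℕ.* (suc k ℕ.* suc l) ℕ.* suc b)))))))
        inner d = begin
          ∑ N (λ m → W (suc m) * ∑ n (λ h → divisorSum h (suc m) * divisorSum h (suc m)))
            ≡⟨ ∑-cong N (λ m _ → ≡.trans (≡.cong (W (suc m) *_) (square-expand (suc m))) (≡.trans (≡.sym (∑-*ˡ N (W (suc m)) _))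
                (∑-cong N λ k _ → ≡.sym (∑-*ˡ N (W (suc m)) _)))) ⟩
          ∑ N (λ m → ∑ N (λ k → ∑ N (λ l → W (suc m) * (𝟙 (suc k ∣? suc m) * 𝟙 (suc l ∣? suc m) * P (suc k) (suc l)))))
            ≡⟨ ≡.trans (∑-swap N N _) (∑-cong N λ k _ → ∑-swap N N _) ⟩
          ∑ N (λ k → ∑ N (λ l → ∑ N (λ m → W (suc m) * (𝟙 (suc k ∣? suc m) * 𝟙 (suc l ∣? suc m) * P (suc k) (suc l)))))
            ≡⟨ ∑-cong N (λ k _ → ∑-cong N λ l _ → ≡.trans (∑-cong N λ m _ → lem (W (suc m)) (𝟙 (suc k ∣? suc m))
                (𝟙 (suc l ∣? suc m)) (P (suc k) (suc l))) (∑-*ˡ N (P (suc k) (suc l)) _)) ⟩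
          ∑ N (λ k → ∑ N (λ l → P (suc k) (suc l) * B (suc k) (suc l)))
            ≡⟨ ∑-by-gcd N (λ k l → P k l * B k l) (λ k l N<k → ≡.trans (≡.cong (P k (suc l) *_) (B-zeroˡ k (suc l) N<k)) (ℚ.*-zeroʳ (P k (suc l))))
                 (λ k l N<l → ≡.trans (≡.cong (P (suc k) l *_) (B-zeroʳ (suc k) l N<l)) (ℚ.*-zeroʳ (P (suc k) l))) ⟩
          ∑ N (λ g → ∑ N (λ k → ∑ N (λ l → cop k l * (P (suc g ℕ.* suc k) (suc g ℕ.* suc l) * B (suc g ℕ.* suc k) (suc g ℕ.* suc l)))))
            ≡⟨ ∑-cong N (λ g _ → ∑-cong N λ k _ → ∑-cong N λ l _ → unfold g k l) ⟩
          _ ∎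
          where
          W : ℕ → ℚ
          W m = w (suc d ℕ.* suc d ℕ.* m)
          W≡0 : ∀ x → N ℕ.< x → W x ≡ 0ℚ
          W≡0 x N<x = w≡0 (suc d ℕ.* suc d ℕ.* x) (ℕ.≤-trans (ℕ.<⇒≤ N<x) (ℕ.m≤n*m x (suc d ℕ.* suc d)))
          B : ℕ → ℕ → ℚ
          B k l = ∑ N (λ m → 𝟙 (k ∣? suc m) * 𝟙 (l ∣? suc m) * W (suc m))
          lem : ∀ w x y p → w * (x * y * p) ≡ p * (x * y * w)
          lem = solve-∀ ℚ-ring
          lem₀ : ∀ y w → 0ℚ * y * w ≡ 0ℚ
          lem₀ = solve-∀ ℚ-ring
          lem₁ : ∀ y w → y * 0ℚ * w ≡ 0ℚ
          lem₁ = solve-∀ ℚ-ring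
          B-zeroˡ : ∀ k l → N ℕ.< k → B k l ≡ 0ℚ
          B-zeroˡ k l N<k = ∑-zero N λ m m<N → ≡.trans (≡.cong (λ z → z * 𝟙 (l ∣? suc m) * W (suc m))
            (𝟙-no (k ∣? suc m) λ k∣m → ℕ.<⇒≱ (ℕ.≤-<-trans m<N N<k) (ℕ.∣⇒≤ k∣m))) (lem₀ (𝟙 (l ∣? suc m)) (W (suc m)))
          B-zeroʳ : ∀ k l → N ℕ.< l → B k l ≡ 0ℚ
          B-zeroʳ k l N<l = ∑-zero N λ m m<N → ≡.trans (≡.cong (λ z → 𝟙 (k ∣? suc m) * z * W (suc m))
            (𝟙-no (l ∣? suc m) λ l∣m → ℕ.<⇒≱ (ℕ.≤-<-trans m<N N<l) (ℕ.∣⇒≤ l∣m))) (lem₁ (𝟙 (k ∣? suc m)) (W (suc m)))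
          𝟙-× : ∀ {A B C : Set} (a : Dec A) (b : Dec B) (c : Dec C) → (A → B → C) → (C → A) → (C → B) → 𝟙 a * 𝟙 b ≡ 𝟙 c
          𝟙-× (yes a) (yes b) c f _ _ = ≡.trans (ℚ.*-identityˡ 1ℚ) (≡.sym (𝟙-yes c (f a b)))
          𝟙-× (yes a) (no ¬b) c _ _ g = ≡.trans (ℚ.*-zeroʳ 1ℚ) (≡.sym (𝟙-no c (¬b ∘ g)))
          𝟙-× (no ¬a) b       c _ f _ = ≡.trans (ℚ.*-zeroˡ (𝟙 b)) (≡.sym (𝟙-no c (¬a ∘ f)))
          B-coprime : ∀ g k l → ℕ.gcd (suc k) (suc l) ≡ 1 → B (suc g ℕ.* suc k) (suc g ℕ.* suc l) ≡
            ∑ N (λ b → W (suc g ℕ.* (suc k ℕ.* suc l) ℕ.* suc b))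
          B-coprime g k l kl≡1 = ≡.trans (∑-cong N λ m _ → ≡.cong (_* W (suc m))
              (𝟙-× (suc g ℕ.* suc k ∣? suc m) (suc g ℕ.* suc l ∣? suc m) (suc g ℕ.* (suc k ℕ.* suc l) ∣? suc m)
                (coprime-∣-* g kl≡1)
                (ℕ.∣-trans (ℕ.*-monoʳ-∣ (suc g) (ℕ.m∣m*n (suc l))))
                (ℕ.∣-trans (ℕ.*-monoʳ-∣ (suc g) (ℕ.n∣m*n (suc k))))))
            (∑-multiples (l ℕ.+ k ℕ.* suc l ℕ.+ g ℕ.* suc (l ℕ.+ k ℕ.* suc l)) N W W≡0)
          unfold : ∀ g k l → cop k l * (P (suc g ℕ.* suc k) (suc g ℕ.* suc l) * B (suc g ℕ.* suc k) (suc g ℕ.* suc l)) ≡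
            cop k l * (χ₀ (suc g) * P (suc k) (suc l) * ∑ N (λ b → W (suc g ℕ.* (suc k ℕ.* suc l) ℕ.* suc b)))
          unfold g k l = by-cases (ℕ.gcd (suc k) (suc l) ℕ.≟ 1)
            where
            by-cases : (D : Dec (ℕ.gcd (suc k) (suc l) ≡ 1)) → 𝟙 D * (P (suc g ℕ.* suc k) (suc g ℕ.* suc l) * B (suc g ℕ.* suc k) (suc g ℕ.* suc l)) ≡
              𝟙 D * (χ₀ (suc g) * P (suc k) (suc l) * ∑ N (λ b → W (suc g ℕ.* (suc k ℕ.* suc l) ℕ.* suc b)))
            by-cases (no _)     = ≡.trans (ℚ.*-zeroˡ (P (suc g ℕ.* suc k) (suc g ℕ.* suc l) * B (suc g ℕ.* suc k) (suc g ℕ.* suc l)))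
              (≡.sym (ℚ.*-zeroˡ (χ₀ (suc g) * P (suc k) (suc l) * ∑ N (λ b → W (suc g ℕ.* (suc k ℕ.* suc l) ℕ.* suc b)))))
            by-cases (yes kl≡1) = ≡.cong (1ℚ *_) (≡.cong₂ _*_ (P-scale (suc g) (suc k) (suc l)) (B-coprime g k l kl≡1))

      -- Here the common divisor of k and l is δ: a (δ k′) b (δ l′) = δ² (a k′ l′ b), with χ₀(δ)
      -- from `P-scale`. The variable a, which carries χ₀ from the start, takes the place of g.
      fourfold-normal : ∑ n (λ h → fourfold (χ₀ ∘ suc) (λ j → F (h ℕ.* suc j)) (λ _ → 1ℚ) (λ j → F (h ℕ.* suc j)) w N) ≡ normal-form
      fourfold-normal = begin
        ∑ n (λ h → ∑ N (λ a → ∑ N (λ k → χ₀ (suc a) * f h k * ∑ N (λ b → ∑ N (λ l → 1ℚ * f h l * w (arg a k b l))))))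
          ≡⟨ ∑-cong n (λ h _ → ∑-cong N λ a _ → ∑-cong N λ k _ → ≡.trans (≡.sym (∑-*ˡ N (χ₀ (suc a) * f h k) _)) (∑-cong N λ b _ →
               ≡.trans (≡.sym (∑-*ˡ N (χ₀ (suc a) * f h k) _)) (∑-cong N λ l _ → lem₁ (χ₀ (suc a)) (f h k) (f h l) (w (arg a k b l))))) ⟩
        ∑ n (λ h → ∑ N (λ a → ∑ N (λ k → ∑ N (λ b → ∑ N (λ l → χ₀ (suc a) * w (arg a k b l) * (f h k * f h l))))))
          ≡⟨ ≡.trans (∑-swap n N _) (∑-cong N λ a _ → ≡.trans (∑-swap n N _) (∑-cong N λ k _ →
               ≡.trans (∑-swap n N _) (∑-cong N λ b _ → ≡.trans (∑-swap n N _) (∑-cong N λ l _ → ∑-*ˡ n (χ₀ (suc a) * w (arg a k b l)) _)))) ⟩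
        ∑ N (λ a → ∑ N (λ k → ∑ N (λ b → ∑ N (λ l → χ₀ (suc a) * w (arg a k b l) * P (suc k) (suc l)))))
          ≡⟨ ∑-cong N (λ a _ → ∑-swap N N _) ⟩
        ∑ N (λ a → ∑ N (λ b → ∑ N (λ k → ∑ N (λ l → χ₀ (suc a) * w (arg a k b l) * P (suc k) (suc l)))))
          ≡⟨ ∑-cong N (λ a _ → ∑-cong N λ b _ → by-gcd a b) ⟩
        ∑ N (λ a → ∑ N (λ b → ∑ N (λ d → ∑ N (λ k → ∑ N (λ l → t a b d k l)))))
          ≡⟨ ≡.trans (∑-cong N λ a _ → ∑-swap N N _) (∑-swap N N _) ⟩
        ∑ N (λ d → ∑ N (λ a → ∑ N (λ b → ∑ N (λ k → ∑ N (λ l → t a b d k l)))))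
          ≡⟨ ∑-cong N (λ d _ → ≡.trans (∑-cong N λ a _ → ≡.trans (∑-swap N N _) (∑-cong N λ k _ → ≡.trans (∑-swap N N _)
              (∑-cong N λ l _ → gather d a k l)))
               (pull d)) ⟩
        normal-form ∎
        where
        open ≡.≡-Reasoning
        f : ℕ → ℕ → ℚ
        f h k = F (h ℕ.* suc k)
        arg : ℕ → ℕ → ℕ → ℕ → ℕ
        arg a k b l = suc a ℕ.* suc k ℕ.* (suc b ℕ.* suc l)
        target : ℕ → ℕ → ℕ → ℕ → ℕ → ℕ
        target d a k l b = suc d ℕ.* suc d ℕ.* (suc a ℕ.* (suc k ℕ.* suc l) ℕ.* suc b)
        t : ℕ → ℕ → ℕ → ℕ → ℕ → ℚ
        t a b d k l = χ₀ (suc d) * (cop k l * (χ₀ (suc a) * P (suc k) (suc l) * w (target d a k l b)))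
        s : ℕ → ℕ → ℕ → ℕ → ℚ
        s d a k l = cop k l * (χ₀ (suc a) * P (suc k) (suc l) * ∑ N (λ b → w (target d a k l b)))
        lem₁ : ∀ c x y w → c * x * (1ℚ * y * w) ≡ c * w * (x * y)
        lem₁ = solve-∀ ℚ-ring
        lem₂ : ∀ c e w d p → c * (e * w * (d * p)) ≡ d * (c * (e * p * w))
        lem₂ = solve-∀ ℚ-ring
        rearrange : ∀ a d k b l → a ℕ.* (d ℕ.* k) ℕ.* (b ℕ.* (d ℕ.* l)) ≡ d ℕ.* d ℕ.* (a ℕ.* (k ℕ.* l) ℕ.* b)
        rearrange = ℕ-Solver.solve-∀
        by-gcd : ∀ a b → ∑ N (λ k → ∑ N (λ l → χ₀ (suc a) * w (arg a k b l) * P (suc k) (suc l))) ≡ ∑ N (λ d → ∑ N (λ k → ∑ N (λ l → t a b d k l)))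
        by-gcd a b = ≡.trans (∑-by-gcd N A (λ k l N<k → vanish k (suc l) (ℕ.≤-trans (ℕ.<⇒≤ N<k) (ℕ.≤-trans (ℕ.m≤n*m k (suc a))
            (ℕ.m≤m*n (suc a ℕ.* k) (suc b ℕ.* suc l)))))
                                           (λ k l N<l → vanish (suc k) l (ℕ.≤-trans (ℕ.<⇒≤ N<l) (ℕ.≤-trans (ℕ.m≤n*m l (suc b))
                                               (ℕ.m≤n*m (suc b ℕ.* l) (suc a ℕ.* suc k))))))
            (∑-cong N λ d _ → ∑-cong N λ k _ → ∑-cong N λ l _ →
              ≡.trans (≡.cong₂ (λ u v → cop k l * (χ₀ (suc a) * w u * v)) (rearrange (suc a) (suc d) (suc k) (suc b) (suc l))
                  (P-scale (suc d) (suc k) (suc l)))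
                (lem₂ (cop k l) (χ₀ (suc a)) (w (target d a k l b)) (χ₀ (suc d)) (P (suc k) (suc l))))
          where
          A : ℕ → ℕ → ℚ
          A k l = χ₀ (suc a) * w (suc a ℕ.* k ℕ.* (suc b ℕ.* l)) * P k l
          lem : ∀ c p → c * 0ℚ * p ≡ 0ℚ
          lem = solve-∀ ℚ-ring
          vanish : ∀ k l → N ℕ.≤ suc a ℕ.* k ℕ.* (suc b ℕ.* l) → A k l ≡ 0ℚ
          vanish k l N≤ = ≡.trans (≡.cong (λ x → χ₀ (suc a) * x * P k l) (w≡0 _ N≤)) (lem (χ₀ (suc a)) (P k l))
        gather : ∀ d a k l → ∑ N (λ b → t a b d k l) ≡ χ₀ (suc d) * s d a k l
        gather d a k l = ≡.trans (∑-*ˡ N (χ₀ (suc d)) _) (≡.cong (χ₀ (suc d) *_) (≡.trans (∑-*ˡ N (cop k l) _)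
          (≡.cong (cop k l *_) (∑-*ˡ N (χ₀ (suc a) * P (suc k) (suc l)) _))))
        pull : ∀ d → ∑ N (λ a → ∑ N (λ k → ∑ N (λ l → χ₀ (suc d) * s d a k l))) ≡ χ₀ (suc d) * ∑ N (λ a → ∑ N (λ k → ∑ N (λ l → s d a k l)))
        pull d = ≡.trans (∑-cong N λ a _ → ≡.trans (∑-cong N λ k _ → ∑-*ˡ N (χ₀ (suc d)) _) (∑-*ˡ N (χ₀ (suc d)) _)) (∑-*ˡ N (χ₀ (suc d)) _)

    squares≡fourfold : squares ≡
      ∑ n (λ h → fourfold (χ₀ ∘ suc) (λ j → F (h ℕ.* suc j)) (λ _ → 1ℚ) (λ j → F (h ℕ.* suc j)) w N)
    squares≡fourfold = ≡.trans squares-normal (≡.sym fourfold-normal)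

    private
      0≤χ₀ : ∀ a → 0ℚ ≤ χ₀ a
      0≤χ₀ a with unit? a
      ... | yes _ = 0≤1
      ... | no _  = ℚ.≤-refl

      divisorSum-1 : ∀ h → 1 ℕ.≤ N → divisorSum h 1 ≡ F h
      divisorSum-1 h 1≤N = ≡.trans (∑-single N _ 1≤N λ k _ k≢0 →
          ≡.trans (≡.cong (_* F (h ℕ.* suc k)) (𝟙-no (suc k ∣? 1) λ 1+k∣1 → k≢0 (ℕ.suc-injective (ℕ.∣1⇒≡1 1+k∣1)))) (ℚ.*-zeroˡ (F (h ℕ.* suc k))))
        (≡.trans (≡.cong₂ _*_ (𝟙-yes (1 ∣? 1) ℕ.∣-refl) (≡.cong F (ℕ.*-identityʳ h))) (ℚ.*-identityˡ (F h)))

    squares≥ : (∀ x → 0ℚ ≤ w x) → 1 ℕ.≤ N → ∀ J → J ℕ.* n ℕ.≤ N → ∀ {W} → 0ℚ ≤ W →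
      (∀ i → i ℕ.< J → W ≤ w (suc (i ℕ.* n) ℕ.* suc (i ℕ.* n))) → ι J * (W * ∑ n (λ h → F h * F h)) ≤ squares
    squares≥ 0≤w 1≤N J Jn≤N {W} 0≤W W≤w = begin
      ι J * (W * p)                               ≡⟨ ∑-const J (W * p) ⟨
      ∑ J (λ _ → W * p)                           ≤⟨ ∑-mono J (λ i i<J → term i i<J) ⟩
      -- A block of n consecutive indices is bounded below by its first term, δ = 1 + i n, since all
      -- its terms are nonnegative.
      ∑ J (λ i → T (i ℕ.* n))                     ≤⟨ ∑-mono J (λ i _ → ≡.subst (_≤ ∑ n (λ r → T (i ℕ.* n ℕ.+ r))) (≡.cong T (ℕ.+-identityʳ (i ℕ.* n)))
                                                        (∑-term≤ n (λ r → T (i ℕ.* n ℕ.+ r)) (λ r _ → 0≤T (i ℕ.* n ℕ.+ r)) (s≤s z≤n))) ⟩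
      ∑ J (λ i → ∑ n (λ r → T (i ℕ.* n ℕ.+ r)))   ≡⟨ ∑-blocks J n T ⟨
      ∑ (J ℕ.* n) T                               ≤⟨ ∑-mono-length Jn≤N T (λ d _ → 0≤T d) ⟩
      ∑ N T                                       ∎
      where
      open ℚ.≤-Reasoning
      p = ∑ n (λ h → F h * F h)
      0≤p : 0ℚ ≤ p
      0≤p = ∑-nonneg n λ h _ → 0≤p² (F h)
      S : ℕ → ℕ → ℚ
      S d m = w (suc d ℕ.* suc d ℕ.* suc m) * ∑ n (λ h → divisorSum h (suc m) * divisorSum h (suc m))
      0≤S : ∀ d m → 0ℚ ≤ S d m
      0≤S d m = 0≤p*q (0≤w (suc d ℕ.* suc d ℕ.* suc m)) (∑-nonneg n λ h _ → 0≤p² (divisorSum h (suc m)))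
      T : ℕ → ℚ
      T d = χ₀ (suc d) * ∑ N (S d)
      0≤T : ∀ d → 0ℚ ≤ T d
      0≤T d = 0≤p*q (0≤χ₀ (suc d)) (∑-nonneg N λ m _ → 0≤S d m)
      term : ∀ i → i ℕ.< J → W * p ≤ T (i ℕ.* n)
      term i i<J = begin
        W * p                 ≤⟨ *-monoʳ p 0≤p (W≤w i i<J) ⟩
        w (δ ℕ.* δ) * p       ≡⟨ ≡.cong₂ _*_ (≡.cong w (≡.sym (ℕ.*-identityʳ (δ ℕ.* δ)))) (∑-cong n λ h _ → ≡.cong₂ _*_
            (≡.sym (divisorSum-1 h 1≤N)) (≡.sym (divisorSum-1 h 1≤N))) ⟩
        S (i ℕ.* n) 0         ≤⟨ ∑-term≤ N (S (i ℕ.* n)) (λ m _ → 0≤S (i ℕ.* n) m) 1≤N ⟩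
        ∑ N (S (i ℕ.* n))     ≡⟨ ≡.trans (≡.cong (_* ∑ N (S (i ℕ.* n))) (𝟙-yes (unit? δ) (unit-≋ (≋-sym (+-kn-≋ 1 i)) unit-1)))
            (ℚ.*-identityˡ (∑ N (S (i ℕ.* n)))) ⟨
        T (i ℕ.* n)           ∎
        where δ = suc (i ℕ.* n)

-- The Archimedean property of ℚ

module Archimedean where
  open RationalInequalities

  toℚᵘ-ι : ∀ m → ℚ.toℚᵘ (ι m) ℚᵘ.≃ ℚᵘ.mkℚᵘ (ℤ.+ m) 0
  toℚᵘ-ι zero    = ℚᵘ.≃-reflexive (≡.cong ℚ.toℚᵘ ι-0)
  toℚᵘ-ι (suc m) = ℚᵘ.≃-trans (ℚᵘ.≃-reflexive (≡.cong ℚ.toℚᵘ (ι-suc m)))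
    (ℚᵘ.≃-trans (ℚ.toℚᵘ-homo-+ 1ℚ (ι m)) (ℚᵘ.≃-trans (ℚᵘ.+-congʳ ℚᵘ.1ℚᵘ (toℚᵘ-ι m))
      (ℚᵘ.*≡* (≡.cong (λ x → (ℤ.+ 1 ℤ.+ x) ℤ.* ℤ.+ 1) (ℤ.*-identityʳ (ℤ.+ m))))))

  archimedean : ∀ p → Σ ℕ λ m → p ≤ ι m
  archimedean p@(ℚ.mkℚ num den _) = ℤ.∣ num ∣ , ℚ.toℚᵘ-cancel-≤
    (ℚᵘ.≤-trans (ℚᵘ.*≤* le) (ℚᵘ.≤-reflexive (ℚᵘ.≃-sym (toℚᵘ-ι ℤ.∣ num ∣))))
    where
    below : ∀ i → i ℤ.≤ ℤ.+ ℤ.∣ i ∣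
    below (ℤ.+ m)      = ℤ.≤-refl
    below (ℤ.-[1+ m ]) = ℤ.-≤+
    le : num ℤ.* ℤ.+ 1 ℤ.≤ ℤ.+ ℤ.∣ num ∣ ℤ.* ℤ.+ suc den
    le = ℤ.≤-trans (ℤ.≤-reflexive (ℤ.*-identityʳ num)) (ℤ.≤-trans (below num)
      (ℤ.≤-trans (ℤ.+≤+ (ℕ.m≤m*n ℤ.∣ num ∣ (suc den))) (ℤ.≤-reflexive (ℤ.pos-* ℤ.∣ num ∣ (suc den)))))

  bounded-multiples : ∀ {p C} → 0ℚ < p → ¬ (∀ i → ι (suc i) * p ≤ C)
  bounded-multiples {p} {C} 0<p bound = ℚ.<-irrefl refl (ℚ.<-≤-trans lt (bound i))
    where
    r = recip p 0<p
    i = proj₁ (archimedean (C * r))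
    lem : ∀ c r p → c * r * p ≡ c * (p * r)
    lem = solve-∀ ℚ-ring
    lem₂ : ∀ a p → p + a * p ≡ (1ℚ + a) * p
    lem₂ = solve-∀ ℚ-ring
    C≤ : C ≤ ι i * p
    C≤ = ≡.subst (_≤ ι i * p) (≡.trans (lem C r p) (≡.trans (≡.cong (C *_) (recip-inverse p 0<p)) (ℚ.*-identityʳ C)))
      (*-monoʳ p (ℚ.<⇒≤ 0<p) (proj₂ (archimedean (C * r))))
    lt : C < ι (suc i) * p
    lt = ℚ.≤-<-trans C≤ (≡.subst₂ _<_ (ℚ.+-identityˡ (ι i * p)) (≡.trans (lem₂ (ι i) p) (≡.cong (_* p) (≡.sym (ι-suc i))))
      (ℚ.+-monoˡ-< (ι i * p) 0<p))

-- Lower bound against upper bound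

module Nonvanishing (n′ : ℕ) (F : ℕ → ℚ)
  (F-≋ : ∀ {a b} → UnitsModulo._≋_ n′ a b → F a ≡ F b)
  (F-nonunit : ∀ {a} → ¬ UnitsModulo.Unit n′ a → F a ≡ 0ℚ)
  (∑F≡0 : RationalInequalities.∑ (suc n′) F ≡ 0ℚ)
  (C₁ : ℚ)
  (L≡0 : ∀ h m → ℚ.∣ RationalInequalities.∑ (suc m) (λ j → F (h ℕ.* suc j) ℚ.* RationalInequalities.inv (suc j)) ∣ ℚ.≤ C₁ ℚ.* RationalInequalities.inv (suc m)) where
  open RationalInequalities
  open AbelSummation
  open HyperbolaMethod
  open FiniteDifferences
  open SmoothSums
  open UnitsModulo n′
  open Positivity n′ F F-≋ F-nonunit
  open Archimedean

  private
    Fₕ : ℕ → ℕ → ℚ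
    Fₕ h j = F (h ℕ.* suc j)

    ≋-n+ : ∀ a → n ℕ.+ a ≋ a
    ≋-n+ a = ≋-trans (≋-reflexive (≡.trans (ℕ.+-comm n a) (≡.cong (a ℕ.+_) (≡.sym (ℕ.*-identityˡ n))))) (+-kn-≋ a 1)

    F-periodic : ∀ h → Periodic n (λ k → F (h ℕ.* k))
    F-periodic h k = F-≋ (≋-*ˡ h (≋-n+ k))

    ∑Fₕ≡0 : ∀ h → ∑ n (λ k → F (h ℕ.* k)) ≡ 0ℚ
    ∑Fₕ≡0 h with unit? h
    ... | yes uh = ≡.trans (∑-cong n λ k _ → F-≋ (≋-sym (%-≋ (h ℕ.* k)))) (≡.trans (∑-unit ℚ.+-*-commutativeRing uh F) ∑F≡0)
    ... | no ¬uh = ∑-zero n λ k _ → F-nonunit λ u → ¬uh (unit-*⁻ˡ h k u)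

    ∑-shift-period : ∀ G → Periodic n G → ∑ n (λ j → G (suc j)) ≡ ∑ n G
    ∑-shift-period G per = ≡.trans (lem (G 0) (∑ n (G ∘ suc)))
      (≡.trans (≡.cong (_- G 0) (≡.sym (∑-head n G))) (≡.trans (≡.cong (λ x → ∑ n G + x - G 0)
          (≡.trans (≡.cong G (≡.sym (ℕ.+-identityʳ n))) (per 0))) (lem₂ (G 0) (∑ n G))))
      where
      lem : ∀ x y → y ≡ x + y - x
      lem = solve-∀ ℚ-ring
      lem₂ : ∀ x y → y + x - x ≡ y
      lem₂ = solve-∀ ℚ-ring

    Fₕ-periodic : ∀ h → Periodic n (Fₕ h)
    Fₕ-periodic h k = ≡.trans (≡.cong (λ x → F (h ℕ.* x)) (≡.sym (ℕ.+-suc n k))) (F-periodic h (suc k))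

    Fₕ-partial : ∀ h m → ∣ ∑ m (Fₕ h) ∣ ≤ ∑ n (λ i → ∣ Fₕ h i ∣)
    Fₕ-partial h = mean-zero-∑-bounded {n} {Fₕ h} (Fₕ-periodic h) (≡.trans (∑-shift-period (λ k → F (h ℕ.* k)) (F-periodic h)) (∑Fₕ≡0 h))

    χ₀≤1 : ∀ a → ∣ χ₀ a ∣ ≤ 1ℚ
    χ₀≤1 a with unit? a
    ... | yes _ = ℚ.≤-refl
    ... | no _  = 0≤1

    χ₀-periodic : Periodic n (χ₀ ∘ suc)
    χ₀-periodic i = 𝟙-cong (unit? (suc (n ℕ.+ i))) (unit? (suc i))
      (unit-≋ (≋-trans (≋-reflexive (≡.sym (ℕ.+-suc n i))) (≋-n+ (suc i))))
      (unit-≋ (≋-trans (≋-sym (≋-n+ (suc i))) (≋-reflexive (ℕ.+-suc n i))))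

    bounded-χ₀ : ∀ h → Σ ℚ (RieszBounded (χ₀ ∘ suc) (Fₕ h))
    bounded-χ₀ h = riesz-bound 8 n′ (χ₀ ∘ suc) (Fₕ h) χ₀-periodic (λ i → χ₀≤1 (suc i)) _ C₁ _
      (periodic-bounded {n} {Fₕ h} (Fₕ-periodic h)) (Fₕ-partial h) (L≡0 h)

    bounded-1 : ∀ h → Σ ℚ (RieszBounded (λ _ → 1ℚ) (Fₕ h))
    bounded-1 h = riesz-bound 8 n′ (λ _ → 1ℚ) (Fₕ h) (λ _ → refl) (λ _ → ℚ.≤-refl) _ C₁ _
      (periodic-bounded {n} {Fₕ h} (Fₕ-periodic h)) (Fₕ-partial h) (L≡0 h)

    E : ℕ → ℚ
    E h = proj₁ (bounded-χ₀ h) * proj₁ (bounded-1 h)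

    Etot = ∑ n E
    0≤Etot : 0ℚ ≤ Etot
    0≤Etot = ∑-nonneg n λ h _ → 0≤p*q (proj₁ (proj₂ (bounded-χ₀ h))) (proj₁ (proj₂ (bounded-1 h)))

    upper : ∀ N s → 4 ℕ.* N ℕ.< suc s ℕ.^ 3 → squares N (weight 5 N) (λ x N≤x → weight-zero 4 N≤x)
      ≤ ι (13 ℕ.* N ℕ.^ 3) * Etot * (ι (4 ℕ.* N) * ι s) * ι N * (H N * H N)
    upper N s 4N< = ℚ.≤-trans (p≤∣p∣ (squares N (weight 5 N) (λ x N≤x → weight-zero 4 N≤x)))
      (ℚ.≤-trans (ℚ.≤-reflexive (≡.cong ∣_∣ (squares≡fourfold N (weight 5 N) (λ x N≤x → weight-zero 4 N≤x))))
      (ℚ.≤-trans (∣∑∣≤ n λ h _ → fourfold-bound {χ₀ ∘ suc} {Fₕ h} {λ _ → 1ℚ} {Fₕ h} (proj₂ (bounded-χ₀ h)) (proj₂ (bounded-1 h)) N s 4N<)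
        (ℚ.≤-reflexive (≡.trans (∑-cong n λ h _ → lem A (E h) B (ι N) (H N * H N)) (≡.trans (∑-*ˡ n (A * B * ι N * (H N * H N)) E)
            (≡.sym (lem A Etot B (ι N) (H N * H N))))))))
      where
      A = ι (13 ℕ.* N ℕ.^ 3)
      B = ι (4 ℕ.* N) * ι s
      lem : ∀ a e b n h → a * e * b * n * h ≡ a * b * n * h * e
      lem = solve-∀ ℚ-ring

    p = ∑ n (λ h → F h * F h)

    cancel : ∀ {x a b} → 0ℚ < x → x * a ≤ x * b → a ≤ b
    cancel {x} 0<x = ℚ.*-cancelˡ-≤-pos x {{ℚ.positive 0<x}}

    0<ι′ : ∀ {m} → 1 ℕ.≤ m → 0ℚ < ι m
    0<ι′ (s≤s {n = m} _) = 0<ι m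

    m<2^m : ∀ m → suc m ℕ.≤ 2 ℕ.^ m
    m<2^m zero    = ℕ.≤-refl
    m<2^m (suc m) = ℕ.≤-trans (ℕ.+-mono-≤ (ℕ.m^n>0 2 m) (m<2^m m)) (ℕ.≤-reflexive (≡.cong (2 ℕ.^ m ℕ.+_) (≡.sym (ℕ.+-identityʳ (2 ℕ.^ m)))))

    -- With z = n² X², N = 6 z and s = 24 n² Y the terms δ = 1 + i n, i < X, satisfy N − δ² ≥ 5 z.
    estimate : ∀ X Y → 1 ℕ.≤ X → 1 ℕ.≤ Y → X ℕ.* X ≡ Y ℕ.* (Y ℕ.* Y) →
      let z = n ℕ.* X ℕ.* (n ℕ.* X) ; N = 6 ℕ.* z in
      ι X * p ≤ ι (13 ℕ.* 6 ℕ.^ 3 ℕ.* (4 ℕ.* 6) ℕ.* 6 ℕ.* (24 ℕ.* (n ℕ.* n))) * ι Y * Etot * (H N * H N)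
    estimate X Y 1≤X 1≤Y X²≡Y³ = cancel (0<ι′ 1≤z⁵) (ℚ.≤-trans (ℚ.≤-reflexive (lem₁ (ι (z ℕ.^ 5)) (ι X) p))
        (ℚ.≤-trans (squares≥ N (weight 5 N) (λ x N≤x → weight-zero 4 N≤x) (0≤weight 5 N) 1≤N X Xn≤N (0≤ι (z ℕ.^ 5)) big)
          (ℚ.≤-trans (upper N s 4N<s³) (ℚ.≤-reflexive eq))))
      where
      z = n ℕ.* X ℕ.* (n ℕ.* X)
      N = 6 ℕ.* z
      s = 24 ℕ.* (n ℕ.* n) ℕ.* Y
      lem₁ : ∀ z x p → z * (x * p) ≡ x * (z * p)
      lem₁ = solve-∀ ℚ-ring
      1≤nX : 1 ℕ.≤ n ℕ.* X
      1≤nX = ℕ.*-mono-≤ {1} {n} {1} {X} (s≤s z≤n) 1≤X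
      1≤z : 1 ℕ.≤ z
      1≤z = ℕ.*-mono-≤ 1≤nX 1≤nX
      1≤z⁵ : 1 ℕ.≤ z ℕ.^ 5
      1≤z⁵ = ℕ.^-monoˡ-≤ 5 1≤z
      z≤N : z ℕ.≤ N
      z≤N = ℕ.m≤n*m z 6
      1≤N = ℕ.≤-trans 1≤z z≤N
      Xn≤N : X ℕ.* n ℕ.≤ N
      Xn≤N = ℕ.≤-trans (ℕ.≤-trans (ℕ.≤-reflexive (ℕ.*-comm X n)) (ℕ.m≤m*n (n ℕ.* X) (n ℕ.* X) {{ℕ.>-nonZero 1≤nX}})) z≤N
      big : ∀ i → i ℕ.< X → ι (z ℕ.^ 5) ≤ weight 5 N (suc (i ℕ.* n) ℕ.* suc (i ℕ.* n))
      big i i<X = ι-mono (ℕ.≤-trans (^≤bin 5 z) (bin-mono 5 (ℕ.m+n≤o⇒m≤o∸n (5 ℕ.* z)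
        (ℕ.≤-trans (ℕ.+-monoʳ-≤ (5 ℕ.* z) (ℕ.*-mono-≤ δ≤ δ≤)) (ℕ.≤-reflexive (ℕ.+-comm (5 ℕ.* z) z))))))
        where
        δ≤ : suc (i ℕ.* n) ℕ.≤ n ℕ.* X
        δ≤ = ℕ.≤-trans (ℕ.≤-trans (s≤s (ℕ.m≤n+m (i ℕ.* n) n′)) (ℕ.*-monoˡ-≤ n i<X)) (ℕ.≤-reflexive (ℕ.*-comm X n))
      -- 4 N = 24 n² X² = 24 n² Y³, and 24 n² is at most its own cube.
      4N<s³ : 4 ℕ.* N ℕ.< suc s ℕ.^ 3
      4N<s³ = ℕ.≤-<-trans (ℕ.≤-trans (ℕ.≤-reflexive (≡.trans (e₁ 4 6 n X) (≡.cong (24 ℕ.* (n ℕ.* n) ℕ.*_) X²≡Y³)))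
          (ℕ.≤-trans (ℕ.*-monoˡ-≤ (Y ℕ.* (Y ℕ.* Y)) (ℕ.m≤m*n t (t ℕ.* t))) (ℕ.≤-reflexive (e₂ t Y))))
        (ℕ.^-monoˡ-< 3 (ℕ.n<1+n s))
        where
        t = 24 ℕ.* (n ℕ.* n)
        e₁ : ∀ a b n X → a ℕ.* (b ℕ.* (n ℕ.* X ℕ.* (n ℕ.* X))) ≡ a ℕ.* b ℕ.* (n ℕ.* n) ℕ.* (X ℕ.* X)
        e₁ = ℕ-Solver.solve-∀
        e₂ : ∀ t Y → t ℕ.* (t ℕ.* t) ℕ.* (Y ℕ.* (Y ℕ.* Y)) ≡ (t ℕ.* Y) ℕ.* ((t ℕ.* Y) ℕ.* ((t ℕ.* Y) ℕ.* 1))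
        e₂ = ℕ-Solver.solve-∀
      eq : ι (13 ℕ.* N ℕ.^ 3) * Etot * (ι (4 ℕ.* N) * ι s) * ι N * (H N * H N) ≡
        ι (z ℕ.^ 5) * (ι (13 ℕ.* 6 ℕ.^ 3 ℕ.* (4 ℕ.* 6) ℕ.* 6 ℕ.* (24 ℕ.* (n ℕ.* n))) * ι Y * Etot * (H N * H N))
      eq = ≡.trans (lem₂ (ι (13 ℕ.* N ℕ.^ 3)) Etot (ι (4 ℕ.* N)) (ι s) (ι N) (H N * H N))
        (≡.trans (≡.cong (_* (Etot * (H N * H N))) (≡.trans (≡.cong (λ x → ι (13 ℕ.* N ℕ.^ 3) * x * ι N) (≡.sym (ι-* (4 ℕ.* N) s)))
            (≡.trans (≡.cong (_* ι N) (≡.sym (ι-* (13 ℕ.* N ℕ.^ 3) (4 ℕ.* N ℕ.* s)))) (≡.trans (≡.sym (ι-* (13 ℕ.* N ℕ.^ 3 ℕ.* (4 ℕ.* N ℕ.* s)) N))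
            (≡.trans (≡.cong ι (e₃ 13 4 6 24 z n Y)) (≡.trans (ι-* (z ℕ.^ 5) _) (≡.cong (ι (z ℕ.^ 5) *_) (ι-* _ Y))))))))
          (lem₃ (ι (z ℕ.^ 5)) (ι (13 ℕ.* 6 ℕ.^ 3 ℕ.* (4 ℕ.* 6) ℕ.* 6 ℕ.* (24 ℕ.* (n ℕ.* n)))) (ι Y) Etot (H N * H N)))
        where
        lem₂ : ∀ a e b s n h → a * e * (b * s) * n * h ≡ a * (b * s) * n * (e * h)
        lem₂ = solve-∀ ℚ-ring
        lem₃ : ∀ z k y e h → z * (k * y) * (e * h) ≡ z * (k * y * e * h)
        lem₃ = solve-∀ ℚ-ring
        e₃ : ∀ a b c d z n Y → a ℕ.* ((c ℕ.* z) ℕ.* ((c ℕ.* z) ℕ.* ((c ℕ.* z) ℕ.* 1))) ℕ.*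
            (b ℕ.* (c ℕ.* z) ℕ.* (d ℕ.* (n ℕ.* n) ℕ.* Y)) ℕ.* (c ℕ.* z) ≡
          z ℕ.* (z ℕ.* (z ℕ.* (z ℕ.* (z ℕ.* 1)))) ℕ.* (a ℕ.* (c ℕ.* (c ℕ.* (c ℕ.* 1))) ℕ.* (b ℕ.* c) ℕ.* c ℕ.* (d ℕ.* (n ℕ.* n)) ℕ.* Y)
        e₃ = ℕ-Solver.solve-∀

    -- With t = 2^i the choice Y = t⁶ and X = t⁹ makes N^(1/3) and N^(1/2) integral up to constants.
    -- Dividing `estimate` by Y leaves t³ p ≤ const · H(N)². Now t ≥ i + 1, while N = 6 n² t¹⁸ ≤
    -- 2^(6 n² + 18 i) gives H(N) ≤ (19 + 6 n²)(i + 1), so one factor i + 1 survives on the left.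
    growth : ∀ i → ι (suc i) * p ≤ ι (13 ℕ.* 6 ℕ.^ 3 ℕ.* (4 ℕ.* 6) ℕ.* 6 ℕ.* (24 ℕ.* (n ℕ.* n))) * Etot *
      (ι (19 ℕ.+ 6 ℕ.* (n ℕ.* n)) * ι (19 ℕ.+ 6 ℕ.* (n ℕ.* n)))
    growth i = cancel (0<p*q (0<ι i) (0<ι i)) (ℚ.≤-trans (ℚ.≤-reflexive (lem₁ (ι (suc i)) p))
        (ℚ.≤-trans (*-monoʳ p 0≤p cube) (ℚ.≤-trans step
          (ℚ.≤-trans (*-monoˡ (K * Etot) (0≤p*q (0≤ι _) 0≤Etot) (*-mono (0≤H N) H≤ (0≤H N) H≤))
              (ℚ.≤-reflexive (lem₂ (K * Etot) (ι b) (ι (suc i))))))))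
      where
      K = ι (13 ℕ.* 6 ℕ.^ 3 ℕ.* (4 ℕ.* 6) ℕ.* 6 ℕ.* (24 ℕ.* (n ℕ.* n)))
      b = 19 ℕ.+ 6 ℕ.* (n ℕ.* n)
      t = 2 ℕ.^ i
      t³ = t ℕ.* (t ℕ.* t)
      Y = t³ ℕ.* t³
      X = t³ ℕ.* Y
      N = 6 ℕ.* (n ℕ.* X ℕ.* (n ℕ.* X))
      1≤t : 1 ℕ.≤ t
      1≤t = ℕ.m^n>0 2 i
      1≤t³ : 1 ℕ.≤ t³
      1≤t³ = ℕ.*-mono-≤ 1≤t (ℕ.*-mono-≤ 1≤t 1≤t)
      1≤Y : 1 ℕ.≤ Y
      1≤Y = ℕ.*-mono-≤ 1≤t³ 1≤t³
      0<p*q : ∀ {p q} → 0ℚ < p → 0ℚ < q → 0ℚ < p * q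
      0<p*q {p} {q} 0<p 0<q = ℚ.positive⁻¹ (p * q) {{ℚ.pos*pos⇒pos p {{ℚ.positive 0<p}} q {{ℚ.positive 0<q}}}}
      0≤p : 0ℚ ≤ p
      0≤p = ∑-nonneg n λ h _ → 0≤p² (F h)
      lem₁ : ∀ x p → x * x * (x * p) ≡ x * (x * x) * p
      lem₁ = solve-∀ ℚ-ring
      lem₂ : ∀ k b x → k * (b * x * (b * x)) ≡ x * x * (k * (b * b))
      lem₂ = solve-∀ ℚ-ring
      lem₃ : ∀ y x p → y * (x * p) ≡ (x * y) * p
      lem₃ = solve-∀ ℚ-ring
      lem₄ : ∀ k y e h → k * y * e * h ≡ y * (k * e * h)
      lem₄ = solve-∀ ℚ-ring
      cube : ι (suc i) * (ι (suc i) * ι (suc i)) ≤ ι t³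
      cube = ≡.subst (_≤ ι t³) (≡.trans (ι-* (suc i) (suc i ℕ.* suc i)) (≡.cong (ι (suc i) *_) (ι-* (suc i) (suc i))))
        (ι-mono (ℕ.*-mono-≤ (m<2^m i) (ℕ.*-mono-≤ (m<2^m i) (m<2^m i))))
      X²≡Y³ : X ℕ.* X ≡ Y ℕ.* (Y ℕ.* Y)
      X²≡Y³ = e t³
        where
        e : ∀ s → s ℕ.* (s ℕ.* s) ℕ.* (s ℕ.* (s ℕ.* s)) ≡ s ℕ.* s ℕ.* (s ℕ.* s ℕ.* (s ℕ.* s))
        e = ℕ-Solver.solve-∀
      step : ι t³ * p ≤ K * Etot * (H N * H N)
      step = cancel (0<ι′ 1≤Y) (ℚ.≤-trans (ℚ.≤-reflexive (≡.trans (lem₃ (ι Y) (ι t³) p) (≡.cong (_* p) (≡.sym (ι-* t³ Y)))))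
        (ℚ.≤-trans (estimate X Y (ℕ.*-mono-≤ 1≤t³ 1≤Y) 1≤Y X²≡Y³) (ℚ.≤-reflexive (lem₄ K (ι Y) Etot (H N * H N)))))
      N≤ : N ℕ.≤ 2 ℕ.^ (6 ℕ.* (n ℕ.* n) ℕ.+ 18 ℕ.* i)
      N≤ = ℕ.≤-trans (ℕ.≤-reflexive (e n t)) (ℕ.≤-trans (ℕ.*-mono-≤ (ℕ.<⇒≤ (m<2^m (6 ℕ.* (n ℕ.* n))))
          (ℕ.≤-reflexive (≡.trans (ℕ.^-*-assoc 2 i 18) (≡.cong (2 ℕ.^_) (ℕ.*-comm i 18)))))
        (ℕ.≤-reflexive (≡.sym (ℕ.^-distribˡ-+-* 2 (6 ℕ.* (n ℕ.* n)) (18 ℕ.* i)))))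
        where
        e : ∀ n t → 6 ℕ.* (n ℕ.* (t ℕ.* (t ℕ.* t) ℕ.* (t ℕ.* (t ℕ.* t) ℕ.* (t ℕ.* (t ℕ.* t)))) ℕ.*
            (n ℕ.* (t ℕ.* (t ℕ.* t) ℕ.* (t ℕ.* (t ℕ.* t) ℕ.* (t ℕ.* (t ℕ.* t))))))
          ≡ 6 ℕ.* (n ℕ.* n) ℕ.* (t ℕ.* (t ℕ.* (t ℕ.* (t ℕ.* (t ℕ.*
              (t ℕ.* (t ℕ.* (t ℕ.* (t ℕ.* (t ℕ.* (t ℕ.* (t ℕ.* (t ℕ.* (t ℕ.* (t ℕ.* (t ℕ.* (t ℕ.* (t ℕ.* 1))))))))))))))))))
        e = ℕ-Solver.solve-∀
      H≤ : H N ≤ ι b * ι (suc i)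
      H≤ = ℚ.≤-trans (∑-mono-length N≤ (λ k → inv (suc k)) (λ k _ → 0≤inv (suc k))) (ℚ.≤-trans (H-dyadic (6 ℕ.* (n ℕ.* n) ℕ.+ 18 ℕ.* i))
        (≡.subst (ι (suc (6 ℕ.* (n ℕ.* n) ℕ.+ 18 ℕ.* i)) ≤_) (ι-* b (suc i)) (ι-mono
          (ℕ.≤-trans (ℕ.m≤m+n _ (18 ℕ.+ i ℕ.+ 6 ℕ.* (n ℕ.* n) ℕ.* i)) (ℕ.≤-reflexive (e (6 ℕ.* (n ℕ.* n)) i))))))
        where
        e : ∀ a i → 1 ℕ.+ (a ℕ.+ 18 ℕ.* i) ℕ.+ (18 ℕ.+ i ℕ.+ a ℕ.* i) ≡ (19 ℕ.+ a) ℕ.* (1 ℕ.+ i)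
        e = ℕ-Solver.solve-∀

  F≡0 : ∀ h → h ℕ.< n → F h ≡ 0ℚ
  F≡0 h h<n with F h ℚ.≟ 0ℚ
  ... | yes eq = eq
  ... | no ≢0  = contradiction growth (bounded-multiples (ℚ.<-≤-trans (square-pos (F h) ≢0)
      (∑-term≤ n (λ h → F h * F h) (λ h _ → 0≤p² (F h)) h<n)))
    where
    square-pos : ∀ x → x ≢ 0ℚ → 0ℚ < x * x
    square-pos x x≢0 with ℚ.<-cmp x 0ℚ
    ... | tri< x<0 _ _ = ℚ.positive⁻¹ (x * x) {{ℚ.neg*neg⇒pos x {{ℚ.negative x<0}} x {{ℚ.negative x<0}}}}
    ... | tri≈ _ x≡0 _ = contradiction x≡0 x≢0
    ... | tri> _ _ 0<x = ℚ.positive⁻¹ (x * x) {{ℚ.pos*pos⇒pos x {{ℚ.positive 0<x}} x {{ℚ.positive 0<x}}}}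

-- Symmetric sums over the integers from -N to N

module SignedSums where
  open RationalInequalities

  open IntegerEmbedding ℚ.+-*-commutativeRing ι ι-0 ι-suc using (ιℤ; ιℤ-+)

  invℤ : ℤ → ℚ
  invℤ (ℤ.+ m)      = inv m
  invℤ (ℤ.-[1+ m ]) = - inv (suc m)

  invℤ-inverse : ∀ k → k ≢ ℤ.0ℤ → ιℤ k * invℤ k ≡ 1ℚ
  invℤ-inverse (ℤ.+ zero)   k≢0 = contradiction refl k≢0
  invℤ-inverse (ℤ.+ suc m)  _   = ι-inv m
  invℤ-inverse (ℤ.-[1+ m ]) _   = ≡.trans (lem (ι (suc m)) (inv (suc m))) (ι-inv m)
    where
    lem : ∀ x y → - x * - y ≡ x * y
    lem = solve-∀ ℚ-ring

  invℤ-neg : ∀ k → invℤ (ℤ.- k) ≡ - invℤ k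
  invℤ-neg (ℤ.+ zero)   rewrite inv-0 = refl
  invℤ-neg (ℤ.+ suc m)  = refl
  invℤ-neg (ℤ.-[1+ m ]) = lem (inv (suc m))
    where
    lem : ∀ x → x ≡ - - x
    lem = solve-∀ ℚ-ring

  -- Eisenstein's starting point: a product of reciprocals becomes linear in them, at the price of
  -- the reciprocal of the sum.
  partial-fractions : ∀ k l → k ≢ ℤ.0ℤ → l ≢ ℤ.0ℤ → k ℤ.+ l ≢ ℤ.0ℤ →
    invℤ k * invℤ l ≡ (invℤ k + invℤ l) * invℤ (k ℤ.+ l)
  partial-fractions k l k≢0 l≢0 k+l≢0 = begin
    i * j                                    ≡⟨ ℚ.*-identityʳ (i * j) ⟨
    i * j * 1ℚ                               ≡⟨ ≡.cong (i * j *_) (invℤ-inverse (k ℤ.+ l) k+l≢0) ⟨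
    i * j * (ιℤ (k ℤ.+ l) * m)               ≡⟨ ≡.cong (λ x → i * j * (x * m)) (ιℤ-+ k l) ⟩
    i * j * ((ιℤ k + ιℤ l) * m)              ≡⟨ lem i j (ιℤ k) (ιℤ l) m ⟩
    (ιℤ l * j * i + ιℤ k * i * j) * m        ≡⟨ ≡.cong₂ (λ x y → (x * i + y * j) * m) (invℤ-inverse l l≢0) (invℤ-inverse k k≢0) ⟩
    (1ℚ * i + 1ℚ * j) * m                    ≡⟨ ≡.cong₂ (λ x y → (x + y) * m) (ℚ.*-identityˡ i) (ℚ.*-identityˡ j) ⟩
    (i + j) * m                              ∎
    where
    open ≡.≡-Reasoning
    i = invℤ k
    j = invℤ l
    m = invℤ (k ℤ.+ l)
    lem : ∀ i j k l m → i * j * ((k + l) * m) ≡ (l * j * i + k * i * j) * m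
    lem = solve-∀ ℚ-ring

  ∑± : ℕ → (ℤ → ℚ) → ℚ
  ∑± N g = g ℤ.0ℤ + ∑ N (λ i → g (ℤ.+ suc i) + g (ℤ.-[1+ i ]))

  ∑±-cong : ∀ N {g h : ℤ → ℚ} → (∀ k → g k ≡ h k) → ∑± N g ≡ ∑± N h
  ∑±-cong N g≡h = ≡.cong₂ _+_ (g≡h _) (∑-cong N λ i _ → ≡.cong₂ _+_ (g≡h _) (g≡h _))

  ∑±-+ : ∀ N (g h : ℤ → ℚ) → ∑± N (λ k → g k + h k) ≡ ∑± N g + ∑± N h
  ∑±-+ N g h = ≡.trans (≡.cong (g ℤ.0ℤ + h ℤ.0ℤ +_) (≡.trans (∑-cong N λ i _ → lem₁ (g (ℤ.+ suc i)) (h (ℤ.+ suc i))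
      (g (ℤ.-[1+ i ])) (h (ℤ.-[1+ i ]))) (∑-+ N _ _)))
    (lem₁ (g ℤ.0ℤ) (h ℤ.0ℤ) (∑ N (λ i → g (ℤ.+ suc i) + g (ℤ.-[1+ i ]))) (∑ N (λ i → h (ℤ.+ suc i) + h (ℤ.-[1+ i ]))))
    where
    lem₁ : ∀ a b c d → (a + b) + (c + d) ≡ (a + c) + (b + d)
    lem₁ = solve-∀ ℚ-ring

  ∑±-*ˡ : ∀ N a (g : ℤ → ℚ) → ∑± N (λ k → a * g k) ≡ a * ∑± N g
  ∑±-*ˡ N a g = ≡.trans (≡.cong (a * g ℤ.0ℤ +_) (≡.trans (∑-cong N λ i _ → ≡.sym (ℚ.*-distribˡ-+ a (g (ℤ.+ suc i)) (g (ℤ.-[1+ i ])))) (∑-*ˡ N a _)))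
    (≡.sym (ℚ.*-distribˡ-+ a (g ℤ.0ℤ) _))

  ∑±-*ʳ : ∀ N a (g : ℤ → ℚ) → ∑± N (λ k → g k * a) ≡ ∑± N g * a
  ∑±-*ʳ N a g = ≡.trans (∑±-cong N λ k → ℚ.*-comm (g k) a) (≡.trans (∑±-*ˡ N a g) (ℚ.*-comm a (∑± N g)))

  ∑±-0 : ∀ N → ∑± N (λ _ → 0ℚ) ≡ 0ℚ
  ∑±-0 N = ≡.trans (ℚ.+-identityˡ _) (∑-zero N λ _ _ → refl)

  ∑±-∑ : ∀ N M (h : ℕ → ℤ → ℚ) → ∑± N (λ k → ∑ M (λ i → h i k)) ≡ ∑ M (λ i → ∑± N (h i))
  ∑±-∑ N zero    h = ∑±-0 N
  ∑±-∑ N (suc M) h = ≡.trans (∑±-+ N (λ k → ∑ M (λ i → h i k)) (h M)) (≡.cong (_+ ∑± N (h M)) (∑±-∑ N M h))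

  ∑±-swap : ∀ M N (h : ℤ → ℤ → ℚ) → ∑± M (λ k → ∑± N (λ l → h k l)) ≡ ∑± N (λ l → ∑± M (λ k → h k l))
  ∑±-swap M N h = ≡.trans (∑±-+ M (λ k → h k ℤ.0ℤ) (λ k → ∑ N (λ i → h k (ℤ.+ suc i) + h k (ℤ.-[1+ i ])))) (≡.cong (∑± M (λ k → h k ℤ.0ℤ) +_)
    (≡.trans (∑±-∑ M N (λ i k → h k (ℤ.+ suc i) + h k (ℤ.-[1+ i ]))) (∑-cong N λ i _ → ∑±-+ M (λ k → h k (ℤ.+ suc i)) (λ k → h k (ℤ.-[1+ i ])))))

  ∑±-neg : ∀ N (g : ℤ → ℚ) → ∑± N (λ k → g (ℤ.- k)) ≡ ∑± N g
  ∑±-neg N g = ≡.cong (g ℤ.0ℤ +_) (∑-cong N λ i _ → ℚ.+-comm (g (ℤ.-[1+ i ])) (g (ℤ.+ suc i)))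

  -- Moving the window from -N to N one place to the right takes in one point and loses one.
  ∑±-step : ∀ N (g : ℤ → ℚ) k → ∑± N (λ l → g (ℤ.suc k ℤ.+ l)) - ∑± N (λ l → g (k ℤ.+ l)) ≡
    g (k ℤ.+ ℤ.+ suc N) - g (k ℤ.+ ℤ.- (ℤ.+ N))
  ∑±-step zero g k = ≡.trans (≡.cong (λ x → g x + 0ℚ - (g (k ℤ.+ ℤ.0ℤ) + 0ℚ)) (≡.trans (ℤ.+-identityʳ (ℤ.suc k)) (ℤ.+-comm (ℤ.+ 1) k)))
    (lem (g (k ℤ.+ ℤ.+ 1)) (g (k ℤ.+ ℤ.0ℤ)))
    where
    lem : ∀ a b → a + 0ℚ - (b + 0ℚ) ≡ a - b
    lem = solve-∀ ℚ-ring
  ∑±-step (suc N) g k = ≡.trans (lem₁ (g (ℤ.suc k ℤ.+ ℤ.0ℤ)) (∑ N (λ i → g (ℤ.suc k ℤ.+ ℤ.+ suc i) + g (ℤ.suc k ℤ.+ ℤ.-[1+ i ])))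
      p q (g (k ℤ.+ ℤ.0ℤ)) (∑ N (λ i → g (k ℤ.+ ℤ.+ suc i) + g (k ℤ.+ ℤ.-[1+ i ]))) r s)
    (≡.trans (≡.cong₂ (λ x y → x + (y - (r + s))) (∑±-step N g k) (≡.cong₂ _+_ (≡.cong g e₁) (≡.cong g e₂)))
      (lem₂ r (g (k ℤ.+ ℤ.- (ℤ.+ N))) (g (k ℤ.+ ℤ.+ suc (suc N))) s))
    where
    p = g (ℤ.suc k ℤ.+ ℤ.+ suc N)
    q = g (ℤ.suc k ℤ.+ ℤ.-[1+ N ])
    r = g (k ℤ.+ ℤ.+ suc N)
    s = g (k ℤ.+ ℤ.-[1+ N ])
    e₁ : ℤ.suc k ℤ.+ ℤ.+ suc N ≡ k ℤ.+ ℤ.+ suc (suc N)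
    e₁ = lem k (ℤ.+ suc N)
      where
      lem : ∀ k m → ℤ.+ 1 ℤ.+ k ℤ.+ m ≡ k ℤ.+ (ℤ.+ 1 ℤ.+ m)
      lem = ℤ-Solver.solve-∀
    e₂ : ℤ.suc k ℤ.+ ℤ.-[1+ N ] ≡ k ℤ.+ ℤ.- (ℤ.+ N)
    e₂ = lem k (ℤ.+ N)
      where
      lem : ∀ k m → ℤ.+ 1 ℤ.+ k ℤ.+ ℤ.- (ℤ.+ 1 ℤ.+ m) ≡ k ℤ.+ ℤ.- m
      lem = ℤ-Solver.solve-∀
    lem₁ : ∀ a b p q c d r s → a + (b + (p + q)) - (c + (d + (r + s))) ≡ (a + b - (c + d)) + ((p + q) - (r + s))
    lem₁ = solve-∀ ℚ-ring
    lem₂ : ∀ r t u s → r - t + ((u + t) - (r + s)) ≡ u - s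
    lem₂ = solve-∀ ℚ-ring

-- Truncated partial fractions of the cotangent

module EisensteinSums (n′ : ℕ) where
  open RationalInequalities
  open AbelSummation
  open SignedSums

  private
    n = suc n′

  Div : ℤ → Set
  Div z = ℤ.+ n ℤ∣.∣ z

  div? : ∀ z → Dec (Div z)
  div? z = ℤ.+ n ℤ∣.∣? z

  div-+ : ∀ {x y} → Div x → Div y → Div (x ℤ.+ y)
  div-+ = ℤ∣.∣m∣n⇒∣m+n

  div-neg : ∀ {x} → Div x → Div (ℤ.- x)
  div-neg = ℤ∣.∣m⇒∣-m

  div-≡ : ∀ {x y} → x ≡ y → Div x → Div y
  div-≡ refl d = d

  δ : ℤ → ℚ
  δ z = 𝟙 (div? z)

  δ-cong : ∀ {x y} → (Div x → Div y) → (Div y → Div x) → δ x ≡ δ y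
  δ-cong {x} {y} = 𝟙-cong (div? x) (div? y)

  δ-neg : ∀ z → δ (ℤ.- z) ≡ δ z
  δ-neg z = δ-cong (λ d → div-≡ (ℤ.neg-involutive z) (div-neg d)) div-neg

  0≤δ : ∀ z → 0ℚ ≤ δ z
  0≤δ z with div? z
  ... | yes _ = 0≤1
  ... | no _  = ℚ.≤-refl

  δ≤1 : ∀ z → δ z ≤ 1ℚ
  δ≤1 z with div? z
  ... | yes _ = ℚ.≤-refl
  ... | no _  = 0≤1

  term : ℤ → ℤ → ℚ
  term r k = δ (k ℤ.- r) * invℤ k

  -- The symmetric truncation of Σ_{k ≡ r mod n} 1/k = (π/n) cot(π r / n).
  T : ℕ → ℤ → ℚ
  T N r = ∑± N (term r)

  term-neg : ∀ r k → term (ℤ.- r) (ℤ.- k) ≡ - term r k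
  term-neg r k = ≡.trans (≡.cong₂ _*_ (≡.trans (≡.cong δ (lem k r)) (δ-neg (k ℤ.- r))) (invℤ-neg k)) (≡.sym (ℚ.neg-distribʳ-* (δ (k ℤ.- r)) (invℤ k)))
    where
    lem : ∀ k r → ℤ.- k ℤ.+ ℤ.- (ℤ.- r) ≡ ℤ.- (k ℤ.+ ℤ.- r)
    lem = ℤ-Solver.solve-∀

  T-odd : ∀ N r → T N (ℤ.- r) ≡ - T N r
  T-odd N r = ≡.trans (≡.sym (∑±-neg N (term (ℤ.- r)))) (≡.trans (∑±-cong N λ k → ≡.trans (term-neg r k) (lem (term r k)))
    (≡.trans (∑±-*ˡ N (- 1ℚ) (term r)) (≡.sym (lem (T N r)))))
    where
    lem : ∀ x → - x ≡ - 1ℚ * x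
    lem = solve-∀ ℚ-ring

  T-periodic : ∀ N {r s} → Div (r ℤ.- s) → T N r ≡ T N s
  T-periodic N {r} {s} r≡s = ∑±-cong N λ k → ≡.cong (_* invℤ k) (δ-cong
      (λ d → div-≡ (lem₁ k r s) (div-+ d r≡s)) (λ d → div-≡ (lem₂ k r s) (div-+ d (div-neg r≡s))))
    where
    lem₁ : ∀ k r s → (k ℤ.+ ℤ.- r) ℤ.+ (r ℤ.+ ℤ.- s) ≡ k ℤ.+ ℤ.- s
    lem₁ = ℤ-Solver.solve-∀
    lem₂ : ∀ k r s → (k ℤ.+ ℤ.- s) ℤ.+ ℤ.- (r ℤ.+ ℤ.- s) ≡ k ℤ.+ ℤ.- r
    lem₂ = ℤ-Solver.solve-∀

  -- Of the congruences k ≡ r, l ≡ s and k + l ≡ r + s any two imply the third, so both sides vanish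
  -- unless all three hold. The hypotheses on r, s and r + s keep the three denominators away from
  -- 0.
  term-product : ∀ {r s} → ¬ Div r → ¬ Div s → ¬ Div (r ℤ.+ s) → ∀ k l →
    term r k * term s l ≡ (term r k + term s l) * term (r ℤ.+ s) (k ℤ.+ l)
  term-product {r} {s} r≢0 s≢0 r+s≢0 k l = cases (div? (k ℤ.- r)) (div? (l ℤ.- s)) (div? (k ℤ.+ l ℤ.- (r ℤ.+ s)))
    where
    sum : ∀ k l r s → (k ℤ.+ ℤ.- r) ℤ.+ (l ℤ.+ ℤ.- s) ≡ k ℤ.+ l ℤ.+ ℤ.- (r ℤ.+ s)
    sum = ℤ-Solver.solve-∀
    diffˡ : ∀ k l r s → (k ℤ.+ l ℤ.+ ℤ.- (r ℤ.+ s)) ℤ.+ ℤ.- (k ℤ.+ ℤ.- r) ≡ l ℤ.+ ℤ.- s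
    diffˡ = ℤ-Solver.solve-∀
    diffʳ : ∀ k l r s → (k ℤ.+ l ℤ.+ ℤ.- (r ℤ.+ s)) ℤ.+ ℤ.- (l ℤ.+ ℤ.- s) ≡ k ℤ.+ ℤ.- r
    diffʳ = ℤ-Solver.solve-∀
    nonzero : ∀ {k r} → ¬ Div r → Div (k ℤ.- r) → k ≢ ℤ.0ℤ
    nonzero {r = r} r≢0 d refl = r≢0 (div-≡ (lem r) (div-neg d))
      where
      lem : ∀ r → ℤ.- (ℤ.0ℤ ℤ.+ ℤ.- r) ≡ r
      lem = ℤ-Solver.solve-∀
    cases : ∀ (a : Dec (Div (k ℤ.- r))) (b : Dec (Div (l ℤ.- s))) (c : Dec (Div (k ℤ.+ l ℤ.- (r ℤ.+ s)))) →
      𝟙 a * invℤ k * (𝟙 b * invℤ l) ≡ (𝟙 a * invℤ k + 𝟙 b * invℤ l) * (𝟙 c * invℤ (k ℤ.+ l))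
    cases (yes a) (yes b) (yes c) = ≡.trans (lem₁ (invℤ k) (invℤ l))
        (≡.trans (partial-fractions k l (nonzero {k} {r} r≢0 a) (nonzero {l} {s} s≢0 b) (nonzero {k ℤ.+ l} {r ℤ.+ s} r+s≢0 c))
            (≡.sym (lem₂ (invℤ k) (invℤ l) (invℤ (k ℤ.+ l)))))
      where
      lem₁ : ∀ x y → 1ℚ * x * (1ℚ * y) ≡ x * y
      lem₁ = solve-∀ ℚ-ring
      lem₂ : ∀ x y z → (1ℚ * x + 1ℚ * y) * (1ℚ * z) ≡ (x + y) * z
      lem₂ = solve-∀ ℚ-ring
    cases (yes a) (yes b) (no ¬c) = contradiction (div-≡ (sum k l r s) (div-+ a b)) ¬c
    cases (yes a) (no ¬b) (yes c) = contradiction (div-≡ (diffˡ k l r s) (div-+ c (div-neg a))) ¬b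
    cases (yes a) (no ¬b) (no ¬c) = lem (invℤ k) (invℤ l) (invℤ (k ℤ.+ l))
      where
      lem : ∀ x y z → 1ℚ * x * (0ℚ * y) ≡ (1ℚ * x + 0ℚ * y) * (0ℚ * z)
      lem = solve-∀ ℚ-ring
    cases (no ¬a) (yes b) (yes c) = contradiction (div-≡ (diffʳ k l r s) (div-+ c (div-neg b))) ¬a
    cases (no ¬a) (yes b) (no ¬c) = lem (invℤ k) (invℤ l) (invℤ (k ℤ.+ l))
      where
      lem : ∀ x y z → 0ℚ * x * (1ℚ * y) ≡ (0ℚ * x + 1ℚ * y) * (0ℚ * z)
      lem = solve-∀ ℚ-ring
    cases (no ¬a) (no ¬b) c       = lem (invℤ k) (invℤ l) (𝟙 c * invℤ (k ℤ.+ l))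
      where
      lem : ∀ x y z → 0ℚ * x * (0ℚ * y) ≡ (0ℚ * x + 0ℚ * y) * z
      lem = solve-∀ ℚ-ring

  -- The error of translating the summation window by k. In `addition-defect` these errors, weighted
  -- by 1/k, are all that separates the truncated sums from T(r) T(s) = T(r + s)(T(r) + T(s)).
  V : ℕ → ℤ → ℤ → ℚ
  V N c k = ∑± N (λ l → term c (k ℤ.+ l)) - T N c

  addition-defect : ∀ N {r s} → ¬ Div r → ¬ Div s → ¬ Div (r ℤ.+ s) →
    T N r * T N s - T N (r ℤ.+ s) * (T N r + T N s) ≡
    ∑± N (λ k → term r k * V N (r ℤ.+ s) k) + ∑± N (λ l → term s l * V N (r ℤ.+ s) l)
  addition-defect N {r} {s} r≢0 s≢0 r+s≢0 = ≡.trans (≡.cong (_- Tc * (T N r + T N s)) expand)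
      (≡.trans (lem (T N r) (T N s) Tc _ _) refl)
    where
    open ≡.≡-Reasoning
    c = r ℤ.+ s
    Tc = T N c
    lem : ∀ x y t a b → (x * t + a) + (y * t + b) - t * (x + y) ≡ a + b
    lem = solve-∀ ℚ-ring
    half : ∀ (q : ℤ → ℚ) → ∑± N (λ k → ∑± N (λ l → q k * term c (k ℤ.+ l))) ≡ ∑± N q * Tc + ∑± N (λ k → q k * V N c k)
    half q = begin
      ∑± N (λ k → ∑± N (λ l → q k * term c (k ℤ.+ l)))
        ≡⟨ ∑±-cong N (λ k → ≡.trans (∑±-*ˡ N (q k) (λ l → term c (k ℤ.+ l))) (split (q k) (∑± N (λ l → term c (k ℤ.+ l))) Tc)) ⟩
      ∑± N (λ k → q k * Tc + q k * V N c k)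
        ≡⟨ ∑±-+ N (λ k → q k * Tc) (λ k → q k * V N c k) ⟩
      ∑± N (λ k → q k * Tc) + ∑± N (λ k → q k * V N c k)
        ≡⟨ ≡.cong (_+ ∑± N (λ k → q k * V N c k)) (∑±-*ʳ N Tc q) ⟩
      ∑± N q * Tc + ∑± N (λ k → q k * V N c k) ∎
      where
      split : ∀ q u t → q * u ≡ q * t + q * (u - t)
      split = solve-∀ ℚ-ring
    expand : T N r * T N s ≡ (T N r * Tc + ∑± N (λ k → term r k * V N c k)) + (T N s * Tc + ∑± N (λ l → term s l * V N c l))
    expand = begin
      T N r * T N s
        ≡⟨ ∑±-*ʳ N (T N s) (term r) ⟨
      ∑± N (λ k → term r k * T N s)
        ≡⟨ ∑±-cong N (λ k → ≡.sym (∑±-*ˡ N (term r k) (term s))) ⟩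
      ∑± N (λ k → ∑± N (λ l → term r k * term s l))
        ≡⟨ ∑±-cong N (λ k → ≡.trans (∑±-cong N λ l → ≡.trans (term-product r≢0 s≢0 r+s≢0 k l) (ℚ.*-distribʳ-+ (term c (k ℤ.+ l))
            (term r k) (term s l)))
             (∑±-+ N (λ l → term r k * term c (k ℤ.+ l)) (λ l → term s l * term c (k ℤ.+ l)))) ⟩
      ∑± N (λ k → ∑± N (λ l → term r k * term c (k ℤ.+ l)) + ∑± N (λ l → term s l * term c (k ℤ.+ l)))
        ≡⟨ ∑±-+ N (λ k → ∑± N (λ l → term r k * term c (k ℤ.+ l))) (λ k → ∑± N (λ l → term s l * term c (k ℤ.+ l))) ⟩
      ∑± N (λ k → ∑± N (λ l → term r k * term c (k ℤ.+ l))) + ∑± N (λ k → ∑± N (λ l → term s l * term c (k ℤ.+ l)))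
        ≡⟨ ≡.cong₂ _+_ (half (term r)) (≡.trans (∑±-swap N N (λ k l → term s l * term c (k ℤ.+ l)))
             (≡.trans (∑±-cong N λ l → ∑±-cong N λ k → ≡.cong (λ z → term s l * term c z) (ℤ.+-comm k l)) (half (term s)))) ⟩
      _ ∎

  V-neg : ∀ N c k → V N c (ℤ.- k) ≡ - V N (ℤ.- c) k
  V-neg N c k = begin
    ∑± N (λ l → term c (ℤ.- k ℤ.+ l)) - T N c
      ≡⟨ ≡.cong (_- T N c) (≡.sym (∑±-neg N (λ l → term c (ℤ.- k ℤ.+ l)))) ⟩
    ∑± N (λ l → term c (ℤ.- k ℤ.+ ℤ.- l)) - T N c
      ≡⟨ ≡.cong₂ _-_ (∑±-cong N λ l → ≡.trans (≡.cong (term c) (≡.sym (ℤ.neg-distrib-+ k l)))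
           (≡.trans (≡.cong (λ z → term z (ℤ.- (k ℤ.+ l))) (≡.sym (ℤ.neg-involutive c))) (≡.trans (term-neg (ℤ.- c) (k ℤ.+ l))
               (lem₁ (term (ℤ.- c) (k ℤ.+ l))))))
           (≡.trans (≡.cong (T N) (≡.sym (ℤ.neg-involutive c))) (T-odd N (ℤ.- c))) ⟩
    ∑± N (λ l → - 1ℚ * term (ℤ.- c) (k ℤ.+ l)) - - T N (ℤ.- c)
      ≡⟨ ≡.cong (_- - T N (ℤ.- c)) (∑±-*ˡ N (- 1ℚ) (λ l → term (ℤ.- c) (k ℤ.+ l))) ⟩
    - 1ℚ * ∑± N (λ l → term (ℤ.- c) (k ℤ.+ l)) - - T N (ℤ.- c)
      ≡⟨ lem₂ (∑± N (λ l → term (ℤ.- c) (k ℤ.+ l))) (T N (ℤ.- c)) ⟩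
    - V N (ℤ.- c) k ∎
    where
    open ≡.≡-Reasoning
    lem₁ : ∀ x → - x ≡ - 1ℚ * x
    lem₁ = solve-∀ ℚ-ring
    lem₂ : ∀ x y → - 1ℚ * x - - y ≡ - (x - y)
    lem₂ = solve-∀ ℚ-ring

  V-telescope : ∀ N c m → V N c (ℤ.+ m) ≡ ∑ m (λ i → term c (ℤ.+ i ℤ.+ ℤ.+ suc N) - term c (ℤ.+ i ℤ.+ ℤ.- (ℤ.+ N)))
  V-telescope N c zero    = ≡.trans (≡.cong (_- T N c) (∑±-cong N λ l → ≡.cong (term c) (ℤ.+-identityˡ l))) (ℚ.+-inverseʳ (T N c))
  V-telescope N c (suc m) = ≡.trans (lem (∑± N (λ l → term c (ℤ.+ suc m ℤ.+ l))) (∑± N (λ l → term c (ℤ.+ m ℤ.+ l))) (T N c))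
    (≡.cong₂ _+_ (V-telescope N c m) (∑±-step N (term c) (ℤ.+ m)))
    where
    lem : ∀ x y t → x - t ≡ (y - t) + (x - y)
    lem = solve-∀ ℚ-ring

  θ : ℤ → ℕ → ℚ
  θ t i = δ (ℤ.+ i ℤ.+ t)

  -- Sizes of the term that enters at the right end and of the term that leaves at the left end when
  -- the window moves from i to i + 1. The left one is negative and is lost, so both contribute
  -- positively.
  g₁ g₂ : ℕ → ℕ → ℚ
  g₁ N i = inv (suc (N ℕ.+ i))
  g₂ N i = inv (N ℕ.∸ i)

  V-explicit : ∀ N c m → m ℕ.≤ N → V N c (ℤ.+ m) ≡
    ∑ m (λ i → θ (ℤ.+ suc N ℤ.- c) i * g₁ N i) + ∑ m (λ i → θ (ℤ.- (ℤ.+ N) ℤ.- c) i * g₂ N i)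
  V-explicit N c m m≤N = ≡.trans (V-telescope N c m) (≡.trans (∑-cong m λ i i<m → ≡.cong₂ _-_ (right i) (left i (ℕ.<-≤-trans i<m m≤N)))
      (≡.trans (∑-cong m λ i _ → lem (θ (ℤ.+ suc N ℤ.- c) i * g₁ N i) (θ (ℤ.- (ℤ.+ N) ℤ.- c) i) (g₂ N i)) (∑-+ m _ _)))
    where
    lem : ∀ x y z → x - y * - z ≡ x + y * z
    lem = solve-∀ ℚ-ring
    assoc : ∀ i a c → i ℤ.+ a ℤ.+ ℤ.- c ≡ i ℤ.+ (a ℤ.+ ℤ.- c)
    assoc = ℤ-Solver.solve-∀
    right : ∀ i → term c (ℤ.+ i ℤ.+ ℤ.+ suc N) ≡ θ (ℤ.+ suc N ℤ.- c) i * g₁ N i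
    right i = ≡.cong₂ _*_ (≡.cong δ (assoc (ℤ.+ i) (ℤ.+ suc N) c)) (≡.cong inv (≡.trans (ℕ.+-suc i N) (≡.cong suc (ℕ.+-comm i N))))
    left : ∀ i → i ℕ.< N → term c (ℤ.+ i ℤ.+ ℤ.- (ℤ.+ N)) ≡ θ (ℤ.- (ℤ.+ N) ℤ.- c) i * - g₂ N i
    left i i<N = ≡.cong₂ _*_ (≡.cong δ (assoc (ℤ.+ i) (ℤ.- (ℤ.+ N)) c))
      (≡.trans (≡.cong invℤ (≡.trans (ℤ.m-n≡m⊖n i N) (ℤ.⊖-≤ (ℕ.<⇒≤ i<N)))) (invℤ-neg (ℤ.+ (N ℕ.∸ i))))

  X : ℕ → ℤ → ℤ → (ℕ → ℚ) → ℚ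
  X N t u g = ∑ N (λ m → θ t (suc m) * inv (suc m) * ∑ (suc m) (λ i → θ u i * g i))

  -- The double sum `X` without its two congruence conditions. Each of them has density 1/n, so n²
  -- `X` is close to `X₀`, whatever the residues are.
  X₀ : ℕ → (ℕ → ℚ) → ℚ
  X₀ N g = ∑ N (λ m → inv (suc m) * ∑ (suc m) g)

  -- Positive k use `V-explicit` with its two ends; negative k are reflected by `V-neg`, which
  -- changes the signs of r and c.
  ∑±-term-V : ∀ N r c → ∑± N (λ k → term r k * V N c k) ≡
    (X N (ℤ.- r) (ℤ.+ suc N ℤ.- c) (g₁ N) + X N (ℤ.- r) (ℤ.- (ℤ.+ N) ℤ.- c) (g₂ N)) +
    (X N r (ℤ.+ suc N ℤ.- ℤ.- c) (g₁ N) + X N r (ℤ.- (ℤ.+ N) ℤ.- ℤ.- c) (g₂ N))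
  ∑±-term-V N r c = begin
    term r ℤ.0ℤ * V N c ℤ.0ℤ + ∑ N (λ i → term r (ℤ.+ suc i) * V N c (ℤ.+ suc i) + term r (ℤ.-[1+ i ]) * V N c (ℤ.-[1+ i ]))
      ≡⟨ ≡.cong₂ _+_ zero-term (∑-cong N λ i i<N → ≡.cong₂ _+_ (piece r c i i<N) (≡.trans (flip i) (piece′ i i<N))) ⟩
    0ℚ + ∑ N (λ i → (x (ℤ.- r) (ℤ.+ suc N ℤ.- c) (g₁ N) i + x (ℤ.- r) (ℤ.- (ℤ.+ N) ℤ.- c) (g₂ N) i) +
                     (x r (ℤ.+ suc N ℤ.- ℤ.- c) (g₁ N) i + x r (ℤ.- (ℤ.+ N) ℤ.- ℤ.- c) (g₂ N) i))
      ≡⟨ ≡.trans (ℚ.+-identityˡ _) (≡.trans (∑-+ N _ _) (≡.cong₂ _+_ (∑-+ N _ _) (∑-+ N _ _))) ⟩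
    _ ∎
    where
    open ≡.≡-Reasoning
    x : ℤ → ℤ → (ℕ → ℚ) → ℕ → ℚ
    x t u g m = θ t (suc m) * inv (suc m) * ∑ (suc m) (λ i → θ u i * g i)
    lem₀ : ∀ x y → x * 0ℚ * y ≡ 0ℚ
    lem₀ = solve-∀ ℚ-ring
    zero-term : term r ℤ.0ℤ * V N c ℤ.0ℤ ≡ 0ℚ
    zero-term = ≡.trans (≡.cong (λ y → δ (ℤ.0ℤ ℤ.- r) * y * V N c ℤ.0ℤ) inv-0) (lem₀ (δ (ℤ.0ℤ ℤ.- r)) (V N c ℤ.0ℤ))
    piece : ∀ r c i → i ℕ.< N → term r (ℤ.+ suc i) * V N c (ℤ.+ suc i) ≡
      x (ℤ.- r) (ℤ.+ suc N ℤ.- c) (g₁ N) i + x (ℤ.- r) (ℤ.- (ℤ.+ N) ℤ.- c) (g₂ N) i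
    piece r c i i<N = ≡.trans (≡.cong (term r (ℤ.+ suc i) *_) (V-explicit N c (suc i) i<N)) (ℚ.*-distribˡ-+ (term r (ℤ.+ suc i)) _ _)
    piece′ : ∀ i → i ℕ.< N → term (ℤ.- r) (ℤ.+ suc i) * V N (ℤ.- c) (ℤ.+ suc i) ≡
      x r (ℤ.+ suc N ℤ.- ℤ.- c) (g₁ N) i + x r (ℤ.- (ℤ.+ N) ℤ.- ℤ.- c) (g₂ N) i
    piece′ i i<N = ≡.trans (piece (ℤ.- r) (ℤ.- c) i i<N) (≡.cong (λ z → x z (ℤ.+ suc N ℤ.- ℤ.- c) (g₁ N) i + x z
        (ℤ.- (ℤ.+ N) ℤ.- ℤ.- c) (g₂ N) i) (ℤ.neg-involutive r))
    lem₁ : ∀ x y → - x * - y ≡ x * y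
    lem₁ = solve-∀ ℚ-ring
    flip : ∀ i → term r (ℤ.-[1+ i ]) * V N c (ℤ.-[1+ i ]) ≡ term (ℤ.- r) (ℤ.+ suc i) * V N (ℤ.- c) (ℤ.+ suc i)
    flip i = ≡.trans (≡.cong₂ _*_ (≡.trans (≡.cong (λ z → term z (ℤ.-[1+ i ])) (≡.sym (ℤ.neg-involutive r)))
        (term-neg (ℤ.- r) (ℤ.+ suc i))) (V-neg N c (ℤ.+ suc i)))
      (lem₁ (term (ℤ.- r) (ℤ.+ suc i)) (V N (ℤ.- c) (ℤ.+ suc i)))

-- Removing the congruence conditions

module Equidistribution (n′ : ℕ) where
  open RationalInequalities
  open AbelSummation
  open SignedSums
  open EisensteinSums n′

  private
    n = suc n′
    ν = ι n

  θ-periodic : ∀ t → Periodic n (θ t)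
  θ-periodic t i = δ-cong
    (λ d → div-≡ (lem₁ (ℤ.+ n) (ℤ.+ i) t) (div-+ d (div-neg ℤ∣.∣-refl)))
    (λ d → div-≡ (lem₂ (ℤ.+ n) (ℤ.+ i) t) (div-+ d ℤ∣.∣-refl))
    where
    lem₁ : ∀ n i t → (n ℤ.+ i ℤ.+ t) ℤ.+ ℤ.- n ≡ i ℤ.+ t
    lem₁ = ℤ-Solver.solve-∀
    lem₂ : ∀ n i t → (i ℤ.+ t) ℤ.+ n ≡ n ℤ.+ i ℤ.+ t
    lem₂ = ℤ-Solver.solve-∀

  ∑-θ : ∀ t → ∑ n (θ t) ≡ 1ℚ
  ∑-θ t = ≡.trans (∑-single n (θ t) (ℤ.n%ℕd<d (ℤ.- t) n) λ i i<n i≢j → 𝟙-no (div? (ℤ.+ i ℤ.+ t)) λ d → i≢j (unique i i<n d))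
    (𝟙-yes (div? (ℤ.+ j ℤ.+ t)) divides-j)
    where
    j = ℤ.- t ℤ.%ℕ n
    q = ℤ.- t ℤ./ℕ n
    divides-j : Div (ℤ.+ j ℤ.+ t)
    divides-j = ℤ∣.divides (ℤ.- q) (≡.trans (lem₁ (ℤ.+ j) t (q ℤ.* ℤ.+ n)) (≡.trans (≡.cong (λ z → z ℤ.+ t ℤ.+ ℤ.- (q ℤ.* ℤ.+ n))
        (≡.sym (ℤ.a≡a%ℕn+[a/ℕn]*n (ℤ.- t) n))) (lem₂ t q (ℤ.+ n))))
      where
      lem₁ : ∀ j t x → j ℤ.+ t ≡ (j ℤ.+ x) ℤ.+ t ℤ.+ ℤ.- x
      lem₁ = ℤ-Solver.solve-∀
      lem₂ : ∀ t q n → ℤ.- t ℤ.+ t ℤ.+ ℤ.- (q ℤ.* n) ≡ ℤ.- q ℤ.* n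
      lem₂ = ℤ-Solver.solve-∀
    small : ∀ a b → a ℕ.< n → b ℕ.≤ a → Div (ℤ.+ a ℤ.+ ℤ.- (ℤ.+ b)) → a ≡ b
    small a b a<n b≤a d with a ℕ.∸ b in eq | ℤ∣.∣⇒∣ᵤ (div-≡ (≡.trans (ℤ.m-n≡m⊖n a b) (ℤ.⊖-≥ b≤a)) d)
    ... | zero  | _   = ℕ.≤-antisym (ℕ.m∸n≡0⇒m≤n eq) b≤a
    ... | suc c | n∣c = contradiction (ℕ.≤-trans (ℕ.∣⇒≤ n∣c) (ℕ.≤-trans (ℕ.≤-reflexive (≡.sym eq)) (ℕ.m∸n≤m a b))) (ℕ.<⇒≱ a<n)
    diff : ∀ i j t → (i ℤ.+ t) ℤ.+ ℤ.- (j ℤ.+ t) ≡ i ℤ.+ ℤ.- j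
    diff = ℤ-Solver.solve-∀
    unique : ∀ i → i ℕ.< n → Div (ℤ.+ i ℤ.+ t) → i ≡ j
    unique i i<n d with ℕ.≤-total j i
    ... | inj₁ j≤i = small i j i<n j≤i (div-≡ (diff (ℤ.+ i) (ℤ.+ j) t) (div-+ d (div-neg divides-j)))
    ... | inj₂ i≤j = ≡.sym (small j i (ℤ.n%ℕd<d (ℤ.- t) n) i≤j (div-≡ (diff (ℤ.+ j) (ℤ.+ i) t) (div-+ divides-j (div-neg d))))

  -- n times the deviation of the indicator from its density 1/n. It has mean zero over a period and
  -- therefore bounded partial sums.
  β : ℤ → ℕ → ℚ
  β t i = ν * θ t i - 1ℚ

  β-periodic : ∀ t → Periodic n (β t)
  β-periodic t i = ≡.cong (λ x → ν * x - 1ℚ) (θ-periodic t i)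

  ∣νθ∣≤ν : ∀ t i → ∣ ν * θ t i ∣ ≤ ν
  ∣νθ∣≤ν t i = 0≤p≤a⇒∣p∣≤a (0≤p*q (0≤ι n) (0≤δ (ℤ.+ i ℤ.+ t)))
    (≡.subst (ν * θ t i ≤_) (ℚ.*-identityʳ ν) (*-monoˡ ν (0≤ι n) (δ≤1 (ℤ.+ i ℤ.+ t))))

  ∣β∣≤ : ∀ t i → ∣ β t i ∣ ≤ ν + 1ℚ
  ∣β∣≤ t i = ∣-∣≤ {ν * θ t i} {1ℚ} (∣νθ∣≤ν t i) ℚ.≤-refl

  ∑-β : ∀ t → ∑ n (β t) ≡ 0ℚ
  ∑-β t = ≡.trans (∑-+ n _ _) (≡.trans (≡.cong₂ _+_ (≡.trans (∑-*ˡ n ν (θ t)) (≡.trans (≡.cong (ν *_) (∑-θ t)) (ℚ.*-identityʳ ν)))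
      (∑-const n (- 1ℚ))) (lem ν))
    where
    lem : ∀ x → x + x * - 1ℚ ≡ 0ℚ
    lem = solve-∀ ℚ-ring

  Cβ : ℚ
  Cβ = ν * (ν + 1ℚ)

  0≤Cβ : 0ℚ ≤ Cβ
  0≤Cβ = 0≤p*q (0≤ι n) (0≤p+q (0≤ι n) 0≤1)

  β-partial : ∀ t m → ∣ ∑ m (β t) ∣ ≤ Cβ
  β-partial t m = ℚ.≤-trans (mean-zero-∑-bounded {n} {β t} (β-periodic t) (∑-β t) m)
    (ℚ.≤-trans (∑-mono n λ i _ → ∣β∣≤ t i) (ℚ.≤-reflexive (∑-const n (ν + 1ℚ))))

  triangular : ∀ N (h : ℕ → ℕ → ℚ) → ∑ N (λ m → ∑ (suc m) (h m)) ≡ ∑ N (λ i → ∑ (N ℕ.∸ i) (λ m → h (i ℕ.+ m) i))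
  triangular zero    h = refl
  triangular (suc N) h = begin
    ∑ N (λ m → ∑ (suc m) (h m)) + (∑ N (h N) + h N N)
      ≡⟨ ≡.cong (_+ (∑ N (h N) + h N N)) (triangular N h) ⟩
    ∑ N (λ i → ∑ (N ℕ.∸ i) (λ m → h (i ℕ.+ m) i)) + (∑ N (h N) + h N N)
      ≡⟨ ℚ.+-assoc (∑ N (λ i → ∑ (N ℕ.∸ i) (λ m → h (i ℕ.+ m) i))) (∑ N (h N)) (h N N) ⟨
    ∑ N (λ i → ∑ (N ℕ.∸ i) (λ m → h (i ℕ.+ m) i)) + ∑ N (h N) + h N N
      ≡⟨ ≡.cong₂ _+_ (≡.trans (≡.sym (∑-+ N _ (h N))) (∑-cong N row)) last ⟩
    ∑ N (λ i → ∑ (suc N ℕ.∸ i) (λ m → h (i ℕ.+ m) i)) + ∑ (suc N ℕ.∸ N) (λ m → h (N ℕ.+ m) N) ∎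
    where
    open ≡.≡-Reasoning
    row : ∀ i → i ℕ.< N → ∑ (N ℕ.∸ i) (λ m → h (i ℕ.+ m) i) + h N i ≡ ∑ (suc N ℕ.∸ i) (λ m → h (i ℕ.+ m) i)
    row i i<N = ≡.trans (≡.cong (λ k → ∑ (N ℕ.∸ i) (λ m → h (i ℕ.+ m) i) + h k i) (≡.sym (ℕ.m+[n∸m]≡n (ℕ.<⇒≤ i<N))))
      (≡.cong (λ k → ∑ k (λ m → h (i ℕ.+ m) i)) (≡.sym (ℕ.+-∸-assoc 1 (ℕ.<⇒≤ i<N))))
    last : h N N ≡ ∑ (suc N ℕ.∸ N) (λ m → h (N ℕ.+ m) N)
    last = ≡.trans (≡.trans (≡.cong (λ k → h k N) (≡.sym (ℕ.+-identityʳ N))) (≡.sym (ℚ.+-identityˡ (h (N ℕ.+ 0) N))))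
      (≡.cong (λ k → ∑ k (λ m → h (N ℕ.+ m) N)) (≡.sym (ℕ.m+n∸n≡m 1 N)))

  J : ℕ → ℚ
  J N = ∑ N (λ m → inv (suc m) * inv (N ℕ.∸ m))

  -- The two denominators add up to N + 1, so partial fractions split the sum into two harmonic
  -- sums.
  J≡ : ∀ N → J N ≡ (H N + H N) * inv (suc N)
  J≡ N = ≡.trans (∑-cong N λ m m<N → split m m<N) (≡.trans (∑-*ʳ N (inv (suc N)) _) (≡.cong (_* inv (suc N))
      (≡.trans (∑-+ N _ _) (≡.cong (H N +_) (reverse N)))))
    where
    reverse : ∀ N → ∑ N (λ m → inv (N ℕ.∸ m)) ≡ H N
    reverse zero    = refl
    reverse (suc N) = ≡.trans (∑-head N (λ m → inv (suc N ℕ.∸ m))) (≡.trans (≡.cong (inv (suc N) +_) (reverse N)) (ℚ.+-comm (inv (suc N)) (H N)))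
    pos : ∀ {k} → 1 ℕ.≤ k → ℤ.+ k ≢ ℤ.0ℤ
    pos (s≤s _) ()
    split : ∀ m → m ℕ.< N → inv (suc m) * inv (N ℕ.∸ m) ≡ (inv (suc m) + inv (N ℕ.∸ m)) * inv (suc N)
    split m m<N = ≡.trans (partial-fractions (ℤ.+ suc m) (ℤ.+ (N ℕ.∸ m)) (λ ()) (pos (ℕ.m<n⇒0<n∸m m<N)) (λ ()))
      (≡.cong (λ k → (inv (suc m) + inv (N ℕ.∸ m)) * inv (suc k)) (ℕ.m+[n∸m]≡n (ℕ.<⇒≤ m<N)))

  rate : ℕ → ℚ
  rate N = H N * inv (suc N)

  0≤rate : ∀ N → 0ℚ ≤ rate N
  0≤rate N = 0≤p*q (0≤H N) (0≤inv (suc N))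

  K : ℚ
  K = (ν + 1ℚ) * ((Cβ + Cβ) + (Cβ + Cβ))

  private
    -- e bounds the twisted partial sums of g, and the two sums against 1/(m + 1) are at most 2 rate.
    X-close : ∀ N (g e : ℕ → ℚ) t u → (∀ i → i ℕ.< N → 0ℚ ≤ g i) →
      (∀ m → m ℕ.< N → ∣ ∑ (suc m) (λ i → β u i * g i) ∣ ≤ (Cβ + Cβ) * e m) →
      ∑ N (λ m → inv (suc m) * e m) ≤ rate N + rate N → ∑ N (λ i → g i * inv (suc i)) ≤ rate N + rate N →
      ∣ ν * ν * X N t u g - X₀ N g ∣ ≤ K * rate N
    X-close N g e t u 0≤g inner≤ e≤ g≤ = ≡.subst (λ x → ∣ x ∣ ≤ K * rate N) (≡.sym eq)
      (ℚ.≤-trans (∣+∣≤ part₁ part₂) (ℚ.≤-reflexive (lem₀ ν (Cβ + Cβ) (rate N))))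
      where
      open ≡.≡-Reasoning
      lem₀ : ∀ ν c r → ν * (c * (r + r)) + c * (r + r) ≡ (ν + 1ℚ) * (c + c) * r
      lem₀ = solve-∀ ℚ-ring
      -- From ν² θ_t θ_u - 1 = ν θ_t (ν θ_u - 1) + (ν θ_t - 1): `S₁` removes the inner congruence,
      -- `S₂` the outer one. For `S₂` the outer index is summed first.
      S₁ = ∑ N (λ m → ν * θ t (suc m) * inv (suc m) * ∑ (suc m) (λ i → β u i * g i))
      S₂ = ∑ N (λ m → β t (suc m) * inv (suc m) * ∑ (suc m) g)
      eq : ν * ν * X N t u g - X₀ N g ≡ S₁ + S₂
      eq = begin
        ν * ν * X N t u g - X₀ N g
          ≡⟨ ≡.cong₂ _+_ (≡.sym (∑-*ˡ N (ν * ν) _)) (≡.sym (∑-neg N _)) ⟩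
        ∑ N (λ m → ν * ν * (θ t (suc m) * inv (suc m) * ∑ (suc m) (λ i → θ u i * g i))) + ∑ N (λ m → - (inv (suc m) * ∑ (suc m) g))
          ≡⟨ ∑-+ N _ _ ⟨
        ∑ N (λ m → ν * ν * (θ t (suc m) * inv (suc m) * ∑ (suc m) (λ i → θ u i * g i)) + - (inv (suc m) * ∑ (suc m) g))
          ≡⟨ ∑-cong N (λ m _ → ≡.trans (lem₁ ν (θ t (suc m)) (inv (suc m)) (∑ (suc m) (λ i → θ u i * g i)) (∑ (suc m) g))
               (≡.cong (λ x → ν * θ t (suc m) * inv (suc m) * x + β t (suc m) * inv (suc m) * ∑ (suc m) g) (≡.sym (∑β (suc m))))) ⟩
        ∑ N (λ m → ν * θ t (suc m) * inv (suc m) * ∑ (suc m) (λ i → β u i * g i) + β t (suc m) * inv (suc m) * ∑ (suc m) g)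
          ≡⟨ ∑-+ N _ _ ⟩
        S₁ + S₂ ∎
        where
        lem₁ : ∀ ν a i x y → ν * ν * (a * i * x) + - (i * y) ≡ ν * a * i * (ν * x - y) + (ν * a - 1ℚ) * i * y
        lem₁ = solve-∀ ℚ-ring
        lem₂ : ∀ ν a g → (ν * a - 1ℚ) * g ≡ ν * (a * g) + - g
        lem₂ = solve-∀ ℚ-ring
        ∑β : ∀ m → ∑ m (λ i → β u i * g i) ≡ ν * ∑ m (λ i → θ u i * g i) - ∑ m g
        ∑β m = ≡.trans (∑-cong m λ i _ → lem₂ ν (θ u i) (g i)) (≡.trans (∑-+ m _ _) (≡.cong₂ _+_ (∑-*ˡ m ν _) (∑-neg m g)))
      part₁ : ∣ S₁ ∣ ≤ ν * ((Cβ + Cβ) * (rate N + rate N))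
      part₁ = ℚ.≤-trans (∣∑∣≤ N λ m m<N → ∣*∣≤ (∣*∣≤ (∣νθ∣≤ν t (suc m)) (ℚ.≤-reflexive (∣p∣≡p (0≤inv (suc m))))) (inner≤ m m<N))
        (ℚ.≤-trans (ℚ.≤-reflexive (≡.trans (∑-cong N λ m _ → lem (inv (suc m)) (Cβ + Cβ) (e m)) (∑-*ˡ N (ν * (Cβ + Cβ)) _)))
          (ℚ.≤-trans (*-monoˡ (ν * (Cβ + Cβ)) (0≤p*q (0≤ι n) (0≤p+q 0≤Cβ 0≤Cβ)) e≤) (ℚ.≤-reflexive (ℚ.*-assoc ν (Cβ + Cβ) (rate N + rate N)))))
        where
        lem′ : ∀ v i c e → v * i * (c * e) ≡ v * c * (i * e)
        lem′ = solve-∀ ℚ-ring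
        lem : ∀ i c e → ν * i * (c * e) ≡ ν * c * (i * e)
        lem = lem′ ν
      part₂ : ∣ S₂ ∣ ≤ (Cβ + Cβ) * (rate N + rate N)
      part₂ = ℚ.≤-trans (ℚ.≤-reflexive (≡.cong ∣_∣ swap)) (ℚ.≤-trans (∣∑∣≤ N λ i i<N → ∣*∣≤ (ℚ.≤-reflexive (∣p∣≡p (0≤g i i<N))) (tail i))
        (ℚ.≤-trans (ℚ.≤-reflexive (≡.trans (∑-cong N λ i _ → lem (g i) (Cβ + Cβ) (inv (suc i))) (∑-*ˡ N (Cβ + Cβ) _)))
          (*-monoˡ (Cβ + Cβ) (0≤p+q 0≤Cβ 0≤Cβ) g≤)))
        where
        lem : ∀ g c i → g * (c * i) ≡ c * (g * i)
        lem = solve-∀ ℚ-ring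
        lem₁ : ∀ b i g → b * i * g ≡ g * (b * i)
        lem₁ = solve-∀ ℚ-ring
        swap : S₂ ≡ ∑ N (λ i → g i * ∑ (N ℕ.∸ i) (λ m → β t (suc i ℕ.+ m) * inv (suc (i ℕ.+ m))))
        swap = ≡.trans (∑-cong N λ m _ → ≡.sym (∑-*ˡ (suc m) (β t (suc m) * inv (suc m)) g))
          (≡.trans (triangular N (λ m i → β t (suc m) * inv (suc m) * g i))
            (∑-cong N λ i _ → ≡.trans (∑-cong (N ℕ.∸ i) λ m _ → lem₁ (β t (suc (i ℕ.+ m))) (inv (suc (i ℕ.+ m))) (g i)) (∑-*ˡ (N ℕ.∸ i) (g i) _)))
        tail : ∀ i → ∣ ∑ (N ℕ.∸ i) (λ m → β t (suc i ℕ.+ m) * inv (suc (i ℕ.+ m))) ∣ ≤ (Cβ + Cβ) * inv (suc i)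
        tail i = ≡.subst (λ k → ∣ ∑ (N ℕ.∸ i) (λ m → β t (suc i ℕ.+ m) * inv (suc (i ℕ.+ m))) ∣ ≤ (Cβ + Cβ) * inv (suc k)) (ℕ.+-identityʳ i)
          (abel-antitone {λ m → β t (suc i ℕ.+ m)} {λ m → inv (suc (i ℕ.+ m))} (shift-bounded {β t} (β-partial t) (suc i))
            (λ m → 0≤inv (suc (i ℕ.+ m))) (λ m → inv-anti (ℕ.+-monoʳ-≤ i (ℕ.n≤1+n m))) (N ℕ.∸ i))

  X-g₁ : ∀ N t u → ∣ ν * ν * X N t u (g₁ N) - X₀ N (g₁ N) ∣ ≤ K * rate N
  X-g₁ N t u = X-close N (g₁ N) (λ _ → inv (suc N)) t u (λ i _ → 0≤inv (suc (N ℕ.+ i)))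
    (λ m _ → ℚ.≤-trans (abel-antitone {β u} {g₁ N} (β-partial u) (λ i → 0≤inv (suc (N ℕ.+ i))) (λ i → inv-anti (ℕ.+-monoʳ-≤ N (ℕ.n≤1+n i))) (suc m))
      (*-mono 0≤Cβ (p≤p+q 0≤Cβ) (0≤inv (suc (N ℕ.+ 0))) (ℚ.≤-reflexive (≡.cong (λ k → inv (suc k)) (ℕ.+-identityʳ N)))))
    (ℚ.≤-trans (ℚ.≤-reflexive (∑-*ʳ N (inv (suc N)) _)) (p≤p+q (0≤rate N)))
    (ℚ.≤-trans (∑-mono N λ i _ → ≡.subst (g₁ N i * inv (suc i) ≤_) (ℚ.*-comm (inv (suc N)) (inv (suc i)))
        (*-monoʳ (inv (suc i)) (0≤inv (suc i)) (inv-anti (ℕ.m≤m+n N i))))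
      (ℚ.≤-trans (ℚ.≤-reflexive (∑-*ʳ N (inv (suc N)) _)) (p≤p+q (0≤rate N))))

  -- Since `g₂ N` increases up to N - 1, its twisted partial sums are controlled by the last value
  -- instead of the first. With e = `g₂ N` both sums required by `X-close` are `J N`.
  X-g₂ : ∀ N t u → ∣ ν * ν * X N t u (g₂ N) - X₀ N (g₂ N) ∣ ≤ K * rate N
  X-g₂ N t u = X-close N (g₂ N) (g₂ N) t u (λ i _ → 0≤inv (N ℕ.∸ i))
    (λ m m<N → abel-monotone {β u} {g₂ N} (β-partial u) m (λ i _ → 0≤inv (N ℕ.∸ i)) (λ i i<m → mono i (ℕ.<-trans i<m m<N) (ℕ.≤-<-trans i<m m<N)))
    (ℚ.≤-reflexive sumJ)
    (ℚ.≤-reflexive (≡.trans (∑-cong N λ i _ → ℚ.*-comm (g₂ N i) (inv (suc i))) sumJ))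
    where
    sumJ : J N ≡ rate N + rate N
    sumJ = ≡.trans (J≡ N) (ℚ.*-distribʳ-+ (inv (suc N)) (H N) (H N))
    mono : ∀ i → i ℕ.< N → suc i ℕ.< N → g₂ N i ≤ g₂ N (suc i)
    mono i i<N 1+i<N with N ℕ.∸ suc i in eq | ℕ.m<n⇒0<n∸m 1+i<N
    ... | suc k | _ = ≡.subst (λ x → inv x ≤ inv (suc k)) (≡.sym (≡.trans (ℕ.+-∸-assoc 1 i<N) (≡.cong suc eq))) (inv-anti (ℕ.n≤1+n k))

-- Sequences of order 1/(j + 1) and bounded sequences

module NullSequences where
  open RationalInequalities

  -- An explicit rate in place of a limit. It survives sums and bounded factors, and it is the form
  -- in which the vanishing of Σ F(k)/k is finally used.
  record Small (u : ℕ → ℚ) : Set where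
    constructor _,_
    field
      constant : ℚ
      decay    : ∀ j → ∣ u j ∣ ≤ constant * inv (suc j)
  open Small public

  record Bdd (u : ℕ → ℚ) : Set where
    constructor _,_
    field
      bound : ℚ
      below : ∀ j → ∣ u j ∣ ≤ bound

  small-≡ : ∀ {u v} → (∀ j → u j ≡ v j) → Small u → Small v
  small-≡ u≡v (C , u≤) = C , λ j → ≡.subst (λ x → ∣ x ∣ ≤ C * inv (suc j)) (u≡v j) (u≤ j)

  small-0 : ∀ {u} → (∀ j → u j ≡ 0ℚ) → Small u
  small-0 u≡0 = 0ℚ , λ j → ℚ.≤-reflexive (≡.trans (≡.cong ∣_∣ (u≡0 j)) (≡.sym (ℚ.*-zeroˡ (inv (suc j)))))

  small-+ : ∀ {u v} → Small u → Small v → Small (λ j → u j + v j)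
  small-+ (C , u≤) (D , v≤) = C + D , λ j →
    ℚ.≤-trans (∣+∣≤ (u≤ j) (v≤ j)) (ℚ.≤-reflexive (≡.sym (ℚ.*-distribʳ-+ (inv (suc j)) C D)))

  small-* : ∀ {u v} → Bdd u → Small v → Small (λ j → u j * v j)
  small-* (C , u≤) (D , v≤) = C * D , λ j →
    ℚ.≤-trans (∣*∣≤ (u≤ j) (v≤ j)) (ℚ.≤-reflexive (≡.sym (ℚ.*-assoc C D (inv (suc j)))))

  small-∑ : ∀ n {u : ℕ → ℕ → ℚ} → (∀ i → i ℕ.< n → Small (u i)) → Small (λ j → ∑ n (λ i → u i j))
  small-∑ zero    _ = small-0 λ _ → refl
  small-∑ (suc n) s = small-+ (small-∑ n λ i i<n → s i (ℕ.m<n⇒m<1+n i<n)) (s n ℕ.≤-refl)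

  bdd-const : ∀ a → Bdd (λ _ → a)
  bdd-const a = ∣ a ∣ , λ _ → ℚ.≤-refl

  bdd-+ : ∀ {u v} → Bdd u → Bdd v → Bdd (λ j → u j + v j)
  bdd-+ (C , u≤) (D , v≤) = C + D , λ j → ∣+∣≤ (u≤ j) (v≤ j)

  bdd-- : ∀ {u v} → Bdd u → Bdd v → Bdd (λ j → u j - v j)
  bdd-- (C , u≤) (D , v≤) = C + D , λ j → ∣-∣≤ (u≤ j) (v≤ j)

  bdd-* : ∀ {u v} → Bdd u → Bdd v → Bdd (λ j → u j * v j)
  bdd-* (C , u≤) (D , v≤) = C * D , λ j → ∣*∣≤ (u≤ j) (v≤ j)

  bdd-≡ : ∀ {u v} → (∀ j → u j ≡ v j) → Bdd u → Bdd v
  bdd-≡ u≡v (C , u≤) = C , λ j → ≡.subst (λ x → ∣ x ∣ ≤ C) (u≡v j) (u≤ j)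

  small⇒bdd : ∀ {u} → Small u → Bdd u
  small⇒bdd (C , u≤) = ∣ C ∣ , λ j → ℚ.≤-trans (u≤ j) (ℚ.≤-trans (*-monoʳ (inv (suc j)) (0≤inv (suc j)) (p≤∣p∣ C))
    (≡.subst (∣ C ∣ * inv (suc j) ≤_) (ℚ.*-identityʳ ∣ C ∣) (*-monoˡ ∣ C ∣ (ℚ.0≤∣p∣ C) (inv≤1 (suc j)))))

-- The approximate addition theorem of the cotangent

module AdditionTheorem (n′ : ℕ) where
  open RationalInequalities
  open AbelSummation
  open SignedSums
  open EisensteinSums n′
  open Equidistribution n′
  open NullSequences

  private
    n = suc n′
    ν = ι n

  abstract
    -- Along squares N = size j the error H(N) / N is O(1 / (j + 1)).
    size : ℕ → ℕ
    size j = suc j ℕ.* suc j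

    size≡ : ∀ j → size j ≡ suc j ℕ.* suc j
    size≡ j = refl

  rate-small : Small (λ j → rate (size j))
  rate-small = (1ℚ + 1ℚ) , λ j → ≡.subst (λ N → ∣ rate N ∣ ≤ (1ℚ + 1ℚ) * inv (suc j)) (≡.sym (size≡ j))
    (0≤p≤a⇒∣p∣≤a (0≤rate (suc j ℕ.* suc j)) (ℚ.≤-trans
      (*-mono (0≤H (suc j ℕ.* suc j)) (H-square j) (0≤inv (suc (suc j ℕ.* suc j)))
        (ℚ.≤-trans (inv-anti {j ℕ.+ j ℕ.* suc j} {suc j ℕ.* suc j} (ℕ.n≤1+n _)) (ℚ.≤-reflexive (inv-* (suc j) (suc j)))))
      (ℚ.≤-reflexive (≡.trans (lem (ι (suc j)) (inv (suc j))) (≡.cong (λ x → (x + x) * inv (suc j)) (ι-inv j))))))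
    where
    lem : ∀ s i → (s + s) * (i * i) ≡ (s * i + s * i) * i
    lem = solve-∀ ℚ-ring

  Q : ℕ → ℚ
  Q N = X₀ N (g₁ N) + X₀ N (g₂ N)

  -- Tends to (π/n)².
  κ : ℕ → ℚ
  κ N = inv n * inv n * ((Q N + Q N) + (Q N + Q N))

  -- Each of r and s leads to four double sums, two with `g₁` and two with `g₂`, and n² times each
  -- is close to the corresponding `X₀`. So n² times either sum of errors is close to 2 Q, and the
  -- same 4 Q/n² serves all r and s.
  defect : ∀ {r s} → ¬ Div r → ¬ Div s → ¬ Div (r ℤ.+ s) →
    Small (λ j → T (size j) r * T (size j) s - T (size j) (r ℤ.+ s) * (T (size j) r + T (size j) s) - κ (size j))
  defect {r} {s} r≢0 s≢0 r+s≢0 = small-≡ (λ j → eq (size j))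
    (small-* (bdd-const (inv n * inv n)) (small-+ (half r) (half s)))
    where
    c = r ℤ.+ s
    W : ℤ → ℕ → ℚ
    W r N = ν * ν * ∑± N (λ k → term r k * V N c k) - (Q N + Q N)
    lem₁ : ∀ ν a b c d p q → (ν * ν * a - p) + (ν * ν * b - q) + ((ν * ν * c - p) + (ν * ν * d - q)) ≡
      ν * ν * ((a + b) + (c + d)) - ((p + q) + (p + q))
    lem₁ = solve-∀ ℚ-ring
    lem₂ : ∀ K r → K * r + K * r + (K * r + K * r) ≡ (K + K + (K + K)) * r
    lem₂ = solve-∀ ℚ-ring
    half : ∀ r → Small (λ j → W r (size j))
    half r = small-≡ (λ j → unfold (size j))
      (small-+
        (small-+
          (close {λ N → ν * ν * X N (ℤ.- r) (ℤ.+ suc N ℤ.- c) (g₁ N) - X₀ N (g₁ N)} λ N → X-g₁ N (ℤ.- r) (ℤ.+ suc N ℤ.- c))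
          (close {λ N → ν * ν * X N (ℤ.- r) (ℤ.- (ℤ.+ N) ℤ.- c) (g₂ N) - X₀ N (g₂ N)} λ N → X-g₂ N (ℤ.- r) (ℤ.- (ℤ.+ N) ℤ.- c)))
        (small-+
          (close {λ N → ν * ν * X N r (ℤ.+ suc N ℤ.- ℤ.- c) (g₁ N) - X₀ N (g₁ N)} λ N → X-g₁ N r (ℤ.+ suc N ℤ.- ℤ.- c))
          (close {λ N → ν * ν * X N r (ℤ.- (ℤ.+ N) ℤ.- ℤ.- c) (g₂ N) - X₀ N (g₂ N)} λ N → X-g₂ N r (ℤ.- (ℤ.+ N) ℤ.- ℤ.- c))))
      where
      unfold : ∀ N → (ν * ν * X N (ℤ.- r) (ℤ.+ suc N ℤ.- c) (g₁ N) - X₀ N (g₁ N)) +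
          (ν * ν * X N (ℤ.- r) (ℤ.- (ℤ.+ N) ℤ.- c) (g₂ N) - X₀ N (g₂ N)) +
        ((ν * ν * X N r (ℤ.+ suc N ℤ.- ℤ.- c) (g₁ N) - X₀ N (g₁ N)) +
          (ν * ν * X N r (ℤ.- (ℤ.+ N) ℤ.- ℤ.- c) (g₂ N) - X₀ N (g₂ N))) ≡ W r N
      unfold N = ≡.trans (lem₁ ν (X N (ℤ.- r) (ℤ.+ suc N ℤ.- c) (g₁ N)) (X N (ℤ.- r) (ℤ.- (ℤ.+ N) ℤ.- c) (g₂ N))
          (X N r (ℤ.+ suc N ℤ.- ℤ.- c) (g₁ N)) (X N r (ℤ.- (ℤ.+ N) ℤ.- ℤ.- c) (g₂ N)) (X₀ N (g₁ N)) (X₀ N (g₂ N)))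
        (≡.cong (λ x → ν * ν * x - (Q N + Q N)) (≡.sym (∑±-term-V N r c)))
      close : ∀ {u} → (∀ N → ∣ u N ∣ ≤ K * rate N) → Small (λ j → u (size j))
      close {u} u≤ = constant K-rate , λ j → ℚ.≤-trans (u≤ (size j)) (ℚ.≤-trans (p≤∣p∣ (K * rate (size j))) (decay K-rate j))
        where K-rate = small-* (bdd-const K) rate-small
    lem₃ : ∀ i ν a b q → i * i * ((ν * ν * a - (q + q)) + (ν * ν * b - (q + q))) ≡ (ν * i) * (ν * i) * (a + b) - i * i * ((q + q) + (q + q))
    lem₃ = solve-∀ ℚ-ring
    eq : ∀ N → inv n * inv n * (W r N + W s N) ≡ T N r * T N s - T N c * (T N r + T N s) - κ N
    eq N = ≡.trans (lem₃ (inv n) ν (A r) (A s) (Q N)) (≡.cong (_- κ N) (≡.trans (≡.cong (λ x → x * x * (A r + A s)) (ι-inv n′))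
      (≡.trans (≡.cong (_* (A r + A s)) (ℚ.*-identityˡ 1ℚ)) (≡.trans (ℚ.*-identityˡ (A r + A s)) (≡.sym (addition-defect N r≢0 s≢0 r+s≢0))))))
      where
      A : ℤ → ℚ
      A r = ∑± N (λ k → term r k * V N c k)

  T-explicit : ∀ N r → T N r ≡ ∑ N (λ i → (θ (ℤ.- r) (suc i) - θ r (suc i)) * inv (suc i))
  T-explicit N r = ≡.trans (≡.cong₂ _+_ (≡.trans (≡.cong (δ (ℤ.0ℤ ℤ.- r) *_) inv-0) (ℚ.*-zeroʳ (δ (ℤ.0ℤ ℤ.- r))))
      (∑-cong N λ i _ → step i)) (ℚ.+-identityˡ _)
    where
    lem : ∀ a b i → a * i + b * - i ≡ (a - b) * i
    lem = solve-∀ ℚ-ring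
    neg : ∀ k r → ℤ.- k ℤ.+ ℤ.- r ≡ ℤ.- (k ℤ.+ r)
    neg = ℤ-Solver.solve-∀
    step : ∀ i → term r (ℤ.+ suc i) + term r (ℤ.-[1+ i ]) ≡ (θ (ℤ.- r) (suc i) - θ r (suc i)) * inv (suc i)
    step i = ≡.trans (≡.cong (λ x → term r (ℤ.+ suc i) + x * - inv (suc i)) (≡.trans (≡.cong δ (neg (ℤ.+ suc i) r)) (δ-neg (ℤ.+ suc i ℤ.+ r))))
      (lem (θ (ℤ.- r) (suc i)) (θ r (suc i)) (inv (suc i)))

  -- n times the difference of the two indicators in `T-explicit` is a difference of two functions
  -- `β`, to which Abel summation against 1/k applies.
  T-bounded : ∀ r → Bdd (λ j → T (size j) r)
  T-bounded r = (inv n * B) , λ j → ≡.subst (λ x → ∣ x ∣ ≤ inv n * B) (≡.sym (eq (size j)))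
      (∣*∣≤ (ℚ.≤-reflexive (∣p∣≡p (0≤inv n))) (∣-∣≤ (part (ℤ.- r) (size j)) (part r (size j))))
    where
    B = (Cβ + Cβ) * inv 1 + (Cβ + Cβ) * inv 1
    part : ∀ t N → ∣ ∑ N (λ i → β t (suc i) * inv (suc i)) ∣ ≤ (Cβ + Cβ) * inv 1
    part t N = abel-antitone {λ i → β t (1 ℕ.+ i)} {λ i → inv (suc i)} (shift-bounded {β t} (β-partial t) 1) (λ i → 0≤inv (suc i))
        (λ i → inv-anti (ℕ.n≤1+n i)) N
    b : ℤ → ℕ → ℚ
    b t i = β t (suc i) * inv (suc i)
    lem : ∀ ν a b i → (ν * a - 1ℚ) * i + - ((ν * b - 1ℚ) * i) ≡ ν * ((a - b) * i)
    lem = solve-∀ ℚ-ring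
    eq : ∀ N → T N r ≡ inv n * (∑ N (λ i → β (ℤ.- r) (suc i) * inv (suc i)) - ∑ N (λ i → β r (suc i) * inv (suc i)))
    eq N = ≡.sym (≡.trans (≡.cong (inv n *_) (≡.trans (≡.cong (∑ N (b (ℤ.- r)) +_) (≡.sym (∑-neg N (b r))))
        (≡.trans (≡.sym (∑-+ N (b (ℤ.- r)) (λ i → - b r i)))
        (≡.trans (∑-cong N λ i _ → lem ν (θ (ℤ.- r) (suc i)) (θ r (suc i)) (inv (suc i)))
            (≡.trans (∑-*ˡ N ν _) (≡.cong (ν *_) (≡.sym (T-explicit N r))))))))
      (≡.trans (lem₂ (inv n) ν (T N r)) (≡.trans (≡.cong (_* T N r) (ι-inv n′)) (ℚ.*-identityˡ (T N r)))))
      where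
      lem₂ : ∀ i ν t → i * (ν * t) ≡ ν * i * t
      lem₂ = solve-∀ ℚ-ring

  κ₀ : ℚ
  κ₀ = inv n * inv n

  0<κ₀ : 0ℚ < κ₀
  0<κ₀ = ℚ.positive⁻¹ κ₀ {{ℚ.pos*pos⇒pos (inv n) {{pos}} (inv n) {{pos}}}}
    where pos = ℚ.positive (0<inv n′)

  -- All N values of g₁ are at least 1/(2 N), so X₀(g₁) ≥ 1/2 and 2 Q ≥ 1. This keeps the
  -- denominators t² + κ away from 0.
  κ-lower : ∀ M → κ₀ ≤ κ (suc M)
  κ-lower M = ≡.subst (_≤ κ N) (ℚ.*-identityʳ κ₀) (*-monoˡ κ₀ (ℚ.<⇒≤ 0<κ₀) (ℚ.≤-trans 1≤Q+Q (p≤p+q (0≤p+q 0≤Q 0≤Q))))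
    where
    N = suc M
    0≤X₀ : ∀ {g} → (∀ i → 0ℚ ≤ g i) → 0ℚ ≤ X₀ N g
    0≤X₀ 0≤g = ∑-nonneg N λ m _ → 0≤p*q (0≤inv (suc m)) (∑-nonneg (suc m) λ i _ → 0≤g i)
    0≤X₀g₁ = 0≤X₀ {g₁ N} (λ i → 0≤inv (suc (N ℕ.+ i)))
    0≤X₀g₂ = 0≤X₀ {g₂ N} (λ i → 0≤inv (N ℕ.∸ i))
    0≤Q = 0≤p+q 0≤X₀g₁ 0≤X₀g₂
    half : ι N * inv (N ℕ.+ N) ≤ X₀ N (g₁ N)
    half = ≡.subst (_≤ X₀ N (g₁ N)) (∑-const N (inv (N ℕ.+ N))) (∑-mono N λ m m<N → ≡.subst (_≤ inv (suc m) * ∑ (suc m) (g₁ N))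
        (≡.trans (≡.cong (inv (suc m) *_) (∑-const (suc m) (inv (N ℕ.+ N))))
            (≡.trans (lem (inv (suc m)) (ι (suc m)) (inv (N ℕ.+ N))) (≡.trans (≡.cong (_* inv (N ℕ.+ N)) (ι-inv m)) (ℚ.*-identityˡ _))))
        (*-monoˡ (inv (suc m)) (0≤inv (suc m)) (∑-mono (suc m) λ i i≤m → anti i (ℕ.<-≤-trans (ℕ.<-≤-trans i≤m ℕ.≤-refl) m<N))))
      where
      lem : ∀ i s v → i * (s * v) ≡ s * i * v
      lem = solve-∀ ℚ-ring
      anti : ∀ i → i ℕ.< N → inv (N ℕ.+ N) ≤ g₁ N i
      anti i i<N = inv-anti (≡.subst (N ℕ.+ i ℕ.≤_) (ℕ.+-comm N M) (ℕ.+-monoʳ-≤ N (ℕ.≤-pred i<N)))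
    1≤Q+Q : 1ℚ ≤ Q N + Q N
    1≤Q+Q = ≡.subst (_≤ Q N + Q N) (≡.trans (≡.sym (ℚ.*-distribʳ-+ (inv (N ℕ.+ N)) (ι N) (ι N)))
        (≡.trans (≡.cong (_* inv (N ℕ.+ N)) (≡.sym (ι-+ N N))) (ι-inv (M ℕ.+ N))))
      (ℚ.+-mono-≤ (ℚ.≤-trans half (p≤p+q 0≤X₀g₂)) (ℚ.≤-trans half (p≤p+q 0≤X₀g₂)))

  κ≥ : ∀ j → κ₀ ≤ κ (size j)
  κ≥ j = ≡.subst (λ N → κ₀ ≤ κ N) (≡.sym (size≡ j)) (κ-lower (j ℕ.+ j ℕ.* suc j))

  -- `κ` is not estimated directly but read off from the addition law at r = s = 1, where all other
  -- terms are bounded. For this n must divide neither 1 nor 2.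
  κ-bounded : ¬ Div (ℤ.+ 1) → ¬ Div (ℤ.+ 2) → Bdd (λ j → κ (size j))
  κ-bounded 1≢0 2≢0 = bdd-≡ (λ j → lem (T (size j) (ℤ.+ 1) * T (size j) (ℤ.+ 1) - T (size j) (ℤ.+ 2) *
      (T (size j) (ℤ.+ 1) + T (size j) (ℤ.+ 1))) (κ (size j)))
    (bdd-- (bdd-- (bdd-* T₁ T₁) (bdd-* (T-bounded (ℤ.+ 2)) (bdd-+ T₁ T₁))) (small⇒bdd (defect {ℤ.+ 1} {ℤ.+ 1} 1≢0 1≢0 2≢0)))
    where
    T₁ = T-bounded (ℤ.+ 1)
    lem : ∀ x k → x - (x - k) ≡ k
    lem = solve-∀ ℚ-ring

-- Approximate sine and cosine, and the Fourier expansion of the cotangent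

module Choice where
  choose : ∀ {P : Set} → Dec P → ℚ → ℚ → ℚ
  choose (yes _) a b = a
  choose (no _)  a b = b

  choose-yes : ∀ {P : Set} (D : Dec P) {a b} → P → choose D a b ≡ a
  choose-yes (yes _) _ = refl
  choose-yes (no ¬p) p = contradiction p ¬p

  choose-no : ∀ {P : Set} (D : Dec P) {a b} → ¬ P → choose D a b ≡ b
  choose-no (yes p) ¬p = contradiction p ¬p
  choose-no (no _)  _  = refl

-- t behaves like the cotangent at level n, scaled by √κ; the functions x and y below are the cosine and
-- (up to scaling) the sine of twice the angle.
module DoubleAngle (n′ : ℕ)
  (t : ℤ → ℕ → ℚ) (κ : ℕ → ℚ) (κ₀ : ℚ) (0<κ₀ : 0ℚ ℚ.< κ₀) (κ≥ : ∀ j → κ₀ ℚ.≤ κ j) (κ-bdd : NullSequences.Bdd κ)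
  (t-odd : ∀ r j → t (ℤ.- r) j ≡ ℚ.- t r j)
  (t-periodic : ∀ r s → EisensteinSums.Div n′ (r ℤ.- s) → ∀ j → t r j ≡ t s j)
  (t-bdd : ∀ r → NullSequences.Bdd (t r))
  (t-addition : ∀ r s → ¬ EisensteinSums.Div n′ r → ¬ EisensteinSums.Div n′ s → ¬ EisensteinSums.Div n′ (r ℤ.+ s) →
    NullSequences.Small (λ j → t r j ℚ.* t s j ℚ.- t (r ℤ.+ s) j ℚ.* (t r j ℚ.+ t s j) ℚ.- κ j)) where
  open EisensteinSums n′
  open RationalInequalities
  open NullSequences
  open Choice

  den : ℤ → ℕ → ℚ
  den r j = t r j * t r j + κ j

  0<den : ∀ r j → 0ℚ < den r j
  0<den r j = ℚ.<-≤-trans 0<κ₀ (ℚ.≤-trans (κ≥ j) (p≤q+p (0≤p² (t r j))))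

  i : ℤ → ℕ → ℚ
  i r j = recip (den r j) (0<den r j)

  i-inverse : ∀ r j → den r j * i r j ≡ 1ℚ
  i-inverse r j = recip-inverse (den r j) (0<den r j)

  i-bdd : ∀ r → Bdd (i r)
  i-bdd r = recip κ₀ 0<κ₀ , λ j → 0≤p≤a⇒∣p∣≤a (0≤recip (den r j) (0<den r j)) (recip-anti 0<κ₀ (0<den r j)
    (ℚ.≤-trans (κ≥ j) (p≤q+p (0≤p² (t r j)))))

  -- For t = √κ cot α these are y₀ = sin 2α / √κ and x₀ = cos 2α, rational in t and κ. At multiples
  -- of n, where the cotangent has a pole, the values 0 and 1 are put in by hand.
  y₀ x₀ y x : ℤ → ℕ → ℚ
  y₀ r j = (t r j + t r j) * i r j
  x₀ r j = (t r j * t r j - κ j) * i r j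
  y r j = choose (div? r) 0ℚ (y₀ r j)
  x r j = choose (div? r) 1ℚ (x₀ r j)

  y-div : ∀ {r} → Div r → ∀ j → y r j ≡ 0ℚ
  y-div {r} d j = choose-yes (div? r) d

  x-div : ∀ {r} → Div r → ∀ j → x r j ≡ 1ℚ
  x-div {r} d j = choose-yes (div? r) d

  y-¬div : ∀ {r} → ¬ Div r → ∀ j → y r j ≡ y₀ r j
  y-¬div {r} ¬d j = choose-no (div? r) ¬d

  x-¬div : ∀ {r} → ¬ Div r → ∀ j → x r j ≡ x₀ r j
  x-¬div {r} ¬d j = choose-no (div? r) ¬d

  private
    i-cong : ∀ {r s} j → den r j ≡ den s j → i r j ≡ i s j
    i-cong {r} {s} j eq = begin
      i r j                     ≡⟨ ℚ.*-identityʳ (i r j) ⟨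
      i r j * 1ℚ                ≡⟨ ≡.cong (i r j *_) (≡.trans (≡.cong (_* i s j) eq) (i-inverse s j)) ⟨
      i r j * (den r j * i s j) ≡⟨ lem (i r j) (den r j) (i s j) ⟩
      den r j * i r j * i s j   ≡⟨ ≡.cong (_* i s j) (i-inverse r j) ⟩
      1ℚ * i s j                ≡⟨ ℚ.*-identityˡ (i s j) ⟩
      i s j                     ∎
      where
      open ≡.≡-Reasoning
      lem : ∀ a d b → a * (d * b) ≡ d * a * b
      lem = solve-∀ ℚ-ring

    square-neg : ∀ a → - a * - a ≡ a * a
    square-neg = solve-∀ ℚ-ring

    i-even : ∀ r j → i (ℤ.- r) j ≡ i r j
    i-even r j = i-cong j (≡.cong (_+ κ j) (≡.trans (≡.cong (λ t → t * t) (t-odd r j)) (square-neg (t r j))))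

    div-transport : ∀ {r s} → Div (r ℤ.- s) → Div r → Div s
    div-transport {r} {s} r≡s d = div-≡ (lem r s) (div-+ d (div-neg r≡s))
      where
      lem : ∀ r s → r ℤ.+ ℤ.- (r ℤ.+ ℤ.- s) ≡ s
      lem = ℤ-Solver.solve-∀

    div-sym : ∀ {r s} → Div (r ℤ.- s) → Div (s ℤ.- r)
    div-sym {r} {s} d = div-≡ (lem r s) (div-neg d)
      where
      lem : ∀ r s → ℤ.- (r ℤ.+ ℤ.- s) ≡ s ℤ.+ ℤ.- r
      lem = ℤ-Solver.solve-∀

    div-neg⁻ : ∀ {r} → Div (ℤ.- r) → Div r
    div-neg⁻ {r} d = div-≡ (ℤ.neg-involutive r) (div-neg d)

  y-periodic : ∀ r s → Div (r ℤ.- s) → ∀ j → y r j ≡ y s j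
  y-periodic r s r≡s j = cases (div? r)
    where
    cases : Dec (Div r) → y r j ≡ y s j
    cases (yes d) = ≡.trans (y-div d j) (≡.sym (y-div (div-transport {r} {s} r≡s d) j))
    cases (no ¬d) = ≡.trans (y-¬div ¬d j) (≡.trans (≡.cong₂ (λ t k → (t + t) * k) (t-periodic r s r≡s j)
        (i-cong j (≡.cong (λ t → t * t + κ j) (t-periodic r s r≡s j))))
      (≡.sym (y-¬div (λ d → ¬d (div-transport {s} {r} (div-sym {r} {s} r≡s) d)) j)))

  y-odd : ∀ r j → y (ℤ.- r) j ≡ - y r j
  y-odd r j = cases (div? r)
    where
    lem : ∀ t k → (- t + - t) * k ≡ - ((t + t) * k)
    lem = solve-∀ ℚ-ring
    cases : Dec (Div r) → y (ℤ.- r) j ≡ - y r j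
    cases (yes d) = ≡.trans (y-div (div-neg d) j) (≡.sym (≡.cong -_ (y-div d j)))
    cases (no ¬d) = ≡.trans (y-¬div (λ d → ¬d (div-neg⁻ d)) j)
      (≡.trans (≡.cong₂ (λ t k → (t + t) * k) (t-odd r j) (i-even r j)) (≡.trans (lem (t r j) (i r j)) (≡.sym (≡.cong -_ (y-¬div ¬d j)))))

  x-even : ∀ r j → x (ℤ.- r) j ≡ x r j
  x-even r j = cases (div? r)
    where
    cases : Dec (Div r) → x (ℤ.- r) j ≡ x r j
    cases (yes d) = ≡.trans (x-div (div-neg d) j) (≡.sym (x-div d j))
    cases (no ¬d) = ≡.trans (x-¬div (λ d → ¬d (div-neg⁻ d)) j)
      (≡.trans (≡.cong₂ (λ t k → (t - κ j) * k) (≡.trans (≡.cong (λ t → t * t) (t-odd r j)) (square-neg (t r j))) (i-even r j)) (≡.sym (x-¬div ¬d j)))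

  x-periodic : ∀ r s → Div (r ℤ.- s) → ∀ j → x r j ≡ x s j
  x-periodic r s r≡s j = cases (div? r)
    where
    cases : Dec (Div r) → x r j ≡ x s j
    cases (yes d) = ≡.trans (x-div d j) (≡.sym (x-div (div-transport {r} {s} r≡s d) j))
    cases (no ¬d) = ≡.trans (x-¬div ¬d j) (≡.trans (≡.cong₂ (λ t k → (t * t - κ j) * k) (t-periodic r s r≡s j)
        (i-cong j (≡.cong (λ t → t * t + κ j) (t-periodic r s r≡s j))))
      (≡.sym (x-¬div (λ d → ¬d (div-transport {s} {r} (div-sym {r} {s} r≡s) d)) j)))

  -- If r, s or r + s is a multiple of n, periodicity and parity make the formula exact; only the
  -- generic case has an error.
  y-addition : ∀ r s → Small (λ j → y (r ℤ.+ s) j - (x r j * y s j + y r j * x s j))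
  y-addition r s = cases (div? r) (div? s) (div? (r ℤ.+ s))
    where
    lem₁ : ∀ a b c → a - (1ℚ * a + 0ℚ * c) ≡ 0ℚ
    lem₁ = solve-∀ ℚ-ring
    cases : Dec (Div r) → Dec (Div s) → Dec (Div (r ℤ.+ s)) → Small (λ j → y (r ℤ.+ s) j - (x r j * y s j + y r j * x s j))
    cases (yes d) _ _ = small-0 λ j → ≡.trans (≡.cong₂ (λ a b → y (r ℤ.+ s) j - (a * y s j + b * x s j)) (x-div d j) (y-div d j))
        (≡.trans (≡.cong (λ a → a - (1ℚ * y s j + 0ℚ * x s j)) (y-periodic (r ℤ.+ s) s (div-≡ (≡.sym (e r s)) d) j)) (lem₁ (y s j) 0ℚ (x s j)))
      where
      e : ∀ r s → r ℤ.+ s ℤ.+ ℤ.- s ≡ r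
      e = ℤ-Solver.solve-∀
    cases (no _) (yes d) _ = small-0 λ j → ≡.trans (≡.cong₂ (λ a b → y (r ℤ.+ s) j - (x r j * b + y r j * a)) (x-div d j) (y-div d j))
        (≡.trans (≡.cong (λ a → a - (x r j * 0ℚ + y r j * 1ℚ)) (y-periodic (r ℤ.+ s) r (div-≡ (≡.sym (e r s)) d) j)) (lem (y r j) (x r j)))
      where
      e : ∀ r s → r ℤ.+ s ℤ.+ ℤ.- r ≡ s
      e = ℤ-Solver.solve-∀
      lem : ∀ a c → a - (c * 0ℚ + a * 1ℚ) ≡ 0ℚ
      lem = solve-∀ ℚ-ring
    cases (no _) (no _) (yes d) = small-0 λ j → ≡.trans (≡.cong₂ (λ a b → a - (x r j * b + y r j * x s j)) (y-div d j)
        (≡.trans (y-periodic s (ℤ.- r) (div-≡ (e r s) d) j) (y-odd r j)))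
        (≡.trans (≡.cong (λ a → 0ℚ - (x r j * - y r j + y r j * a)) (≡.trans (x-periodic s (ℤ.- r) (div-≡ (e r s) d) j)
            (x-even r j))) (lem (x r j) (y r j)))
      where
      e : ∀ r s → r ℤ.+ s ≡ s ℤ.+ ℤ.- (ℤ.- r)
      e = ℤ-Solver.solve-∀
      lem : ∀ a b → 0ℚ - (a * - b + b * a) ≡ 0ℚ
      lem = solve-∀ ℚ-ring
    cases (no r≢0) (no s≢0) (no r+s≢0) = small-≡ (λ j → ≡.sym (≡.trans
        (≡.cong₂ _-_ (y-¬div r+s≢0 j) (≡.cong₂ _+_ (≡.cong₂ _*_ (x-¬div r≢0 j) (y-¬div s≢0 j)) (≡.cong₂ _*_ (y-¬div r≢0 j) (x-¬div s≢0 j))))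
        (general j)))
      (small-* (bdd-* (bdd-* (bdd-* (bdd-* (bdd-const (1ℚ + 1ℚ)) (bdd-- (bdd-* t-bdd-c bdd-A) (bdd-* κ-bdd bdd-B)))
          (i-bdd (r ℤ.+ s))) (i-bdd r)) (i-bdd s))
        (t-addition r s r≢0 s≢0 r+s≢0))
      where
      t-bdd-c = t-bdd (r ℤ.+ s)
      bdd-A = bdd-- (bdd-* (t-bdd r) (t-bdd s)) κ-bdd
      bdd-B = bdd-+ (t-bdd r) (t-bdd s)
      -- Clearing denominators, the difference is a multiple of the defect of the addition law for t.
      identity : ∀ a b c k i₁ i₂ i₃ →
        (c + c) * i₃ * (((a * a + k) * i₁) * ((b * b + k) * i₂)) - ((a * a - k) * i₁ * ((b + b) * i₂) + (a + a) * i₁ *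
            ((b * b - k) * i₂)) * ((c * c + k) * i₃)
        ≡ (1ℚ + 1ℚ) * (c * (a * b - k) - k * (a + b)) * i₃ * i₁ * i₂ * (a * b - c * (a + b) - k)
      identity = solve-∀ ℚ-ring
      lem₃ : ∀ u v → u - v ≡ u * (1ℚ * 1ℚ) - v * 1ℚ
      lem₃ = solve-∀ ℚ-ring
      general : ∀ j → y₀ (r ℤ.+ s) j - (x₀ r j * y₀ s j + y₀ r j * x₀ s j) ≡
        (1ℚ + 1ℚ) * (t (r ℤ.+ s) j * (t r j * t s j - κ j) - κ j * (t r j + t s j)) * i (r ℤ.+ s) j * i r j * i s j *
        (t r j * t s j - t (r ℤ.+ s) j * (t r j + t s j) - κ j)
      general j = ≡.trans (lem₃ (y₀ (r ℤ.+ s) j) (x₀ r j * y₀ s j + y₀ r j * x₀ s j))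
        (≡.trans (≡.cong₂ (λ p q → y₀ (r ℤ.+ s) j * p - (x₀ r j * y₀ s j + y₀ r j * x₀ s j) * q)
            (≡.sym (≡.cong₂ _*_ (i-inverse r j) (i-inverse s j))) (≡.sym (i-inverse (r ℤ.+ s) j)))
          (identity (t r j) (t s j) (t (r ℤ.+ s) j) (κ j) (i r j) (i s j) (i (r ℤ.+ s) j)))

  module _ (b : ℤ) where
    Y : ℕ → ℕ → ℚ
    Y a = y (ℤ.+ a ℤ.* b)

    -- The addition formulas for b and -b are added; the terms with y(b) cancel because y is odd,
    -- and those with x(b) double because x is even.
    second-difference : ∀ a → Small (λ j → (Y (suc a) j + Y (suc a) j) - Y (suc (suc a)) j - Y a j - (1ℚ - x b j + (1ℚ - x b j)) * Y (suc a) j)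
    second-difference a = small-≡ (λ j → ≡.trans
        (≡.cong₂ (λ u v → - 1ℚ * ((y (r ℤ.+ b) j - (x r j * y b j + y r j * x b j)) +
            (y (r ℤ.+ ℤ.- b) j - (x r j * u + y r j * v)))) (y-odd b j) (x-even b j))
        (≡.trans (lem (y (r ℤ.+ b) j) (y (r ℤ.+ ℤ.- b) j) (x r j) (y r j) (x b j) (y b j))
          (≡.cong₂ (λ u v → (y r j + y r j) - u - v - (1ℚ - x b j + (1ℚ - x b j)) * y r j) (≡.cong (λ z → y z j) (e₁ (ℤ.+ a) b))
              (≡.cong (λ z → y z j) (e₂ (ℤ.+ a) b)))))
      (small-* (bdd-const (- 1ℚ)) (small-+ (y-addition r b) (y-addition r (ℤ.- b))))
      where
      r = ℤ.+ suc a ℤ.* b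
      e₁ : ∀ a b → (ℤ.+ 1 ℤ.+ a) ℤ.* b ℤ.+ b ≡ (ℤ.+ 1 ℤ.+ (ℤ.+ 1 ℤ.+ a)) ℤ.* b
      e₁ = ℤ-Solver.solve-∀
      e₂ : ∀ a b → (ℤ.+ 1 ℤ.+ a) ℤ.* b ℤ.+ ℤ.- b ≡ a ℤ.* b
      e₂ = ℤ-Solver.solve-∀
      lem : ∀ u v xr yr xb yb → - 1ℚ * ((u - (xr * yb + yr * xb)) + (v - (xr * - yb + yr * xb))) ≡ (yr + yr) - u - v - (1ℚ - xb + (1ℚ - xb)) * yr
      lem = solve-∀ ℚ-ring

    summation : ∀ M j → ∑ M (λ a → ι (suc a) * ((Y (suc a) j + Y (suc a) j) - Y (suc (suc a)) j - Y a j)) ≡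
      ι (suc M) * Y M j - ι M * Y (suc M) j - Y 0 j
    summation zero j = ≡.sym (≡.trans (≡.cong₂ (λ u v → u * Y 0 j - v * Y 1 j - Y 0 j) ι-1 ι-0) (lem (Y 0 j) (Y 1 j)))
      where
      lem : ∀ a b → 1ℚ * a - 0ℚ * b - a ≡ 0ℚ
      lem = solve-∀ ℚ-ring
    summation (suc M) j = ≡.trans (≡.cong (_+ ι (suc M) * ((Y (suc M) j + Y (suc M) j) - Y (suc (suc M)) j - Y M j)) (summation M j))
      (≡.trans (≡.cong (λ u → u * Y M j - ι M * Y (suc M) j - Y 0 j + u * ((Y (suc M) j + Y (suc M) j) - Y (suc (suc M)) j - Y M j)) (ι-suc M))
        (≡.trans (lem (ι M) (Y M j) (Y (suc M) j) (Y (suc (suc M)) j) (Y 0 j))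
          (≡.cong₂ (λ u v → u * Y (suc M) j - v * Y (suc (suc M)) j - Y 0 j)
              (≡.sym (≡.trans (ι-suc (suc M)) (≡.cong (1ℚ +_) (ι-suc M)))) (≡.sym (ι-suc M)))))
      where
      lem : ∀ m a b c d → (1ℚ + m) * a - m * b - d + (1ℚ + m) * ((b + b) - c - a) ≡ (1ℚ + (1ℚ + m)) * b - (1ℚ + m) * c - d
      lem = solve-∀ ℚ-ring

    Y-boundary : ∀ j → ι (suc n′) * Y n′ j - ι n′ * Y (suc n′) j - Y 0 j ≡ - (ι (suc n′) * y b j)
    Y-boundary j = ≡.trans (≡.cong₂ (λ u v → ι (suc n′) * u - ι n′ * v - Y 0 j)
        (≡.trans (y-periodic (ℤ.+ n′ ℤ.* b) (ℤ.- b) (ℤ∣.divides b (e₁ (ℤ.+ n′) b)) j) (y-odd b j)) (y-div (ℤ∣.divides b (ℤ.*-comm (ℤ.+ suc n′) b)) j))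
      (≡.trans (≡.cong (λ u → ι (suc n′) * - y b j - ι n′ * 0ℚ - u) (y-div {ℤ.+ 0 ℤ.* b} (ℤ∣.divides (ℤ.+ 0) refl) j))
          (lem (ι (suc n′)) (ι n′) (y b j)))
      where
      e₁ : ∀ m b → m ℤ.* b ℤ.+ ℤ.- (ℤ.- b) ≡ b ℤ.* (ℤ.+ 1 ℤ.+ m)
      e₁ = ℤ-Solver.solve-∀
      lem : ∀ n m y → n * - y - m * 0ℚ - 0ℚ ≡ - (n * y)
      lem = solve-∀ ℚ-ring

    -- The finite Fourier expansion of the cotangent.
    fourier : ¬ Div b → Small (λ j → (κ j + κ j + (κ j + κ j)) * ∑ (suc n′) (λ a → ι a * Y a j) + ι (suc n′) * (t b j + t b j))
    -- Abel summation gives -n y(b) ≈ 2 (1 - x(b)) Σ a Y(a). The factor -(t² + κ) clears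
    -- denominators, as (t² + κ)(1 - x₀) = 2 κ and (t² + κ) y₀ = 2 t.
    fourier b≢0 = small-≡ (λ j → eq j) (small-* (bdd-* (bdd-const (- 1ℚ)) (bdd-+ (bdd-* (t-bdd b) (t-bdd b)) κ-bdd))
        (small-∑ n′ λ a _ → small-* (bdd-const (ι (suc a))) (second-difference a)))
      where
      open ≡.≡-Reasoning
      lem₁ : ∀ s u z v → s * (u - z * v) ≡ s * u + - z * (s * v)
      lem₁ = solve-∀ ℚ-ring
      lem₂ : ∀ t k i S n → - 1ℚ * (t * t + k) * (- (n * ((t + t) * i)) + - (1ℚ - (t * t - k) * i + (1ℚ - (t * t - k) * i)) * S)
        ≡ ((t * t + k) + (t * t + k) - ((t * t - k) * ((t * t + k) * i) + (t * t - k) * ((t * t + k) * i))) * S + n * ((t + t) * ((t * t + k) * i))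
      lem₂ = solve-∀ ℚ-ring
      lem₃ : ∀ t k S n → ((t * t + k) + (t * t + k) - ((t * t - k) * 1ℚ + (t * t - k) * 1ℚ)) * S + n * ((t + t) * 1ℚ) ≡
          (k + k + (k + k)) * S + n * (t + t)
      lem₃ = solve-∀ ℚ-ring
      S : ℕ → ℚ
      S j = ∑ n′ (λ a → ι (suc a) * Y (suc a) j)
      z : ℕ → ℚ
      z j = 1ℚ - x b j + (1ℚ - x b j)
      S-full : ∀ j → S j ≡ ∑ (suc n′) (λ a → ι a * Y a j)
      S-full j = ≡.sym (≡.trans (∑-head n′ (λ a → ι a * Y a j))
          (≡.trans (≡.cong (_+ S j) (≡.trans (≡.cong (_* Y 0 j) ι-0) (ℚ.*-zeroˡ (Y 0 j)))) (ℚ.+-identityˡ (S j))))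
      eq : ∀ j → - 1ℚ * (t b j * t b j + κ j) * ∑ n′ (λ a → ι (suc a) * ((Y (suc a) j + Y (suc a) j) - Y
          (suc (suc a)) j - Y a j - z j * Y (suc a) j)) ≡
        (κ j + κ j + (κ j + κ j)) * ∑ (suc n′) (λ a → ι a * Y a j) + ι (suc n′) * (t b j + t b j)
      eq j = begin
        m * ∑ n′ (λ a → ι (suc a) * ((Y (suc a) j + Y (suc a) j) - Y (suc (suc a)) j - Y a j - z j * Y (suc a) j))
          ≡⟨ ≡.cong (m *_) (≡.trans (∑-cong n′ λ a _ → lem₁ (ι (suc a)) ((Y (suc a) j + Y (suc a) j) - Y (suc (suc a)) j - Y a j) (z j) (Y (suc a) j))
               (≡.trans (∑-+ n′ _ _) (≡.cong₂ _+_ (≡.trans (summation n′ j) (Y-boundary j)) (∑-*ˡ n′ (- z j) _)))) ⟩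
        m * (- (ι (suc n′) * y b j) + - z j * S j)
          ≡⟨ ≡.cong₂ (λ u v → m * (- (ι (suc n′) * u) + - (1ℚ - v + (1ℚ - v)) * S j)) (y-¬div b≢0 j) (x-¬div b≢0 j) ⟩
        m * (- (ι (suc n′) * y₀ b j) + - (1ℚ - x₀ b j + (1ℚ - x₀ b j)) * S j)
          ≡⟨ lem₂ (t b j) (κ j) (i b j) (S j) (ι (suc n′)) ⟩
        (den b j + den b j - ((t b j * t b j - κ j) * (den b j * i b j) + (t b j * t b j - κ j) * (den b j * i b j))) * S j + ι
            (suc n′) * ((t b j + t b j) * (den b j * i b j))
          ≡⟨ ≡.cong (λ u → (den b j + den b j - ((t b j * t b j - κ j) * u + (t b j * t b j - κ j) * u)) * S j + ι (suc n′) *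
              ((t b j + t b j) * u)) (i-inverse b j) ⟩
        _ ≡⟨ lem₃ (t b j) (κ j) (S j) (ι (suc n′)) ⟩
        (κ j + κ j + (κ j + κ j)) * S j + ι (suc n′) * (t b j + t b j)
          ≡⟨ ≡.cong (λ s → (κ j + κ j + (κ j + κ j)) * s + ι (suc n′) * (t b j + t b j)) (S-full j) ⟩
        _ ∎
        where m = - 1ℚ * (t b j * t b j + κ j)

-- Odd functions annihilating all S(x)

module OddAnnihilators (n′ : ℕ) (2<n : 2 ℕ.< suc n′) where
  open RationalInequalities
  open AbelSummation
  open NullSequences
  open EisensteinSums n′
  open AdditionTheorem n′
  open UnitsModulo n′

  private
    +≋⇒Div : ∀ {a b} → a ≋ b → Div (ℤ.+ a ℤ.- ℤ.+ b)
    +≋⇒Div {a} {b} (mk≋ eq) = ℤ∣.divides (ℤ.+ (a ℕ./ n) ℤ.- ℤ.+ (b ℕ./ n))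
        (≡.trans (≡.cong₂ (λ u v → ℤ.+ u ℤ.- ℤ.+ v) (ℕ.m≡m%n+[m/n]*n a n) (ℕ.m≡m%n+[m/n]*n b n))
      (≡.trans (≡.cong₂ (λ u v → ℤ.+ (a ℕ.% n) ℤ.+ u ℤ.- (ℤ.+ (b ℕ.% n) ℤ.+ v)) (ℤ.pos-* (a ℕ./ n) n) (ℤ.pos-* (b ℕ./ n) n))
      (≡.trans (≡.cong (λ u → ℤ.+ u ℤ.+ ℤ.+ (a ℕ./ n) ℤ.* ℤ.+ n ℤ.- (ℤ.+ (b ℕ.% n) ℤ.+ ℤ.+ (b ℕ./ n) ℤ.* ℤ.+ n)) eq)
        (lem (ℤ.+ (b ℕ.% n)) (ℤ.+ (a ℕ./ n)) (ℤ.+ (b ℕ./ n)) (ℤ.+ n)))))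
      where
      lem : ∀ r p q n → r ℤ.+ p ℤ.* n ℤ.+ ℤ.- (r ℤ.+ q ℤ.* n) ≡ (p ℤ.+ ℤ.- q) ℤ.* n
      lem = ℤ-Solver.solve-∀

    Div⇒≋ : ∀ {a b} → Div (ℤ.+ a ℤ.- ℤ.+ b) → a ≋ b
    Div⇒≋ {a} {b} d with ℕ.≤-total b a
    ... | inj₁ b≤a = ordered b≤a d
      where
      ordered : ∀ {a b} → b ℕ.≤ a → Div (ℤ.+ a ℤ.- ℤ.+ b) → a ≋ b
      ordered {a} {b} b≤a d with ℤ∣.∣⇒∣ᵤ (div-≡ (≡.trans (ℤ.m-n≡m⊖n a b) (ℤ.⊖-≥ b≤a)) d)
      ... | ℕ.divides q eq = ≋-trans (≋-reflexive (≡.trans (≡.sym (ℕ.m+[n∸m]≡n b≤a)) (≡.cong (b ℕ.+_) eq))) (+-kn-≋ b q)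
    ... | inj₂ a≤b with ℤ∣.∣⇒∣ᵤ (div-≡ (≡.trans (lem (ℤ.+ a) (ℤ.+ b)) (≡.trans (ℤ.m-n≡m⊖n b a) (ℤ.⊖-≥ a≤b))) (div-neg d))
      where
      lem : ∀ a b → ℤ.- (a ℤ.+ ℤ.- b) ≡ b ℤ.+ ℤ.- a
      lem = ℤ-Solver.solve-∀
    ... | ℕ.divides q eq = ≋-sym (≋-trans (≋-reflexive (≡.trans (≡.sym (ℕ.m+[n∸m]≡n a≤b)) (≡.cong (a ℕ.+_) eq))) (+-kn-≋ a q))

    ¬Div-small : ∀ a → 1 ℕ.≤ a → a ℕ.< n → ¬ Div (ℤ.+ a)
    ¬Div-small (suc a) _ a<n d = ℕ.<⇒≱ a<n (ℕ.∣⇒≤ (ℤ∣.∣⇒∣ᵤ d))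

    ¬Div-unit : ∀ {u} → Unit u → ¬ Div (ℤ.+ u)
    ¬Div-unit {u} (mkUnit uu) d = ℕ.<⇒≱ (ℕ.<-trans (s≤s (s≤s z≤n)) 2<n)
      (ℕ.∣⇒≤ (≡.subst (n ℕ.∣_) uu (ℕ.gcd-greatest (ℤ∣.∣⇒∣ᵤ d) ℕ.∣-refl)))

  -- From here on only the periodicity of the sine and the expansion itself matter; how y arises
  -- from the truncated cotangents is hidden.
  record SineExpansion : Set where
    field
      y          : ℤ → ℕ → ℚ
      y-periodic : ∀ r s → Div (r ℤ.- s) → ∀ j → y r j ≡ y s j
      κ₄         : ℕ → ℚ
      expansion  : ∀ b → ¬ Div b → Small (λ j → κ₄ j * ∑ n (λ a → ι a * y (ℤ.+ a ℤ.* b) j) + ι n * (T (size j) b + T (size j) b))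

  abstract
    sineExpansion : SineExpansion
    sineExpansion = record
      { y          = D.y
      ; y-periodic = D.y-periodic
      ; κ₄         = λ j → κ (size j) + κ (size j) + (κ (size j) + κ (size j))
      ; expansion  = D.fourier
      }
      where
      module D = DoubleAngle n′ (λ r j → T (size j) r) (λ j → κ (size j)) κ₀ 0<κ₀ κ≥
        (κ-bounded (¬Div-small 1 ℕ.≤-refl (ℕ.<-trans (s≤s (s≤s z≤n)) 2<n)) (¬Div-small 2 (s≤s z≤n) 2<n))
        (λ r j → T-odd (size j) r) (λ r s d j → T-periodic (size j) {r} {s} d) T-bounded (λ r s → defect {r} {s})

  open SineExpansion sineExpansion

  -- `n′` is n - 1 and represents -1 modulo n throughout.
  n′*n′≋1 : n′ ℕ.* n′ ≋ 1
  n′*n′≋1 = ≋-trans (≋-sym (mk≋ (ℕ.[m+n]%n≡m%n (n′ ℕ.* n′) n))) (≋-trans (≋-reflexive (lem n′)) (+-kn-≋ 1 n′))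
    where
    lem : ∀ m → m ℕ.* m ℕ.+ (1 ℕ.+ m) ≡ 1 ℕ.+ m ℕ.* (1 ℕ.+ m)
    lem = ℕ-Solver.solve-∀

  unit-n′ : Unit n′
  unit-n′ = unit-*⁻ˡ n′ n′ (unit-≋ (≋-sym n′*n′≋1) unit-1)

  -- For odd f, pairing with the residue r of g a is half of pairing with r - (-r mod n) = 2 n
  -- B₁(r/n). So `vanishing` says that f annihilates S(a/n), with the correction -1/2 left out.
  record OddAnnihilator (f : ℕ → ℚ) : Set where
    field
      cong-≋    : ∀ {a b} → a ≋ b → f a ≡ f b
      nonunit   : ∀ {a} → ¬ Unit a → f a ≡ 0ℚ
      odd       : ∀ a → f (n′ ℕ.* a) ≡ - f a
      vanishing : ∀ a → ∑ n (λ g → f g * ι (g ℕ.* a ℕ.% n)) ≡ 0ℚ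

  -- The annihilators are stable under translation by units; this extends the vanishing of Σ F(k)/k
  -- to Σ F(h k)/k for every unit h.
  dilate : (ℕ → ℚ) → ℕ → ℕ → ℚ
  dilate f h g = f (h ⁻¹ ℕ.* g)

  dilate-annihilator : ∀ {f h} → Unit h → OddAnnihilator f → OddAnnihilator (dilate f h)
  dilate-annihilator {f} {h} uh ann = record
    { cong-≋    = λ a≋b → cong-≋ (≋-*ˡ (h ⁻¹) a≋b)
    ; nonunit   = λ ¬ua → nonunit λ u → ¬ua (unit-*⁻ʳ (h ⁻¹) _ u)
    ; odd       = λ a → ≡.trans (≡.cong f (lem (h ⁻¹) n′ a)) (odd (h ⁻¹ ℕ.* a))
    ; vanishing = λ a → ≡.trans (≡.sym (∑-unit ℚ.+-*-commutativeRing uh (λ g → dilate f h g * ι (g ℕ.* a ℕ.% n))))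
        (≡.trans (∑-cong n λ g _ → ≡.cong₂ _*_
            (cong-≋ (≋-trans (≋-*ˡ (h ⁻¹) (%-≋ (h ℕ.* g))) (*-undo (h ⁻¹) h (⁻¹-inverseˡ uh) g)))
            (≡.cong ι (%≡ (≋-trans (≋-*ʳ a (%-≋ (h ℕ.* g))) (≋-reflexive (lem₂ h g a))))))
          (vanishing (h ℕ.* a)))
    }
    where
    open OddAnnihilator ann
    lem : ∀ i m a → i ℕ.* (m ℕ.* a) ≡ m ℕ.* (i ℕ.* a)
    lem = ℕ-Solver.solve-∀
    lem₂ : ∀ h g a → h ℕ.* g ℕ.* a ≡ g ℕ.* (h ℕ.* a)
    lem₂ = ℕ-Solver.solve-∀

  open Choice

  invert : (ℕ → ℚ) → ℕ → ℚ
  invert f k = choose (unit? k) (f (k ⁻¹)) 0ℚ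

  invert-unit : ∀ f {k} → Unit k → invert f k ≡ f (k ⁻¹)
  invert-unit f {k} = choose-yes (unit? k)

  invert-nonunit : ∀ f {k} → ¬ Unit k → invert f k ≡ 0ℚ
  invert-nonunit f {k} = choose-no (unit? k)

  invert-≋ : ∀ f {a b} → a ≋ b → invert f a ≡ invert f b
  invert-≋ f {a} {b} a≋b = cases (unit? a)
    where
    cases : Dec (Unit a) → invert f a ≡ invert f b
    cases (yes ua) = ≡.trans (invert-unit f ua) (≡.trans (≡.cong f (⁻¹-≋ ua a≋b)) (≡.sym (invert-unit f (unit-≋ a≋b ua))))
    cases (no ¬ua) = ≡.trans (invert-nonunit f ¬ua) (≡.sym (invert-nonunit f λ ub → ¬ua (unit-≋ (≋-sym a≋b) ub)))

  invert-odd : ∀ {f} → OddAnnihilator f → ∀ k → invert f (n′ ℕ.* k) ≡ - invert f k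
  invert-odd {f} ann k = cases (unit? k)
    where
    open OddAnnihilator ann
    lem : ∀ m k i → m ℕ.* k ℕ.* (m ℕ.* i) ≡ m ℕ.* m ℕ.* (k ℕ.* i)
    lem = ℕ-Solver.solve-∀
    cases : Dec (Unit k) → invert f (n′ ℕ.* k) ≡ - invert f k
    cases (yes uk) = ≡.trans (invert-unit f u) (≡.trans (cong-≋
        (≋-sym (⁻¹-unique u (≋-trans (≋-reflexive (lem n′ k (k ⁻¹))) (≋-* n′*n′≋1 (⁻¹-inverse uk))))))
        (≡.trans (odd (k ⁻¹)) (≡.cong -_ (≡.sym (invert-unit f uk)))))
      where u = unit-* unit-n′ uk
    cases (no ¬uk) = ≡.trans (invert-nonunit f λ u → ¬uk (unit-*⁻ʳ n′ k u)) (≡.sym (≡.cong -_ (invert-nonunit f ¬uk)))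

  invert-dilate : ∀ {f} → OddAnnihilator f → ∀ {h} → Unit h → ∀ k → invert (dilate f h) k ≡ invert f (h ℕ.* k)
  invert-dilate {f} ann {h} uh k = cases (unit? k)
    where
    open OddAnnihilator ann
    lem : ∀ h k i l → h ℕ.* k ℕ.* (i ℕ.* l) ≡ h ℕ.* i ℕ.* (k ℕ.* l)
    lem = ℕ-Solver.solve-∀
    cases : Dec (Unit k) → invert (dilate f h) k ≡ invert f (h ℕ.* k)
    cases (yes uk) = ≡.trans (invert-unit (dilate f h) uk) (≡.trans
      (cong-≋ (⁻¹-unique (unit-* uh uk) (≋-trans (≋-reflexive (lem h k (h ⁻¹) (k ⁻¹))) (≋-* (⁻¹-inverse uh) (⁻¹-inverse uk)))))
      (≡.sym (invert-unit f (unit-* uh uk))))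
    cases (no ¬uk) = ≡.trans (invert-nonunit (dilate f h) ¬uk) (≡.sym (invert-nonunit f λ u → ¬uk (unit-*⁻ʳ h k u)))

  ∑-invert : ∀ {f} → OddAnnihilator f → ∑ n (invert f) ≡ 0ℚ
  ∑-invert {f} ann = self-negative (∑ n (invert f)) (≡.trans (≡.sym (∑-unit ℚ.+-*-commutativeRing unit-n′ (invert f)))
    (≡.trans (∑-cong n λ k _ → ≡.trans (invert-≋ f (%-≋ (n′ ℕ.* k))) (invert-odd ann k)) (∑-neg n (invert f))))
    where
    self-negative : ∀ s → s ≡ - s → s ≡ 0ℚ
    self-negative s s≡-s = ≡.trans (lem s) (≡.trans (≡.cong (λ u → ℚ.½ * (s + u)) s≡-s) (lem₂ s))
      where
      lem : ∀ s → s ≡ ℚ.½ * (s + s)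
      lem = solve-∀ ℚ-ring
      lem₂ : ∀ s → ℚ.½ * (s + - s) ≡ 0ℚ
      lem₂ = solve-∀ ℚ-ring

  module _ {f : ℕ → ℚ} (ann : OddAnnihilator f) where
    open OddAnnihilator ann

    private
      F = invert f

      -- Substituting g a for a turns a · y(a g⁻¹) into (g a mod n) · y(a), and for fixed a the sum
      -- over g vanishes. This is why the cotangents are taken at the inverses g⁻¹, and hence why F
      -- uses f at inverses.
      frequency-zero : ∀ j → ∑ n (λ g → f g * ∑ n (λ a → ι a * y (ℤ.+ a ℤ.* ℤ.+ (g ⁻¹)) j)) ≡ 0ℚ
      frequency-zero j = begin
        ∑ n (λ g → f g * ∑ n (λ a → ι a * y (ℤ.+ a ℤ.* ℤ.+ (g ⁻¹)) j))
          ≡⟨ ∑-cong n (λ g _ → reindex g (unit? g)) ⟩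
        ∑ n (λ g → f g * ∑ n (λ a → ι (g ℕ.* a ℕ.% n) * y (ℤ.+ a) j))
          ≡⟨ ∑-cong n (λ g _ → ≡.sym (∑-*ˡ n (f g) _)) ⟩
        ∑ n (λ g → ∑ n (λ a → f g * (ι (g ℕ.* a ℕ.% n) * y (ℤ.+ a) j)))
          ≡⟨ ∑-swap n n _ ⟩
        ∑ n (λ a → ∑ n (λ g → f g * (ι (g ℕ.* a ℕ.% n) * y (ℤ.+ a) j)))
          ≡⟨ ∑-zero n (λ a _ → ≡.trans (∑-cong n λ g _ → ≡.sym (ℚ.*-assoc (f g) _ _)) (≡.trans (∑-*ʳ n (y (ℤ.+ a) j) _)
               (≡.trans (≡.cong (_* y (ℤ.+ a) j) (vanishing a)) (ℚ.*-zeroˡ (y (ℤ.+ a) j))))) ⟩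
        0ℚ ∎
        where
        open ≡.≡-Reasoning
        lem : ∀ g a i → g ℕ.* a ℕ.* i ≡ g ℕ.* i ℕ.* a
        lem = ℕ-Solver.solve-∀
        reindex : ∀ g → Dec (Unit g) → f g * ∑ n (λ a → ι a * y (ℤ.+ a ℤ.* ℤ.+ (g ⁻¹)) j) ≡ f g * ∑ n (λ a → ι (g ℕ.* a ℕ.% n) * y (ℤ.+ a) j)
        reindex g (no ¬ug) = ≡.trans (≡.cong (_* ∑ n (λ a → ι a * y (ℤ.+ a ℤ.* ℤ.+ (g ⁻¹)) j)) (nonunit ¬ug))
          (≡.trans (ℚ.*-zeroˡ (∑ n (λ a → ι a * y (ℤ.+ a ℤ.* ℤ.+ (g ⁻¹)) j)))
          (≡.sym (≡.trans (≡.cong (_* ∑ n (λ a → ι (g ℕ.* a ℕ.% n) * y (ℤ.+ a) j)) (nonunit ¬ug))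
              (ℚ.*-zeroˡ (∑ n (λ a → ι (g ℕ.* a ℕ.% n) * y (ℤ.+ a) j))))))
        reindex g (yes ug) = ≡.cong (f g *_) (≡.trans (≡.sym (∑-unit ℚ.+-*-commutativeRing ug (λ a → ι a * y (ℤ.+ a ℤ.* ℤ.+ (g ⁻¹)) j)))
          (∑-cong n λ a _ → ≡.cong (ι (g ℕ.* a ℕ.% n) *_) (≡.trans (≡.cong (λ z → y z j) (≡.sym (ℤ.pos-* (g ℕ.* a ℕ.% n) (g ⁻¹))))
            (y-periodic (ℤ.+ ((g ℕ.* a ℕ.% n) ℕ.* g ⁻¹)) (ℤ.+ a)
                (+≋⇒Div (≋-trans (≋-*ʳ (g ⁻¹) (%-≋ (g ℕ.* a))) (≋-trans (≋-reflexive (lem g a (g ⁻¹)))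
              (≋-trans (≋-*ʳ a (⁻¹-inverse ug)) (≋-reflexive (ℕ.*-identityˡ a)))))) j))))

      pick-inverse : ∀ k → ∑ n (λ g → f g * θ (ℤ.- (ℤ.+ (g ⁻¹))) k) ≡ F k
      pick-inverse k = cases (unit? k)
        where
        nonzero⇒ : ∀ g → Unit g → Div (ℤ.+ k ℤ.+ ℤ.- (ℤ.+ (g ⁻¹))) → Unit k × g ≋ k ⁻¹
        nonzero⇒ g ug d = uk , ⁻¹-unique uk (≋-trans (≋-*ʳ g k≋) (⁻¹-inverseˡ ug))
          where
          k≋ = Div⇒≋ d
          uk = unit-≋ (≋-sym k≋) (⁻¹-unit ug)
        term-zero : ∀ g → ¬ (Unit g × Unit k × g ≋ k ⁻¹) → f g * θ (ℤ.- (ℤ.+ (g ⁻¹))) k ≡ 0ℚ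
        term-zero g none = go (unit? g)
          where
          go : Dec (Unit g) → f g * θ (ℤ.- (ℤ.+ (g ⁻¹))) k ≡ 0ℚ
          go (no ¬ug) = ≡.trans (≡.cong (_* θ (ℤ.- (ℤ.+ (g ⁻¹))) k) (nonunit ¬ug)) (ℚ.*-zeroˡ (θ (ℤ.- (ℤ.+ (g ⁻¹))) k))
          go (yes ug) = ≡.trans (≡.cong (f g *_) (𝟙-no (div? (ℤ.+ k ℤ.+ ℤ.- (ℤ.+ (g ⁻¹)))) λ d → none (ug , nonzero⇒ g ug d))) (ℚ.*-zeroʳ (f g))
        cases : Dec (Unit k) → ∑ n (λ g → f g * θ (ℤ.- (ℤ.+ (g ⁻¹))) k) ≡ F k
        cases (no ¬uk) = ≡.trans (∑-zero n λ g _ → term-zero g λ (_ , uk , _) → ¬uk uk) (≡.sym (invert-nonunit f ¬uk))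
        cases (yes uk) = ≡.trans (∑-single n (λ g → f g * θ (ℤ.- (ℤ.+ (g ⁻¹))) k) (⁻¹-< k) λ g g<n g≢ → term-zero g
            λ (_ , _ , g≋) → g≢ (≋⇒≡ g≋ g<n (⁻¹-< k)))
          (≡.trans (≡.cong (f (k ⁻¹) *_) (𝟙-yes (div? (ℤ.+ k ℤ.+ ℤ.- (ℤ.+ (k ⁻¹ ⁻¹)))) (+≋⇒Div (⁻¹-unique (⁻¹-unit uk) (⁻¹-inverseˡ uk)))))
            (≡.trans (ℚ.*-identityʳ (f (k ⁻¹))) (≡.sym (invert-unit f uk))))

      pick-negative : ∀ k → ∑ n (λ g → f g * θ (ℤ.+ (g ⁻¹)) k) ≡ - F k
      pick-negative k = ≡.trans (∑-cong n λ g _ → ≡.cong (f g *_) (flip (g ⁻¹))) (≡.trans (pick-inverse (n′ ℕ.* k)) (invert-odd ann k))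
        where
        e₁ : ∀ m k g → ℤ.- (k ℤ.+ g) ℤ.+ (ℤ.+ 1 ℤ.+ m) ℤ.* k ≡ m ℤ.* k ℤ.+ ℤ.- g
        e₁ = ℤ-Solver.solve-∀
        e₂ : ∀ m k g → ℤ.- (m ℤ.* k ℤ.+ ℤ.- g) ℤ.+ (ℤ.+ 1 ℤ.+ m) ℤ.* k ≡ k ℤ.+ g
        e₂ = ℤ-Solver.solve-∀
        period : Div (ℤ.+ n ℤ.* ℤ.+ k)
        period = ℤ∣.divides (ℤ.+ k) (ℤ.*-comm (ℤ.+ n) (ℤ.+ k))
        flip : ∀ g → θ (ℤ.+ g) k ≡ θ (ℤ.- (ℤ.+ g)) (n′ ℕ.* k)
        flip g = δ-cong
          (λ d → div-≡ (≡.trans (e₁ (ℤ.+ n′) (ℤ.+ k) (ℤ.+ g)) (≡.cong (ℤ._+ ℤ.- (ℤ.+ g)) (≡.sym (ℤ.pos-* n′ k)))) (div-+ (div-neg d) period))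
          (λ d → div-≡ (e₂ (ℤ.+ n′) (ℤ.+ k) (ℤ.+ g)) (div-+ (div-neg (div-≡ (≡.cong (ℤ._+ ℤ.- (ℤ.+ g)) (ℤ.pos-* n′ k)) d)) period))

      -- The classes of g⁻¹ and -g⁻¹ pick out F(k) and -F(k). The minus sign of 1/(-k) makes the two
      -- contributions add up, hence the factor 2.
      ∑fT : ∀ N → ∑ n (λ g → f g * T N (ℤ.+ (g ⁻¹))) ≡ (1ℚ + 1ℚ) * ∑ N (λ i → F (suc i) * inv (suc i))
      ∑fT N = begin
        ∑ n (λ g → f g * T N (ℤ.+ (g ⁻¹)))
          ≡⟨ ∑-cong n (λ g _ → ≡.trans (≡.cong (f g *_) (T-explicit N (ℤ.+ (g ⁻¹)))) (≡.sym (∑-*ˡ N (f g) _))) ⟩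
        ∑ n (λ g → ∑ N (λ i → f g * ((θ (ℤ.- (ℤ.+ (g ⁻¹))) (suc i) - θ (ℤ.+ (g ⁻¹)) (suc i)) * inv (suc i))))
          ≡⟨ ∑-swap n N _ ⟩
        ∑ N (λ i → ∑ n (λ g → f g * ((θ (ℤ.- (ℤ.+ (g ⁻¹))) (suc i) - θ (ℤ.+ (g ⁻¹)) (suc i)) * inv (suc i))))
          ≡⟨ ∑-cong N (λ i _ → ≡.trans (∑-cong n λ g _ → lem₁ (f g) (θ (ℤ.- (ℤ.+ (g ⁻¹))) (suc i)) (θ (ℤ.+ (g ⁻¹)) (suc i)) (inv (suc i)))
               (≡.trans (∑-*ʳ n (inv (suc i)) _) (≡.cong (_* inv (suc i)) (≡.trans (∑-+ n _ _) (≡.cong₂ _+_ (pick-inverse (suc i))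
                   (≡.trans (∑-neg n _) (≡.cong -_ (pick-negative (suc i))))))))) ⟩
        ∑ N (λ i → (F (suc i) + - - F (suc i)) * inv (suc i))
          ≡⟨ ≡.trans (∑-cong N λ i _ → lem₂ (F (suc i)) (inv (suc i))) (∑-*ˡ N (1ℚ + 1ℚ) _) ⟩
        (1ℚ + 1ℚ) * ∑ N (λ i → F (suc i) * inv (suc i)) ∎
        where
        open ≡.≡-Reasoning
        lem₁ : ∀ f a b i → f * ((a - b) * i) ≡ (f * a + - (f * b)) * i
        lem₁ = solve-∀ ℚ-ring
        lem₂ : ∀ a i → (a + - - a) * i ≡ (1ℚ + 1ℚ) * (a * i)
        lem₂ = solve-∀ ℚ-ring

      -- In the expansions at b = g⁻¹, weighted by f(g), the sine part cancels and the cotangent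
      -- part is 2 n · 2 Σ F(k)/k; the factor 1/(4 n) undoes this.
      L-small : Small (λ j → ∑ (size j) (λ i → F (suc i) * inv (suc i)))
      L-small = small-≡ eq (small-* (bdd-const (inv n * (ℚ.½ * ℚ.½))) (small-∑ n λ g _ → per-unit g (unit? g)))
        where
        open ≡.≡-Reasoning
        A : ℕ → ℕ → ℚ
        A g j = κ₄ j * ∑ n (λ a → ι a * y (ℤ.+ a ℤ.* ℤ.+ (g ⁻¹)) j)
        B : ℕ → ℕ → ℚ
        B g j = ι n * (T (size j) (ℤ.+ (g ⁻¹)) + T (size j) (ℤ.+ (g ⁻¹)))
        per-unit : ∀ g → Dec (Unit g) → Small (λ j → f g * (A g j + B g j))
        per-unit g (yes ug) = small-* (bdd-const (f g)) (expansion (ℤ.+ (g ⁻¹)) (¬Div-unit (⁻¹-unit ug)))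
        per-unit g (no ¬ug) = small-0 λ j → ≡.trans (≡.cong (_* (A g j + B g j)) (nonunit ¬ug)) (ℚ.*-zeroˡ (A g j + B g j))
        lem₁ : ∀ f k s n t → f * (k * s + n * (t + t)) ≡ k * (f * s) + (n + n) * (f * t)
        lem₁ = solve-∀ ℚ-ring
        lem₂ : ∀ i n k L → i * (ℚ.½ * ℚ.½) * (k * 0ℚ + (n + n) * ((1ℚ + 1ℚ) * L)) ≡ n * i * L
        lem₂ = solve-∀ ℚ-ring
        eq : ∀ j → inv n * (ℚ.½ * ℚ.½) * ∑ n (λ g → f g * (A g j + B g j)) ≡ ∑ (size j) (λ i → F (suc i) * inv (suc i))
        eq j = begin
          c * ∑ n (λ g → f g * (A g j + B g j))
            ≡⟨ ≡.cong (c *_) (≡.trans (∑-cong n λ g _ → lem₁ (f g) k (s g) (ι n) (T (size j) (ℤ.+ (g ⁻¹))))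
                (≡.trans (∑-+ n _ _) (≡.cong₂ _+_ (∑-*ˡ n k _) (∑-*ˡ n (ι n + ι n) _)))) ⟩
          c * (k * ∑ n (λ g → f g * s g) + (ι n + ι n) * ∑ n (λ g → f g * T (size j) (ℤ.+ (g ⁻¹))))
            ≡⟨ ≡.cong₂ (λ u v → c * (k * u + (ι n + ι n) * v)) (frequency-zero j) (∑fT (size j)) ⟩
          c * (k * 0ℚ + (ι n + ι n) * ((1ℚ + 1ℚ) * L))
            ≡⟨ lem₂ (inv n) (ι n) k L ⟩
          ι n * inv n * L
            ≡⟨ ≡.trans (≡.cong (_* L) (ι-inv n′)) (ℚ.*-identityˡ L) ⟩
          L ∎
          where
          c = inv n * (ℚ.½ * ℚ.½)
          k = κ₄ j
          s : ℕ → ℚ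
          s g = ∑ n (λ a → ι a * y (ℤ.+ a ℤ.* ℤ.+ (g ⁻¹)) j)
          L = ∑ (size j) (λ i → F (suc i) * inv (suc i))

    -- `L-small` speaks only of the lengths (m + 1)². The stretch from m + 1 to (m + 1)² pairs the
    -- bounded sums of F with the decreasing 1/k, so it too is of order 1/(m + 1).
    L-bound : Σ ℚ λ C → ∀ m → ∣ ∑ (suc m) (λ j → F (suc j) * inv (suc j)) ∣ ≤ C * inv (suc m)
    L-bound = (Cₛ + (C₀ + C₀)) , bound
      where
      Cₛ = constant L-small
      ≋-n+ : ∀ a → n ℕ.+ a ≋ a
      ≋-n+ a = ≋-trans (≋-reflexive (≡.trans (ℕ.+-comm n a) (≡.cong (a ℕ.+_) (≡.sym (ℕ.*-identityˡ n))))) (+-kn-≋ a 1)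
      F-periodic : Periodic n F
      F-periodic i = invert-≋ f (≋-n+ i)
      C₀ = ∑ n (λ i → ∣ F i ∣)
      ∑F≤ : ∀ m → ∣ ∑ m F ∣ ≤ C₀
      ∑F≤ = mean-zero-∑-bounded {n} {F} F-periodic (∑-invert ann)
      lem₁ : ∀ a b → a ≡ (a + b) - b
      lem₁ = solve-∀ ℚ-ring
      bound : ∀ m → ∣ ∑ (suc m) (λ j → F (suc j) * inv (suc j)) ∣ ≤ (Cₛ + (C₀ + C₀)) * inv (suc m)
      bound m = ≡.subst (λ x → ∣ x ∣ ≤ (Cₛ + (C₀ + C₀)) * inv (suc m)) (≡.sym eq)
        (ℚ.≤-trans (∣-∣≤ (decay L-small m) tail) (ℚ.≤-reflexive (≡.sym (ℚ.*-distribʳ-+ (inv (suc m)) Cₛ (C₀ + C₀)))))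
        where
        G : ℕ → ℚ
        G j = F (suc j) * inv (suc j)
        M = m ℕ.* suc m
        rest = ∑ M (λ j → G (suc m ℕ.+ j))
        eq : ∑ (suc m) G ≡ ∑ (size m) G - rest
        eq = ≡.trans (lem₁ (∑ (suc m) G) rest) (≡.cong (_- rest) (≡.trans (≡.sym (∑-split (suc m) M G)) (≡.cong (λ k → ∑ k G) (≡.sym (size≡ m)))))
        tail : ∣ rest ∣ ≤ (C₀ + C₀) * inv (suc m)
        tail = ℚ.≤-trans (abel-antitone {λ j → F (suc (suc m) ℕ.+ j)} {λ j → inv (suc (suc m ℕ.+ j))} (shift-bounded {F} ∑F≤ (suc (suc m)))
            (λ j → 0≤inv (suc (suc m ℕ.+ j))) (λ j → inv-anti (ℕ.+-monoʳ-≤ (suc m) (ℕ.n≤1+n j))) M)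
          (*-monoˡ (C₀ + C₀) (0≤p+q 0≤C₀ 0≤C₀) (inv-anti (ℕ.≤-trans (ℕ.n≤1+n m) (ℕ.m≤m+n (suc m) 0))))
          where 0≤C₀ = ∑-nonneg n λ i _ → ℚ.0≤∣p∣ (F i)

  -- As f(h) = F(h⁻¹), it is enough that F vanishes. The bounds on Σ F(h k)/k come from the dilates
  -- of f when h is a unit and are trivial otherwise; they depend on h modulo n only, so one
  -- constant serves all h.
  annihilator-zero : ∀ {f} → OddAnnihilator f → ∀ {h} → Unit h → f h ≡ 0ℚ
  annihilator-zero {f} ann {h} uh = ≡.trans (cong-≋ (⁻¹-unique (⁻¹-unit uh) (⁻¹-inverseˡ uh)))
      (≡.trans (≡.sym (invert-unit f (⁻¹-unit uh))) (Nonvanishing.F≡0 n′ F (invert-≋ f) (invert-nonunit f) (∑-invert ann) C L (h ⁻¹) (⁻¹-< h)))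
    where
    open OddAnnihilator ann
    F = invert f
    zero-sum : ∀ h m → ¬ Unit h → ∑ (suc m) (λ j → F (h ℕ.* suc j) * inv (suc j)) ≡ 0ℚ
    zero-sum h m ¬uh = ∑-zero (suc m) λ j _ → ≡.trans (≡.cong (_* inv (suc j)) (invert-nonunit f λ u → ¬uh
        (unit-*⁻ˡ h (suc j) u))) (ℚ.*-zeroˡ (inv (suc j)))
    Cₕ : ∀ h → Dec (Unit h) → ℚ
    Cₕ h (yes uh) = proj₁ (L-bound (dilate-annihilator uh ann))
    Cₕ h (no _)   = 0ℚ
    Lₕ : ∀ h (D : Dec (Unit h)) m → ∣ ∑ (suc m) (λ j → F (h ℕ.* suc j) * inv (suc j)) ∣ ≤ Cₕ h D * inv (suc m)
    Lₕ h (yes uh) m = ≡.subst (λ x → ∣ x ∣ ≤ Cₕ h (yes uh) * inv (suc m)) (∑-cong (suc m) λ j _ → ≡.cong (_* inv (suc j))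
        (invert-dilate ann uh (suc j)))
      (proj₂ (L-bound (dilate-annihilator uh ann)) m)
    Lₕ h (no ¬uh) m = ℚ.≤-reflexive (≡.trans (≡.cong ∣_∣ (zero-sum h m ¬uh)) (≡.sym (ℚ.*-zeroˡ (inv (suc m)))))
    C = ∑ n (λ h → ∣ Cₕ h (unit? h) ∣)
    L : ∀ h m → ∣ ∑ (suc m) (λ j → F (h ℕ.* suc j) * inv (suc j)) ∣ ≤ C * inv (suc m)
    L h m = ≡.subst (λ x → ∣ x ∣ ≤ C * inv (suc m)) (∑-cong (suc m) λ j _ → ≡.cong (_* inv (suc j)) (invert-≋ f (≋-*ʳ (suc j) (%-≋ h))))
      (ℚ.≤-trans (Lₕ h′ (unit? h′) m) (*-monoʳ (inv (suc m)) (0≤inv (suc m)) (ℚ.≤-trans (p≤∣p∣ (Cₕ h′ (unit? h′)))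
        (∑-term≤ n (λ h → ∣ Cₕ h (unit? h) ∣) (λ h _ → ℚ.0≤∣p∣ (Cₕ h (unit? h))) (ℕ.m%n<n h n)))))
      where h′ = h ℕ.% n

-- The integral span of the vectors S(x)

module StickelbergerSpan (n′ : ℕ) (2<n : 2 ℕ.< suc n′) where
  open UnitsModulo n′
  open OddAnnihilators n′ 2<n
  private
    module ℤ∑ = FiniteSum ℤ.+-*-commutativeRing
  open Fredholm using (dot; fredholm; InSpan; Separated)

  -- 2 n B₁(r / n) for a residue r.
  bernoulli : ℕ → ℤ
  bernoulli zero    = 0ℤ
  bernoulli (suc r) = ℤ.+ (2 ℕ.* suc r) ℤ.- ℤ.+ n

  negate : ℕ → ℕ
  negate a = n′ ℕ.* a ℕ.% n

  private
    n∸-≋ : ∀ a → a ℕ.≤ n → n ℕ.∸ a ≋ n′ ℕ.* a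
    n∸-≋ a a≤n = ≋-trans (≋-sym (+-kn-≋ (n ℕ.∸ a) a)) (≋-trans (≋-reflexive eq) (+-kn-≋ (n′ ℕ.* a) 1))
      where
      eq : n ℕ.∸ a ℕ.+ a ℕ.* n ≡ n′ ℕ.* a ℕ.+ 1 ℕ.* n
      eq = ≡.trans (≡.cong (n ℕ.∸ a ℕ.+_) (lem a n′)) (≡.trans (≡.sym (ℕ.+-assoc (n ℕ.∸ a) a (n′ ℕ.* a)))
        (≡.trans (≡.cong (ℕ._+ n′ ℕ.* a) (ℕ.m∸n+n≡m a≤n)) (lem₂ n (n′ ℕ.* a))))
        where
        lem : ∀ a m → a ℕ.* (1 ℕ.+ m) ≡ a ℕ.+ m ℕ.* a
        lem = ℕ-Solver.solve-∀
        lem₂ : ∀ n x → n ℕ.+ x ≡ x ℕ.+ 1 ℕ.* n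
        lem₂ = ℕ-Solver.solve-∀

  negate-∸ : ∀ a → a ℕ.≤ n → (n ℕ.∸ a) ℕ.% n ≡ negate a
  negate-∸ a a≤n = %≡ (n∸-≋ a a≤n)

  negate-pos : ∀ r → suc r ℕ.< n → negate (suc r) ≡ n ℕ.∸ suc r
  negate-pos r r<n = ≡.trans (≡.sym (negate-∸ (suc r) (ℕ.<⇒≤ r<n))) (ℕ.m<n⇒m%n≡m (s≤s (ℕ.m∸n≤m n′ r)))

  negate-≋ : ∀ a → negate a ≋ n′ ℕ.* a
  negate-≋ a = %-≋ (n′ ℕ.* a)

  negate-< : ∀ a → negate a ℕ.< n
  negate-< a = ℕ.m%n<n (n′ ℕ.* a) n

  negate-unit : ∀ {a} → Unit a → Unit (negate a)
  negate-unit {a} ua = unit-≋ (≋-sym (negate-≋ a)) (unit-* unit-n′ ua)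

  negate-involutive : ∀ {a} → a ℕ.< n → negate (negate a) ≡ a
  negate-involutive {a} a<n = ≋⇒≡ (≋-trans (negate-≋ (negate a)) (≋-trans (≋-*ˡ n′ (negate-≋ a)) (*-undo n′ n′ n′*n′≋1 a))) (negate-< (negate a)) a<n

  -- One expression covers r = 0 too, where B₁ takes its exceptional value. It makes oddness
  -- immediate and links the Bernoulli values to the bare residues in `vanishing`.
  bernoulli-difference : ∀ r → r ℕ.< n → ℤ.+ r ℤ.- ℤ.+ negate r ≡ bernoulli r
  bernoulli-difference zero    _   = ≡.cong (λ x → 0ℤ ℤ.- ℤ.+ (x ℕ.% n)) (ℕ.*-zeroʳ n′)
  bernoulli-difference (suc r) r<n = ≡.trans (≡.cong (λ x → ℤ.+ suc r ℤ.- ℤ.+ x) (negate-pos r r<n))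
    (≡.trans (≡.cong (λ x → ℤ.+ suc r ℤ.- x) (≡.sym (≡.trans (ℤ.m-n≡m⊖n n (suc r)) (ℤ.⊖-≥ (ℕ.<⇒≤ r<n)))))
      (≡.trans (lem (ℤ.+ suc r) (ℤ.+ n)) (≡.cong (λ x → ℤ.+ (suc r ℕ.+ x) ℤ.- ℤ.+ n) (≡.sym (ℕ.+-identityʳ (suc r))))))
    where
    lem : ∀ r n → r ℤ.+ ℤ.- (n ℤ.+ ℤ.- r) ≡ r ℤ.+ r ℤ.+ ℤ.- n
    lem = ℤ-Solver.solve-∀

  bernoulli-odd : ∀ a b → bernoulli ((negate a ℕ.* b) ℕ.% n) ≡ ℤ.- bernoulli (a ℕ.* b ℕ.% n)
  bernoulli-odd a b = ≡.trans (≡.cong bernoulli (%≡ (≋-trans (≋-*ʳ b (negate-≋ a)) (≋-trans (≋-reflexive (ℕ.*-assoc n′ a b))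
      (≋-*ˡ n′ (≋-sym (%-≋ (a ℕ.* b))))))))
    (≡.trans (≡.sym (bernoulli-difference (negate r) (negate-< r))) (≡.trans (≡.cong (λ x → ℤ.+ negate r ℤ.- ℤ.+ x) (negate-involutive r<n))
      (≡.trans (lem (ℤ.+ negate r) (ℤ.+ r)) (≡.cong ℤ.-_ (bernoulli-difference r r<n)))))
    where
    r = a ℕ.* b ℕ.% n
    r<n = ℕ.m%n<n (a ℕ.* b) n
    lem : ∀ a b → a ℤ.+ ℤ.- b ≡ ℤ.- (b ℤ.+ ℤ.- a)
    lem = ℤ-Solver.solve-∀

  -- The integral vector 2 n S(a/n), extended by 0 to the residues that are not units.
  stickelberger : ℕ → ℕ → ℤ
  stickelberger a g = ℤ∑.𝟙 (unit? g) ℤ.* bernoulli (g ℕ.* a ℕ.% n)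

  odd-basis : ℕ → ℕ → ℤ
  odd-basis h g = ℤ∑.𝟙 (g ℕ.≟ h) ℤ.- ℤ∑.𝟙 (g ℕ.≟ negate h)

  private
    module _ (f : ℕ → ℤ) (f⊥ : ∀ a → a ℕ.< n → dot n f (stickelberger a) ≡ 0ℤ) where
      open RationalInequalities
      open IntegerEmbedding ℚ.+-*-commutativeRing ι ι-0 ι-suc using (ιℤ; ιℤ-+; ιℤ-neg; ιℤ-*; ιℤ-∑; ιℤ-𝟙)

      -- A functional that kills all S(x) need not be odd, but its antisymmetrisation is, and it
      -- still kills them because S(x) is odd.
      f̂ : ℕ → ℚ
      f̂ a = 𝟙 (unit? a) * ιℤ (f (a ℕ.% n) ℤ.- f (negate a))

      annihilator : OddAnnihilator f̂
      annihilator = record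
        { cong-≋ = λ {a} {b} a≋b → ≡.cong₂ _*_ (𝟙-cong (unit? a) (unit? b) (unit-≋ a≋b) (unit-≋ (≋-sym a≋b)))
            (≡.cong₂ (λ x y → ιℤ (f x ℤ.- f y)) (%≡ a≋b) (%≡ (≋-*ˡ n′ a≋b)))
        ; nonunit = λ {a} ¬ua → ≡.trans (≡.cong (_* ιℤ (f (a ℕ.% n) ℤ.- f (negate a))) (𝟙-no (unit? a) ¬ua)) (ℚ.*-zeroˡ (ιℤ (f (a ℕ.% n) ℤ.- f (negate a))))
        ; odd = λ a → ≡.trans (≡.cong₂ _*_ (𝟙-cong (unit? (n′ ℕ.* a)) (unit? a) (unit-*⁻ʳ n′ a) (unit-* unit-n′))
            (≡.trans (≡.cong (λ x → ιℤ (f (negate a) ℤ.- f x)) (%≡ (*-undo n′ n′ n′*n′≋1 a)))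
              (≡.trans (≡.cong ιℤ (lem₁ (f (negate a)) (f (a ℕ.% n)))) (ιℤ-neg (f (a ℕ.% n) ℤ.- f (negate a))))))
            (≡.sym (ℚ.neg-distribʳ-* (𝟙 (unit? a)) _))
        ; vanishing = vanish
        }
        where
        lem₁ : ∀ x y → x ℤ.+ ℤ.- y ≡ ℤ.- (y ℤ.+ ℤ.- x)
        lem₁ = ℤ-Solver.solve-∀
        vanish : ∀ a → ∑ n (λ g → f̂ g * ι (g ℕ.* a ℕ.% n)) ≡ 0ℚ
        vanish a = begin
          ∑ n (λ g → f̂ g * ρ g)
            ≡⟨ ∑-cong n (λ g g<n → ≡.trans (≡.cong (λ x → 𝟙 (unit? g) * x * ρ g) (≡.trans (≡.cong (λ x → ιℤ (f x ℤ.- f (negate g))) (ℕ.m<n⇒m%n≡m g<n))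
                 (≡.trans (ιℤ-+ (f g) (ℤ.- f (negate g))) (≡.cong (ιℤ (f g) +_) (ιℤ-neg (f (negate g)))))))
                 (lem₂ (𝟙 (unit? g)) (ιℤ (f g)) (ιℤ (f (negate g))) (ρ g))) ⟩
          ∑ n (λ g → 𝟙 (unit? g) * ιℤ (f g) * ρ g + - (𝟙 (unit? g) * ιℤ (f (negate g)) * ρ g))
            ≡⟨ ≡.trans (∑-+ n _ _) (≡.cong (∑ n (λ g → 𝟙 (unit? g) * ιℤ (f g) * ρ g) +_) (≡.trans (∑-neg n _) (≡.cong -_ flip))) ⟩
          ∑ n (λ g → 𝟙 (unit? g) * ιℤ (f g) * ρ g) - ∑ n (λ g → 𝟙 (unit? g) * ιℤ (f g) * ρ (negate g))
            ≡⟨ ≡.trans (≡.cong (∑ n (λ g → 𝟙 (unit? g) * ιℤ (f g) * ρ g) +_) (≡.sym (∑-neg n _))) (≡.sym (∑-+ n _ _)) ⟩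
          ∑ n (λ g → 𝟙 (unit? g) * ιℤ (f g) * ρ g + - (𝟙 (unit? g) * ιℤ (f g) * ρ (negate g)))
            ≡⟨ ∑-cong n (λ g _ → combine g) ⟩
          ∑ n (λ g → ιℤ (f g ℤ.* stickelberger (a ℕ.% n) g))
            ≡⟨ ιℤ-∑ n _ ⟨
          ιℤ (dot n f (stickelberger (a ℕ.% n)))
            ≡⟨ ≡.trans (≡.cong ιℤ (f⊥ (a ℕ.% n) (ℕ.m%n<n a n))) ι-0 ⟩
          0ℚ ∎
          where
          open ≡.≡-Reasoning
          ρ : ℕ → ℚ
          ρ g = ι (g ℕ.* a ℕ.% n)
          lem₂ : ∀ u x y r → u * (x + - y) * r ≡ u * x * r + - (u * y * r)
          lem₂ = solve-∀ ℚ-ring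
          lem₃ : ∀ u x r s → u * x * r + - (u * x * s) ≡ x * (u * (r + - s))
          lem₃ = solve-∀ ℚ-ring
          flip : ∑ n (λ g → 𝟙 (unit? g) * ιℤ (f (negate g)) * ρ g) ≡ ∑ n (λ g → 𝟙 (unit? g) * ιℤ (f g) * ρ (negate g))
          flip = ≡.trans (≡.sym (∑-unit ℚ.+-*-commutativeRing unit-n′ (λ g → 𝟙 (unit? g) * ιℤ (f (negate g)) * ρ g)))
            (∑-cong n λ g g<n → ≡.cong₂ (λ u x → u * ιℤ (f x) * ρ (negate g))
              (𝟙-cong (unit? (negate g)) (unit? g) (λ u → unit-*⁻ʳ n′ g (unit-≋ (negate-≋ g) u)) negate-unit) (negate-involutive g<n))
          combine : ∀ g → 𝟙 (unit? g) * ιℤ (f g) * ρ g + - (𝟙 (unit? g) * ιℤ (f g) * ρ (negate g)) ≡ ιℤ (f g ℤ.* stickelberger (a ℕ.% n) g)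
          combine g = ≡.trans (lem₃ (𝟙 (unit? g)) (ιℤ (f g)) (ρ g) (ρ (negate g))) (≡.sym (≡.trans (ιℤ-* (f g) _) (≡.cong (ιℤ (f g) *_)
            (≡.trans (ιℤ-* (ℤ∑.𝟙 (unit? g)) _) (≡.cong₂ _*_ (ιℤ-𝟙 (unit? g)) value)))))
            where
            r = g ℕ.* a ℕ.% n
            value : ιℤ (bernoulli (g ℕ.* (a ℕ.% n) ℕ.% n)) ≡ ρ g + - ρ (negate g)
            value = ≡.trans (≡.cong (ιℤ ∘ bernoulli) (%≡ (≋-*ˡ g (%-≋ a))))
                (≡.trans (≡.cong ιℤ (≡.sym (bernoulli-difference r (ℕ.m%n<n (g ℕ.* a) n))))
              (≡.trans (ιℤ-+ (ℤ.+ r) (ℤ.- (ℤ.+ negate r))) (≡.cong (ι r +_) (≡.trans (ιℤ-neg (ℤ.+ negate r))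
                (≡.cong (λ x → - ι x) (%≡ (≋-trans (≋-*ˡ n′ (%-≋ (g ℕ.* a))) (≋-trans (≋-reflexive (≡.sym (ℕ.*-assoc n′ g a)))
                    (≋-*ʳ a (≋-sym (negate-≋ g)))))))))))

      ιℤ-injective : ∀ z → ιℤ z ≡ 0ℚ → z ≡ 0ℤ
      ιℤ-injective (ℤ.+ zero)   _  = refl
      ιℤ-injective (ℤ.+ suc m)  eq = contradiction (≡.sym eq) (ℚ.<⇒≢ (0<ι m))
      ιℤ-injective (ℤ.-[1+ m ]) eq = contradiction (≡.sym (≡.trans (lem (ι (suc m))) (≡.cong -_ eq))) (ℚ.<⇒≢ (0<ι m))
        where
        lem : ∀ x → x ≡ - - x
        lem = solve-∀ ℚ-ring

      symmetric : ∀ h → h ℕ.< n → Unit h → f h ℤ.- f (negate h) ≡ 0ℤ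
      symmetric h h<n uh = ≡.trans (≡.cong (λ x → f x ℤ.- f (negate h)) (≡.sym (ℕ.m<n⇒m%n≡m h<n)))
          (ιℤ-injective _ (≡.trans (≡.sym (ℚ.*-identityˡ (ιℤ (f (h ℕ.% n) ℤ.- f (negate h)))))
        (≡.trans (≡.cong (_* ιℤ (f (h ℕ.% n) ℤ.- f (negate h))) (≡.sym (𝟙-yes (unit? h) uh))) (annihilator-zero annihilator uh))))

  -- A functional f separating `odd-basis h` from the S(x) would have f(h) ≠ f(-h), whereas its
  -- antisymmetrisation vanishes at h by `annihilator-zero`.
  span : ∀ h → h ℕ.< n → Unit h → InSpan n n stickelberger (odd-basis h)
  span h h<n uh = [ (λ s → s) , (λ s → contradiction (vanishes s) (proj₂ (proj₂ s))) ]′ (fredholm n n stickelberger (odd-basis h))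
    where
    lem : ∀ x a b → x ℤ.* (a ℤ.+ ℤ.- b) ≡ a ℤ.* x ℤ.+ ℤ.- (b ℤ.* x)
    lem = ℤ-Solver.solve-∀
    vanishes : (s : Separated n n stickelberger (odd-basis h)) → dot n (proj₁ s) (odd-basis h) ≡ 0ℤ
    vanishes (f , f⊥ , _) = ≡.trans (ℤ∑.∑-cong n λ g _ → lem (f g) (ℤ∑.𝟙 (g ℕ.≟ h)) (ℤ∑.𝟙 (g ℕ.≟ negate h)))
      (≡.trans (ℤ∑.∑-+ n _ _) (≡.trans (≡.cong₂ ℤ._+_ (ℤ∑.∑-𝟙 n f h<n)
          (≡.trans (ℤ∑.∑-neg n _) (≡.cong ℤ.-_ (ℤ∑.∑-𝟙 n f (negate-< h))))) (symmetric f f⊥ h h<n uh)))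

open import Defs
open import Data.Bool using (true; false; if_then_else_; T)
open import Data.Bool.Properties using (T?)
open import Data.Fin as Fin using (Fin; toℕ; fromℕ<)
import Data.Fin.Properties as Fin
open import Data.Maybe using (Maybe; just; nothing; maybe′)
import Data.Maybe.Relation.Unary.Any as MaybeAny
open import Data.List.Membership.Propositional using (_∈_)
open import Data.List.Membership.Propositional.Properties using (∈-filter⁺; ∈-filter⁻; ∈-allFin; ∈-lookup)
open import Data.List.Relation.Unary.All as All using (All; []; _∷_)
open import Data.List.Relation.Unary.AllPairs using ([]; _∷_)
import Data.List.Relation.Unary.Any as Any
import Data.List.Relation.Unary.Any.Properties as Any
open import Data.List.Relation.Unary.Unique.Propositional using (Unique)
open import Data.List.Relation.Unary.Unique.Propositional.Properties using (filter⁺; allFin⁺)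

-- Sums over the list of units and sums over residues

module UnitSums {c ℓ} (R : CommutativeRing c ℓ) where
  open CommutativeRing R renaming (refl to ≈-refl)
  open FiniteSum R

  listSum : ∀ {a} {A : Set a} → (A → Carrier) → List A → Carrier
  listSum f = foldr (λ x acc → f x + acc) 0#

  listSum-cong : ∀ {a} {A : Set a} {f g : A → Carrier} → (∀ x → f x ≈ g x) → ∀ xs → listSum f xs ≈ listSum g xs
  listSum-cong f≈g []       = ≈-refl
  listSum-cong f≈g (x ∷ xs) = +-cong (f≈g x) (listSum-cong f≈g xs)

  listSum-mapMaybe : ∀ {a b} {A : Set a} {B : Set b} (p : A → Maybe B) (f : B → Carrier) xs →
    listSum f (mapMaybe p xs) ≈ listSum (λ x → maybe′ f 0# (p x)) xs
  listSum-mapMaybe p f []       = ≈-refl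
  listSum-mapMaybe p f (x ∷ xs) with p x
  ... | just y  = +-congˡ (listSum-mapMaybe p f xs)
  ... | nothing = trans (listSum-mapMaybe p f xs) (sym (+-identityˡ _))

  listSum-tabulate : ∀ {a} {A : Set a} m (e : Fin m → A) (f : A → Carrier) (φ : ℕ → Carrier) →
    (∀ i → f (e i) ≈ φ (toℕ i)) → listSum f (tabulate e) ≈ ∑ m φ
  listSum-tabulate zero    e f φ eq = ≈-refl
  listSum-tabulate (suc m) e f φ eq = trans
    (+-cong (eq Fin.zero) (listSum-tabulate m (e ∘ Fin.suc) f (φ ∘ suc) (eq ∘ Fin.suc))) (sym (∑-head m φ))

  listSum-zero : ∀ {a} {A : Set a} m (e : Fin m → A) (f : A → Carrier) → (∀ i → f (e i) ≈ 0#) → listSum f (tabulate e) ≈ 0#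
  listSum-zero zero    e f f≈0 = ≈-refl
  listSum-zero (suc m) e f f≈0 = trans (+-cong (f≈0 Fin.zero) (listSum-zero m (e ∘ Fin.suc) f (f≈0 ∘ Fin.suc))) (+-identityˡ 0#)

  listSum-single : ∀ {a} {A : Set a} m (e : Fin m → A) (f : A → Carrier) i₀ →
    (∀ i → i ≢ i₀ → f (e i) ≈ 0#) → listSum f (tabulate e) ≈ f (e i₀)
  listSum-single (suc m) e f Fin.zero     f≈0 = trans (+-congˡ (listSum-zero m (e ∘ Fin.suc) f λ i → f≈0 (Fin.suc i) λ ())) (+-identityʳ _)
  listSum-single (suc m) e f (Fin.suc i₀) f≈0 = trans (+-cong (f≈0 Fin.zero λ ())
    (listSum-single m (e ∘ Fin.suc) f i₀ λ i i≢ → f≈0 (Fin.suc i) (i≢ ∘ Fin.suc-injective))) (+-identityˡ _)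

G-≡ : ∀ {n} {g h : G n} → val g ≡ val h → g ≡ h
G-≡ {g = a , p} {b , q} eq with Fin.toℕ-injective eq
... | refl = ≡.cong (a ,_) (ℕ.≡-irrelevant p q)

mkG : ∀ {n} i → i ℕ.< n → ℕ.gcd i n ≡ 1 → G n
mkG {n} i i<n u = fromℕ< i<n , ≡.trans (≡.cong (λ k → ℕ.gcd k n) (Fin.toℕ-fromℕ< i<n)) u

val-mkG : ∀ {n} i (i<n : i ℕ.< n) u → val (mkG {n} i i<n u) ≡ i
val-mkG i i<n u = Fin.toℕ-fromℕ< i<n

-- The selection function of Gs is local to Defs; unification recovers it.
selection : ∀ n → Σ (Fin n → Maybe (G n)) λ p → Gs n ≡ mapMaybe p (allFin n)
selection n = _ , refl

selection-just : ∀ n (g : G n) → proj₁ (selection n) (proj₁ g) ≡ just g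
selection-just n (a , p) with ℕ.gcd (toℕ a) n ℕ.≟ 1
... | yes q = ≡.cong (λ r → just (a , r)) (ℕ.≡-irrelevant q p)
... | no ¬p = contradiction p ¬p

selection-nothing : ∀ n a → ¬ ℕ.gcd (toℕ a) n ≡ 1 → proj₁ (selection n) a ≡ nothing
selection-nothing n a ¬p with ℕ.gcd (toℕ a) n ℕ.≟ 1
... | yes q = contradiction q ¬p
... | no _  = refl

module SumOverG {c ℓ} (R : CommutativeRing c ℓ) (n : ℕ) where
  open CommutativeRing R renaming (refl to ≈-refl)
  open FiniteSum R
  open UnitSums R
  open import Relation.Binary.Reasoning.Setoid setoid

  private
    extend′ : (G n → Carrier) → ∀ i → Dec (i ℕ.< n) → Dec (ℕ.gcd i n ≡ 1) → Carrier
    extend′ f i (yes i<n) (yes u) = f (mkG i i<n u)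
    extend′ f i (yes i<n) (no _)  = 0#
    extend′ f i (no _)    _       = 0#

  -- Extension by 0 turns a sum over the list of units into one over all residues, where reindexing
  -- by a unit is available.
  extend : (G n → Carrier) → ℕ → Carrier
  extend f i = extend′ f i (i ℕ.<? n) (ℕ.gcd i n ℕ.≟ 1)

  extend-val : ∀ f g → extend f (val g) ≈ f g
  extend-val f g = go (val g ℕ.<? n) (ℕ.gcd (val g) n ℕ.≟ 1)
    where
    go : ∀ D E → extend′ f (val g) D E ≈ f g
    go (yes i<n) (yes u) = reflexive (≡.cong f (G-≡ (val-mkG (val g) i<n u)))
    go (yes i<n) (no ¬u) = contradiction (proj₂ g) ¬u
    go (no ¬i<n) _       = contradiction (Fin.toℕ<n (proj₁ g)) ¬i<n

  extend-nonunit : ∀ f i → ¬ ℕ.gcd i n ≡ 1 → extend f i ≈ 0#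
  extend-nonunit f i ¬u = go (i ℕ.<? n) (ℕ.gcd i n ℕ.≟ 1)
    where
    go : ∀ D E → extend′ f i D E ≈ 0#
    go (yes _) (yes u) = contradiction u ¬u
    go (yes _) (no _)  = ≈-refl
    go (no _)  _       = ≈-refl

  sumG : (G n → Carrier) → Carrier
  sumG f = listSum f (Gs n)

  sumG-∑ : ∀ f → sumG f ≈ ∑ n (extend f)
  sumG-∑ f = trans (listSum-mapMaybe p f (allFin n)) (listSum-tabulate n (λ i → i) (λ a → maybe′ f 0# (p a)) (extend f) step)
    where
    p = proj₁ (selection n)
    step : ∀ a → maybe′ f 0# (p a) ≈ extend f (toℕ a)
    step a = go (ℕ.gcd (toℕ a) n ℕ.≟ 1)
      where
      go : Dec (ℕ.gcd (toℕ a) n ≡ 1) → maybe′ f 0# (p a) ≈ extend f (toℕ a)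
      go (yes u) = trans (reflexive (≡.cong (maybe′ f 0#) (selection-just n (a , u)))) (sym (extend-val f (a , u)))
      go (no ¬u) = trans (reflexive (≡.cong (maybe′ f 0#) (selection-nothing n a ¬u))) (sym (extend-nonunit f (toℕ a) ¬u))

  sumG-cong : ∀ {f g} → (∀ x → f x ≈ g x) → sumG f ≈ sumG g
  sumG-cong f≈g = listSum-cong f≈g (Gs n)

  sumG-𝟙 : ∀ (f : G n → Carrier) g → sumG (λ h → 𝟙 (val h ℕ.≟ val g) * f h) ≈ f g
  sumG-𝟙 f g = begin
    sumG (λ h → 𝟙 (val h ℕ.≟ val g) * f h)
      ≈⟨ sumG-∑ _ ⟩
    ∑ n (extend (λ h → 𝟙 (val h ℕ.≟ val g) * f h))
      ≈⟨ ∑-cong n (λ i _ → go i (i ℕ.<? n) (ℕ.gcd i n ℕ.≟ 1)) ⟩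
    ∑ n (λ i → 𝟙 (i ℕ.≟ val g) * extend f i)
      ≈⟨ ∑-𝟙 n (extend f) (Fin.toℕ<n (proj₁ g)) ⟩
    extend f (val g)
      ≈⟨ extend-val f g ⟩
    f g ∎
    where
    go : ∀ i D E → extend′ (λ h → 𝟙 (val h ℕ.≟ val g) * f h) i D E ≈ 𝟙 (i ℕ.≟ val g) * extend′ f i D E
    go i (yes i<n) (yes u) = *-congʳ (reflexive (≡.cong (λ k → 𝟙 (k ℕ.≟ val g)) (val-mkG i i<n u)))
    go i (yes _)   (no _)  = sym (zeroʳ _)
    go i (no _)    _       = sym (zeroʳ _)

  sumG-+ : ∀ f g → sumG (λ x → f x + g x) ≈ sumG f + sumG g
  sumG-+ f g = go (Gs n)
    where
    open import Algebra.Properties.CommutativeSemigroup +-commutativeSemigroup using (interchange)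
    go : ∀ xs → listSum (λ x → f x + g x) xs ≈ listSum f xs + listSum g xs
    go []       = sym (+-identityˡ 0#)
    go (x ∷ xs) = trans (+-congˡ (go xs)) (interchange _ _ _ _)

  sumG-neg : ∀ f → sumG (λ x → - f x) ≈ - sumG f
  sumG-neg f = go (Gs n)
    where
    open import Algebra.Properties.Ring ring using (-0#≈0#; -‿+-comm)
    go : ∀ xs → listSum (λ x → - f x) xs ≈ - listSum f xs
    go []       = sym -0#≈0#
    go (x ∷ xs) = trans (+-congˡ (go xs)) (-‿+-comm _ _)

mapMaybe-unique : ∀ {a b} {A : Set a} {B : Set b} (p : A → Maybe B) →
  (∀ {x y z} → p x ≡ just z → p y ≡ just z → x ≡ y) → ∀ {xs} → Unique xs → Unique (mapMaybe p xs)
mapMaybe-unique p p-inj []                  = []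
mapMaybe-unique p p-inj {x ∷ xs} (x∉ ∷ uxs) with p x in eq
... | nothing = mapMaybe-unique p p-inj uxs
... | just y  = fresh xs x∉ ∷ mapMaybe-unique p p-inj uxs
  where
  fresh : ∀ xs → All (x ≢_) xs → All (y ≢_) (mapMaybe p xs)
  fresh []        []            = []
  fresh (x′ ∷ xs) (x≢x′ ∷ x≢xs) with p x′ in eq′
  ... | nothing = fresh xs x≢xs
  ... | just y′ = (λ { refl → x≢x′ (p-inj eq eq′) }) ∷ fresh xs x≢xs

lookup-injective : ∀ {a} {A : Set a} {xs : List A} → Unique xs → ∀ i j → lookup xs i ≡ lookup xs j → i ≡ j
lookup-injective (x∉ ∷ uxs) Fin.zero    Fin.zero    eq = refl
lookup-injective (x∉ ∷ uxs) Fin.zero    (Fin.suc j) eq = contradiction eq (All.lookup x∉ (∈-lookup j))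
lookup-injective (x∉ ∷ uxs) (Fin.suc i) Fin.zero    eq = contradiction (≡.sym eq) (All.lookup x∉ (∈-lookup i))
lookup-injective (x∉ ∷ uxs) (Fin.suc i) (Fin.suc j) eq = ≡.cong Fin.suc (lookup-injective uxs i j eq)

Gs-unique : ∀ n → Unique (Gs n)
Gs-unique n = mapMaybe-unique p p-inj (allFin⁺ n)
  where
  p = proj₁ (selection n)
  p-val : ∀ {a g} → p a ≡ just g → proj₁ g ≡ a
  p-val {a} {g} eq = go (ℕ.gcd (toℕ a) n ℕ.≟ 1)
    where
    go : Dec (ℕ.gcd (toℕ a) n ≡ 1) → proj₁ g ≡ a
    go (yes u) with ≡.trans (≡.sym (selection-just n (a , u))) eq
    ... | refl = refl
    go (no ¬u) with ≡.trans (≡.sym (selection-nothing n a ¬u)) eq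
    ... | ()
  p-inj : ∀ {a b g} → p a ≡ just g → p b ≡ just g → a ≡ b
  p-inj pa pb = ≡.trans (≡.sym (p-val pa)) (p-val pb)

∈-Gs : ∀ n (g : G n) → g ∈ Gs n
∈-Gs n g = Any.mapMaybe⁺ (proj₁ (selection n)) (allFin n)
  (Any.map⁺ (Any.map (λ { refl → ≡.subst (MaybeAny.Any (g ≡_)) (≡.sym (selection-just n g)) (MaybeAny.just refl) }) (∈-allFin (proj₁ g))))

-- Representatives of the units modulo ±1

module HalfSystem (n′ : ℕ) (2<n : 2 ℕ.< suc n′) where
  open UnitsModulo n′
  open OddAnnihilators n′ 2<n using (unit-n′)
  open StickelbergerSpan n′ 2<n

  unit : (g : G n) → Unit (val g)
  unit g = mkUnit (proj₂ g)

  val<n : (g : G n) → val g ℕ.< n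
  val<n g = Fin.toℕ<n (proj₁ g)

  abstract
    neg : G n → G n
    neg g = mkG (negate (val g)) (negate-< (val g)) (gcd≡1 (negate-unit (unit g)))

    val-neg : ∀ g → val (neg g) ≡ negate (val g)
    val-neg g = val-mkG (negate (val g)) (negate-< (val g)) (gcd≡1 (negate-unit (unit g)))

  neg-involutive : ∀ g → neg (neg g) ≡ g
  neg-involutive g = G-≡ (≡.trans (val-neg (neg g)) (≡.trans (≡.cong negate (val-neg g)) (negate-involutive (val<n g))))

  private
    1<n : 1 ℕ.< n
    1<n = ℕ.<-trans (s≤s (s≤s z≤n)) 2<n

    val-pos : ∀ g → val g ≢ 0
    val-pos g eq = ℕ.<⇒≢ 1<n (≡.sym (≡.trans (≡.sym (ℕ.gcd-identityˡ n)) (≡.trans (≡.cong (λ x → ℕ.gcd x n) (≡.sym eq)) (proj₂ g))))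

    val-neg-∸ : ∀ g → val (neg g) ≡ n ℕ.∸ val g
    val-neg-∸ g = go (val g) refl
      where
      go : ∀ v → val g ≡ v → val (neg g) ≡ n ℕ.∸ val g
      go zero    eq = contradiction eq (val-pos g)
      go (suc v) eq = ≡.trans (val-neg g) (≡.trans (≡.cong negate eq) (≡.trans (negate-pos v (≡.subst (ℕ._< n) eq (val<n g)))
          (≡.cong (n ℕ.∸_) (≡.sym eq))))

    -- If 2 v = n, then v divides gcd(v , n) = 1 and n = 2. So for n > 2 no unit lies on the
    -- boundary of the half system, and exactly one of g and -g lies inside.
    2v≢n : ∀ g → 2 ℕ.* val g ≢ n
    2v≢n g eq = ℕ.<⇒≢ 2<n (≡.trans (≡.cong (2 ℕ.*_) (≡.sym v≡1)) eq)
      where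
      v≡1 : val g ≡ 1
      v≡1 = ℕ.∣1⇒≡1 (≡.subst (val g ℕ.∣_) (proj₂ g) (ℕ.gcd-greatest ℕ.∣-refl (≡.subst (val g ℕ.∣_) eq (ℕ.n∣m*n 2))))

    complement : ∀ g → 2 ℕ.* val (neg g) ℕ.+ 2 ℕ.* val g ≡ n ℕ.+ n
    complement g = ≡.trans (≡.sym (ℕ.*-distribˡ-+ 2 (val (neg g)) (val g)))
      (≡.trans (≡.cong (2 ℕ.*_) (≡.trans (≡.cong (ℕ._+ val g) (val-neg-∸ g)) (ℕ.m∸n+n≡m (ℕ.<⇒≤ (val<n g))))) (≡.cong (n ℕ.+_) (ℕ.+-identityʳ n)))

  half-neg : ∀ g → ¬ T (half g) → T (half (neg g))
  half-neg g ¬half = ℕ.<⇒<ᵇ (ℕ.+-cancelʳ-< (2 ℕ.* val g) (2 ℕ.* val (neg g)) n (≡.subst (ℕ._< n ℕ.+ 2 ℕ.* val g)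
      (≡.sym (complement g)) (ℕ.+-monoʳ-< n n<2v)))
    where
    n<2v : n ℕ.< 2 ℕ.* val g
    n<2v = ℕ.≤∧≢⇒< (ℕ.≮⇒≥ λ lt → ¬half (ℕ.<⇒<ᵇ lt)) (2v≢n g ∘ ≡.sym)

  ¬half-neg : ∀ g → T (half g) → ¬ T (half (neg g))
  ¬half-neg g half-g half-neg-g = ℕ.<⇒≢ (ℕ.+-mono-< (ℕ.<ᵇ⇒< (2 ℕ.* val (neg g)) n half-neg-g) (ℕ.<ᵇ⇒< (2 ℕ.* val g) n half-g)) (complement g)

  representative : ∀ h → Dec (T (half h)) → G n
  representative h (yes _) = h
  representative h (no _)  = neg h

  rep : G n → G n
  rep h = representative h (T? (half h))

  rep-half : ∀ h → T (half (rep h))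
  rep-half h = go (T? (half h))
    where
    go : (D : Dec (T (half h))) → T (half (representative h D))
    go (yes p) = p
    go (no ¬p) = half-neg h ¬p

  rep-of-half : ∀ h → T (half h) → rep h ≡ h
  rep-of-half h p = go (T? (half h))
    where
    go : (D : Dec (T (half h))) → representative h D ≡ h
    go (yes _) = refl
    go (no ¬p) = contradiction p ¬p

  rep-of-nonhalf : ∀ h → ¬ T (half h) → rep h ≡ neg h
  rep-of-nonhalf h ¬p = go (T? (half h))
    where
    go : (D : Dec (T (half h))) → representative h D ≡ neg h
    go (yes p) = contradiction p ¬p
    go (no _)  = refl

  halves : List (G n)
  halves = filterᵇ half (Gs n)

  halves-unique : Unique halves
  halves-unique = filter⁺ (T? ∘ half) (Gs-unique n)

  rep-∈ : ∀ h → rep h ∈ halves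
  rep-∈ h = ∈-filter⁺ (T? ∘ half) (∈-Gs n (rep h)) (rep-half h)

  halves-half : ∀ i → T (half (lookup halves i))
  halves-half i = proj₂ (∈-filter⁻ (T? ∘ half) {xs = Gs n} (∈-lookup {xs = halves} i))

  rep-index : ∀ h → Σ (Fin (length halves)) λ i → lookup halves i ≡ rep h
  rep-index h = Any.index (rep-∈ h) , ≡.sym (Any.lookup-index (rep-∈ h))

  private
    module ℤ∑ = FiniteSum ℤ.+-*-commutativeRing
    module ℤU = UnitSums ℤ.+-*-commutativeRing
    module ℤG = SumOverG ℤ.+-*-commutativeRing n

    indicator : G n → ℤ
    indicator g = ℤ∑.𝟙 (T? (half g))

    length-sum : ∀ (xs : List (G n)) → ℤ.+ length xs ≡ ℤU.listSum (λ _ → 1ℤ) xs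
    length-sum []       = refl
    length-sum (x ∷ xs) = ≡.cong (λ z → 1ℤ ℤ.+ z) (length-sum xs)

    length-filter : ∀ (xs : List (G n)) → ℤ.+ length (filterᵇ half xs) ≡ ℤU.listSum indicator xs
    length-filter []       = refl
    length-filter (x ∷ xs) with half x
    ... | true  = ≡.cong (λ z → 1ℤ ℤ.+ z) (length-filter xs)
    ... | false = ≡.trans (length-filter xs) (≡.sym (ℤ.+-identityˡ _))

    sum-neg : ∀ f → ℤG.sumG (f ∘ neg) ≡ ℤG.sumG f
    sum-neg f = ≡.trans (ℤG.sumG-∑ (f ∘ neg)) (≡.trans (ℤ∑.∑-cong n λ i i<n → go i i<n (unit? i))
      (≡.trans (∑-unit ℤ.+-*-commutativeRing unit-n′ (ℤG.extend f)) (≡.sym (ℤG.sumG-∑ f))))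
      where
      go : ∀ i → i ℕ.< n → Dec (Unit i) → ℤG.extend (f ∘ neg) i ≡ ℤG.extend f (negate i)
      go i i<n (yes (mkUnit u)) = ≡.trans (≡.cong (ℤG.extend (f ∘ neg)) (≡.sym (val-mkG i i<n u))) (≡.trans (ℤG.extend-val (f ∘ neg) g)
        (≡.trans (≡.sym (ℤG.extend-val f (neg g))) (≡.cong (ℤG.extend f) (≡.trans (val-neg g) (≡.cong negate (val-mkG i i<n u))))))
        where g = mkG i i<n u
      go i i<n (no ¬u) = ≡.trans (ℤG.extend-nonunit (f ∘ neg) i λ u → ¬u (mkUnit u))
        (≡.sym (ℤG.extend-nonunit f (negate i) λ u → ¬u (unit-*⁻ʳ n′ i (unit-≋ (negate-≋ i) (mkUnit u)))))

    one-half : ∀ g → 1ℤ ≡ indicator g ℤ.+ indicator (neg g)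
    one-half g = go (T? (half g)) (T? (half (neg g)))
      where
      go : (D : Dec (T (half g))) (E : Dec (T (half (neg g)))) → 1ℤ ≡ ℤ∑.𝟙 D ℤ.+ ℤ∑.𝟙 E
      go (yes p) (yes q) = contradiction q (¬half-neg g p)
      go (yes p) (no _)  = refl
      go (no _)  (yes _) = refl
      go (no ¬p) (no ¬q) = contradiction (half-neg g ¬p) ¬q

  φ≡2*halves : φ n ≡ length halves ℕ.+ length halves
  φ≡2*halves = ℤ.+-injective (begin
    ℤ.+ φ n                                       ≡⟨ length-sum (Gs n) ⟩
    ℤG.sumG (λ _ → 1ℤ)                            ≡⟨ ℤG.sumG-cong one-half ⟩
    ℤG.sumG (λ g → indicator g ℤ.+ indicator (neg g)) ≡⟨ ℤG.sumG-+ indicator (indicator ∘ neg) ⟩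
    ℤG.sumG indicator ℤ.+ ℤG.sumG (indicator ∘ neg) ≡⟨ ≡.cong (λ z → ℤG.sumG indicator ℤ.+ z) (sum-neg indicator) ⟩
    ℤG.sumG indicator ℤ.+ ℤG.sumG indicator       ≡⟨ ≡.cong₂ ℤ._+_ (length-filter (Gs n)) (length-filter (Gs n)) ⟨
    ℤ.+ length halves ℤ.+ ℤ.+ length halves       ∎)
    where open ≡.≡-Reasoning

  length-halves : length halves ≡ φ n ℕ./ 2
  length-halves = ≡.sym (≡.trans (≡.cong (ℕ._/ 2) (≡.trans φ≡2*halves
      (≡.trans (≡.cong (length halves ℕ.+_) (≡.sym (ℕ.+-identityʳ _))) (ℕ.*-comm 2 (length halves))))) (ℕ.m*n/n≡m (length halves) 2))

-- Bases of U and its annihilator over K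

module OverField {c ℓ} (K : CharZeroField c ℓ) (n′ : ℕ) (2<n : 2 ℕ.< suc n′) where
  open CharZeroField K renaming (refl to ≈-refl)
  open FiniteSum commutativeRing
  open UnitSums commutativeRing
  open SumOverG commutativeRing (suc n′)
  open IntegerEmbedding commutativeRing ι ≈-refl (λ _ → ≈-refl)
  open HalfSystem n′ 2<n
  open StickelbergerSpan n′ 2<n
  open import Relation.Binary.Reasoning.Setoid setoid
  open import Algebra.Properties.Ring ring using (-0#≈0#; -‿involutive; -‿distribˡ-*; -‿distribʳ-*; -‿+-comm)

  private
    n = suc n′

    if-T : ∀ {b} {x y : Carrier} → T b → (if b then x else y) ≈ x
    if-T {true} _ = ≈-refl

    if-¬T : ∀ {b} {x y : Carrier} → ¬ T b → (if b then x else y) ≈ y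
    if-¬T {false} _  = ≈-refl
    if-¬T {true}  ¬t = contradiction _ ¬t

    if-𝟙 : ∀ a b → (if a ℕ.≡ᵇ b then 1# else 0#) ≈ 𝟙 (a ℕ.≟ b)
    if-𝟙 a b = go (a ℕ.≟ b)
      where
      go : (D : Dec (a ≡ b)) → (if a ℕ.≡ᵇ b then 1# else 0#) ≈ 𝟙 D
      go (yes eq) = if-T (ℕ.≡⇒≡ᵇ a b eq)
      go (no ¬eq) = if-¬T (λ t → ¬eq (ℕ.≡ᵇ⇒≡ a b t))

  u*-𝟙 : ∀ g h → u* K n g h ≈ 𝟙 (val h ℕ.≟ val g) + 𝟙 (val h ℕ.≟ val (neg g))
  u*-𝟙 g h = +-cong (if-𝟙 (val h) (val g)) (trans (if-𝟙 (val h) ((n ℕ.∸ val g) ℕ.% n))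
    (reflexive (≡.cong (λ x → 𝟙 (val h ℕ.≟ x)) (≡.trans (negate-∸ (val g) (ℕ.<⇒≤ (val<n g))) (≡.sym (val-neg g))))))

  private
    2n : ℕ
    2n = 2 ℕ.* n

    2n-inverse : ι 2n * ι 2n ⁻¹ ≈ 1#
    2n-inverse = ⁻¹-inv (ι 2n) λ eq → ℕ.1+n≢0 (charZero 2n eq)

  S-bernoulli : ∀ a g → S K n a g ≈ ιℤ (bernoulli (val g ℕ.* toℕ a ℕ.% n)) * ι 2n ⁻¹
  S-bernoulli a g with (val g ℕ.* toℕ a) ℕ.% n
  ... | zero  = sym (zeroˡ _)
  ... | suc r = *-congʳ (sym (trans (ιℤ-+ (ℤ.+ (2 ℕ.* suc r)) (ℤ.- (ℤ.+ n))) (+-congˡ (ιℤ-neg (ℤ.+ n)))))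

  S-odd : ∀ a g → S K n a (neg g) ≈ - S K n a g
  S-odd a g = begin
    S K n a (neg g)                                             ≈⟨ S-bernoulli a (neg g) ⟩
    ιℤ (bernoulli (val (neg g) ℕ.* toℕ a ℕ.% n)) * ι 2n ⁻¹      ≡⟨ ≡.cong (λ z → ιℤ z * ι 2n ⁻¹)
        (≡.trans (≡.cong (λ x → bernoulli (x ℕ.* toℕ a ℕ.% n)) (val-neg g)) (bernoulli-odd (val g) (toℕ a))) ⟩
    ιℤ (ℤ.- bernoulli (val g ℕ.* toℕ a ℕ.% n)) * ι 2n ⁻¹        ≈⟨ *-congʳ (ιℤ-neg (bernoulli (val g ℕ.* toℕ a ℕ.% n))) ⟩
    - ιℤ (bernoulli (val g ℕ.* toℕ a ℕ.% n)) * ι 2n ⁻¹          ≈⟨ -‿distribˡ-* _ _ ⟨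
    - (ιℤ (bernoulli (val g ℕ.* toℕ a ℕ.% n)) * ι 2n ⁻¹)        ≈⟨ -‿cong (S-bernoulli a g) ⟨
    - S K n a g                                                 ∎

  U-odd : ∀ {u} → InU K n u → ∀ g → u (neg g) ≈ - u g
  U-odd {u} (μ , u≈) g = begin
    u (neg g)                                  ≈⟨ u≈ (neg g) ⟩
    ΣX K n (λ a → μ a * S K n a (neg g))       ≈⟨ go (allFin n) ⟩
    - ΣX K n (λ a → μ a * S K n a g)           ≈⟨ -‿cong (u≈ g) ⟨
    - u g                                      ∎
    where
    go : ∀ xs → listSum (λ a → μ a * S K n a (neg g)) xs ≈ - listSum (λ a → μ a * S K n a g) xs
    go []       = sym -0#≈0#
    go (a ∷ xs) = trans (+-cong (trans (*-congˡ (S-odd a g)) (sym (-‿distribʳ-* _ _))) (go xs)) (-‿+-comm _ _)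

  basis : G n → Vec K n
  basis k h = 𝟙 (val h ℕ.≟ val k) - 𝟙 (val h ℕ.≟ val (neg k))

  ev-u* : ∀ g v → ev K n (u* K n g) v ≈ v g + v (neg g)
  ev-u* g v = begin
    sumG (λ h → u* K n g h * v h)
      ≈⟨ sumG-cong (λ h → trans (*-congʳ (u*-𝟙 g h)) (distribʳ (v h) _ _)) ⟩
    sumG (λ h → 𝟙 (val h ℕ.≟ val g) * v h + 𝟙 (val h ℕ.≟ val (neg g)) * v h)
      ≈⟨ sumG-+ _ _ ⟩
    sumG (λ h → 𝟙 (val h ℕ.≟ val g) * v h) + sumG (λ h → 𝟙 (val h ℕ.≟ val (neg g)) * v h)
      ≈⟨ +-cong (sumG-𝟙 v g) (sumG-𝟙 v (neg g)) ⟩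
    v g + v (neg g) ∎

  ev-basis : ∀ f k → ev K n f (basis k) ≈ f k - f (neg k)
  ev-basis f k = begin
    sumG (λ h → f h * (𝟙 (val h ℕ.≟ val k) - 𝟙 (val h ℕ.≟ val (neg k))))
      ≈⟨ sumG-cong (λ h → trans (*-comm (f h) _) (trans (distribʳ (f h) _ _) (+-congˡ (sym (-‿distribˡ-* _ (f h)))))) ⟩
    sumG (λ h → 𝟙 (val h ℕ.≟ val k) * f h + - (𝟙 (val h ℕ.≟ val (neg k)) * f h))
      ≈⟨ trans (sumG-+ _ _) (+-cong (sumG-𝟙 f k) (trans (sumG-neg _) (-‿cong (sumG-𝟙 f (neg k))))) ⟩
    f k - f (neg k) ∎

  private
    ιℤ-nonzero : ∀ z → z ≢ 0ℤ → ¬ (ιℤ z ≈ 0#)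
    ιℤ-nonzero (ℤ.+ m)      z≢0 eq = z≢0 (≡.cong ℤ.+_ (charZero m eq))
    ιℤ-nonzero (ℤ.-[1+ m ]) _   eq = ℕ.1+n≢0 (charZero (suc m) (trans (sym (-‿involutive (ι (suc m)))) (trans (-‿cong eq) -0#≈0#)))

  -- The integral relation from `span` is divided by its denominator D, and the factor 2 n in the
  -- coefficients undoes the normalisation of the Bernoulli values.
  basis-∈U : ∀ k → InU K n (basis k)
  basis-∈U k = let D , μ , D≢0 , eq = span (val k) (val<n k) (unit k) in in-span D μ D≢0 eq
    where
    module ℤ∑ = FiniteSum ℤ.+-*-commutativeRing
    open UnitsModulo n′ using (unit?)
    in-span : ∀ D μ → D ≢ 0ℤ → (∀ g → g ℕ.< n → D ℤ.* odd-basis (val k) g ≡ ℤ∑.∑ n (λ a → μ a ℤ.* stickelberger a g)) → InU K n (basis k)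
    in-span D μ D≢0 eq = (λ a → D⁻¹ * (ιℤ (μ (toℕ a)) * ι 2n)) , λ h → sym (begin
      ΣX K n (λ a → D⁻¹ * (ιℤ (μ (toℕ a)) * ι 2n) * S K n a h)
        ≈⟨ listSum-tabulate n (λ a → a) (λ a → D⁻¹ * (ιℤ (μ (toℕ a)) * ι 2n) * S K n a h)
            (λ a → D⁻¹ * ιℤ (μ a ℤ.* stickelberger a (val h))) (term h) ⟩
      ∑ n (λ a → D⁻¹ * ιℤ (μ a ℤ.* stickelberger a (val h)))
        ≈⟨ trans (∑-*ˡ n D⁻¹ _) (*-congˡ (sym (ιℤ-∑ n _))) ⟩
      D⁻¹ * ιℤ (ℤ∑.∑ n (λ a → μ a ℤ.* stickelberger a (val h)))
        ≡⟨ ≡.cong (λ z → D⁻¹ * ιℤ z) (≡.sym (eq (val h) (val<n h))) ⟩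
      D⁻¹ * ιℤ (D ℤ.* odd-basis (val k) (val h))
        ≈⟨ *-congˡ (ιℤ-* D _) ⟩
      D⁻¹ * (ιℤ D * ιℤ (odd-basis (val k) (val h)))
        ≈⟨ *-assoc D⁻¹ (ιℤ D) _ ⟨
      D⁻¹ * ιℤ D * ιℤ (odd-basis (val k) (val h))
        ≈⟨ *-congʳ (trans (*-comm D⁻¹ (ιℤ D)) (⁻¹-inv (ιℤ D) (ιℤ-nonzero D D≢0))) ⟩
      1# * ιℤ (odd-basis (val k) (val h))
        ≈⟨ *-identityˡ _ ⟩
      ιℤ (ℤ∑.𝟙 (val h ℕ.≟ val k) ℤ.- ℤ∑.𝟙 (val h ℕ.≟ negate (val k)))
        ≈⟨ trans (ιℤ-+ (ℤ∑.𝟙 (val h ℕ.≟ val k)) _) (+-cong (ιℤ-𝟙 (val h ℕ.≟ val k))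
            (trans (ιℤ-neg (ℤ∑.𝟙 (val h ℕ.≟ negate (val k)))) (-‿cong (ιℤ-𝟙 (val h ℕ.≟ negate (val k)))))) ⟩
      𝟙 (val h ℕ.≟ val k) - 𝟙 (val h ℕ.≟ negate (val k))
        ≡⟨ ≡.cong (λ x → 𝟙 (val h ℕ.≟ val k) - 𝟙 (val h ℕ.≟ x)) (≡.sym (val-neg k)) ⟩
      basis k h ∎)
      where
      D⁻¹ = ιℤ D ⁻¹
      term : ∀ h a → D⁻¹ * (ιℤ (μ (toℕ a)) * ι 2n) * S K n a h ≈ D⁻¹ * ιℤ (μ (toℕ a) ℤ.* stickelberger (toℕ a) (val h))
      term h a = begin
        D⁻¹ * (ιℤ m * ι 2n) * S K n a h              ≈⟨ *-assoc D⁻¹ _ _ ⟩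
        D⁻¹ * (ιℤ m * ι 2n * S K n a h)              ≈⟨ *-congˡ (*-congˡ (trans (S-bernoulli a h) (*-comm _ _))) ⟩
        D⁻¹ * (ιℤ m * ι 2n * (ι 2n ⁻¹ * ιℤ b))       ≈⟨ *-congˡ
            (trans (*-assoc _ _ _) (*-congˡ (trans (sym (*-assoc _ _ _)) (trans (*-congʳ 2n-inverse) (*-identityˡ _))))) ⟩
        D⁻¹ * (ιℤ m * ιℤ b)                          ≈⟨ *-congˡ (ιℤ-* m b) ⟨
        D⁻¹ * ιℤ (m ℤ.* b)                           ≡⟨ ≡.cong (λ z → D⁻¹ * ιℤ (m ℤ.* z))
            (≡.sym (≡.trans (≡.cong (ℤ._* b) (ℤ∑.𝟙-yes (unit? (val h)) (unit h))) (ℤ.*-identityˡ b))) ⟩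
        D⁻¹ * ιℤ (m ℤ.* stickelberger (toℕ a) (val h)) ∎
        where
        m = μ (toℕ a)
        b = bernoulli (val h ℕ.* toℕ a ℕ.% n)

  val≢ : ∀ (g h : G n) → g ≢ h → val g ≢ val h
  val≢ g h g≢h eq = g≢h (G-≡ {g = g} {h} eq)

  private
    neg≢ : ∀ h k → T (half h) → T (half k) → h ≢ neg k
    neg≢ h k half-h half-k eq = ¬half-neg k half-k (≡.subst (T ∘ half) eq half-h)

    neg-swap : ∀ h k → h ≡ neg k → k ≡ neg h
    neg-swap h k eq = ≡.trans (≡.sym (neg-involutive k)) (≡.cong neg (≡.sym eq))

  u*-half : ∀ {k} → T (half k) → ∀ h → u* K n k h ≈ 𝟙 (val k ℕ.≟ val (rep h))
  u*-half {k} half-k h = trans (u*-𝟙 k h) (go (T? (half h)))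
    where
    go : Dec (T (half h)) → 𝟙 (val h ℕ.≟ val k) + 𝟙 (val h ℕ.≟ val (neg k)) ≈ 𝟙 (val k ℕ.≟ val (rep h))
    go (yes p) = trans (+-cong (𝟙-cong (val h ℕ.≟ val k) (val k ℕ.≟ val (rep h))
        (λ eq → ≡.trans (≡.sym eq) (≡.cong val (≡.sym (rep-of-half h p)))) (λ eq → ≡.sym (≡.trans eq (≡.cong val (rep-of-half h p)))))
        (𝟙-no (val h ℕ.≟ val (neg k)) (val≢ h (neg k) (neg≢ h k p half-k)))) (+-identityʳ _)
    go (no ¬p) = trans (+-cong (𝟙-no (val h ℕ.≟ val k) λ eq → ¬p (≡.subst (T ∘ half) (≡.sym (G-≡ {g = h} {k} eq)) half-k))
        (𝟙-cong (val h ℕ.≟ val (neg k)) (val k ℕ.≟ val (rep h))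
          (λ eq → ≡.cong val (≡.trans (neg-swap h k (G-≡ {g = h} {neg k} eq)) (≡.sym (rep-of-nonhalf h ¬p))))
          (λ eq → ≡.cong val (neg-swap k h (≡.trans (G-≡ {g = k} {rep h} eq) (rep-of-nonhalf h ¬p)))))) (+-identityˡ _)

  -- At h only the representative of h and -h in the half system contributes. This gives
  -- independence, since evaluation recovers the coefficients, and also spanning, since an even
  -- function is its own coefficient function.
  half-expansion : ∀ (a : G n → Carrier) h → ΣH K n (λ k → a k * u* K n k h) ≈ a (rep h)
  half-expansion a h = trans (sumG-cong λ k → go k (T? (half k))) (sumG-𝟙 a (rep h))
    where
    go : ∀ k → Dec (T (half k)) → (if half k then a k * u* K n k h else 0#) ≈ 𝟙 (val k ℕ.≟ val (rep h)) * a k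
    go k (yes p) = trans (if-T p) (trans (*-comm _ _) (*-congʳ (u*-half {k} p h)))
    go k (no ¬p) = trans (if-¬T ¬p) (sym (trans (*-congʳ (𝟙-no (val k ℕ.≟ val (rep h)) (val≢ k (rep h) λ eq → ¬p
        (≡.subst (T ∘ half) (≡.sym eq) (rep-half h))))) (zeroˡ _)))

  u*-neg : ∀ g → _≈ᵛ_ K (u* K n g) (u* K n (neg g))
  u*-neg g h = begin
    u* K n g h                                                        ≈⟨ u*-𝟙 g h ⟩
    𝟙 (val h ℕ.≟ val g) + 𝟙 (val h ℕ.≟ val (neg g))                    ≈⟨ +-comm _ _ ⟩
    𝟙 (val h ℕ.≟ val (neg g)) + 𝟙 (val h ℕ.≟ val g)                    ≡⟨ ≡.cong (λ k → 𝟙 (val h ℕ.≟ val (neg g)) + 𝟙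
        (val h ℕ.≟ val k)) (≡.sym (neg-involutive g)) ⟩
    𝟙 (val h ℕ.≟ val (neg g)) + 𝟙 (val h ℕ.≟ val (neg (neg g)))        ≈⟨ u*-𝟙 (neg g) h ⟨
    u* K n (neg g) h                                                  ∎

  U⊥-even : ∀ f → InU⊥ K n f → ∀ k → f k ≈ f (neg k)
  U⊥-even f f⊥ k = begin
    f k                               ≈⟨ +-identityʳ (f k) ⟨
    f k + 0#                          ≈⟨ +-congˡ (-‿inverseˡ (f (neg k))) ⟨
    f k + (- f (neg k) + f (neg k))   ≈⟨ +-assoc _ _ _ ⟨
    f k - f (neg k) + f (neg k)       ≈⟨ +-congʳ (trans (sym (ev-basis f k)) (f⊥ (basis k) (basis-∈U k))) ⟩
    0# + f (neg k)                    ≈⟨ +-identityˡ _ ⟩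
    f (neg k)                         ∎

  sign : (h : G n) → Dec (T (half h)) → Carrier
  sign h (yes _) = 1#
  sign h (no _)  = - 1#

  basis-rep : ∀ h → basis (rep h) h ≈ sign h (T? (half h))
  basis-rep h = go (T? (half h))
    where
    go : (D : Dec (T (half h))) → basis (representative h D) h ≈ sign h D
    go (yes p) = trans (+-cong (𝟙-yes (val h ℕ.≟ val h) refl)
        (trans (-‿cong (𝟙-no (val h ℕ.≟ val (neg h)) (val≢ h (neg h) (neg≢ h h p p)))) -0#≈0#)) (+-identityʳ 1#)
    go (no ¬p) = trans (+-cong (𝟙-no (val h ℕ.≟ val (neg h)) (val≢ h (neg h) λ eq → ¬p (≡.subst (T ∘ half) (≡.sym eq) (half-neg h ¬p))))
      (-‿cong (𝟙-yes (val h ℕ.≟ val (neg (neg h))) (≡.cong val (≡.sym (neg-involutive h)))))) (+-identityˡ (- 1#))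

  basis-other : ∀ {k} h → T (half k) → k ≢ rep h → basis k h ≈ 0#
  basis-other {k} h half-k k≢ = trans (+-cong (𝟙-no (val h ℕ.≟ val k) (val≢ h k h≢k))
      (trans (-‿cong (𝟙-no (val h ℕ.≟ val (neg k)) (val≢ h (neg k) h≢-k))) -0#≈0#)) (+-identityˡ 0#)
    where
    h≢k : h ≢ k
    h≢k refl = k≢ (≡.sym (rep-of-half h half-k))
    h≢-k : h ≢ neg k
    h≢-k eq = k≢ (≡.trans (neg-swap h k eq) (≡.sym (rep-of-nonhalf h λ p → neg≢ h k p half-k eq)))

  odd-expansion : ∀ {v : Vec K n} → (∀ g → v (neg g) ≈ - v g) → ∀ h → v (rep h) * sign h (T? (half h)) ≈ v h
  odd-expansion {v} v-odd h = go (T? (half h))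
    where
    go : (D : Dec (T (half h))) → v (representative h D) * sign h D ≈ v h
    go (yes _) = *-identityʳ (v h)
    go (no _)  = trans (*-congʳ (v-odd h)) (trans (sym (-‿distribˡ-* _ _)) (trans (-‿cong (sym (-‿distribʳ-* _ _)))
        (trans (-‿involutive _) (*-identityʳ (v h)))))

  -- `m` is left general because the basis of U is to be indexed by `Fin (φ n / 2)`, whose size
  -- agrees with the number of representatives only by a proven equation.
  module _ {m} (m≡ : m ≡ length halves) where
    element : Fin m → G n
    element i = lookup halves (Fin.cast m≡ i)

    private
      cast-injective : ∀ i j → Fin.cast m≡ i ≡ Fin.cast m≡ j → i ≡ j
      cast-injective i j eq = Fin.toℕ-injective (≡.trans (≡.sym (Fin.toℕ-cast m≡ i)) (≡.trans (≡.cong toℕ eq) (Fin.toℕ-cast m≡ j)))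

      index : ∀ h → Σ (Fin m) λ i → element i ≡ rep h
      index h = let i , eq = rep-index h in Fin.cast (≡.sym m≡) i , ≡.trans (≡.cong (lookup halves)
        (Fin.toℕ-injective (≡.trans (Fin.toℕ-cast m≡ (Fin.cast (≡.sym m≡) i)) (Fin.toℕ-cast (≡.sym m≡) i)))) eq

    ∑-basis : ∀ (b : Fin m → Carrier) h → ΣF K m (λ i → b i * basis (element i) h) ≈ b (proj₁ (index h)) * sign h (T? (half h))
    ∑-basis b h = trans (listSum-single m (λ i → i) (λ i → b i * basis (element i) h) i₀ λ i i≢ → trans
        (*-congˡ (basis-other h (halves-half (Fin.cast m≡ i))
        λ eq → i≢ (cast-injective i i₀ (lookup-injective halves-unique (Fin.cast m≡ i) (Fin.cast m≡ i₀)
            (≡.trans eq (≡.sym (proj₂ (index h)))))))) (zeroʳ (b i)))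
      (*-congˡ (trans (reflexive (≡.cong (λ k → basis k h) (proj₂ (index h)))) (basis-rep h)))
      where i₀ = proj₁ (index h)

    basis-independent : ∀ (b : Fin m → Carrier) → _≈ᵛ_ K (λ h → ΣF K m (λ i → b i * basis (element i) h)) (zeroᵛ K) → ∀ i → b i ≈ 0#
    basis-independent b b≈0 i = begin
      b i                                      ≈⟨ *-identityʳ (b i) ⟨
      b i * 1#                                 ≈⟨ *-congˡ (one (T? (half h))) ⟨
      b i * sign h (T? (half h))               ≡⟨ ≡.cong (λ j → b j * sign h (T? (half h))) (≡.sym i₀≡i) ⟩
      b (proj₁ (index h)) * sign h (T? (half h)) ≈⟨ ∑-basis b h ⟨
      ΣF K m (λ i → b i * basis (element i) h) ≈⟨ b≈0 h ⟩
      0#                                       ∎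
      where
      h = element i
      half-h = halves-half (Fin.cast m≡ i)
      one : (D : Dec (T (half h))) → sign h D ≈ 1#
      one (yes _) = ≈-refl
      one (no ¬p) = contradiction half-h ¬p
      i₀≡i : proj₁ (index h) ≡ i
      i₀≡i = cast-injective (proj₁ (index h)) i (lookup-injective halves-unique (Fin.cast m≡ (proj₁ (index h))) (Fin.cast m≡ i)
          (≡.trans (proj₂ (index h)) (rep-of-half h half-h)))

    -- An odd vector is determined by its values at the representatives, and these are its
    -- coefficients.
    basis-spans : ∀ v → InU K n v → Σ (Fin m → Carrier) λ b → _≈ᵛ_ K v (λ h → ΣF K m (λ i → b i * basis (element i) h))
    basis-spans v v∈U = (λ i → v (element i)) , λ h → sym (trans (∑-basis (λ i → v (element i)) h)
      (trans (*-congʳ (reflexive (≡.cong v (proj₂ (index h))))) (odd-expansion (U-odd v∈U) h)))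

open import Data.Nat using (_<_)
open import Data.Nat.DivMod using (_/_)

theorem3p1 : ∀ {c ℓ} (K : CharZeroField c ℓ) (n : ℕ) → 2 < n →
    let open CharZeroField K in
    (∀ (g : G n) → InU⊥ K n (u* K n g))
    × (∀ (g : G n) → Σ[ k ∈ G n ] (T (half k) × _≈ᵛ_ K (u* K n g) (u* K n k)))
    × (∀ (a : G n → Carrier) →
    _≈ᵛ_ K (λ h → ΣH K n (λ k → a k * u* K n k h)) (zeroᵛ K) →
    ∀ (k : G n) → T (half k) → a k ≈ 0#)
    × (∀ (f : Vec K n) → InU⊥ K n f →
    Σ[ a ∈ (G n → Carrier) ] _≈ᵛ_ K f (λ h → ΣH K n (λ k → a k * u* K n k h)))
    × (length (filterᵇ half (Gs n)) ≡ φ n / 2)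
    × (Σ[ w ∈ (Fin (φ n / 2) → Vec K n) ]
    ((∀ i → InU K n (w i))
    × (∀ (b : Fin (φ n / 2) → Carrier) →
    _≈ᵛ_ K (λ h → ΣF K (φ n / 2) (λ i → b i * w i h)) (zeroᵛ K) →
    ∀ i → b i ≈ 0#)
    × (∀ (v : Vec K n) → InU K n v →
    Σ[ b ∈ (Fin (φ n / 2) → Carrier) ] _≈ᵛ_ K v (λ h → ΣF K (φ n / 2) (λ i → b i * w i h)))))
theorem3p1 K (suc n′) 2<n =
    (λ g u u∈U → trans (ev-u* g u) (trans (+-congˡ (U-odd u∈U g)) (-‿inverseʳ (u g))))
  , (λ g → rep g , rep-half g , λ h → by-representative g h (T? (half g)))
  , (λ a a≈0 k half-k → trans (reflexive (≡.cong a (≡.sym (rep-of-half k half-k)))) (trans (sym (half-expansion a k)) (a≈0 k)))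
  -- f serves as its own family of coefficients: the expansion returns f at the representative, and
  -- f is even.
  , (λ f f⊥ → f , λ h → trans (even f f⊥ h (T? (half h))) (sym (half-expansion f h)))
  , length-halves
  , (λ i → basis (element m≡ i))
  , (λ i → basis-∈U (element m≡ i))
  , basis-independent m≡
  , basis-spans m≡
  where
  open CharZeroField K
  open HalfSystem n′ 2<n
  open OverField K n′ 2<n
  m≡ = ≡.sym length-halves
  by-representative : ∀ g h D → u* K (suc n′) g h ≈ u* K (suc n′) (representative g D) h
  by-representative g h (yes _) = CharZeroField.refl K
  by-representative g h (no _)  = u*-neg g h
  even : ∀ f → InU⊥ K (suc n′) f → ∀ h D → f h ≈ f (representative h D)
  even f f⊥ h (yes _) = CharZeroField.refl K
  even f f⊥ h (no _)  = U⊥-even f f⊥ h
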